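{- For all integers $a\geq 1$ and $k\geq 0$, the reduced Kronecker coefficient $\overline{g}_{(k^a), (k^a)}^{(k)}$ equals the number of plane partitions of $k$ fitting inside a $2\times a$ rectangle.
   Context: For partitions $\lambda,\mu,\nu$ of $n$, the Kronecker coefficient $g_{\mu,\nu}^{\lambda}$ is the multiplicity of the irreducible character $\chi^\lambda$ of $S_n$ in $\chi^\mu\otimes\chi^\nu$. For a partition $\alpha$ and $n\ge |\alpha|+\alpha_1$, let $\alpha[n]=(n-|\alpha|,\alpha_1,\alpha_2,\dots)$. The reduced Kronecker coefficient $\overline{g}_{\alpha,\beta}^{\gamma}$ is the eventual (stable) value of $g_{\alpha[n],\beta[n]}^{\gamma[n]}$ as $n\to\infty$. $(k^a)$ is the partition with $a$ parts equal to $k$, and $(k)$ the one-row partition of $k$. A plane partition of $k$ fitting inside a $2\times a$ rectangle is an array $(\pi_{ij})_{1\le i\le 2,\,1\le j\le a}$ of nonnegative integers, weakly decreasing along rows and columns, with $\sum_{i,j}\pi_{ij}=k$. -}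

module Defs where

open import Data.Bool using (Bool; true; false; _∧_; if_then_else_)
open import Data.Nat as ℕ using (ℕ; zero; suc; _∸_; _≤ᵇ_; _≡ᵇ_; _^_; _!; NonZero)
open import Data.Nat.Properties using (m*n≢0; m^n≢0; _!≢0)
open import Data.Integer as ℤ using (ℤ; +_; -_)
open import Data.Integer.DivMod using (_/ℕ_)
open import Data.List using (List; []; _∷_; [_]; map; concatMap; filterᵇ; length; replicate; applyUpTo; zipWith; foldr; _++_)
open import Data.Nat.ListAction using (sum; product)
open import Data.Maybe using (Maybe; just; nothing)
open import Data.Product using (_×_; _,_)
open import Data.Vec as Vec using (Vec)
open import Relation.Nullary.Decidable using (does)
open import Relation.Unary using (Decidable)

-- Partitions are represented as weakly decreasing lists of positive
-- naturals.

size : List ℕ → ℕ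
size = sum

oneTo : ℕ → List ℕ
oneTo n = applyUpTo suc n

-- partitions of n with all parts ≤ m (fuel f ≥ n suffices)
partsBounded : ℕ → ℕ → ℕ → List (List ℕ)
partsBounded _ zero _ = [ [] ]
partsBounded zero (suc n) _ = []
partsBounded (suc f) (suc n) m =
  concatMap (λ p → if p ≤ᵇ suc n
                   then map (p ∷_) (partsBounded f (suc n ∸ p) p)
                   else [])
            (oneTo m)

partitionsOf : ℕ → List (List ℕ)
partitionsOf n = partsBounded n n n

-- Permutation character of the Young subgroup S_α (α a composition,
-- zero parts allowed) evaluated at the class of cycle type ρ:
-- η^α(ρ) = number of maps f from the parts of ρ to the positions of α
-- with  Σ_{j : f j = i} ρ_j = α_i  for every i.

allZero : List ℕ → Bool
allZero [] = true
allZero (x ∷ xs) = (x ≡ᵇ 0) ∧ allZero xs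

choices : ℕ → List ℕ → List (List ℕ)
choices r [] = []
choices r (x ∷ xs) =
  (if r ≤ᵇ x then [ (x ∸ r) ∷ xs ] else []) ++ map (x ∷_) (choices r xs)

eta : List ℕ → List ℕ → ℕ
eta α [] = if allZero α then 1 else 0
eta α (r ∷ ρ) = sum (map (λ α' → eta α' ρ) (choices r α))

-- compositions with integer entries: negative entry ⇒ h_α = 0
toNatComp : List ℤ → Maybe (List ℕ)
toNatComp [] = just []
toNatComp (+ n ∷ xs) with toNatComp xs
... | just ys = just (n ∷ ys)
... | nothing = nothing
toNatComp (ℤ.-[1+ _ ] ∷ xs) = nothing

etaZ : List ℤ → List ℕ → ℤ
etaZ α ρ with toNatComp α
... | just β = + eta β ρ
... | nothing = + 0

pickS : {A : Set} → List A → List (ℤ × A × List A)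
pickS [] = []
pickS (x ∷ xs) =
  (ℤ.1ℤ , x , xs) ∷ map (λ { (s , y , ys) → (- s , y , x ∷ ys) }) (pickS xs)

permsF : {A : Set} → ℕ → List A → List (ℤ × List A)
permsF zero _ = [ (ℤ.1ℤ , []) ]
permsF (suc f) [] = [ (ℤ.1ℤ , []) ]
permsF (suc f) xs@(_ ∷ _) =
  concatMap (λ { (s , y , ys) →
                 map (λ { (t , w) → (s ℤ.* t , y ∷ w) }) (permsF f ys) })
            (pickS xs)

signedPerms : ℕ → List (ℤ × List ℕ)
signedPerms ℓ = permsF ℓ (oneTo ℓ)

-- Irreducible character χ^λ(ρ) of S_n (λ, ρ ⊢ n), via the
-- Jacobi–Trudi determinant  χ^λ = det [ η^{(λ_i - i + j)} ]_{i,j ≤ ℓ(λ)}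
-- (products of the h's being the Young permutation characters η).

zipWith3 : {A B C D : Set} → (A → B → C → D) → List A → List B → List C → List D
zipWith3 f (a ∷ as) (b ∷ bs) (c ∷ cs) = f a b c ∷ zipWith3 f as bs cs
zipWith3 f _ _ _ = []

character : List ℕ → List ℕ → ℤ
character λ' ρ =
  foldr ℤ._+_ (+ 0)
    (map (λ { (s , w) →
              s ℤ.* etaZ (zipWith3 (λ l i wi → (+ l ℤ.- + i) ℤ.+ + wi)
                                   λ' (oneTo (length λ')) w) ρ })
         (signedPerms (length λ')))

-- z_ρ = Π_i i^{m_i} m_i!  (centralizer order), so |class ρ| = n!/z_ρ.

mult : ℕ → List ℕ → ℕ
mult i ρ = length (filterᵇ (λ x → i ≡ᵇ x) ρ)

zFactor : List ℕ → ℕ → ℕ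
zFactor ρ i = suc i ^ mult (suc i) ρ ℕ.* (mult (suc i) ρ) !

zρ : List ℕ → ℕ
zρ ρ = product (map (zFactor ρ) (Data.List.upTo (size ρ)))

zFactor≢0 : ∀ ρ i → NonZero (zFactor ρ i)
zFactor≢0 ρ i = m*n≢0 _ _ {{m^n≢0 (suc i) (mult (suc i) ρ)}} {{(mult (suc i) ρ) !≢0}}

product≢0 : ∀ ρ (is : List ℕ) → NonZero (product (map (zFactor ρ) is))
product≢0 ρ [] = _
product≢0 ρ (i ∷ is) = m*n≢0 _ _ {{zFactor≢0 ρ i}} {{product≢0 ρ is}}

classSize : ℕ → List ℕ → ℕ
classSize n ρ = ℕ._/_ (n !) (zρ ρ) {{product≢0 ρ (Data.List.upTo (size ρ))}}

-- Kronecker coefficient g^λ_{μ,ν} = ⟨χ^λ, χ^μ χ^ν⟩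
--   = (1/n!) Σ_{ρ ⊢ n} |class ρ| χ^λ(ρ) χ^μ(ρ) χ^ν(ρ),   n = |λ|.

kronecker : List ℕ → List ℕ → List ℕ → ℤ
kronecker λ' μ ν =
  let n = size λ' in
  _/ℕ_ (foldr ℤ._+_ (+ 0)
          (map (λ ρ → + classSize n ρ ℤ.* character λ' ρ
                        ℤ.* character μ ρ ℤ.* character ν ρ)
               (partitionsOf n)))
       (n !) {{n !≢0}}

pad : ℕ → List ℕ → List ℕ
pad n α = (n ∸ size α) ∷ α

rect : ℕ → ℕ → List ℕ
rect zero a = []
rect (suc k) a = replicate a (suc k)

row : ℕ → List ℕ
row k = rect k 1

vecsUpTo : (a b : ℕ) → List (Vec ℕ a)
vecsUpTo zero b = [ Vec.[] ]
vecsUpTo (suc a) b =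
  concatMap (λ x → map (x Vec.∷_) (vecsUpTo a b)) (Data.List.upTo (suc b))

weaklyDecr : List ℕ → Bool
weaklyDecr (x ∷ y ∷ xs) = (y ≤ᵇ x) ∧ weaklyDecr (y ∷ xs)
weaklyDecr _ = true

colsDecr : {a : ℕ} → Vec ℕ a → Vec ℕ a → Bool
colsDecr Vec.[] Vec.[] = true
colsDecr (x Vec.∷ xs) (y Vec.∷ ys) = (y ≤ᵇ x) ∧ colsDecr xs ys

isPlanePartitionOf : (k : ℕ) {a : ℕ} → Vec ℕ a → Vec ℕ a → Bool
isPlanePartitionOf k r₁ r₂ =
  weaklyDecr (Vec.toList r₁) ∧ weaklyDecr (Vec.toList r₂) ∧ colsDecr r₁ r₂
  ∧ (Vec.sum r₁ ℕ.+ Vec.sum r₂ ≡ᵇ k)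

-- number of plane partitions of k fitting inside a 2 × a rectangle
-- (entries of such an array are automatically ≤ k)
planePartitions2 : (k a : ℕ) → ℕ
planePartitions2 k a =
  length (filterᵇ (λ p → isPlanePartitionOf k (Data.Product.proj₁ p) (Data.Product.proj₂ p))
                 (Data.List.cartesianProduct (vecsUpTo a k) (vecsUpTo a k)))

{-# OPTIONS --safe #-}
-- Write ℓ = a + 1, λ = (n − a k, kᵃ) and Lᵢ = λᵢ + ℓ − i. By Newton's identities the average of
-- the power sums p_ρ over the classes of Sₙ is hₙ, and by Jacobi–Trudi χ^λ(ρ) is the coefficient
-- of x^L in V(x) p_ρ(x), with V the Vandermonde product. So the Kronecker coefficient is the
-- coefficient of x^L y^L t^k in
--   (1 − t) V(x) V(y) ∏ 1/(1 − xᵢ yⱼ) ∏ 1/(1 − t xᵢ yⱼ).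
-- Cauchy's determinant turns V(x) V(y) ∏ 1/(1 − xᵢ yⱼ) into ∑_w ± ∏ᵢ 1/(1 − xᵢ y_w(i)), and in
-- degree t^k this amounts to the substitution xᵢ = 1/y_w(i), because every Lᵢ is at least k.
-- In the resulting constant term in y the first variable u is fixed by w, as L₁ is large, and
-- antisymmetrising the others gives a! times the coefficient as the part of degree k in t of
--   U_a(s) = CT V(y) V(1/y) ∏ 1/(1 − t yᵢ/yⱼ) ∏ 1/((1 − t yᵢ/u)(1 − s u/yᵢ))   at s = t.
-- By interpolation (1 − tᵃ) V(y) = (1 − t) ∑ᵢ ± ∏_{j≠i} (yᵢ − t yⱼ) V(y without yᵢ). In the i-th
-- term, after cancellation, negative powers of yᵢ occur only in 1/(1 − s u/yᵢ), so that the
-- constant term in yᵢ is the value at yᵢ = s u. Hence U_a(s) = a U_{a−1}(t s) / ((1 − tᵃ)(1 − t s))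
-- and the coefficient is that of t^k in ∏_{i ≤ a} 1/((1 − tⁱ)(1 − tⁱ⁺¹)). Exchanging the tails of
-- two rows after the first violation of π₁ⱼ ≥ π₂ⱼ shows that this series also counts plane partitions.
module Submission where

open import Algebra.Bundles using (CommutativeRing; RawRing)
import Algebra.Properties.AbelianGroup
import Algebra.Properties.Ring
import Algebra.Properties.Semiring.Exp
import Algebra.Properties.Semiring.Mult.TCOptimised
import Algebra.Solver.Ring
open import Algebra.Solver.Ring.AlmostCommutativeRing using (fromCommutativeRing; _-Raw-AlmostCommutative⟶_)
open import Data.Bool as Bool using (Bool; true; false; _∧_; if_then_else_)
open import Data.Empty using (⊥-elim)
open import Data.Fin.Base as Fin using (Fin)
open import Data.Integer as ℤ using (ℤ; +_; -[1+_])
import Data.Integer.Properties as ℤₚ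
import Data.Integer.Tactic.RingSolver as ℤSolver
open import Data.List as List using (List; []; _∷_; _++_; map; length; replicate; downFrom; concatMap; upTo)
import Data.List.Properties as Listₚ
open import Data.List.Relation.Binary.Permutation.Propositional as Perm using (_↭_; ↭-refl; ↭-sym; ↭-trans; prep; swap)
open import Data.List.Relation.Binary.Permutation.Propositional.Properties using (↭-length; All-resp-↭; map⁺)
open import Data.List.Relation.Unary.All as All using (All; []; _∷_)
import Data.List.Relation.Unary.All.Properties as Allₚ
open import Data.Maybe using (Maybe; just; nothing)
open import Data.Nat as ℕ using (ℕ; zero; suc; z≤n; s≤s; _!)
open import Data.Nat using (_≤_)
open import Data.Nat.Combinatorics.Specification using ([n∸k]!k!∣n!)
import Data.Nat.DivMod as DivMod
open import Data.Nat.Divisibility using (_∣_; ∣-trans; ∣-refl; ∣-reflexive; *-pres-∣; m∣m*n; 1∣_)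
open import Data.Nat.Induction using (<-rec)
open import Data.Nat.ListAction using (sum; product)
open import Data.Nat.ListAction.Properties using (product-++; sum-↭)
import Data.Nat.Properties as ℕₚ
import Data.Nat.Tactic.RingSolver as ℕSolver
open import Data.Product using (Σ; ∃; _×_; _,_; proj₁; proj₂)
open import Data.Sum using (_⊎_; inj₁; inj₂)
open import Data.Unit using (⊤; tt)
open import Data.Vec as Vec using (Vec; []; _∷_)
open import Defs
open import Function.Base using (_∘_; flip)
open import Level using (0ℓ)
open import Relation.Binary.PropositionalEquality as ≡ using (_≡_)
import Relation.Binary.Reasoning.Setoid
open import Relation.Nullary.Decidable using (yes; no)

-- No rational functions occur: every `1/(1 - m)` is a geometric series of fixed length `D` in a
-- ring of finite sums of monomials, and equality there is modulo high degree, which makes these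
-- series true inverses. The obstacle is that two gradings are needed. Cauchy's determinant has
-- denominators without `t` and makes sense modulo large x-degree, whereas the recursion for the
-- constant term works modulo `t^(k+1)`, with Laurent monomials. A congruence for one grading says
-- nothing about the other. So all passages between rings are exact identities: products are lists
-- of factors, substitutions are homomorphisms of exponent monoids acting on these lists, and
-- coefficients are extracted by linear functionals. The factor `a!` is cancelled only among
-- integers, after the extraction. Largeness of `n` rules out the permutations whose first variable
-- is not `u`. The case `k = 0` is separate: the rectangle is empty and all three padded partitions
-- are `(n)`.

-- The ring solver needs coefficients with decidable equality mapping into an
-- arbitrary commutative ring: formal differences of naturals.
module IntegerSolver (R : CommutativeRing 0ℓ 0ℓ) where
  open CommutativeRing R hiding (zero)
  open Algebra.Properties.Ring ring
  open Algebra.Properties.AbelianGroup +-abelianGroup using (⁻¹-∙-comm; ε⁻¹≈ε; ⁻¹-involutive)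
  open Algebra.Properties.Semiring.Mult.TCOptimised semiring using (×-homo-+; ×1-homo-*) renaming (_×_ to _·_)
  open Relation.Binary.Reasoning.Setoid setoid

  private
    -- A zero subtrahend has its own clause so that the coefficients 0 and 1 are sent to `0#` and
    -- `1#` themselves, not merely to elements equal to them.
    dif : ℕ × ℕ → Carrier
    dif (a , zero) = a · 1#
    dif (a , suc b) = a · 1# - suc b · 1#

    dif≈ : ∀ a b → dif (a , b) ≈ a · 1# - b · 1#
    dif≈ a zero = sym (trans (+-congˡ ε⁻¹≈ε) (+-identityʳ _))
    dif≈ a (suc b) = refl

    norm : ℕ → ℕ → ℕ × ℕ
    norm zero b = zero , b
    norm (suc a) zero = suc a , zero
    norm (suc a) (suc b) = norm a b

    swap-mid : ∀ a b c d → (a + b) + (c + d) ≈ (a + c) + (b + d)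
    swap-mid a b c d = begin
      (a + b) + (c + d) ≈⟨ +-assoc _ _ _ ⟩
      a + (b + (c + d)) ≈⟨ +-congˡ (sym (+-assoc _ _ _)) ⟩
      a + ((b + c) + d) ≈⟨ +-congˡ (+-congʳ (+-comm b c)) ⟩
      a + ((c + b) + d) ≈⟨ +-congˡ (+-assoc _ _ _) ⟩
      a + (c + (b + d)) ≈⟨ sym (+-assoc _ _ _) ⟩
      (a + c) + (b + d) ∎

    dif-+ : ∀ a b c d → dif (a ℕ.+ c , b ℕ.+ d) ≈ dif (a , b) + dif (c , d)
    dif-+ a b c d = begin
      dif (a ℕ.+ c , b ℕ.+ d) ≈⟨ dif≈ (a ℕ.+ c) (b ℕ.+ d) ⟩
      (a ℕ.+ c) · 1# - (b ℕ.+ d) · 1# ≈⟨ +-cong (×-homo-+ 1# a c) (-‿cong (×-homo-+ 1# b d)) ⟩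
      (a · 1# + c · 1#) - (b · 1# + d · 1#) ≈⟨ +-congˡ (sym (⁻¹-∙-comm _ _)) ⟩
      (a · 1# + c · 1#) + (- (b · 1#) + - (d · 1#)) ≈⟨ swap-mid _ _ _ _ ⟩
      (a · 1# - b · 1#) + (c · 1# - d · 1#) ≈⟨ sym (+-cong (dif≈ a b) (dif≈ c d)) ⟩
      dif (a , b) + dif (c , d) ∎

    dif-norm : ∀ a b → dif (norm a b) ≈ dif (a , b)
    dif-norm zero b = refl
    dif-norm (suc a) zero = refl
    dif-norm (suc a) (suc b) = begin
      dif (norm a b) ≈⟨ dif-norm a b ⟩
      dif (a , b) ≈⟨ sym (+-identityˡ _) ⟩
      0# + dif (a , b) ≈⟨ +-congʳ (sym (-‿inverseʳ 1#)) ⟩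
      dif (1 , 1) + dif (a , b) ≈⟨ sym (dif-+ 1 1 a b) ⟩
      dif (suc a , suc b) ∎

    mul-dif : ∀ x y z w → (x - y) * (z - w) ≈ (x * z + y * w) - (x * w + y * z)
    mul-dif x y z w = begin
      (x - y) * (z - w) ≈⟨ distribʳ _ _ _ ⟩
      x * (z - w) + - y * (z - w) ≈⟨ +-cong (distribˡ _ _ _) (distribˡ _ _ _) ⟩
      (x * z + x * - w) + (- y * z + - y * - w)
        ≈⟨ +-congˡ (+-comm _ _) ⟩
      (x * z + x * - w) + (- y * - w + - y * z) ≈⟨ swap-mid _ _ _ _ ⟩
      (x * z + - y * - w) + (x * - w + - y * z)
        ≈⟨ +-cong (+-congˡ (trans (sym (-‿distribˡ-* _ _)) (trans (-‿cong (sym (-‿distribʳ-* _ _))) (⁻¹-involutive _))))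
                  (+-cong (sym (-‿distribʳ-* _ _)) (sym (-‿distribˡ-* _ _))) ⟩
      (x * z + y * w) + (- (x * w) + - (y * z)) ≈⟨ +-congˡ (⁻¹-∙-comm _ _) ⟩
      (x * z + y * w) - (x * w + y * z) ∎

    dif-* : ∀ a b c d → dif (a ℕ.* c ℕ.+ b ℕ.* d , a ℕ.* d ℕ.+ b ℕ.* c) ≈ dif (a , b) * dif (c , d)
    dif-* a b c d = begin
      dif (a ℕ.* c ℕ.+ b ℕ.* d , a ℕ.* d ℕ.+ b ℕ.* c) ≈⟨ dif≈ _ (a ℕ.* d ℕ.+ b ℕ.* c) ⟩
      (a ℕ.* c ℕ.+ b ℕ.* d) · 1# - (a ℕ.* d ℕ.+ b ℕ.* c) · 1#
        ≈⟨ +-cong (hom a c b d) (-‿cong (hom a d b c)) ⟩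
      (a · 1# * c · 1# + b · 1# * d · 1#) - (a · 1# * d · 1# + b · 1# * c · 1#) ≈⟨ sym (mul-dif _ _ _ _) ⟩
      (a · 1# - b · 1#) * (c · 1# - d · 1#) ≈⟨ sym (*-cong (dif≈ a b) (dif≈ c d)) ⟩
      dif (a , b) * dif (c , d) ∎
      where
      hom : ∀ a c b d → (a ℕ.* c ℕ.+ b ℕ.* d) · 1# ≈ a · 1# * c · 1# + b · 1# * d · 1#
      hom a c b d = trans (×-homo-+ 1# (a ℕ.* c) (b ℕ.* d)) (+-cong (×1-homo-* a c) (×1-homo-* b d))

    dif-neg : ∀ a b → dif (b , a) ≈ - dif (a , b)
    dif-neg a b = begin
      dif (b , a) ≈⟨ dif≈ b a ⟩
      b · 1# - a · 1# ≈⟨ +-comm _ _ ⟩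
      - (a · 1#) + b · 1# ≈⟨ +-congˡ (sym (⁻¹-involutive _)) ⟩
      - (a · 1#) + - (- (b · 1#)) ≈⟨ ⁻¹-∙-comm _ _ ⟩
      - (a · 1# - b · 1#) ≈⟨ -‿cong (sym (dif≈ a b)) ⟩
      - dif (a , b) ∎

    difRing : RawRing 0ℓ 0ℓ
    difRing = record
      { Carrier = ℕ × ℕ
      ; _≈_ = _≡_
      ; _+_ = λ (a , b) (c , d) → norm (a ℕ.+ c) (b ℕ.+ d)
      ; _*_ = λ (a , b) (c , d) → a ℕ.* c ℕ.+ b ℕ.* d , a ℕ.* d ℕ.+ b ℕ.* c
      ; -_ = λ (a , b) → b , a
      ; 0# = 0 , 0
      ; 1# = 1 , 0
      }

    morphism : difRing -Raw-AlmostCommutative⟶ fromCommutativeRing R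
    morphism = record
      { ⟦_⟧ = dif
      ; +-homo = λ (a , b) (c , d) → trans (dif-norm (a ℕ.+ c) (b ℕ.+ d)) (dif-+ a b c d)
      ; *-homo = λ (a , b) (c , d) → dif-* a b c d
      ; -‿homo = λ (a , b) → dif-neg a b
      ; 0-homo = refl
      ; 1-homo = refl
      }

    cross : ∀ x y z w → x + w ≈ z + y → x - y ≈ z - w
    cross x y z w eq = begin
      x - y ≈⟨ sym (+-identityʳ _) ⟩
      (x - y) + 0# ≈⟨ +-congˡ (sym (-‿inverseʳ w)) ⟩
      (x - y) + (w - w) ≈⟨ swap-mid _ _ _ _ ⟩
      (x + w) + (- y - w) ≈⟨ +-cong eq (+-comm _ _) ⟩
      (z + y) + (- w - y) ≈⟨ swap-mid _ _ _ _ ⟩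
      (z - w) + (y - y) ≈⟨ +-congˡ (-‿inverseʳ y) ⟩
      (z - w) + 0# ≈⟨ +-identityʳ _ ⟩
      z - w ∎

    dif≟ : ∀ p q → Maybe (dif p ≈ dif q)
    dif≟ (a , b) (c , d) with a ℕ.+ d ℕ.≟ c ℕ.+ b
    ... | yes eq = just (trans (dif≈ a b) (trans (cross _ _ _ _ (trans (sym (×-homo-+ 1# a d))
              (trans (reflexive (≡.cong (_· 1#) eq)) (×-homo-+ 1# c b)))) (sym (dif≈ c d))))
    ... | no _ = nothing

  open Algebra.Solver.Ring difRing (fromCommutativeRing R) morphism dif≟ public

  :1 : ∀ {n} → Polynomial n
  :1 = con (1 , 0)

  :0 : ∀ {n} → Polynomial n
  :0 = con (0 , 0)

-- Alternating sums, interpolation, and the determinants of Vandermonde and Cauchy over a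
-- commutative ring.

module Alternating (R : CommutativeRing 0ℓ 0ℓ) where
  open CommutativeRing R hiding (zero)
  open Algebra.Properties.Ring ring
  open Algebra.Properties.Semiring.Exp semiring using (_^_; ^-homo-*)
  open IntegerSolver R using (solve; _:+_; _:*_; _:-_; :-_; :0; :1; _:=_)
  open Relation.Binary.Reasoning.Setoid setoid

  private variable A B : Set

  ∏ : List A → (A → Carrier) → Carrier
  ∏ [] g = 1#
  ∏ (x ∷ xs) g = g x * ∏ xs g

  ∏-cong : ∀ (xs : List A) {g h} → (∀ x → g x ≈ h x) → ∏ xs g ≈ ∏ xs h
  ∏-cong [] e = refl
  ∏-cong (x ∷ xs) e = *-cong (e x) (∏-cong xs e)

  ∏-* : ∀ (xs : List A) {g h} → ∏ xs g * ∏ xs h ≈ ∏ xs (λ x → g x * h x)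
  ∏-* [] = *-identityˡ 1#
  ∏-* (x ∷ xs) {g} {h} = trans
    (solve 4 (λ a b c d → (a :* b) :* (c :* d) := (a :* c) :* (b :* d)) refl (g x) (∏ xs g) (h x) (∏ xs h))
    (*-congˡ (∏-* xs))

  ∏-1 : ∀ (xs : List A) {g} → (∀ x → g x ≈ 1#) → ∏ xs g ≈ 1#
  ∏-1 [] e = refl
  ∏-1 (x ∷ xs) e = trans (*-cong (e x) (∏-1 xs e)) (*-identityˡ 1#)

  ∏-swap : ∀ (xs : List A) (ys : List B) {g : A → B → Carrier} → ∏ xs (λ x → ∏ ys (g x)) ≈ ∏ ys (λ y → ∏ xs (λ x → g x y))
  ∏-swap [] ys = sym (∏-1 ys (λ _ → refl))
  ∏-swap (x ∷ xs) ys = trans (*-congˡ (∏-swap xs ys)) (∏-* ys)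

  ∏-inverse : ∀ (xs : List A) {g h} → (∀ x → g x * h x ≈ 1#) → ∏ xs g * ∏ xs h ≈ 1#
  ∏-inverse xs e = trans (∏-* xs) (∏-1 xs e)

  ∏-inverse-All : ∀ {xs : List A} {g h} → All (λ x → g x * h x ≈ 1#) xs → ∏ xs g * ∏ xs h ≈ 1#
  ∏-inverse-All [] = *-identityˡ 1#
  ∏-inverse-All {xs = x ∷ xs} {g} {h} (e ∷ es) = trans
    (solve 4 (λ a b c d → (a :* b) :* (c :* d) := (a :* c) :* (b :* d)) refl (g x) (∏ xs g) (h x) (∏ xs h))
    (trans (*-cong e (∏-inverse-All es)) (*-identityˡ 1#))

  ∏-↭ : ∀ {xs ys : List A} (g : A → Carrier) → xs ↭ ys → ∏ xs g ≈ ∏ ys g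
  ∏-↭ g Perm.refl = refl
  ∏-↭ g (prep x p) = *-congˡ (∏-↭ g p)
  ∏-↭ g (swap x y p) = trans (*-congˡ (*-congˡ (∏-↭ g p)))
    (solve 3 (λ a b c → a :* (b :* c) := b :* (a :* c)) refl (g x) (g y) _)
  ∏-↭ g (Perm.trans p q) = trans (∏-↭ g p) (∏-↭ g q)

  -- The sign in alt is that of the cycle moving the removed element to the front.
  alt pick : List A → (A → List A → Carrier) → Carrier
  alt [] g = 0#
  alt (x ∷ xs) g = g x xs - alt xs (λ y ys → g y (x ∷ ys))
  pick [] g = 0#
  pick (x ∷ xs) g = g x xs + pick xs (λ y ys → g y (x ∷ ys))

  private
    to-front : ∀ {x y : A} {ys xs} → y ∷ ys ↭ xs → y ∷ x ∷ ys ↭ x ∷ xs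
    to-front p = ↭-trans (swap _ _ ↭-refl) (prep _ p)

  alt-cong : ∀ (xs : List A) {g h : A → List A → Carrier} → (∀ y ys → y ∷ ys ↭ xs → g y ys ≈ h y ys) →
             alt xs g ≈ alt xs h
  alt-cong [] e = refl
  alt-cong (x ∷ xs) e = +-cong (e x xs ↭-refl) (-‿cong (alt-cong xs (λ y ys p → e y (x ∷ ys) (to-front p))))

  pick-cong : ∀ (xs : List A) {g h : A → List A → Carrier} → (∀ y ys → y ∷ ys ↭ xs → g y ys ≈ h y ys) →
              pick xs g ≈ pick xs h
  pick-cong [] e = refl
  pick-cong (x ∷ xs) e = +-cong (e x xs ↭-refl) (pick-cong xs (λ y ys p → e y (x ∷ ys) (to-front p)))

  alt-*ˡ : ∀ (xs : List A) c {g} → c * alt xs g ≈ alt xs (λ y ys → c * g y ys)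
  alt-*ˡ [] c = zeroʳ c
  alt-*ˡ (x ∷ xs) c {g} = trans
    (solve 3 (λ c a b → c :* (a :- b) := c :* a :- c :* b) refl c (g x xs) _)
    (+-congˡ (-‿cong (alt-*ˡ xs c)))

  alt-*ʳ : ∀ (xs : List A) c {g} → alt xs g * c ≈ alt xs (λ y ys → g y ys * c)
  alt-*ʳ xs c = trans (*-comm _ _) (trans (alt-*ˡ xs c) (alt-cong xs (λ _ _ _ → *-comm _ _)))

  pick-*ʳ : ∀ (xs : List A) c {g} → pick xs g * c ≈ pick xs (λ y ys → g y ys * c)
  pick-*ʳ [] c = zeroˡ c
  pick-*ʳ (x ∷ xs) c = trans (distribʳ _ _ _) (+-congˡ (pick-*ʳ xs c))

  alt-+ : ∀ (xs : List A) {g h} → alt xs g + alt xs h ≈ alt xs (λ y ys → g y ys + h y ys)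
  alt-+ [] = +-identityˡ 0#
  alt-+ (x ∷ xs) {g} {h} = trans
    (solve 4 (λ a b c d → (a :- b) :+ (c :- d) := (a :+ c) :- (b :+ d)) refl (g x xs) _ (h x xs) _)
    (+-congˡ (-‿cong (alt-+ xs)))

  alt-0 : ∀ (xs : List A) → alt xs (λ _ _ → 0#) ≈ 0#
  alt-0 [] = refl
  alt-0 (x ∷ xs) = trans (+-congˡ (-‿cong (alt-0 xs))) (-‿inverseʳ 0#)

  alt-neg : ∀ (xs : List A) {g} → - alt xs g ≈ alt xs (λ y ys → - g y ys)
  alt-neg xs {g} = trans (sym (-1*x≈-x _)) (trans (alt-*ˡ xs (- 1#)) (alt-cong xs (λ _ _ _ → -1*x≈-x _)))

  alt-swap : ∀ (xs : List A) (ys : List B) {g : A → List A → B → List B → Carrier} →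
    alt xs (λ x xs′ → alt ys (g x xs′)) ≈ alt ys (λ y ys′ → alt xs (λ x xs′ → g x xs′ y ys′))
  alt-swap [] ys = sym (alt-0 ys)
  alt-swap (x ∷ xs) ys = trans (+-congˡ (trans (-‿cong (alt-swap xs ys)) (alt-neg ys))) (alt-+ ys)

  V : (A → Carrier) → List A → Carrier
  V v [] = 1#
  V v (y ∷ ys) = ∏ ys (λ y′ → v y - v y′) * V v ys

  -- A linear form at the point `z : w` in homogeneous coordinates. This makes the point at infinity
  -- `1 : 0` available, where interpolation reads off leading coefficients.
  form : Carrier × Carrier → Carrier → Carrier → Carrier
  form (p , q) z w = p * w + q * z

  -- The product of linear forms interpolated at the nodes v y, cleared of denominators.
  lagrange : ∀ (v : A → Carrier) ys cs z w → length ys ≡ suc (length cs) →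
    ∏ cs (λ c → form c z w) * V v ys ≈
    alt ys (λ y ys′ → ∏ cs (λ c → form c (v y) 1#) * (∏ ys′ (λ y′ → z - w * v y′) * V v ys′))
  lagrange v (y ∷ []) [] z w _ = sym (trans
    (solve 1 (λ o → :1 :* (:1 :* :1) :- o := :1 :* (:1 :* :1) :- o) refl 0#)
    (trans (+-congˡ -0#≈0#) (+-identityʳ _)))
  lagrange v (y ∷ ys) (c@(p , q) ∷ cs) z w e = sym (begin
    αy * Πy * (N * V v ys) - alt ys (λ y′ ys′ → (form c (v y′) 1# * Π y′) * ((z - w * v y) * ∏ ys′ node * (∏ ys′ (λ y″ → v y - v y″) * V v ys′)))
      ≈⟨ +-congˡ (-‿cong (alt-cong ys three-term)) ⟩
    αy * Πy * (N * V v ys) - alt ys (λ y′ ys′ → - (α * D) * (Π y′ * (∏ ys′ node * V v ys′))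
      + αy * N * (Π y′ * (∏ ys′ (λ y″ → v y - 1# * v y″) * V v ys′)))
      ≈⟨ +-congˡ (-‿cong (sym (trans (+-cong (trans (*-congˡ (lagrange v ys cs z w e′)) (alt-*ˡ ys _)) (trans (*-congˡ (lagrange v ys cs (v y) 1# e′)) (alt-*ˡ ys _))) (alt-+ ys)))) ⟩
    αy * Πy * (N * V v ys) - (- (α * D) * (∏ cs (λ c → form c z w) * V v ys) + αy * N * (Πy * V v ys))
      ≈⟨ solve 7 (λ αy Πy N V α D C → αy :* Πy :* (N :* V) :- (:- (α :* D) :* (C :* V) :+ αy :* N :* (Πy :* V))
                   := α :* C :* (D :* V)) refl αy Πy N (V v ys) α D (∏ cs (λ c → form c z w)) ⟩
    α * ∏ cs (λ c → form c z w) * (D * V v ys) ∎)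
    where
    e′ = ℕₚ.suc-injective e
    node = λ y′ → z - w * v y′
    Π = λ y′ → ∏ cs (λ c → form c (v y′) 1#)
    α = form c z w
    αy = form c (v y) 1#
    Πy = Π y
    N = ∏ ys node
    D = ∏ ys (λ y′ → v y - v y′)
    -- Two forms and two points satisfy a quadratic relation: `form c (v y′) 1# * (z - w * v y)` is
    -- a combination of `v y - v y′` and `z - w * v y′`. It splits the sum into two interpolations
    -- with one form and one node fewer, at `z : w` and at `v y : 1`.
    three-term : ∀ y′ ys′ → y′ ∷ ys′ ↭ ys →
      (form c (v y′) 1# * Π y′) * ((z - w * v y) * ∏ ys′ node * (∏ ys′ (λ y″ → v y - v y″) * V v ys′))
      ≈ - (α * D) * (Π y′ * (∏ ys′ node * V v ys′)) + αy * N * (Π y′ * (∏ ys′ (λ y″ → v y - 1# * v y″) * V v ys′))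
    three-term y′ ys′ pm = begin
      (form c (v y′) 1# * Π y′) * ((z - w * v y) * ∏ ys′ node * (∏ ys′ (λ y″ → v y - v y″) * V v ys′))
        ≈⟨ solve 10 (λ p q z w a b P n d V → ((p :* :1 :+ q :* b) :* P) :* ((z :- w :* a) :* n :* (d :* V))
             := :- ((p :* w :+ q :* z) :* ((a :- b) :* d)) :* (P :* (n :* V))
              :+ (p :* :1 :+ q :* a) :* ((z :- w :* b) :* n) :* (P :* (d :* V))) refl
             p q z w (v y) (v y′) (Π y′) (∏ ys′ node) (∏ ys′ (λ y″ → v y - v y″)) (V v ys′) ⟩
      - (α * ∏ (y′ ∷ ys′) (λ y″ → v y - v y″)) * (Π y′ * (∏ ys′ node * V v ys′))
        + αy * ∏ (y′ ∷ ys′) node * (Π y′ * (∏ ys′ (λ y″ → v y - v y″) * V v ys′))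
        ≈⟨ +-cong (*-congʳ (-‿cong (*-congˡ (∏-↭ _ pm))))
             (*-cong (*-congˡ (∏-↭ _ pm)) (*-congˡ (*-congʳ (∏-cong ys′ (λ y″ → +-congˡ (-‿cong (sym (*-identityˡ _)))))))) ⟩
      - (α * D) * (Π y′ * (∏ ys′ node * V v ys′)) + αy * N * (Π y′ * (∏ ys′ (λ y″ → v y - 1# * v y″) * V v ys′)) ∎

  det : (A → B → Carrier) → List A → List B → Carrier
  det M [] ys = 1#
  det M (a ∷ as) ys = alt ys (λ y ys′ → M a y * det M as ys′)

  -- Seen from the first row, `∏ (x a - x a′)` is a product of linear forms at the point `1 : x a`,
  -- whose values at the node `y b` are the `1 - x a′ * y b`. Interpolating at the nodes is then the
  -- expansion along the row `a`: the values of the forms cancel the column of `b` in `Q`, and the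
  -- node factors cancel the rest of the row.
  cauchy : ∀ (x : A → Carrier) (y : B → Carrier) (Q : A → B → Carrier) →
    ∀ as → All (λ a → ∀ b → (1# - x a * y b) * Q a b ≈ 1#) as → ∀ bs → length as ≡ length bs →
    V x as * V y bs * ∏ as (λ a → ∏ bs (Q a)) ≈ det Q as bs
  cauchy x y Q [] [] [] e = solve 0 (:1 :* :1 :* :1 := :1) refl
  cauchy x y Q (a ∷ as) (inv ∷ invs) bs e = begin
    (D * V x as) * V y bs * (Qa * QQ)
      ≈⟨ solve 5 (λ D Va Vb Qa QQ → (D :* Va) :* Vb :* (Qa :* QQ) := (D :* Vb) :* (Va :* (Qa :* QQ))) refl D (V x as) (V y bs) Qa QQ ⟩
    (D * V y bs) * (V x as * (Qa * QQ))
      ≈⟨ *-congʳ (trans (*-congʳ D-forms) (lagrange y bs cs 1# (x a) (≡.trans (≡.sym e) (≡.cong suc (≡.sym (length-cs as)))))) ⟩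
    alt bs (λ b bs′ → ∏ cs (λ c → form c (y b) 1#) * (∏ bs′ (λ b′ → 1# - x a * y b′) * V y bs′)) * (V x as * (Qa * QQ))
      ≈⟨ alt-*ʳ bs _ ⟩
    alt bs (λ b bs′ → ∏ cs (λ c → form c (y b) 1#) * (∏ bs′ (λ b′ → 1# - x a * y b′) * V y bs′) * (V x as * (Qa * QQ)))
      ≈⟨ alt-cong bs step ⟩
    alt bs (λ b bs′ → Q a b * det Q as bs′) ∎
    where
    D = ∏ as (λ a′ → x a - x a′)
    Qa = ∏ bs (Q a)
    QQ = ∏ as (λ a′ → ∏ bs (Q a′))
    cs = map (λ a′ → (1# , - x a′)) as
    length-cs : ∀ as → length (map (λ a′ → (1# , - x a′)) as) ≡ length as
    length-cs [] = ≡.refl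
    length-cs (_ ∷ as) = ≡.cong suc (length-cs as)
    ∏-forms : ∀ as z w → ∏ (map (λ a′ → (1# , - x a′)) as) (λ c → form c z w) ≈ ∏ as (λ a′ → w - x a′ * z)
    ∏-forms [] z w = refl
    ∏-forms (a′ ∷ as) z w = *-cong (solve 3 (λ x z w → :1 :* w :+ :- x :* z := w :- x :* z) refl (x a′) z w) (∏-forms as z w)
    D-forms : D ≈ ∏ cs (λ c → form c 1# (x a))
    D-forms = sym (trans (∏-forms as 1# (x a)) (∏-cong as (λ a′ → +-congˡ (-‿cong (*-identityʳ _)))))
    step : ∀ b bs′ → b ∷ bs′ ↭ bs →
      ∏ cs (λ c → form c (y b) 1#) * (∏ bs′ (λ b′ → 1# - x a * y b′) * V y bs′) * (V x as * (Qa * QQ)) ≈ Q a b * det Q as bs′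
    step b bs′ pm = begin
      ∏ cs (λ c → form c (y b) 1#) * (∏ bs′ (λ b′ → 1# - x a * y b′) * V y bs′) * (V x as * (Qa * QQ))
        ≈⟨ *-cong (*-congʳ (∏-forms as (y b) 1#)) (*-congˡ (*-cong (sym (∏-↭ _ pm))
             (trans (∏-cong as (λ a′ → sym (∏-↭ (Q a′) pm))) (sym (∏-* as))))) ⟩
      F * (G * V y bs′) * (V x as * ((Q a b * H) * (K * L)))
        ≈⟨ solve 8 (λ F G Vb Va q H K L → F :* (G :* Vb) :* (Va :* ((q :* H) :* (K :* L))) := (F :* K) :* ((G :* H) :* (q :* (Va :* Vb :* L)))) refl F G (V y bs′) (V x as) (Q a b) H K L ⟩
      (F * K) * ((G * H) * (Q a b * (V x as * V y bs′ * L)))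
        ≈⟨ *-cong (∏-inverse-All (All.map (λ i → i b) invs)) (*-cong (∏-inverse bs′ inv)
             (*-congˡ (cauchy x y Q as invs bs′ (ℕₚ.suc-injective (≡.trans e (≡.sym (↭-length pm))))))) ⟩
      1# * (1# * (Q a b * det Q as bs′)) ≈⟨ trans (*-identityˡ _) (*-identityˡ _) ⟩
      Q a b * det Q as bs′ ∎
      where
      F = ∏ as (λ a′ → 1# - x a′ * y b)
      G = ∏ bs′ (λ b′ → 1# - x a * y b′)
      H = ∏ bs′ (Q a)
      K = ∏ as (λ a′ → Q a′ b)
      L = ∏ as (λ a′ → ∏ bs′ (Q a′))

  -- Interpolation with all forms equal to the coordinate `z`, evaluated at infinity, where each of
  -- them is 1.
  V-expand : ∀ (v : A → Carrier) y ys → V v (y ∷ ys) ≈ alt (y ∷ ys) (λ y′ ys′ → v y′ ^ length ys′ * V v ys′)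
  V-expand v y ys = begin
    V v (y ∷ ys) ≈⟨ sym (*-identityˡ _) ⟩
    1# * V v (y ∷ ys) ≈⟨ *-congʳ (sym (one (length ys))) ⟩
    ∏ (forms (length ys)) (λ c → form c 1# 0#) * V v (y ∷ ys)
      ≈⟨ lagrange v (y ∷ ys) (forms (length ys)) 1# 0# (≡.cong suc (≡.sym (len (length ys)))) ⟩
    alt (y ∷ ys) (λ y′ ys′ → ∏ (forms (length ys)) (λ c → form c (v y′) 1#) * (∏ ys′ (λ y″ → 1# - 0# * v y″) * V v ys′))
      ≈⟨ alt-cong (y ∷ ys) (λ y′ ys′ p → *-cong
           (trans (pow (length ys) (v y′)) (reflexive (≡.cong (v y′ ^_) (≡.sym (ℕₚ.suc-injective (↭-length p))))))
           (trans (*-congʳ {V v ys′} (∏-1 ys′ (λ y″ → trans (+-congˡ (trans (-‿cong (zeroˡ _)) -0#≈0#)) (+-identityʳ 1#)))) (*-identityˡ (V v ys′)))) ⟩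
    alt (y ∷ ys) (λ y′ ys′ → v y′ ^ length ys′ * V v ys′) ∎
    where
    forms : ℕ → List (Carrier × Carrier)
    forms n = replicate n (0# , 1#)
    len : ∀ n → length (forms n) ≡ n
    len zero = ≡.refl
    len (suc n) = ≡.cong suc (len n)
    one : ∀ n → ∏ (forms n) (λ c → form c 1# 0#) ≈ 1#
    one zero = refl
    one (suc n) = trans (*-cong (trans (+-cong (zeroˡ _) (*-identityˡ _)) (+-identityˡ _)) (one n)) (*-identityˡ _)
    pow : ∀ n z → ∏ (forms n) (λ c → form c z 1#) ≈ z ^ n
    pow zero z = refl
    pow (suc n) z = *-cong (trans (+-congʳ (zeroˡ _)) (trans (+-identityˡ _) (*-identityˡ _))) (pow n z)

  vandermonde : ∀ (v : A → Carrier) ys → V v ys ≈ det (λ e y → v y ^ e) (downFrom (length ys)) ys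
  vandermonde v ys = go (length ys) ys ≡.refl
    where
    go : ∀ n ys → n ≡ length ys → V v ys ≈ det (λ e y → v y ^ e) (downFrom n) ys
    go zero [] e = refl
    go (suc n) (y ∷ ys) e = trans (V-expand v y ys) (alt-cong (y ∷ ys) (λ y′ ys′ p →
      let n≡ = ≡.trans (ℕₚ.suc-injective e) (≡.sym (ℕₚ.suc-injective (↭-length p)))
      in *-cong (reflexive (≡.cong (v y′ ^_) (≡.sym n≡))) (go n ys′ n≡)))

  -- Apart from the corner entry, expanding along the first row and then the first column gives the
  -- same double alternating sum as the opposite order. The inner expansions need the statement for
  -- shorter row lists, hence the induction on a bound for `length as`.
  det-transpose : ∀ (M : A → B → Carrier) as bs → length as ≡ length bs → det M as bs ≈ det (flip M) bs as
  det-transpose M as bs e = go (length as) M as bs ℕₚ.≤-refl e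
    where
    go : ∀ n (M : A → B → Carrier) as bs → length as ℕ.≤ n → length as ≡ length bs → det M as bs ≈ det (flip M) bs as
    go n M [] [] _ e = refl
    go (suc n) M (a ∷ as) (b ∷ bs) (ℕ.s≤s l) e = +-cong (*-congˡ (go n M as bs l e′)) (-‿cong (begin
      alt bs (λ b′ bs′ → M a b′ * det M as (b ∷ bs′))
        ≈⟨ alt-cong bs (λ b′ bs′ p → trans (*-congˡ (go n M as (b ∷ bs′) l (≡.trans e′ (≡.sym (↭-length p))))) (alt-*ˡ as _)) ⟩
      alt bs (λ b′ bs′ → alt as (λ a′ as′ → M a b′ * (M a′ b * det (flip M) bs′ as′)))
        ≈⟨ alt-cong bs (λ b′ bs′ p → alt-cong as (λ a′ as′ q → trans
             (*-congˡ (*-congˡ (sym (go n M as′ bs′ (ℕₚ.≤-trans (ℕₚ.≤-trans (ℕₚ.n≤1+n _) (ℕₚ.≤-reflexive (↭-length q))) l)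
               (ℕₚ.suc-injective (≡.trans (↭-length q) (≡.trans e′ (≡.sym (↭-length p)))))))))
             (solve 3 (λ x y z → x :* (y :* z) := y :* (x :* z)) refl (M a b′) (M a′ b) (det M as′ bs′)))) ⟩
      alt bs (λ b′ bs′ → alt as (λ a′ as′ → M a′ b * (M a b′ * det M as′ bs′))) ≈⟨ alt-swap bs as ⟩
      alt as (λ a′ as′ → alt bs (λ b′ bs′ → M a′ b * (M a b′ * det M as′ bs′)))
        ≈⟨ alt-cong as (λ a′ as′ q → trans (sym (alt-*ˡ bs (M a′ b))) (*-congˡ
             (go n M (a ∷ as′) bs (ℕₚ.≤-trans (ℕₚ.≤-reflexive (↭-length q)) l) (≡.trans (↭-length q) e′)))) ⟩
      alt as (λ a′ as′ → M a′ b * det (flip M) bs (a ∷ as′)) ∎))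
      where
      e′ = ℕₚ.suc-injective e

  ∏-map : ∀ (f : A → B) xs {g} → ∏ (map f xs) g ≈ ∏ xs (g ∘ f)
  ∏-map f [] = refl
  ∏-map f (x ∷ xs) = *-congˡ (∏-map f xs)

  alt-map : ∀ (f : A → B) xs {g} → alt (map f xs) g ≈ alt xs (λ y ys → g (f y) (map f ys))
  alt-map f [] = refl
  alt-map f (x ∷ xs) = +-congˡ (-‿cong (alt-map f xs))

  V-map : ∀ (v : B → Carrier) (f : A → B) xs → V v (map f xs) ≈ V (v ∘ f) xs
  V-map v f [] = refl
  V-map v f (x ∷ xs) = *-cong (∏-map f xs) (V-map v f xs)

  -- Interpolation of ∏ (z − t xᵢ) at the nodes 0, x₁, …, xₐ; the node 0 contributes tᵃ.
  t-identity : ∀ (v v⁻¹ : A → Carrier) → (∀ x → v x * v⁻¹ x ≈ 1#) → ∀ t xs →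
    (1# - ∏ xs (λ _ → t)) * V v xs ≈ (1# - t) * alt xs (λ x ys → ∏ ys (λ y → v x - t * v y) * V v ys)
  t-identity {A = A} v v⁻¹ inv t xs = begin
    (1# - T) * V v xs ≈⟨ sym (trans (*-congʳ PP⁻¹) (*-identityˡ _)) ⟩
    P * P⁻¹ * ((1# - T) * V v xs) ≈⟨ solve 4 (λ P Q T V → P :* Q :* ((:1 :- T) :* V) := Q :* (P :* V :- T :* P :* V)) refl P P⁻¹ T (V v xs) ⟩
    P⁻¹ * (P * V v xs - T * P * V v xs) ≈⟨ *-congˡ (+-congʳ key) ⟩
    P⁻¹ * (T * P * V v xs - - ((1# - t) * P) * S - T * P * V v xs)
      ≈⟨ solve 4 (λ P Q X s → Q :* (X :- :- P :* s :- X) := Q :* (P :* s)) refl ((1# - t) * P) P⁻¹ (T * P * V v xs) S ⟩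
    P⁻¹ * ((1# - t) * P * S) ≈⟨ solve 4 (λ P Q t S → Q :* ((:1 :- t) :* P :* S) := P :* Q :* ((:1 :- t) :* S)) refl P P⁻¹ t S ⟩
    P * P⁻¹ * ((1# - t) * S) ≈⟨ trans (*-congʳ PP⁻¹) (*-identityˡ _) ⟩
    (1# - t) * S ∎
    where
    T = ∏ xs (λ _ → t)
    P = ∏ xs (λ x → 0# - v x)
    P⁻¹ = ∏ xs (λ x → - v⁻¹ x)
    S = alt xs (λ x ys → ∏ ys (λ y → v x - t * v y) * V v ys)
    PP⁻¹ : P * P⁻¹ ≈ 1#
    PP⁻¹ = ∏-inverse xs (λ x → trans (solve 2 (λ a b → (:0 :- a) :* (:- b) := a :* b) refl (v x) (v⁻¹ x)) (inv x))
    node : Maybe A → Carrier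
    node nothing = 0#
    node (just x) = v x
    cs = map (λ x → (- (t * v x) , 1#)) xs
    length-cs : ∀ ys → suc (length (map (just {A = A}) ys)) ≡ suc (length (map (λ x → (- (t * v x) , 1#)) ys))
    length-cs [] = ≡.refl
    length-cs (_ ∷ ys) = ≡.cong suc (length-cs ys)
    no-∏ : ∀ (ys : List (Maybe A)) → ∏ ys (λ y → 1# - 0# * node y) ≈ 1#
    no-∏ ys = ∏-1 ys (λ y → solve 1 (λ a → :1 :- :0 :* a := :1) refl (node y))
    term : ∀ x ys → x ∷ ys ↭ xs →
      ∏ cs (λ c → form c (v x) 1#) * (∏ (nothing ∷ map just ys) (λ y → 1# - 0# * node y) * (∏ (map just ys) (λ y → 0# - node y) * V node (map just ys)))
      ≈ - ((1# - t) * P) * (∏ ys (λ y → v x - t * v y) * V v ys)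
    term x ys p = begin
      ∏ cs (λ c → form c (v x) 1#) * (∏ (nothing ∷ map just ys) (λ y → 1# - 0# * node y) * (∏ (map just ys) (λ y → 0# - node y) * V node (map just ys)))
        ≈⟨ *-cong (trans (∏-map _ xs) (trans (∏-cong xs (λ y → solve 3 (λ t x y → :- (t :* y) :* :1 :+ :1 :* x := x :- t :* y) refl t (v x) (v y))) (sym (∏-↭ _ p))))
             (*-cong (no-∏ (nothing ∷ map just ys)) (*-cong (∏-map just ys) (V-map node just ys))) ⟩
      ((v x - t * v x) * F) * (1# * (G * V v ys))
        ≈⟨ solve 5 (λ x t F G V → ((x :- t :* x) :* F) :* (:1 :* (G :* V)) := :- ((:1 :- t) :* ((:0 :- x) :* G)) :* (F :* V)) refl (v x) t F G (V v ys) ⟩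
      - ((1# - t) * ∏ (x ∷ ys) (λ y → 0# - v y)) * (F * V v ys) ≈⟨ *-congʳ (-‿cong (*-congˡ (∏-↭ _ p))) ⟩
      - ((1# - t) * P) * (F * V v ys) ∎
      where
      F = ∏ ys (λ y → v x - t * v y)
      G = ∏ ys (λ y → 0# - v y)
    -- At infinity all forms are 1. The node 0 yields `T * P * V v xs`; every other summand contains
    -- `(1# - t) * P`, because its factor `v x - t * v x` supplies the missing `0# - v x` up to
    -- sign.
    key : P * V v xs ≈ T * P * V v xs - - ((1# - t) * P) * S
    key = begin
      P * V v xs ≈⟨ sym (trans (*-cong (trans (∏-map _ xs) (∏-1 xs (λ y → solve 2 (λ t y → :- (t :* y) :* :0 :+ :1 :* :1 := :1) refl t (v y))))
                         (*-cong (∏-map just xs) (V-map node just xs))) (*-identityˡ _)) ⟩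
      ∏ cs (λ c → form c 1# 0#) * V node (nothing ∷ map just xs) ≈⟨ lagrange node (nothing ∷ map just xs) cs 1# 0# (length-cs xs) ⟩
      ∏ cs (λ c → form c 0# 1#) * (∏ (map just xs) (λ y → 1# - 0# * node y) * V node (map just xs)) - _
        ≈⟨ +-cong (*-cong (trans (∏-map _ xs) (trans (∏-cong xs (λ y → solve 2 (λ t y → :- (t :* y) :* :1 :+ :1 :* :0 := t :* (:0 :- y)) refl t (v y))) (sym (∏-* xs))))
                          (trans (*-cong (no-∏ (map just xs)) (V-map node just xs)) (*-identityˡ _)))
                  (-‿cong (trans (alt-map just xs) (trans (alt-cong xs term) (sym (alt-*ˡ xs _))))) ⟩
      T * P * V v xs - - ((1# - t) * P) * S ∎

  -- Behind the first row of the padded rectangle the exponents `Lᵢ` are `k + a - 1, …, k`, so their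
  -- alternant is a product as well.
  V-shift : ∀ (v : A → Carrier) k ys → det (λ e y → v y ^ e) (map (k ℕ.+_) (downFrom (length ys))) ys ≈ ∏ ys (λ y → v y ^ k) * V v ys
  V-shift v k ys = trans (go (length ys) ys ≡.refl) (*-congˡ (sym (vandermonde v ys)))
    where
    go : ∀ n ys → n ≡ length ys → det (λ e y → v y ^ e) (map (k ℕ.+_) (downFrom n)) ys ≈
                                  ∏ ys (λ y → v y ^ k) * det (λ e y → v y ^ e) (downFrom n) ys
    go zero [] e = sym (*-identityˡ _)
    go (suc n) ys e = trans (alt-cong ys (λ y ys′ p → trans
      (*-cong (^-homo-* (v y) k n) (go n ys′ (ℕₚ.suc-injective (≡.trans e (≡.sym (↭-length p))))))
      (trans (solve 4 (λ a b c d → a :* b :* (c :* d) := (a :* c) :* (b :* d)) refl (v y ^ k) (v y ^ n) _ _)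
             (*-congʳ (∏-↭ (λ y → v y ^ k) p)))))
      (sym (alt-*ˡ ys _))

  Antisymmetric : (List A → Carrier) → Set
  Antisymmetric Y = ∀ pre x y post → Y (pre ++ x ∷ y ∷ post) ≈ - Y (pre ++ y ∷ x ∷ post)

  V-antisymmetric : ∀ (v : A → Carrier) → Antisymmetric (V v)
  V-antisymmetric v [] x y post =
    solve 5 (λ x y p q V → ((x :- y) :* p) :* (q :* V) := :- (((y :- x) :* q) :* (p :* V))) refl (v x) (v y) _ _ _
  V-antisymmetric v (z ∷ pre) x y post = trans
    (*-cong (∏-↭ _ (shift pre)) (V-antisymmetric v pre x y post)) (sym (-‿distribʳ-* _ _))
    where
    shift : ∀ pre → pre ++ x ∷ y ∷ post ↭ pre ++ y ∷ x ∷ post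
    shift [] = swap x y ↭-refl
    shift (z ∷ pre) = prep z (shift pre)

  -- Moving `y` to the front costs `Y` exactly the sign that `alt` attaches to the choice of `y`, so
  -- all signs cancel.
  alt-antisymmetric : ∀ {Y : List A → Carrier} → Antisymmetric Y → ∀ xs {B} →
    alt xs B * Y xs ≈ pick xs (λ y ys → B y ys * Y (y ∷ ys))
  alt-antisymmetric as [] = zeroˡ _
  alt-antisymmetric {Y = Y} as (x ∷ xs) {B} = begin
    (B x xs - alt xs (λ y ys → B y (x ∷ ys))) * Y (x ∷ xs)
      ≈⟨ solve 3 (λ a b c → (a :- b) :* c := a :* c :+ :- (b :* c)) refl _ _ _ ⟩
    B x xs * Y (x ∷ xs) + - (alt xs (λ y ys → B y (x ∷ ys)) * Y (x ∷ xs))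
      ≈⟨ +-congˡ (-‿cong (alt-antisymmetric {Y = λ l → Y (x ∷ l)} (λ pre → as (x ∷ pre)) xs)) ⟩
    B x xs * Y (x ∷ xs) + - pick xs (λ y ys → B y (x ∷ ys) * Y (x ∷ y ∷ ys))
      ≈⟨ +-congˡ (pick-neg xs) ⟩
    B x xs * Y (x ∷ xs) + pick xs (λ y ys → - (B y (x ∷ ys) * Y (x ∷ y ∷ ys)))
      ≈⟨ +-congˡ (pick-cong xs (λ y ys _ → trans (-‿distribʳ-* _ _) (*-congˡ (trans (-‿cong (as [] x y ys)) (-‿involutive _))))) ⟩
    B x xs * Y (x ∷ xs) + pick xs (λ y ys → B y (x ∷ ys) * Y (y ∷ x ∷ ys)) ∎
    where
    pick-neg : ∀ (xs : List A) {g} → - pick xs g ≈ pick xs (λ y ys → - g y ys)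
    pick-neg [] = -0#≈0#
    pick-neg (x ∷ xs) = trans (sym (-‿+-comm _ _)) (+-congˡ (pick-neg xs))

  -- The number n is meant to be the length of the list that is permuted.
  altPerm permSum : ℕ → List A → (List A → Carrier) → Carrier
  altPerm zero xs G = G []
  altPerm (suc n) xs G = alt xs (λ y ys → altPerm n ys (G ∘ (y ∷_)))
  permSum zero xs G = G []
  permSum (suc n) xs G = pick xs (λ y ys → permSum n ys (G ∘ (y ∷_)))

  altPerm-cong : ∀ n (xs : List A) {G H} → length xs ≡ n → (∀ w → w ↭ xs → G w ≈ H w) → altPerm n xs G ≈ altPerm n xs H
  altPerm-cong zero [] e eq = eq [] ↭-refl
  altPerm-cong (suc n) xs e eq = alt-cong xs (λ y ys p →
    altPerm-cong n ys (ℕₚ.suc-injective (≡.trans (↭-length p) e)) (λ w q → eq (y ∷ w) (↭-trans (prep y q) p)))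

  altPerm-*ˡ : ∀ n (xs : List A) c {G} → c * altPerm n xs G ≈ altPerm n xs (λ w → c * G w)
  altPerm-*ˡ zero xs c = refl
  altPerm-*ˡ (suc n) xs c = trans (alt-*ˡ xs c) (alt-cong xs (λ y ys _ → altPerm-*ˡ n ys c))

  altPerm-antisymmetric : ∀ {Y : List A → Carrier} → Antisymmetric Y → ∀ n xs {G} → length xs ≡ n →
    altPerm n xs G * Y xs ≈ permSum n xs (λ w → G w * Y w)
  altPerm-antisymmetric as zero [] e = refl
  altPerm-antisymmetric {Y = Y} as (suc n) xs e = trans (alt-antisymmetric as xs) (pick-cong xs (λ y ys p →
    altPerm-antisymmetric {Y = λ l → Y (y ∷ l)} (λ pre → as (y ∷ pre)) n ys (ℕₚ.suc-injective (≡.trans (↭-length p) e))))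

  zipΠ : (A → B → Carrier) → List A → List B → Carrier
  zipΠ M (a ∷ as) (b ∷ bs) = M a b * zipΠ M as bs
  zipΠ M _ _ = 1#

  det-altPerm : ∀ (M : A → B → Carrier) as bs → det M as bs ≈ altPerm (length as) bs (zipΠ M as)
  det-altPerm M [] bs = refl
  det-altPerm M (a ∷ as) bs = alt-cong bs (λ b bs′ _ → trans (*-congˡ (det-altPerm M as bs′)) (altPerm-*ˡ (length as) bs′ (M a b)))

  altPerm-*ʳ : ∀ n (xs : List A) c {G} → altPerm n xs G * c ≈ altPerm n xs (λ w → G w * c)
  altPerm-*ʳ zero xs c = refl
  altPerm-*ʳ (suc n) xs c {G} = trans (alt-*ʳ xs c) (alt-cong xs (λ y ys _ → altPerm-*ʳ n ys c))

  altPerm-map : ∀ n (f : A → B) xs {G} → altPerm n (map f xs) G ≈ altPerm n xs (λ w → G (map f w))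
  altPerm-map zero f xs = refl
  altPerm-map (suc n) f xs = trans (alt-map f xs) (alt-cong xs (λ y ys _ → altPerm-map n f ys))

  permSum-cong : ∀ n (xs : List A) {G H} → length xs ≡ n → (∀ w → w ↭ xs → G w ≈ H w) → permSum n xs G ≈ permSum n xs H
  permSum-cong zero [] e eq = eq [] ↭-refl
  permSum-cong (suc n) xs e eq = pick-cong xs (λ y ys p →
    permSum-cong n ys (ℕₚ.suc-injective (≡.trans (↭-length p) e)) (λ w q → eq (y ∷ w) (↭-trans (prep y q) p)))

  permSum-*ʳ : ∀ n (xs : List A) c {G} → permSum n xs G * c ≈ permSum n xs (λ w → G w * c)
  permSum-*ʳ zero xs c = refl
  permSum-*ʳ (suc n) xs c = trans (pick-*ʳ xs c) (pick-cong xs (λ y ys _ → permSum-*ʳ n ys c))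

open ≡ using (refl; sym; trans; cong; cong₂; subst; module ≡-Reasoning; _≢_; subst₂)

-- Finite sums of integers.

private variable I J : Set

∑ : List I → (I → ℤ) → ℤ
∑ [] g = + 0
∑ (x ∷ xs) g = g x ℤ.+ ∑ xs g

∑-cong : ∀ (xs : List I) {g h} → (∀ x → g x ≡ h x) → ∑ xs g ≡ ∑ xs h
∑-cong [] e = refl
∑-cong (x ∷ xs) e = cong₂ ℤ._+_ (e x) (∑-cong xs e)

∑-++ : ∀ (xs ys : List I) {g} → ∑ (xs ++ ys) g ≡ ∑ xs g ℤ.+ ∑ ys g
∑-++ [] ys = sym (ℤₚ.+-identityˡ _)
∑-++ (x ∷ xs) ys {g} = trans (cong (ℤ._+_ (g x)) (∑-++ xs ys)) (sym (ℤₚ.+-assoc (g x) _ _))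

∑-map : ∀ (f : I → J) xs {g} → ∑ (map f xs) g ≡ ∑ xs (g ∘ f)
∑-map f [] = refl
∑-map f (x ∷ xs) {g} = cong (ℤ._+_ (g (f x))) (∑-map f xs)

∑-concatMap : ∀ (f : I → List J) xs {g} → ∑ (concatMap f xs) g ≡ ∑ xs (λ x → ∑ (f x) g)
∑-concatMap f [] = refl
∑-concatMap f (x ∷ xs) = trans (∑-++ (f x) _) (cong (ℤ._+_ (∑ (f x) _)) (∑-concatMap f xs))

∑-+ : ∀ (xs : List I) {g h} → ∑ xs (λ x → g x ℤ.+ h x) ≡ ∑ xs g ℤ.+ ∑ xs h
∑-+ [] = refl
∑-+ (x ∷ xs) {g} {h} = trans (cong (ℤ._+_ (g x ℤ.+ h x)) (∑-+ xs {g} {h})) (lemma (g x) (h x) _ _)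
  where
  lemma : ∀ a b c d → (a ℤ.+ b) ℤ.+ (c ℤ.+ d) ≡ (a ℤ.+ c) ℤ.+ (b ℤ.+ d)
  lemma = ℤSolver.solve-∀

∑-*ˡ : ∀ c (xs : List I) {g} → c ℤ.* ∑ xs g ≡ ∑ xs (λ x → c ℤ.* g x)
∑-*ˡ c [] = ℤₚ.*-zeroʳ c
∑-*ˡ c (x ∷ xs) {g} = trans (ℤₚ.*-distribˡ-+ c (g x) _) (cong (ℤ._+_ (c ℤ.* g x)) (∑-*ˡ c xs {g}))

∑-*ʳ : ∀ c (xs : List I) {g} → ∑ xs g ℤ.* c ≡ ∑ xs (λ x → g x ℤ.* c)
∑-*ʳ c xs {g} = trans (ℤₚ.*-comm _ c) (trans (∑-*ˡ c xs) (∑-cong xs (λ x → ℤₚ.*-comm c (g x))))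

∑-neg : ∀ (xs : List I) {g} → ∑ xs (λ x → ℤ.- g x) ≡ ℤ.- ∑ xs g
∑-neg [] = refl
∑-neg (x ∷ xs) {g} = trans (cong (ℤ._+_ (ℤ.- g x)) (∑-neg xs {g})) (sym (ℤₚ.neg-distrib-+ (g x) _))

∑-0 : ∀ (xs : List I) {g} → (∀ x → g x ≡ + 0) → ∑ xs g ≡ + 0
∑-0 [] e = refl
∑-0 (x ∷ xs) e = cong₂ ℤ._+_ (e x) (∑-0 xs e)

∑-swap : ∀ (xs : List I) (ys : List J) {g : I → J → ℤ} → ∑ xs (λ x → ∑ ys (g x)) ≡ ∑ ys (λ y → ∑ xs (λ x → g x y))
∑-swap [] ys = sym (∑-0 ys (λ _ → refl))
∑-swap (x ∷ xs) ys {g} = trans (cong (ℤ._+_ (∑ ys (g x))) (∑-swap xs ys {g})) (sym (∑-+ ys {g x}))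

∑≤ : ℕ → (ℕ → ℤ) → ℤ
∑≤ zero h = h 0
∑≤ (suc D) h = h 0 ℤ.+ ∑≤ D (h ∘ suc)

∑≤-cong : ∀ D {g h} → (∀ b → g b ≡ h b) → ∑≤ D g ≡ ∑≤ D h
∑≤-cong zero e = e 0
∑≤-cong (suc D) e = cong₂ ℤ._+_ (e 0) (∑≤-cong D (e ∘ suc))

-- Graded monoid rings, truncated geometric series, and homomorphisms of the exponents.

record CMon : Set₁ where
  infixl 7 _∙_
  field
    E : Set
    _∙_ : E → E → E
    ε : E
    assoc : ∀ a b c → (a ∙ b) ∙ c ≡ a ∙ (b ∙ c)
    comm : ∀ a b → a ∙ b ≡ b ∙ a
    idˡ : ∀ a → ε ∙ a ≡ a

  idʳ : ∀ a → a ∙ ε ≡ a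
  idʳ a = trans (comm a ε) (idˡ a)

  pow : ℕ → E → E
  pow zero e = ε
  pow (suc b) e = e ∙ pow b e

  powprod : List E → List ℕ → E
  powprod (e ∷ es) (b ∷ bs) = pow b e ∙ powprod es bs
  powprod _ _ = ε

  pow-∙ : ∀ b x y → pow b (x ∙ y) ≡ pow b x ∙ pow b y
  pow-∙ zero x y = sym (idˡ ε)
  pow-∙ (suc b) x y = begin
    (x ∙ y) ∙ pow b (x ∙ y) ≡⟨ cong ((x ∙ y) ∙_) (pow-∙ b x y) ⟩
    (x ∙ y) ∙ (pow b x ∙ pow b y) ≡⟨ assoc x y _ ⟩
    x ∙ (y ∙ (pow b x ∙ pow b y)) ≡⟨ cong (x ∙_) (trans (sym (assoc y _ _)) (trans (cong (_∙ pow b y) (comm y _)) (assoc _ y _))) ⟩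
    x ∙ (pow b x ∙ (y ∙ pow b y)) ≡⟨ sym (assoc x _ _) ⟩
    (x ∙ pow b x) ∙ (y ∙ pow b y) ∎
    where open ≡-Reasoning

record Hom (M M′ : CMon) : Set where
  module M = CMon M
  module M′ = CMon M′
  field
    ⟦_⟧ : M.E → M′.E
    ⟦∙⟧ : ∀ a b → ⟦ a M.∙ b ⟧ ≡ ⟦ a ⟧ M′.∙ ⟦ b ⟧
    ⟦ε⟧ : ⟦ M.ε ⟧ ≡ M′.ε

  ⟦pow⟧ : ∀ b a → ⟦ M.pow b a ⟧ ≡ M′.pow b ⟦ a ⟧
  ⟦pow⟧ zero a = ⟦ε⟧
  ⟦pow⟧ (suc b) a = trans (⟦∙⟧ a _) (cong (⟦ a ⟧ M′.∙_) (⟦pow⟧ b a))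

-- Like terms are never collected and may cancel; an element is known only through the sums
-- `⟨ P , f ⟩`, so no normal form is required.
module Terms (M : CMon) where
  open CMon M

  Carrier : Set
  Carrier = List (ℤ × E)

  opaque
    _+_ _*_ : Carrier → Carrier → Carrier
    P + Q = P ++ Q
    P * Q = concatMap (λ (c , a) → map (λ (d , b) → (c ℤ.* d , a ∙ b)) Q) P

    -_ : Carrier → Carrier
    - P = map (λ (c , a) → (ℤ.- c , a)) P

    0# 1# : Carrier
    0# = []
    1# = (+ 1 , ε) ∷ []

    mono : E → Carrier
    mono e = (+ 1 , e) ∷ []

    ⟨_,_⟩ : Carrier → (E → ℤ) → ℤ
    ⟨ P , f ⟩ = ∑ P (λ (c , e) → c ℤ.* f e)

    ⟨⟩-cong : ∀ P {f g} → (∀ e → f e ≡ g e) → ⟨ P , f ⟩ ≡ ⟨ P , g ⟩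
    ⟨⟩-cong P e = ∑-cong P (λ (c , a) → cong (c ℤ.*_) (e a))

    ⟨⟩-+ : ∀ P Q f → ⟨ P + Q , f ⟩ ≡ ⟨ P , f ⟩ ℤ.+ ⟨ Q , f ⟩
    ⟨⟩-+ P Q f = ∑-++ P Q

    ⟨⟩-neg : ∀ P f → ⟨ - P , f ⟩ ≡ ℤ.- ⟨ P , f ⟩
    ⟨⟩-neg P f = trans (∑-map _ P) (trans (∑-cong P (λ (c , e) → sym (ℤₚ.neg-distribˡ-* c (f e)))) (∑-neg P))

    ⟨⟩-0 : ∀ f → ⟨ 0# , f ⟩ ≡ + 0
    ⟨⟩-0 f = refl

    ⟨⟩-mono : ∀ e f → ⟨ mono e , f ⟩ ≡ f e
    ⟨⟩-mono e f = trans (ℤₚ.+-identityʳ _) (ℤₚ.*-identityˡ _)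

    1≡mono : 1# ≡ mono ε
    1≡mono = refl

    ⟨⟩-* : ∀ P Q f → ⟨ P * Q , f ⟩ ≡ ⟨ P , (λ a → ⟨ Q , (λ b → f (a ∙ b)) ⟩) ⟩
    ⟨⟩-* P Q f = trans (∑-concatMap _ P) (∑-cong P (λ (c , a) → trans (∑-map _ Q)
      (trans (∑-cong Q (λ (d , b) → ℤₚ.*-assoc c d _)) (sym (∑-*ˡ c Q)))))

    ⟨⟩-swap : ∀ P Q (f : E → E → ℤ) → ⟨ P , (λ a → ⟨ Q , f a ⟩) ⟩ ≡ ⟨ Q , (λ b → ⟨ P , (λ a → f a b) ⟩) ⟩
    ⟨⟩-swap P Q f = begin
      ∑ P (λ (c , a) → c ℤ.* ∑ Q (λ (d , b) → d ℤ.* f a b)) ≡⟨ ∑-cong P (λ (c , a) → ∑-*ˡ c Q) ⟩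
      ∑ P (λ (c , a) → ∑ Q (λ (d , b) → c ℤ.* (d ℤ.* f a b))) ≡⟨ ∑-swap P Q ⟩
      ∑ Q (λ (d , b) → ∑ P (λ (c , a) → c ℤ.* (d ℤ.* f a b))) ≡⟨ ∑-cong Q (λ (d , b) → trans (∑-cong P (λ (c , a) → lemma c d (f a b))) (sym (∑-*ˡ d P))) ⟩
      ∑ Q (λ (d , b) → d ℤ.* ∑ P (λ (c , a) → c ℤ.* f a b)) ∎
      where
      open ≡-Reasoning
      lemma : ∀ c d x → c ℤ.* (d ℤ.* x) ≡ d ℤ.* (c ℤ.* x)
      lemma = ℤSolver.solve-∀

    ⟨⟩-0ʳ : ∀ P {f} → (∀ e → f e ≡ + 0) → ⟨ P , f ⟩ ≡ + 0
    ⟨⟩-0ʳ P z = ∑-0 P (λ (c , e) → trans (cong (c ℤ.*_) (z e)) (ℤₚ.*-zeroʳ c))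

    ⟨⟩-scale : ∀ P c f → ⟨ P , (λ e → c ℤ.* f e) ⟩ ≡ c ℤ.* ⟨ P , f ⟩
    ⟨⟩-scale P c f = trans (∑-cong P (λ (d , e) → lemma d c (f e))) (sym (∑-*ˡ c P))
      where
      lemma : ∀ d c x → d ℤ.* (c ℤ.* x) ≡ c ℤ.* (d ℤ.* x)
      lemma = ℤSolver.solve-∀

    Supp : (E → Set) → Carrier → Set
    Supp S P = All (S ∘ proj₂) P

    supp-+ : ∀ {S P Q} → Supp S P → Supp S Q → Supp S (P + Q)
    supp-+ = Allₚ.++⁺

    supp-neg : ∀ {S P} → Supp S P → Supp S (- P)
    supp-neg p = Allₚ.map⁺ p

    supp-* : ∀ {S S′ S″ P Q} → (∀ {a b} → S a → S′ b → S″ (a ∙ b)) → Supp S P → Supp S′ Q → Supp S″ (P * Q)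
    supp-* h p q = Allₚ.concat⁺ (Allₚ.map⁺ (All.map (λ sa → Allₚ.map⁺ (All.map (h sa) q)) p))

    supp-mono : ∀ {S e} → S e → Supp S (mono e)
    supp-mono s = s ∷ []

    ⟨⟩-supp : ∀ {S P f g} → Supp S P → (∀ e → S e → f e ≡ g e) → ⟨ P , f ⟩ ≡ ⟨ P , g ⟩
    ⟨⟩-supp [] h = refl
    ⟨⟩-supp {P = (c , e) ∷ P} (s ∷ p) h = cong₂ ℤ._+_ (cong (c ℤ.*_) (h e s)) (⟨⟩-supp p h)

opaque
  unfolding Terms._+_
  mapE : ∀ {M M′} → Hom M M′ → Terms.Carrier M → Terms.Carrier M′
  mapE φ = map (λ (c , e) → (c , Hom.⟦_⟧ φ e))

  mapE-+ : ∀ {M M′} (φ : Hom M M′) P Q → mapE φ (Terms._+_ M P Q) ≡ Terms._+_ M′ (mapE φ P) (mapE φ Q)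
  mapE-+ φ P Q = Listₚ.map-++ _ P Q

  mapE-neg : ∀ {M M′} (φ : Hom M M′) P → mapE φ (Terms.-_ M P) ≡ Terms.-_ M′ (mapE φ P)
  mapE-neg φ P = trans (sym (Listₚ.map-∘ P)) (Listₚ.map-∘ P)

  mapE-mono : ∀ {M M′} (φ : Hom M M′) e → mapE φ (Terms.mono M e) ≡ Terms.mono M′ (Hom.⟦_⟧ φ e)
  mapE-mono φ e = refl

  mapE-* : ∀ {M M′} (φ : Hom M M′) P Q → mapE φ (Terms._*_ M P Q) ≡ Terms._*_ M′ (mapE φ P) (mapE φ Q)
  mapE-* φ [] Q = refl
  mapE-* {M} {M′} φ ((c , a) ∷ P) Q = trans (Listₚ.map-++ _ (map _ Q) _) (cong₂ _++_
    (trans (sym (Listₚ.map-∘ Q)) (trans (Listₚ.map-cong (λ (d , b) → cong (c ℤ.* d ,_) (Hom.⟦∙⟧ φ a b)) Q) (Listₚ.map-∘ Q)))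
    (mapE-* {M} {M′} φ P Q))

  ⟨⟩-mapE : ∀ {M M′} (φ : Hom M M′) P f → Terms.⟨_,_⟩ M′ (mapE φ P) f ≡ Terms.⟨_,_⟩ M P (f ∘ Hom.⟦_⟧ φ)
  ⟨⟩-mapE φ P f = ∑-map _ P

module MonoidRing (M : CMon) (deg : CMon.E M → ℕ)
                  (deg-∙ : ∀ a b → deg (CMon._∙_ M a b) ≡ deg a ℕ.+ deg b) (N : ℕ) where
  open CMon M
  open Terms M

  Test : (E → ℤ) → Set
  Test f = ∀ e → N ℕ.< deg e → f e ≡ + 0

  -- Multiplication never lowers the degree. This is what makes the congruence below compatible with
  -- products.
  test-∙ : ∀ {f} a → Test f → Test (λ b → f (a ∙ b))
  test-∙ a t b l = t (a ∙ b) (ℕₚ.<-≤-trans l (subst (deg b ℕ.≤_) (sym (deg-∙ a b)) (ℕₚ.m≤n+m (deg b) (deg a))))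

  infix 4 _≈_
  -- Congruence modulo the terms of degree exceeding N, tested by linear functionals.
  record _≈_ (P Q : Carrier) : Set where
    constructor tested
    field ⟨_⟩≈ : ∀ {f} → Test f → ⟨ P , f ⟩ ≡ ⟨ Q , f ⟩
  open _≈_ public

  private
    exact : ∀ {P Q} → (∀ f → ⟨ P , f ⟩ ≡ ⟨ Q , f ⟩) → P ≈ Q
    exact e = tested (λ {f} _ → e f)

    *-cong : ∀ {P P′ Q Q′} → P ≈ P′ → Q ≈ Q′ → (P * Q) ≈ (P′ * Q′)
    *-cong {P} {P′} {Q} {Q′} p q = tested λ {f} t → begin
      ⟨ P * Q , f ⟩ ≡⟨ ⟨⟩-* P Q f ⟩
      ⟨ P , (λ a → ⟨ Q , (λ b → f (a ∙ b)) ⟩) ⟩ ≡⟨ ⟨⟩-cong P (λ a → ⟨ q ⟩≈ (test-∙ a t)) ⟩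
      ⟨ P , (λ a → ⟨ Q′ , (λ b → f (a ∙ b)) ⟩) ⟩ ≡⟨ ⟨⟩-swap P Q′ _ ⟩
      ⟨ Q′ , (λ b → ⟨ P , (λ a → f (a ∙ b)) ⟩) ⟩ ≡⟨ ⟨⟩-cong Q′ (λ b → ⟨ p ⟩≈ (λ a l → trans (cong f (comm a b)) (test-∙ b t a l))) ⟩
      ⟨ Q′ , (λ b → ⟨ P′ , (λ a → f (a ∙ b)) ⟩) ⟩ ≡⟨ ⟨⟩-swap Q′ P′ _ ⟩
      ⟨ P′ , (λ a → ⟨ Q′ , (λ b → f (a ∙ b)) ⟩) ⟩ ≡⟨ sym (⟨⟩-* P′ Q′ f) ⟩
      ⟨ P′ * Q′ , f ⟩ ∎
      where open ≡-Reasoning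

    *-comm : ∀ P Q → P * Q ≈ Q * P
    *-comm P Q = exact λ f → trans (⟨⟩-* P Q f) (trans (⟨⟩-swap P Q _)
      (trans (⟨⟩-cong Q (λ b → ⟨⟩-cong P (λ a → cong f (comm a b)))) (sym (⟨⟩-* Q P f))))

    *-assoc : ∀ P Q S → (P * Q) * S ≈ P * (Q * S)
    *-assoc P Q S = exact λ f → begin
      ⟨ (P * Q) * S , f ⟩ ≡⟨ ⟨⟩-* (P * Q) S f ⟩
      ⟨ P * Q , (λ e → ⟨ S , (λ c → f (e ∙ c)) ⟩) ⟩ ≡⟨ ⟨⟩-* P Q _ ⟩
      ⟨ P , (λ a → ⟨ Q , (λ b → ⟨ S , (λ c → f ((a ∙ b) ∙ c)) ⟩) ⟩) ⟩
        ≡⟨ ⟨⟩-cong P (λ a → trans (⟨⟩-cong Q (λ b → ⟨⟩-cong S (λ c → cong f (assoc a b c)))) (sym (⟨⟩-* Q S _))) ⟩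
      ⟨ P , (λ a → ⟨ Q * S , (λ e → f (a ∙ e)) ⟩) ⟩ ≡⟨ sym (⟨⟩-* P (Q * S) f) ⟩
      ⟨ P * (Q * S) , f ⟩ ∎
      where open ≡-Reasoning

    *-identityˡ : ∀ P → 1# * P ≈ P
    *-identityˡ P = exact λ f → trans (⟨⟩-* 1# P f) (trans (cong (λ o → ⟨ o , (λ a → ⟨ P , (λ b → f (a ∙ b)) ⟩) ⟩) 1≡mono)
      (trans (⟨⟩-mono ε _) (⟨⟩-cong P (λ b → cong f (idˡ b)))))

    distribʳ : ∀ P Q S → (Q + S) * P ≈ (Q * P) + (S * P)
    distribʳ P Q S = exact λ f → trans (⟨⟩-* (Q + S) P f) (trans (⟨⟩-+ Q S _)
      (trans (cong₂ ℤ._+_ (sym (⟨⟩-* Q P f)) (sym (⟨⟩-* S P f))) (sym (⟨⟩-+ (Q * P) (S * P) f))))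

    ≈-trans : ∀ {P Q S} → P ≈ Q → Q ≈ S → P ≈ S
    ≈-trans p q = tested λ t → trans (⟨ p ⟩≈ t) (⟨ q ⟩≈ t)

    +-cong : ∀ {P P′ Q Q′} → P ≈ P′ → Q ≈ Q′ → (P + Q) ≈ (P′ + Q′)
    +-cong {P} {P′} {Q} {Q′} p q = tested λ {f} t → trans (⟨⟩-+ P Q f) (trans (cong₂ ℤ._+_ (⟨ p ⟩≈ t) (⟨ q ⟩≈ t)) (sym (⟨⟩-+ P′ Q′ f)))

    +-comm : ∀ P Q → P + Q ≈ Q + P
    +-comm P Q = exact λ f → trans (⟨⟩-+ P Q f) (trans (ℤₚ.+-comm ⟨ P , f ⟩ _) (sym (⟨⟩-+ Q P f)))

    +-identityˡ : ∀ P → 0# + P ≈ P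
    +-identityˡ P = exact λ f → trans (⟨⟩-+ 0# P f) (trans (cong (ℤ._+ ⟨ P , f ⟩) (⟨⟩-0 f)) (ℤₚ.+-identityˡ _))

    -‿inverseˡ : ∀ P → (- P) + P ≈ 0#
    -‿inverseˡ P = exact λ f → trans (⟨⟩-+ (- P) P f) (trans (cong (ℤ._+ ⟨ P , f ⟩) (⟨⟩-neg P f))
      (trans (ℤₚ.+-inverseˡ ⟨ P , f ⟩) (sym (⟨⟩-0 f))))

  ring : CommutativeRing 0ℓ 0ℓ
  ring = record
    { Carrier = Carrier ; _≈_ = _≈_ ; _+_ = _+_ ; _*_ = _*_ ; -_ = -_ ; 0# = 0# ; 1# = 1#
    ; isCommutativeRing = record
      { isRing = record
        { +-isAbelianGroup = record
          { isGroup = record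
            { isMonoid = record
              { isSemigroup = record
                { isMagma = record
                  { isEquivalence = record { refl = tested (λ _ → refl) ; sym = λ p → tested (λ t → sym (⟨ p ⟩≈ t)) ; trans = ≈-trans }
                  ; ∙-cong = +-cong }
                ; assoc = λ P Q S → exact λ f → trans (⟨⟩-+ (P + Q) S f) (trans (cong (ℤ._+ ⟨ S , f ⟩) (⟨⟩-+ P Q f))
                    (trans (ℤₚ.+-assoc ⟨ P , f ⟩ _ _) (trans (cong (λ z → ⟨ P , f ⟩ ℤ.+ z) (sym (⟨⟩-+ Q S f))) (sym (⟨⟩-+ P (Q + S) f))))) }
              ; identity = +-identityˡ , λ P → ≈-trans (+-comm P 0#) (+-identityˡ P) }
            ; inverse = -‿inverseˡ , λ P → ≈-trans (+-comm P (- P)) (-‿inverseˡ P)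
            ; ⁻¹-cong = λ {P} {Q} p → tested λ {f} t → trans (⟨⟩-neg P f) (trans (cong ℤ.-_ (⟨ p ⟩≈ t)) (sym (⟨⟩-neg Q f))) }
          ; comm = +-comm }
        ; *-cong = *-cong
        ; *-assoc = *-assoc
        ; *-identity = *-identityˡ , λ P → ≈-trans (*-comm P 1#) (*-identityˡ P)
        ; distrib = (λ P Q S → ≈-trans (*-comm P (Q + S)) (≈-trans (distribʳ P Q S) (+-cong (*-comm Q P) (*-comm S P)))) , distribʳ }
      ; *-comm = *-comm } }

  mono-* : ∀ a b → mono a * mono b ≈ mono (a ∙ b)
  mono-* a b = exact λ f → trans (⟨⟩-* (mono a) (mono b) f) (trans (⟨⟩-mono a _) (trans (⟨⟩-mono b _) (sym (⟨⟩-mono (a ∙ b) f))))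

  ⟨mono*⟩ : ∀ a P f → ⟨ mono a * P , f ⟩ ≡ ⟨ P , (λ e → f (a ∙ e)) ⟩
  ⟨mono*⟩ a P f = trans (⟨⟩-* (mono a) P f) (⟨⟩-mono a _)

  high-degree : ∀ {P} → Supp (λ e → N ℕ.< deg e) P → P ≈ 0#
  high-degree {P} s = tested λ {f} t → trans (⟨⟩-supp s (λ e l → t e l)) (trans (⟨⟩-0ʳ P (λ _ → refl)) (sym (⟨⟩-0 f)))

ℕM ℤM : CMon
ℕM = record { E = ℕ ; _∙_ = ℕ._+_ ; ε = 0 ; assoc = ℕₚ.+-assoc ; comm = ℕₚ.+-comm ; idˡ = λ _ → refl }
ℤM = record { E = ℤ ; _∙_ = ℤ._+_ ; ε = + 0 ; assoc = ℤₚ.+-assoc ; comm = ℤₚ.+-comm ; idˡ = ℤₚ.+-identityˡ }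

infixr 5 _×M_
_×M_ : CMon → CMon → CMon
M ×M M′ = record
  { E = M.E × M′.E
  ; _∙_ = λ (a , a′) (b , b′) → a M.∙ b , a′ M′.∙ b′
  ; ε = M.ε , M′.ε
  ; assoc = λ (a , a′) (b , b′) (c , c′) → cong₂ _,_ (M.assoc a b c) (M′.assoc a′ b′ c′)
  ; comm = λ (a , a′) (b , b′) → cong₂ _,_ (M.comm a b) (M′.comm a′ b′)
  ; idˡ = λ (a , a′) → cong₂ _,_ (M.idˡ a) (M′.idˡ a′)
  }
  where
  module M = CMon M
  module M′ = CMon M′

VecM : CMon → ℕ → CMon
VecM M n = record
  { E = Vec E n
  ; _∙_ = Vec.zipWith _∙_
  ; ε = Vec.replicate n ε
  ; assoc = as
  ; comm = co
  ; idˡ = il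
  }
  where
  open CMon M
  as : ∀ {n} (x y z : Vec E n) → Vec.zipWith _∙_ (Vec.zipWith _∙_ x y) z ≡ Vec.zipWith _∙_ x (Vec.zipWith _∙_ y z)
  as [] [] [] = refl
  as (x ∷ xs) (y ∷ ys) (z ∷ zs) = cong₂ _∷_ (assoc x y z) (as xs ys zs)
  co : ∀ {n} (x y : Vec E n) → Vec.zipWith _∙_ x y ≡ Vec.zipWith _∙_ y x
  co [] [] = refl
  co (x ∷ xs) (y ∷ ys) = cong₂ _∷_ (comm x y) (co xs ys)
  il : ∀ {n} (x : Vec E n) → Vec.zipWith _∙_ (Vec.replicate n ε) x ≡ x
  il [] = refl
  il (x ∷ xs) = cong₂ _∷_ (idˡ x) (il xs)

powℤ : ∀ b x → CMon.pow ℤM b x ≡ + b ℤ.* x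
powℤ zero x = sym (ℤₚ.*-zeroˡ x)
powℤ (suc b) x = trans (cong (λ z → x ℤ.+ z) (powℤ b x)) (sym (ℤₚ.suc-* (+ b) x))

pow-× : ∀ M M′ b x → CMon.pow (M ×M M′) b x ≡ (CMon.pow M b (proj₁ x) , CMon.pow M′ b (proj₂ x))
pow-× M M′ zero x = refl
pow-× M M′ (suc b) x = cong (CMon._∙_ (M ×M M′) x) (pow-× M M′ b x)

-- geo a stands for 1 / (1 − a); it is evaluated as a geometric series of fixed length.
data Fac (E : Set) : Set where
  mon : E → Fac E
  diff : E → E → Fac E
  geo : E → Fac E

mapFac : ∀ {E E′ : Set} → (E → E′) → Fac E → Fac E′
mapFac φ (mon a) = mon (φ a)
mapFac φ (diff a b) = diff (φ a) (φ b)
mapFac φ (geo a) = geo (φ a)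

AllFac : ∀ {E : Set} → (E → Set) → Fac E → Set
AllFac S (mon a) = S a
AllFac S (diff a b) = S a × S b
AllFac S (geo a) = S a

module Eval (M : CMon) (D : ℕ) where
  open CMon M
  open Terms M

  series : ℕ → E → Carrier
  series zero a = 1#
  series (suc n) a = 1# + (mono a * series n a)

  fac : Fac E → Carrier
  fac (mon a) = mono a
  fac (diff a b) = mono a + (- mono b)
  fac (geo a) = series D a

  ev : List (Fac E) → Carrier
  ev [] = 1#
  ev (f ∷ fs) = fac f * ev fs

  ⟨series⟩ : ∀ n a f → ⟨ series n a , f ⟩ ≡ ∑≤ n (λ b → f (pow b a))
  ⟨series⟩ zero a f = trans (cong (λ o → ⟨ o , f ⟩) 1≡mono) (⟨⟩-mono ε f)
  ⟨series⟩ (suc n) a f = trans (⟨⟩-+ 1# _ f) (cong₂ ℤ._+_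
    (trans (cong (λ o → ⟨ o , f ⟩) 1≡mono) (⟨⟩-mono ε f))
    (trans (⟨⟩-* (mono a) (series n a) f) (trans (⟨⟩-mono a _) (⟨series⟩ n a _))))

  supp-ev : ∀ {S : E → Set} → S ε → (∀ {a b} → S a → S b → S (a ∙ b)) → ∀ {fs} → All (AllFac S) fs → Supp S (ev fs)
  supp-ev {S} sε s∙ = go
    where
    supp-1 : Supp S 1#
    supp-1 = subst (Supp S) (sym 1≡mono) (supp-mono sε)
    supp-series : ∀ n {a} → S a → Supp S (series n a)
    supp-series zero sa = supp-1
    supp-series (suc n) sa = supp-+ supp-1 (supp-* s∙ (supp-mono sa) (supp-series n sa))
    supp-fac : ∀ f → AllFac S f → Supp S (fac f)
    supp-fac (mon a) s = supp-mono s
    supp-fac (diff a b) (s , s′) = supp-+ (supp-mono s) (supp-neg (supp-mono s′))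
    supp-fac (geo a) s = supp-series D s
    go : ∀ {fs} → All (AllFac S) fs → Supp S (ev fs)
    go [] = supp-1
    go {f ∷ fs} (s ∷ ss) = supp-* s∙ (supp-fac f s) (go ss)

mapE-ev : ∀ {M M′} (φ : Hom M M′) D fs → mapE φ (Eval.ev M D fs) ≡ Eval.ev M′ D (map (mapFac (Hom.⟦_⟧ φ)) fs)
mapE-ev {M} {M′} φ D = go
  where
  module S = Terms M
  module T = Terms M′
  h-1 : mapE φ S.1# ≡ T.1#
  h-1 = trans (cong (mapE φ) S.1≡mono) (trans (mapE-mono φ _) (trans (cong T.mono (Hom.⟦ε⟧ φ)) (sym T.1≡mono)))
  h-series : ∀ n a → mapE φ (Eval.series M D n a) ≡ Eval.series M′ D n (Hom.⟦_⟧ φ a)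
  h-series zero a = h-1
  h-series (suc n) a = trans (mapE-+ φ _ _) (cong₂ T._+_ h-1 (trans (mapE-* φ _ _) (cong₂ T._*_ (mapE-mono φ a) (h-series n a))))
  h-fac : ∀ f → mapE φ (Eval.fac M D f) ≡ Eval.fac M′ D (mapFac (Hom.⟦_⟧ φ) f)
  h-fac (mon a) = mapE-mono φ a
  h-fac (diff a b) = trans (mapE-+ φ _ _) (cong₂ T._+_ (mapE-mono φ a) (trans (mapE-neg φ _) (cong T.-_ (mapE-mono φ b))))
  h-fac (geo a) = h-series D a
  go : ∀ fs → mapE φ (Eval.ev M D fs) ≡ Eval.ev M′ D (map (mapFac (Hom.⟦_⟧ φ)) fs)
  go [] = h-1
  go (f ∷ fs) = trans (mapE-* φ _ _) (cong₂ T._*_ (h-fac f) (go fs))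

-- Change of variables as an exact identity: both sides use series of the same length, so the
-- homomorphism need not respect any degree. Some of the substitutions used later do change the
-- grading.
⟨ev⟩-hom : ∀ {M M′} (φ : Hom M M′) D fs f →
  Terms.⟨_,_⟩ M (Eval.ev M D fs) (f ∘ Hom.⟦_⟧ φ) ≡ Terms.⟨_,_⟩ M′ (Eval.ev M′ D (map (mapFac (Hom.⟦_⟧ φ)) fs)) f
⟨ev⟩-hom {M} {M′} φ D fs f = trans (sym (⟨⟩-mapE φ (Eval.ev M D fs) f)) (cong (λ P → Terms.⟨_,_⟩ M′ P f) (mapE-ev φ D fs))

vdm : ∀ {E : Set} → List E → List (Fac E)
vdm [] = []
vdm (y ∷ ys) = map (diff y) ys ++ vdm ys

vdm-map : ∀ {E E′ : Set} (φ : E → E′) ys → map (mapFac φ) (vdm ys) ≡ vdm (map φ ys)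
vdm-map φ [] = refl
vdm-map φ (y ∷ ys) = trans (Listₚ.map-++ (mapFac φ) (map (diff y) ys) _)
  (cong₂ _++_ (trans (sym (Listₚ.map-∘ ys)) (Listₚ.map-∘ ys)) (vdm-map φ ys))

module FacRing (M : CMon) (deg : CMon.E M → ℕ)
               (deg-∙ : ∀ a b → deg (CMon._∙_ M a b) ≡ deg a ℕ.+ deg b) (N D : ℕ) (N≤D : N ℕ.≤ D) where
  open CMon M
  module T = Terms M
  open T using (mono; ⟨_,_⟩; supp-mono)
  module MR = MonoidRing M deg deg-∙ N
  open MR using (ring; mono-*; high-degree; Test; _≈_; tested; ⟨_⟩≈)
  open Eval M D public
  module R = CommutativeRing ring
  open R using (_+_; _*_; _-_; -_; 0#; 1#)
  open IntegerSolver ring using (solve; _:+_; _:*_; _:-_; :-_; :0; :1; _:=_)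
  module Alt = Alternating ring
  open Alt using (∏)
  open Relation.Binary.Reasoning.Setoid R.setoid

  open Algebra.Properties.Semiring.Exp R.semiring using (_^_)

  mono-^ : ∀ y b → mono y ^ b ≈ mono (pow b y)
  mono-^ y zero = R.reflexive T.1≡mono
  mono-^ y (suc b) = R.trans (R.*-congˡ (mono-^ y b)) (mono-* y (pow b y))

  zipΠ-mono : ∀ ys bs → Alt.zipΠ (λ y b → mono y ^ b) ys bs ≈ mono (powprod ys bs)
  zipΠ-mono [] bs = R.reflexive T.1≡mono
  zipΠ-mono (y ∷ ys) [] = R.reflexive T.1≡mono
  zipΠ-mono (y ∷ ys) (b ∷ bs) = R.trans (R.*-cong (mono-^ y b) (zipΠ-mono ys bs)) (mono-* (pow b y) _)

  zipΠ-mono′ : ∀ bs ys → Alt.zipΠ (λ b y → mono y ^ b) bs ys ≈ mono (powprod ys bs)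
  zipΠ-mono′ [] [] = R.reflexive T.1≡mono
  zipΠ-mono′ [] (y ∷ ys) = R.reflexive T.1≡mono
  zipΠ-mono′ (b ∷ bs) [] = R.reflexive T.1≡mono
  zipΠ-mono′ (b ∷ bs) (y ∷ ys) = R.trans (R.*-cong (mono-^ y b) (zipΠ-mono′ bs ys)) (mono-* (pow b y) _)

  deg-pow : ∀ n a → deg (pow n a) ≡ n ℕ.* deg a
  deg-pow zero a = ℕₚ.+-cancelˡ-≡ (deg ε) _ _ (trans (sym (deg-∙ ε ε)) (trans (cong deg (idˡ ε)) (sym (ℕₚ.+-identityʳ _))))
  deg-pow (suc n) a = trans (deg-∙ a _) (cong (deg a ℕ.+_) (deg-pow n a))

  mono-inverse : ∀ a b → a ∙ b ≡ ε → mono a * mono b ≈ 1#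
  mono-inverse a b e = R.trans (mono-* a b) (R.reflexive (trans (cong mono e) (sym T.1≡mono)))

  -- The product telescopes to `1 - a^(D+1)`, whose last term has degree at least `D + 1`, beyond
  -- `N`.
  geo-inverse : ∀ a → 1 ℕ.≤ deg a → (1# - mono a) * fac (geo a) ≈ 1#
  geo-inverse a 1≤ = R.trans (telescope D) (R.trans (R.+-congˡ (R.-‿cong (high-degree (supp-mono big))))
    (solve 1 (λ o → o :- :0 := o) R.refl 1#))
    where
    big : N ℕ.< deg (pow (suc D) a)
    big = subst (N ℕ.<_) (sym (deg-pow (suc D) a)) (ℕₚ.≤-trans (s≤s N≤D)
      (subst (ℕ._≤ suc D ℕ.* deg a) (ℕₚ.*-identityʳ (suc D)) (ℕₚ.*-monoʳ-≤ (suc D) 1≤)))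
    telescope : ∀ n → (1# - mono a) * series n a ≈ 1# - mono (pow (suc n) a)
    telescope zero = R.trans (R.*-identityʳ _) (R.+-congˡ (R.-‿cong (R.reflexive (cong mono (sym (idʳ a))))))
    telescope (suc n) = begin
      (1# - mono a) * (1# + mono a * series n a)
        ≈⟨ solve 2 (λ m s → (:1 :- m) :* (:1 :+ m :* s) := :1 :- m :+ m :* ((:1 :- m) :* s)) R.refl (mono a) (series n a) ⟩
      1# - mono a + mono a * ((1# - mono a) * series n a) ≈⟨ R.+-congˡ (R.*-congˡ (telescope n)) ⟩
      1# - mono a + mono a * (1# - mono (pow (suc n) a))
        ≈⟨ solve 2 (λ m s → :1 :- m :+ m :* (:1 :- s) := :1 :- m :* s) R.refl (mono a) _ ⟩
      1# - mono a * mono (pow (suc n) a) ≈⟨ R.+-congˡ (R.-‿cong (mono-* a _)) ⟩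
      1# - mono (pow (suc (suc n)) a) ∎

  ev-++ : ∀ fs gs → ev (fs ++ gs) ≈ ev fs * ev gs
  ev-++ [] gs = R.sym (R.*-identityˡ _)
  ev-++ (f ∷ fs) gs = R.trans (R.*-congˡ (ev-++ fs gs)) (R.sym (R.*-assoc _ _ _))

  ev-map : ∀ {A : Set} (h : A → Fac E) xs → ev (map h xs) ≈ ∏ xs (λ x → fac (h x))
  ev-map h [] = R.refl
  ev-map h (x ∷ xs) = R.*-congˡ (ev-map h xs)

  ev-concatMap : ∀ {A : Set} (h : A → List (Fac E)) xs → ev (concatMap h xs) ≈ ∏ xs (λ x → ev (h x))
  ev-concatMap h [] = R.refl
  ev-concatMap h (x ∷ xs) = R.trans (ev-++ (h x) _) (R.*-congˡ (ev-concatMap h xs))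

  ev-parts : ∀ {A : Set} (p q : A → Fac E) ys f fs →
    ev (map p ys ++ map q ys ++ f ∷ fs) ≈ ∏ ys (λ y → fac (p y)) * (∏ ys (λ y → fac (q y)) * (fac f * ev fs))
  ev-parts p q ys f fs = R.trans (ev-++ (map p ys) _) (R.*-cong (ev-map p ys)
    (R.trans (ev-++ (map q ys) _) (R.*-congʳ (ev-map q ys))))

  ev-vdm : ∀ ys → ev (vdm ys) ≈ Alt.V mono ys
  ev-vdm [] = R.refl
  ev-vdm (y ∷ ys) = R.trans (ev-++ (map (diff y) ys) _) (R.*-cong (ev-map (diff y) ys) (ev-vdm ys))

δℕ : ℕ → ℕ → ℤ
δℕ zero zero = + 1
δℕ zero (suc _) = + 0
δℕ (suc _) zero = + 0
δℕ (suc m) (suc n) = δℕ m n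

δℤ : ℤ → ℤ
δℤ (+ zero) = + 1
δℤ (+ suc _) = + 0
δℤ -[1+ _ ] = + 0

δV : ∀ {n} → Vec ℤ n → ℤ
δV [] = + 1
δV (z ∷ e) = δℤ z ℤ.* δV e

δℕ-< : ∀ {m n} → m ℕ.< n → δℕ m n ≡ + 0
δℕ-< {zero} {suc n} l = refl
δℕ-< {suc m} {suc n} (s≤s l) = δℕ-< l

δℤ-minus : ∀ n b → δℤ ((ℤ.- (+ n)) ℤ.+ (+ b)) ≡ δℕ n b
δℤ-minus n b = trans (cong δℤ (ℤₚ.+-comm (ℤ.- (+ n)) (+ b))) (trans (cong δℤ (ℤₚ.m-n≡m⊖n b n)) (go n b))
  where
  go : ∀ n b → δℤ (b ℤ.⊖ n) ≡ δℕ n b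
  go zero zero = refl
  go zero (suc b) = refl
  go (suc n) zero = refl
  go (suc n) (suc b) = trans (cong δℤ (ℤₚ.[1+m]⊖[1+n]≡m⊖n b n)) (go n b)

∑≤-0 : ∀ D {h : ℕ → ℤ} → (∀ n → h n ≡ + 0) → ∑≤ D h ≡ + 0
∑≤-0 zero e = e 0
∑≤-0 (suc D) e = cong₂ ℤ._+_ (e 0) (∑≤-0 D (e ∘ suc))

∑≤-δ : ∀ D b (h : ℕ → ℤ) → b ℕ.≤ D → ∑≤ D (λ n → h n ℤ.* δℕ n b) ≡ h b
∑≤-δ zero zero h l = ℤₚ.*-identityʳ (h 0)
∑≤-δ (suc D) zero h l = trans (cong₂ ℤ._+_ (ℤₚ.*-identityʳ (h 0)) (∑≤-0 D (λ n → ℤₚ.*-zeroʳ (h (suc n))))) (ℤₚ.+-identityʳ _)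
∑≤-δ (suc D) (suc b) h (s≤s l) = trans (cong₂ ℤ._+_ (ℤₚ.*-zeroʳ (h 0)) (∑≤-δ D b (h ∘ suc) l)) (ℤₚ.+-identityˡ _)

∑≤-δ-out : ∀ D b (h : ℕ → ℤ) → D ℕ.< b → ∑≤ D (λ n → h n ℤ.* δℕ n b) ≡ + 0
∑≤-δ-out zero (suc b) h l = ℤₚ.*-zeroʳ (h 0)
∑≤-δ-out (suc D) (suc b) h (s≤s l) = cong₂ ℤ._+_ (ℤₚ.*-zeroʳ (h 0)) (∑≤-δ-out D b (h ∘ suc) l)

-- Laurent monomials, the factors of the constant term, and renaming of variables.

record Grp : Set₁ where
  field
    cmon : CMon
  open CMon cmon public
  field
    neg : E → E
    inv : ∀ w → w ∙ neg w ≡ ε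

  infixl 7 _⊖_
  _⊖_ : E → E → E
  w ⊖ w′ = w ∙ neg w′

  neg-unique : ∀ w w′ → w ∙ w′ ≡ ε → w′ ≡ neg w
  neg-unique w w′ e = begin
    w′ ≡⟨ sym (idˡ w′) ⟩
    ε ∙ w′ ≡⟨ cong (_∙ w′) (sym (trans (comm (neg w) w) (inv w))) ⟩
    (neg w ∙ w) ∙ w′ ≡⟨ assoc _ _ _ ⟩
    neg w ∙ (w ∙ w′) ≡⟨ cong (neg w ∙_) e ⟩
    neg w ∙ ε ≡⟨ idʳ _ ⟩
    neg w ∎
    where open ≡-Reasoning

module _ (M : CMon) where
  open CMon M

  ∙-interchange : ∀ a b c d → (a ∙ b) ∙ (c ∙ d) ≡ (a ∙ c) ∙ (b ∙ d)
  ∙-interchange a b c d = begin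
    (a ∙ b) ∙ (c ∙ d) ≡⟨ assoc a b _ ⟩
    a ∙ (b ∙ (c ∙ d)) ≡⟨ cong (a ∙_) (trans (sym (assoc b c d)) (trans (cong (_∙ d) (comm b c)) (assoc c b d))) ⟩
    a ∙ (c ∙ (b ∙ d)) ≡⟨ sym (assoc a c _) ⟩
    (a ∙ c) ∙ (b ∙ d) ∎
    where open ≡-Reasoning

negHom : (G : Grp) → Hom (Grp.cmon G) (Grp.cmon G)
negHom G = record
  { ⟦_⟧ = neg
  ; ⟦∙⟧ = λ p q → sym (neg-unique (p ∙ q) _ (trans (∙-interchange cmon p q _ _) (trans (cong₂ _∙_ (inv p) (inv q)) (idˡ ε))))
  ; ⟦ε⟧ = sym (neg-unique ε ε (idˡ ε))
  }
  where open Grp G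

module _ {G H : Grp} (h : Hom (Grp.cmon G) (Grp.cmon H)) where
  private
    module G = Grp G
    module H = Grp H
  open Hom h

  ⟦neg⟧ : ∀ w → ⟦ G.neg w ⟧ ≡ H.neg ⟦ w ⟧
  ⟦neg⟧ w = H.neg-unique _ _ (trans (sym (⟦∙⟧ w (G.neg w))) (trans (cong ⟦_⟧ (G.inv w)) ⟦ε⟧))

  ⟦⊖⟧ : ∀ w w′ → ⟦ w G.⊖ w′ ⟧ ≡ ⟦ w ⟧ H.⊖ ⟦ w′ ⟧
  ⟦⊖⟧ w w′ = trans (⟦∙⟧ w _) (cong (⟦ w ⟧ H.∙_) (⟦neg⟧ w′))

-- The variables are elements of a group G of monomials; the first component of ℕ × G is the
-- exponent of t.
module Lists (G : Grp) where
  open Grp G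

  F : Set
  F = Fac (ℕ × E)

  vandermondeF : List E → List F
  vandermondeF [] = []
  vandermondeF (y ∷ ys) = map (λ y′ → diff (0 , y) (0 , y′)) ys ++ vandermondeF ys

  crossF : List E → List E → List F
  crossF [] ys = []
  crossF (x ∷ xs) ys = map (λ y → geo (1 , x ⊖ y)) ys ++ crossF xs ys

  tailF : ℕ → E → List E → List F
  tailF m u [] = []
  tailF m u (y ∷ ys) = geo (1 , y ⊖ u) ∷ geo (m , u ⊖ y) ∷ tailF m u ys

  tF : List ℕ → List F
  tF js = map (λ j → geo (j , ε)) js

  -- The product under the constant term in `U_a(s)`, at `s = t^m`. The list `js` collects the
  -- exponents of the denominators `1 - t^j` already split off.
  baseF : ℕ → E → List E → List ℕ → List F
  baseF m u ys js = vandermondeF ys ++ vandermondeF (map neg ys) ++ crossF ys ys ++ tailF m u ys ++ tF js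

  -- One summand of the interpolated product, with `yᵢ` as the head of the list. The denominator
  -- `1 - t^a` comes in through `js`. The empty list is a dummy case.
  pivotF : ℕ → E → List E → List ℕ → List F
  pivotF m u [] js = []
  pivotF m u (y ∷ ys) js = diff (0 , ε) (1 , ε) ∷ map (λ y′ → diff (0 , y) (1 , y′)) ys ++
    vandermondeF ys ++ vandermondeF (map neg (y ∷ ys)) ++ crossF (y ∷ ys) (y ∷ ys) ++ tailF m u (y ∷ ys) ++ tF js

module _ {G H : Grp} (h : Hom (Grp.cmon G) (Grp.cmon H)) where
  private
    module G = Grp G
    module H = Grp H
    module LG = Lists G
    module LH = Lists H
  open Hom h

  lift : Hom (ℕM ×M Grp.cmon G) (ℕM ×M Grp.cmon H)
  lift = record { ⟦_⟧ = λ (d , w) → d , ⟦ w ⟧ ; ⟦∙⟧ = λ (d , w) (d′ , w′) → cong (d ℕ.+ d′ ,_) (⟦∙⟧ w w′) ; ⟦ε⟧ = cong (0 ,_) ⟦ε⟧ }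

  private
    L : LG.F → LH.F
    L = mapFac (Hom.⟦_⟧ lift)

    map-nat : ∀ (f : G.E → LG.F) (g : H.E → LH.F) → (∀ y → g ⟦ y ⟧ ≡ L (f y)) → ∀ ys → map g (map ⟦_⟧ ys) ≡ map L (map f ys)
    map-nat f g e [] = refl
    map-nat f g e (y ∷ ys) = cong₂ _∷_ (e y) (map-nat f g e ys)

    ++-nat : ∀ {xs ys : List LH.F} {xs′ ys′} → xs ≡ map L xs′ → ys ≡ map L ys′ → xs ++ ys ≡ map L (xs′ ++ ys′)
    ++-nat {xs′ = xs′} p q = trans (cong₂ _++_ p q) (sym (Listₚ.map-++ L xs′ _))

    neg-nat : ∀ ys → map H.neg (map ⟦_⟧ ys) ≡ map ⟦_⟧ (map G.neg ys)
    neg-nat [] = refl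
    neg-nat (y ∷ ys) = cong₂ _∷_ (sym (⟦neg⟧ {G} {H} h y)) (neg-nat ys)

  vandermondeF-nat : ∀ ys → LH.vandermondeF (map ⟦_⟧ ys) ≡ map L (LG.vandermondeF ys)
  vandermondeF-nat [] = refl
  vandermondeF-nat (y ∷ ys) = ++-nat (map-nat _ _ (λ _ → refl) ys) (vandermondeF-nat ys)

  crossF-nat : ∀ xs ys → LH.crossF (map ⟦_⟧ xs) (map ⟦_⟧ ys) ≡ map L (LG.crossF xs ys)
  crossF-nat [] ys = refl
  crossF-nat (x ∷ xs) ys = ++-nat (map-nat _ _ (λ y → cong (λ w → geo (1 , w)) (sym (⟦⊖⟧ {G} {H} h x y))) ys) (crossF-nat xs ys)

  tailF-nat : ∀ m u ys → LH.tailF m ⟦ u ⟧ (map ⟦_⟧ ys) ≡ map L (LG.tailF m u ys)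
  tailF-nat m u [] = refl
  tailF-nat m u (y ∷ ys) = cong₂ _∷_ (cong (λ w → geo (1 , w)) (sym (⟦⊖⟧ {G} {H} h y u)))
    (cong₂ _∷_ (cong (λ w → geo (m , w)) (sym (⟦⊖⟧ {G} {H} h u y))) (tailF-nat m u ys))

  tF-nat : ∀ js → LH.tF js ≡ map L (LG.tF js)
  tF-nat [] = refl
  tF-nat (j ∷ js) = cong₂ _∷_ (cong (λ w → geo (j , w)) (sym ⟦ε⟧)) (tF-nat js)

  private
    negV-nat : ∀ ys → LH.vandermondeF (map H.neg (map ⟦_⟧ ys)) ≡ map L (LG.vandermondeF (map G.neg ys))
    negV-nat ys = trans (cong LH.vandermondeF (neg-nat ys)) (vandermondeF-nat (map G.neg ys))

  baseF-nat : ∀ m u ys js → LH.baseF m ⟦ u ⟧ (map ⟦_⟧ ys) js ≡ map L (LG.baseF m u ys js)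
  baseF-nat m u ys js = ++-nat (vandermondeF-nat ys) (++-nat (negV-nat ys)
    (++-nat (crossF-nat ys ys) (++-nat (tailF-nat m u ys) (tF-nat js))))

  pivotF-nat : ∀ m u ys js → LH.pivotF m ⟦ u ⟧ (map ⟦_⟧ ys) js ≡ map L (LG.pivotF m u ys js)
  pivotF-nat m u [] js = refl
  pivotF-nat m u (y ∷ ys) js = cong₂ _∷_ (cong₂ (λ v w → diff (0 , v) (1 , w)) (sym ⟦ε⟧) (sym ⟦ε⟧))
    (++-nat (map-nat _ _ (λ _ → refl) ys) (++-nat (vandermondeF-nat ys) (++-nat (negV-nat (y ∷ ys))
    (++-nat (crossF-nat (y ∷ ys) (y ∷ ys)) (++-nat (tailF-nat m u (y ∷ ys)) (tF-nat js))))))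

-- Exponents of `u` and of `a` further variables. The exponent of `u` is kept apart because `u`
-- survives while the others are eliminated one by one.
Wᵍ : ℕ → Grp
Wᵍ a = record
  { cmon = ℤM ×M VecM ℤM a
  ; neg = λ (u , e) → ℤ.- u , Vec.map ℤ.-_ e
  ; inv = λ (u , e) → cong₂ _,_ (ℤₚ.+-inverseʳ u) (go e)
  }
  where
  go : ∀ {n} (e : Vec ℤ n) → Vec.zipWith ℤ._+_ e (Vec.map ℤ.-_ e) ≡ Vec.replicate n (+ 0)
  go [] = refl
  go (z ∷ e) = cong₂ _∷_ (ℤₚ.+-inverseʳ z) (go e)

W : ℕ → Set
W a = ℤ × Vec ℤ a

module W {a} = Grp (Wᵍ a)

0V : ∀ {a} → Vec ℤ a
0V = Vec.replicate _ (+ 0)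

u₀ : ∀ {a} → W a
u₀ = + 1 , 0V

embed : ∀ {a} → Hom (Grp.cmon (Wᵍ a)) (Grp.cmon (Wᵍ (suc a)))
embed = record { ⟦_⟧ = λ (u , e) → u , + 0 ∷ e ; ⟦∙⟧ = λ _ _ → refl ; ⟦ε⟧ = refl }

vars : ∀ a → List (W a)
vars zero = []
vars (suc a) = (+ 0 , + 1 ∷ 0V) ∷ map (Hom.⟦_⟧ embed) (vars a)

length-vars : ∀ a → length (vars a) ≡ a
length-vars zero = refl
length-vars (suc a) = cong suc (trans (Listₚ.length-map _ (vars a)) (length-vars a))

CT : ∀ k a → ℕ × W a → ℤ
CT k a (d , (u , e)) = δℕ k d ℤ.* (δℤ u ℤ.* δV e)

_⋆_ : ∀ {a} → ℤ → W a → W a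
z ⋆ (u , e) = z ℤ.* u , Vec.map (z ℤ.*_) e

⋆-+ : ∀ {a} y z (w : W a) → (y ℤ.+ z) ⋆ w ≡ (y ⋆ w) W.∙ (z ⋆ w)
⋆-+ y z (u , e) = cong₂ _,_ (ℤₚ.*-distribʳ-+ u y z) (go e)
  where
  go : ∀ {n} (e : Vec ℤ n) → Vec.map ((y ℤ.+ z) ℤ.*_) e ≡ Vec.zipWith ℤ._+_ (Vec.map (y ℤ.*_) e) (Vec.map (z ℤ.*_) e)
  go [] = refl
  go (x ∷ e) = cong₂ _∷_ (ℤₚ.*-distribʳ-+ x y z) (go e)

⋆-1 : ∀ {a} (w : W a) → (+ 1) ⋆ w ≡ w
⋆-1 (u , e) = cong₂ _,_ (ℤₚ.*-identityˡ u) (go e)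
  where
  go : ∀ {n} (e : Vec ℤ n) → Vec.map (+ 1 ℤ.*_) e ≡ e
  go [] = refl
  go (x ∷ e) = cong₂ _∷_ (ℤₚ.*-identityˡ x) (go e)

⋆-0 : ∀ {a} (w : W a) → (+ 0) ⋆ w ≡ W.ε
⋆-0 (u , e) = cong₂ _,_ (ℤₚ.*-zeroˡ u) (go e)
  where
  go : ∀ {n} (e : Vec ℤ n) → Vec.map (+ 0 ℤ.*_) e ≡ Vec.replicate n (+ 0)
  go [] = refl
  go (x ∷ e) = cong₂ _∷_ (ℤₚ.*-zeroˡ x) (go e)

⋆-ε : ∀ {a} z → z ⋆ W.ε {a} ≡ W.ε
⋆-ε z = cong₂ _,_ (ℤₚ.*-zeroʳ z) (go _)
  where
  go : ∀ n → Vec.map (z ℤ.*_) (Vec.replicate n (+ 0)) ≡ Vec.replicate n (+ 0)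
  go zero = refl
  go (suc n) = cong₂ _∷_ (ℤₚ.*-zeroʳ z) (go n)

comb : ∀ {a n} → List (W a) → Vec ℤ n → W a
comb (w ∷ l) (z ∷ e) = (z ⋆ w) W.∙ comb l e
comb _ _ = W.ε

comb-+ : ∀ {a n} (l : List (W a)) (e e′ : Vec ℤ n) → comb l (Vec.zipWith ℤ._+_ e e′) ≡ comb l e W.∙ comb l e′
comb-+ [] e e′ = sym (W.idˡ _)
comb-+ (w ∷ l) [] [] = sym (W.idˡ _)
comb-+ {a} (w ∷ l) (z ∷ e) (z′ ∷ e′) = trans (cong₂ W._∙_ (⋆-+ z z′ w) (comb-+ l e e′))
  (∙-interchange (Grp.cmon (Wᵍ a)) (z ⋆ w) (z′ ⋆ w) (comb l e) (comb l e′))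

comb-0 : ∀ {a} (l : List (W a)) n → comb l (Vec.replicate n (+ 0)) ≡ W.ε
comb-0 [] n = refl
comb-0 (w ∷ l) zero = refl
comb-0 (w ∷ l) (suc n) = trans (cong₂ W._∙_ (⋆-0 w) (comb-0 l n)) (W.idˡ _)

comb-embed : ∀ {a n} (l : List (W a)) (e : Vec ℤ n) → comb (map (Hom.⟦_⟧ embed) l) e ≡ Hom.⟦_⟧ embed (comb l e)
comb-embed [] e = refl
comb-embed (w ∷ l) [] = refl
comb-embed {a} ((u , v) ∷ l) (z ∷ e) = cong₂ (W._∙_ {suc a}) (cong (z ℤ.* u ,_) (cong₂ _∷_ (ℤₚ.*-zeroʳ z) refl)) (comb-embed l e)

comb-vars : ∀ {a} (e : Vec ℤ a) → comb (vars a) e ≡ (+ 0 , e)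
comb-vars [] = refl
comb-vars {suc a} (z ∷ e) = begin
  (z ⋆ (+ 0 , + 1 ∷ 0V)) W.∙ comb (map (Hom.⟦_⟧ embed) (vars a)) e
    ≡⟨ cong₂ W._∙_ (cong₂ _,_ (ℤₚ.*-zeroʳ z) (cong₂ _∷_ (ℤₚ.*-identityʳ z) (cong proj₂ (⋆-ε {a} z)))) (trans (comb-embed (vars a) e) (cong (Hom.⟦_⟧ embed) (comb-vars e))) ⟩
  (+ 0 , z ∷ 0V) W.∙ (+ 0 , + 0 ∷ e) ≡⟨ cong₂ _,_ refl (cong₂ _∷_ (ℤₚ.+-identityʳ z) (cong proj₂ (W.idˡ (+ 0 , e)))) ⟩
  (+ 0 , z ∷ e) ∎
  where open ≡-Reasoning

comb-↭ : ∀ {a n} {l l′ : List (W a)} → l ↭ l′ → length l ≡ n → (e : Vec ℤ n) → ∃ λ e′ → comb l e ≡ comb l′ e′ × δV e ≡ δV {n} e′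
comb-↭ Perm.refl p e = e , refl , refl
comb-↭ (prep x q) p (z ∷ e) with comb-↭ q (ℕₚ.suc-injective p) e
... | e′ , eq , d = z ∷ e′ , cong ((z ⋆ x) W.∙_) eq , cong (δℤ z ℤ.*_) d
comb-↭ {a} (swap x y q) p (z ∷ z′ ∷ e) with comb-↭ q (ℕₚ.suc-injective (ℕₚ.suc-injective p)) e
... | e′ , eq , d = z′ ∷ z ∷ e′
  , trans (cong (λ c → (z ⋆ x) W.∙ ((z′ ⋆ y) W.∙ c)) eq)
      (trans (sym (W.assoc (z ⋆ x) (z′ ⋆ y) _)) (trans (cong (W._∙ _) (W.comm (z ⋆ x) (z′ ⋆ y))) (W.assoc (z′ ⋆ y) (z ⋆ x) _)))
  , trans (cong (λ c → δℤ z ℤ.* (δℤ z′ ℤ.* c)) d) (lemma (δℤ z) (δℤ z′) (δV e′))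
  where
  lemma : ∀ x y z → x ℤ.* (y ℤ.* z) ≡ y ℤ.* (x ℤ.* z)
  lemma = ℤSolver.solve-∀
comb-↭ (Perm.trans q r) p e with comb-↭ q p e
... | e′ , eq , d with comb-↭ r (trans (sym (↭-length q)) p) e′
... | e″ , eq′ , d′ = e″ , trans eq eq′ , trans d d′

substHom : ∀ {a} → List (W a) → Hom (Grp.cmon (Wᵍ a)) (Grp.cmon (Wᵍ a))
substHom {a} l = record
  { ⟦_⟧ = λ (u , e) → (u , 0V) W.∙ comb l e
  ; ⟦∙⟧ = λ (u , e) (u′ , e′) → trans (cong₂ W._∙_ (cong (u ℤ.+ u′ ,_) (sym (cong proj₂ (W.idˡ {a} (u , 0V))))) (comb-+ l e e′))
      (∙-interchange (Grp.cmon (Wᵍ a)) (u , 0V) (u′ , 0V) (comb l e) (comb l e′))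
  ; ⟦ε⟧ = trans (W.idˡ _) (comb-0 l a)
  }

substHom-u : ∀ {a} (l : List (W a)) → Hom.⟦_⟧ (substHom l) u₀ ≡ u₀
substHom-u {a} l = trans (cong (u₀ W.∙_) (comb-0 l a)) (W.idʳ u₀)

substHom-vars : ∀ {a} (l : List (W a)) → length l ≡ a → map (Hom.⟦_⟧ (substHom l)) (vars a) ≡ l
substHom-vars {a} l p = trans (cong (map _) (vars-units a)) (trans (sym (Listₚ.map-∘ (units a)))
  (trans (Listₚ.map-cong (λ v → W.idˡ (comb l v)) (units a)) (comb-units l p)))
  where
  units : ∀ n → List (Vec ℤ n)
  units zero = []
  units (suc n) = (+ 1 ∷ 0V) ∷ map (+ 0 ∷_) (units n)
  comb-units : ∀ {n} (l : List (W a)) → length l ≡ n → map (comb l) (units n) ≡ l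
  comb-units [] refl = refl
  comb-units {suc n} (w ∷ l) p = cong₂ _∷_ (trans (cong₂ W._∙_ (⋆-1 w) (comb-0 l n)) (W.idʳ w))
    (trans (sym (Listₚ.map-∘ (units n))) (trans (Listₚ.map-cong (λ v → trans (cong (W._∙ comb l v) (⋆-0 w)) (W.idˡ _)) (units n))
      (comb-units l (ℕₚ.suc-injective p))))
  vars-units : ∀ n → vars n ≡ map (+ 0 ,_) (units n)
  vars-units zero = refl
  vars-units (suc n) = cong (_ ∷_) (trans (cong (map _) (vars-units n)) (trans (sym (Listₚ.map-∘ (units n))) (Listₚ.map-∘ (units n))))

-- `comb-↭` carries the exponents along the permutation, and `δV` asks only that all of them vanish.
CT-subst : ∀ k {a} (l : List (W a)) → l ↭ vars a → ∀ x → CT k a (Hom.⟦_⟧ (lift {Wᵍ a} {Wᵍ a} (substHom l)) x) ≡ CT k a x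
CT-subst k {a} l p (d , (u , e)) with comb-↭ p (trans (↭-length p) (length-vars a)) e
... | e′ , eq , de = cong (δℕ k d ℤ.*_) (begin
  δℤ (u ℤ.+ proj₁ (comb l e)) ℤ.* δV (Vec.zipWith ℤ._+_ 0V (proj₂ (comb l e)))
    ≡⟨ cong (λ w → δℤ (u ℤ.+ proj₁ w) ℤ.* δV (Vec.zipWith ℤ._+_ 0V (proj₂ w))) (trans eq (comb-vars e′)) ⟩
  δℤ (u ℤ.+ + 0) ℤ.* δV (Vec.zipWith ℤ._+_ 0V e′) ≡⟨ cong₂ (λ x y → δℤ x ℤ.* δV y) (ℤₚ.+-identityʳ u) (cong proj₂ (W.idˡ (+ 0 , e′))) ⟩
  δℤ u ℤ.* δV e′ ≡⟨ cong (δℤ u ℤ.*_) (sym de) ⟩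
  δℤ u ℤ.* δV e ∎)
  where open ≡-Reasoning

-- Eliminating one variable: the recursion for the constant term.

module Aℤ = Alternating ℤₚ.+-*-commutativeRing

pick-const : ∀ {A : Set} (xs : List A) c → Aℤ.pick xs (λ _ _ → c) ≡ + length xs ℤ.* c
pick-const [] c = sym (ℤₚ.*-zeroˡ c)
pick-const (x ∷ xs) c = trans (cong (λ z → c ℤ.+ z) (pick-const xs c)) (sym (ℤₚ.suc-* (+ length xs) c))

-- The second exponent is that of the variable about to be eliminated. Being a natural number, it
-- certifies a power series in this variable, which is what permits evaluation at `t^m u`.
inclHom : ∀ {a} → Hom (ℕM ×M ℕM ×M Grp.cmon (Wᵍ a)) (ℕM ×M Grp.cmon (Wᵍ (suc a)))
inclHom = record { ⟦_⟧ = λ (d , (b , (u , e))) → d , (u , + b ∷ e) ; ⟦∙⟧ = λ _ _ → refl ; ⟦ε⟧ = refl }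

-- Substituting tᵐ u for the eliminated variable.
evalHom : ∀ {a} → ℕ → Hom (ℕM ×M ℕM ×M Grp.cmon (Wᵍ a)) (ℕM ×M Grp.cmon (Wᵍ a))
evalHom m = record
  { ⟦_⟧ = λ (d , (b , (u , e))) → b ℕ.* m ℕ.+ d , (+ b ℤ.+ u , e)
  ; ⟦∙⟧ = λ (d , (b , (u , e))) (d′ , (b′ , (u′ , e′))) → cong₂ _,_ (ℕeq b b′ m d d′) (cong (_, Vec.zipWith ℤ._+_ e e′) (ℤeq (+ b) (+ b′) u u′))
  ; ⟦ε⟧ = refl
  }
  where
  ℕeq : ∀ b b′ m d d′ → (b ℕ.+ b′) ℕ.* m ℕ.+ (d ℕ.+ d′) ≡ (b ℕ.* m ℕ.+ d) ℕ.+ (b′ ℕ.* m ℕ.+ d′)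
  ℕeq = ℕSolver.solve-∀
  ℤeq : ∀ b b′ u u′ → (b ℤ.+ b′) ℤ.+ (u ℤ.+ u′) ≡ (b ℤ.+ u) ℤ.+ (b′ ℤ.+ u′)
  ℤeq = ℤSolver.solve-∀

x₀ : ∀ {a} → W (suc a)
x₀ = + 0 , + 1 ∷ 0V

neg-0V : ∀ n → Vec.map ℤ.-_ (0V {n}) ≡ 0V
neg-0V zero = refl
neg-0V (suc n) = cong (_ ∷_) (neg-0V n)

0V-+ : ∀ {n} (e : Vec ℤ n) → Vec.zipWith ℤ._+_ 0V e ≡ e
0V-+ {n} e = cong proj₂ (W.idˡ {n} (+ 0 , e))

module _ (k D : ℕ) (k≤D : k ℕ.≤ D) where

  private
    pow-g : ∀ {a} m n → CMon.pow (ℕM ×M Grp.cmon (Wᵍ (suc a))) n (m , u₀ W.⊖ x₀) ≡ (n ℕ.* m , (+ n , (ℤ.- (+ n)) ∷ 0V))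
    pow-g m zero = refl
    pow-g {a} m (suc n) = trans (cong ((m , u₀ W.⊖ x₀) G.∙_) (pow-g m n))
      (cong (m ℕ.+ n ℕ.* m ,_) (cong₂ _,_ refl (cong₂ _∷_ (minus n) (trans (cong (λ e → Vec.zipWith ℤ._+_ e 0V)
        (trans (0V-+ _) (neg-0V a))) (0V-+ 0V)))))
      where
      module G = CMon (ℕM ×M Grp.cmon (Wᵍ (suc a)))
      minus : ∀ n → -[1+ 0 ] ℤ.+ (ℤ.- (+ n)) ≡ ℤ.- (+ suc n)
      minus zero = refl
      minus (suc n) = refl

  -- CT_y of φ(y) / (1 − s u / y) is φ(s u) when φ is a power series in y.
  eliminate : ∀ {a} m → 1 ℕ.≤ m → ∀ P →
    Terms.⟨_,_⟩ _ (Terms._*_ _ (Eval.series (ℕM ×M Grp.cmon (Wᵍ (suc a))) D D (m , u₀ W.⊖ x₀)) (mapE (inclHom {a}) P)) (CT k (suc a))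
      ≡ Terms.⟨_,_⟩ _ P (CT k a ∘ Hom.⟦_⟧ (evalHom m))
  eliminate {a} m 1≤m P = begin
    T.⟨ S T.* Q , CT k (suc a) ⟩ ≡⟨ T.⟨⟩-* S Q _ ⟩
    T.⟨ S , (λ g → T.⟨ Q , (λ e → CT k (suc a) (g G.∙ e)) ⟩) ⟩ ≡⟨ T.⟨⟩-swap S Q _ ⟩
    T.⟨ Q , (λ e → T.⟨ S , (λ g → CT k (suc a) (g G.∙ e)) ⟩) ⟩ ≡⟨ ⟨⟩-mapE inclHom P _ ⟩
    T′.⟨ P , (λ x → T.⟨ S , (λ g → CT k (suc a) (g G.∙ Hom.⟦_⟧ inclHom x)) ⟩) ⟩
      ≡⟨ T′.⟨⟩-cong P (λ x → trans (Eval.⟨series⟩ _ D D _ _) (point x)) ⟩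
    T′.⟨ P , CT k a ∘ Hom.⟦_⟧ (evalHom m) ⟩ ∎
    where
    open ≡-Reasoning
    M = ℕM ×M Grp.cmon (Wᵍ (suc a))
    module G = CMon M
    module T = Terms M
    module T′ = Terms (ℕM ×M ℕM ×M Grp.cmon (Wᵍ a))
    S = Eval.series M D D (m , u₀ W.⊖ x₀)
    Q = mapE (inclHom {a}) P
    point : ∀ x → ∑≤ D (λ n → CT k (suc a) (G.pow n (m , u₀ W.⊖ x₀) G.∙ Hom.⟦_⟧ inclHom x)) ≡ CT k a (Hom.⟦_⟧ (evalHom m) x)
    point (d , (b , (u , e))) = trans (∑≤-cong D summand) total
      where
      h : ℕ → ℤ
      h n = δℕ k (n ℕ.* m ℕ.+ d) ℤ.* (δℤ (+ n ℤ.+ u) ℤ.* δV e)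
      lemma : ∀ w x y z → w ℤ.* (x ℤ.* (y ℤ.* z)) ≡ (w ℤ.* (x ℤ.* z)) ℤ.* y
      lemma = ℤSolver.solve-∀
      summand : ∀ n → CT k (suc a) (G.pow n (m , u₀ W.⊖ x₀) G.∙ (d , (u , + b ∷ e))) ≡ h n ℤ.* δℕ n b
      summand n = trans (cong (λ g → CT k (suc a) (g G.∙ (d , (u , + b ∷ e)))) (pow-g m n))
        (trans (cong (λ v → δℕ k (n ℕ.* m ℕ.+ d) ℤ.* (δℤ (+ n ℤ.+ u) ℤ.* (δℤ ((ℤ.- (+ n)) ℤ.+ (+ b)) ℤ.* δV v))) (0V-+ e))
        (trans (lemma (δℕ k (n ℕ.* m ℕ.+ d)) (δℤ (+ n ℤ.+ u)) _ (δV e)) (cong (h n ℤ.*_) (δℤ-minus n b))))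
      total : ∑≤ D (λ n → h n ℤ.* δℕ n b) ≡ h b
      total with b ℕ.≤? D
      ... | yes b≤D = ∑≤-δ D b h b≤D
      -- Beyond the truncation no summand matches, and the evaluated monomial has `t`-degree at
      -- least `b * m > k`, so both sides vanish.
      ... | no b≰D = trans (∑≤-δ-out D b h (ℕₚ.≰⇒> b≰D)) (sym (cong (ℤ._* (δℤ (+ b ℤ.+ u) ℤ.* δV e)) (δℕ-< (ℕₚ.≤-<-trans k≤D
          (ℕₚ.<-≤-trans (ℕₚ.≰⇒> b≰D) (ℕₚ.≤-trans (ℕₚ.≤-trans (ℕₚ.≤-reflexive (sym (ℕₚ.*-identityʳ b))) (ℕₚ.*-monoʳ-≤ b 1≤m)) (ℕₚ.m≤m+n _ d)))))))

-- The ring of series in t (modulo t^(k+1)) over the Laurent polynomials in u and a variables.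
module Laurent (a k D : ℕ) (k≤D : k ℕ.≤ D) where
  open FacRing (ℕM ×M Grp.cmon (Wᵍ a)) proj₁ (λ _ _ → refl) k D k≤D public
  open T using (mono; ⟨_,_⟩)
  open MR using (mono-*; tested; ⟨_⟩≈)
  open R using (_≈_; _+_; _*_; _-_; -_; 0#; 1#)
  open IntegerSolver MR.ring using (solve; _:+_; _:*_; _:-_; :-_; :0; :1; _:=_)
  open Alt using (∏; ∏-cong; ∏-*; ∏-↭; ∏-1; ∏-inverse; V; alt; pick; pick-cong; alt-*ʳ; pick-*ʳ; V-map; V-antisymmetric; alt-antisymmetric; t-identity)
  open Lists (Wᵍ a)
  open Relation.Binary.Reasoning.Setoid R.setoid

  v v⁻ : W a → T.Carrier
  v y = mono (0 , y)
  v⁻ y = mono (0 , W.neg y)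

  t : T.Carrier
  t = mono (1 , W.ε)

  g : ℕ → W a → T.Carrier
  g d w = fac (geo (d , w))

  t* : ∀ w → t * v w ≈ mono (1 , w)
  t* w = R.trans (mono-* _ _) (R.reflexive (cong (λ w → mono (1 , w)) (W.idˡ w)))

  v* : ∀ w w′ → v w * v⁻ w′ ≈ v (w W.⊖ w′)
  v* w w′ = mono-* _ _

  v-inverse : ∀ w → v w * v⁻ w ≈ 1#
  v-inverse w = mono-inverse _ _ (cong (0 ,_) (W.inv w))

  mono-ε : mono (0 , W.ε) ≈ 1#
  mono-ε = R.reflexive (sym T.1≡mono)

  ev-V : ∀ ys → ev (vandermondeF ys) ≈ V v ys
  ev-V [] = R.refl
  ev-V (y ∷ ys) = R.trans (ev-++ (map _ ys) _) (R.*-cong (ev-map _ ys) (ev-V ys))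

  ev-V⁻ : ∀ ys → ev (vandermondeF (map W.neg ys)) ≈ V v⁻ ys
  ev-V⁻ ys = R.trans (ev-V (map W.neg ys)) (V-map v W.neg ys)

  cross : List (W a) → List (W a) → T.Carrier
  cross xs ys = ∏ xs (λ x → ∏ ys (λ y → g 1 (x W.⊖ y)))

  ev-cross : ∀ xs ys → ev (crossF xs ys) ≈ cross xs ys
  ev-cross [] ys = R.refl
  ev-cross (x ∷ xs) ys = R.trans (ev-++ (map _ ys) _) (R.*-cong (ev-map _ ys) (ev-cross xs ys))

  tails : ℕ → W a → List (W a) → T.Carrier
  tails m u ys = ∏ ys (λ y → g 1 (y W.⊖ u) * g m (u W.⊖ y))

  ev-tail : ∀ m u ys → ev (tailF m u ys) ≈ tails m u ys
  ev-tail m u [] = R.refl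
  ev-tail m u (y ∷ ys) = R.trans (R.sym (R.*-assoc _ _ _)) (R.*-congˡ (ev-tail m u ys))

  ev-base : ∀ m u ys js → ev (baseF m u ys js) ≈ V v ys * (V v⁻ ys * (cross ys ys * (tails m u ys * ev (tF js))))
  ev-base m u ys js = R.trans (ev-++ (vandermondeF ys) _) (R.*-cong (ev-V ys)
    (R.trans (ev-++ (vandermondeF (map W.neg ys)) _) (R.*-cong (ev-V⁻ ys)
    (R.trans (ev-++ (crossF ys ys) _) (R.*-cong (ev-cross ys ys)
    (R.trans (ev-++ (tailF m u ys) _) (R.*-congʳ (ev-tail m u ys))))))))

  ev-pivot : ∀ m u y ys js → ev (pivotF m u (y ∷ ys) js) ≈
    (1# - t) * (∏ ys (λ y′ → v y - t * v y′) * (V v ys * (V v⁻ (y ∷ ys) * (cross (y ∷ ys) (y ∷ ys) * (tails m u (y ∷ ys) * ev (tF js))))))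
  ev-pivot m u y ys js = R.*-cong (R.+-congʳ mono-ε) (R.trans (ev-++ (map _ ys) _) (R.*-cong
    (R.trans (ev-map _ ys) (∏-cong ys (λ y′ → R.+-congˡ (R.-‿cong (R.sym (t* y′))))))
    (R.trans (ev-++ (vandermondeF ys) _) (R.*-cong (ev-V ys)
    (R.trans (ev-++ (vandermondeF (map W.neg (y ∷ ys))) _) (R.*-cong (ev-V⁻ (y ∷ ys))
    (R.trans (ev-++ (crossF (y ∷ ys) (y ∷ ys)) _) (R.*-cong (ev-cross (y ∷ ys) (y ∷ ys))
    (R.trans (ev-++ (tailF m u (y ∷ ys)) _) (R.*-congʳ (ev-tail m u (y ∷ ys)))))))))))) 

  cross-↭ : ∀ {xs ys} → xs ↭ ys → cross xs xs ≈ cross ys ys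
  cross-↭ {xs} {ys} p = R.trans (∏-cong xs (λ x → ∏-↭ _ p)) (∏-↭ _ p)

  ∏-t : ∀ (ys : List (W a)) → ∏ ys (λ _ → t) ≈ mono (length ys , W.ε)
  ∏-t [] = R.sym mono-ε
  ∏-t (y ∷ ys) = R.trans (R.*-congˡ (∏-t ys)) (R.trans (mono-* _ _) (R.reflexive (cong (λ w → mono (suc (length ys) , w)) (W.idˡ _))))

  -- After insertion of `1 - t^a` and its inverse, `t-identity` replaces `V(y)` by an alternating
  -- sum. Its signs disappear against `V(1/y)`, and the remaining factors are symmetric, so each
  -- summand can be written with its pivot in front.
  base≈pivots : ∀ m u y ys js →
    ev (baseF m u (y ∷ ys) js) ≈ pick (y ∷ ys) (λ y ys → ev (pivotF m u (y ∷ ys) (suc (length ys) ∷ js)))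
  base≈pivots m u y₁ ys₁ js = begin
    ev (baseF m u vs js) ≈⟨ ev-base m u vs js ⟩
    V v vs * (V v⁻ vs * Z vs) ≈⟨ R.sym (R.trans (R.*-congʳ (geo-inverse (suc (length ys₁) , W.ε) (s≤s z≤n))) (R.*-identityˡ _)) ⟩
    ((1# - mono (length vs , W.ε)) * g₁) * (V v vs * (V v⁻ vs * Z vs))
      ≈⟨ solve 5 (λ p q x y z → (p :* q) :* (x :* (y :* z)) := (p :* x) :* (y :* (z :* q))) R.refl (1# - mono (length vs , W.ε)) g₁ (V v vs) (V v⁻ vs) (Z vs) ⟩
    ((1# - mono (length vs , W.ε)) * V v vs) * (V v⁻ vs * (Z vs * g₁))
      ≈⟨ R.*-congʳ (R.trans (R.*-congʳ (R.+-congˡ (R.-‿cong (R.sym (∏-t vs))))) (t-identity v v⁻ v-inverse t vs)) ⟩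
    ((1# - t) * alt vs (λ y ys → S y ys)) * (V v⁻ vs * (Z vs * g₁))
      ≈⟨ solve 5 (λ p q x y z → (p :* q) :* (x :* (y :* z)) := (q :* x) :* (p :* (y :* z))) R.refl (1# - t) (alt vs S) (V v⁻ vs) (Z vs) g₁ ⟩
    (alt vs S * V v⁻ vs) * ((1# - t) * (Z vs * g₁)) ≈⟨ R.*-congʳ (alt-antisymmetric {Y = V v⁻} (V-antisymmetric v⁻) vs {S}) ⟩
    pick vs (λ y ys → S y ys * V v⁻ (y ∷ ys)) * ((1# - t) * (Z vs * g₁)) ≈⟨ pick-*ʳ vs _ {λ y ys → S y ys * V v⁻ (y ∷ ys)} ⟩
    pick vs (λ y ys → S y ys * V v⁻ (y ∷ ys) * ((1# - t) * (Z vs * g₁))) ≈⟨ pick-cong vs step ⟩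
    pick vs (λ y ys → ev (pivotF m u (y ∷ ys) (suc (length ys) ∷ js))) ∎
    where
    vs = y₁ ∷ ys₁
    S : W a → List (W a) → T.Carrier
    S y ys = ∏ ys (λ y′ → v y - t * v y′) * V v ys
    Z : List (W a) → T.Carrier
    Z l = cross l l * (tails m u l * ev (tF js))
    g₁ = g (suc (length ys₁)) W.ε
    step : ∀ y ys → y ∷ ys ↭ vs → S y ys * V v⁻ (y ∷ ys) * ((1# - t) * (Z vs * g₁)) ≈ ev (pivotF m u (y ∷ ys) (suc (length ys) ∷ js))
    step y ys p = begin
      S y ys * V v⁻ (y ∷ ys) * ((1# - t) * (Z vs * g₁))
        ≈⟨ R.*-congˡ (R.*-congˡ (R.*-cong (R.*-cong (cross-↭ (↭-sym p)) (R.*-congʳ (∏-↭ _ (↭-sym p))))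
             (R.reflexive (cong (λ n → g n W.ε) (sym (↭-length p)))))) ⟩
      S y ys * V v⁻ (y ∷ ys) * ((1# - t) * (cross (y ∷ ys) (y ∷ ys) * (tails m u (y ∷ ys) * ev (tF js)) * g (suc (length ys)) W.ε))
        ≈⟨ solve 8 (λ p V V⁻ t c ta e g → p :* V :* V⁻ :* (t :* (c :* (ta :* e) :* g)) := t :* (p :* (V :* (V⁻ :* (c :* (ta :* (g :* e)))))))
             R.refl (∏ ys (λ y′ → v y - t * v y′)) (V v ys) (V v⁻ (y ∷ ys)) (1# - t) (cross (y ∷ ys) (y ∷ ys)) (tails m u (y ∷ ys)) (ev (tF js)) (g (suc (length ys)) W.ε) ⟩
      _ ≈⟨ R.sym (ev-pivot m u y ys (suc (length ys) ∷ js)) ⟩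
      ev (pivotF m u (y ∷ ys) (suc (length ys) ∷ js)) ∎

  -- For each other variable `(x - t y)(1/x - 1/y) = (1 - x/y)(1 - t y/x)`, and the last factor
  -- cancels an entry of the cross product; `1 - t` cancels its diagonal entry. Only the first
  -- factor on the right still has negative powers of `x`.
  pivot≈ : ∀ m u x xs js → ev (pivotF m u (x ∷ xs) js) ≈ g m (u W.⊖ x) *
    (∏ xs (λ y → 1# - v (x W.⊖ y)) * (∏ xs (λ y → g 1 (x W.⊖ y)) * (g 1 (x W.⊖ u) * ev (baseF m u xs js))))
  pivot≈ m u x xs js = begin
    ev (pivotF m u (x ∷ xs) js) ≈⟨ ev-pivot m u x xs js ⟩
    (1# - t) * (∏ xs (λ y → v x - t * v y) * (V v xs * ((∏ xs (λ y → v⁻ x - v⁻ y) * V v⁻ xs) *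
      ((g 1 (x W.⊖ x) * G₁ * ∏ xs (λ y → g 1 (y W.⊖ x) * ∏ xs (λ y′ → g 1 (y W.⊖ y′)))) * ((g 1 (x W.⊖ u) * g m (u W.⊖ x)) * tails m u xs * ev (tF js))))))
      ≈⟨ R.*-congˡ (R.*-congˡ (R.*-congˡ (R.*-congˡ (R.*-congʳ (R.*-congˡ (R.sym (∏-* xs))))))) ⟩
    (1# - t) * (A * (V v xs * ((B * V v⁻ xs) *
      ((g 1 (x W.⊖ x) * G₁ * (C * cross xs xs)) * ((g 1 (x W.⊖ u) * g m (u W.⊖ x)) * tails m u xs * ev (tF js))))))
      ≈⟨ solve 13 (λ t A V B V⁻ gx G₁ C c g1 gm ta e →
           t :* (A :* (V :* ((B :* V⁻) :* ((gx :* G₁ :* (C :* c)) :* ((g1 :* gm) :* ta :* e)))))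
           := (t :* gx) :* ((A :* B :* C) :* (gm :* (G₁ :* (g1 :* (V :* (V⁻ :* (c :* (ta :* e)))))))))
         R.refl (1# - t) A (V v xs) B (V v⁻ xs) (g 1 (x W.⊖ x)) G₁ C (cross xs xs) (g 1 (x W.⊖ u)) (g m (u W.⊖ x)) (tails m u xs) (ev (tF js)) ⟩
    ((1# - t) * g 1 (x W.⊖ x)) * ((A * B * C) * (g m (u W.⊖ x) * (G₁ * (g 1 (x W.⊖ u) * (V v xs * (V v⁻ xs * (cross xs xs * (tails m u xs * ev (tF js)))))))))
      ≈⟨ R.*-cong (R.trans (R.*-congˡ (R.reflexive (cong (g 1) (W.inv x)))) (geo-inverse (1 , W.ε) ℕₚ.≤-refl))
           (R.*-cong ABC (R.*-congˡ (R.*-congˡ (R.*-congˡ (R.sym (ev-base m u xs js)))))) ⟩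
    1# * (P * (g m (u W.⊖ x) * (G₁ * (g 1 (x W.⊖ u) * ev (baseF m u xs js)))))
      ≈⟨ solve 5 (λ P gm G g1 b → :1 :* (P :* (gm :* (G :* (g1 :* b)))) := gm :* (P :* (G :* (g1 :* b)))) R.refl P (g m (u W.⊖ x)) G₁ (g 1 (x W.⊖ u)) _ ⟩
    g m (u W.⊖ x) * (P * (G₁ * (g 1 (x W.⊖ u) * ev (baseF m u xs js)))) ∎
    where
    A = ∏ xs (λ y → v x - t * v y)
    B = ∏ xs (λ y → v⁻ x - v⁻ y)
    C = ∏ xs (λ y → g 1 (y W.⊖ x))
    G₁ = ∏ xs (λ y → g 1 (x W.⊖ y))
    P = ∏ xs (λ y → 1# - v (x W.⊖ y))
    ABC : A * B * C ≈ P
    ABC = R.trans (R.*-congʳ (∏-* xs)) (R.trans (∏-* xs) (∏-cong xs (λ y → begin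
      (v x - t * v y) * (v⁻ x - v⁻ y) * g 1 (y W.⊖ x)
        ≈⟨ R.*-congʳ (solve 5 (λ x x̄ y ȳ t → (x :- t :* y) :* (x̄ :- ȳ) := x :* x̄ :- x :* ȳ :- t :* (y :* x̄) :+ t :* (y :* ȳ)) R.refl (v x) (v⁻ x) (v y) (v⁻ y) t) ⟩
      (v x * v⁻ x - v x * v⁻ y - t * (v y * v⁻ x) + t * (v y * v⁻ y)) * g 1 (y W.⊖ x)
        ≈⟨ R.*-congʳ (R.+-cong (R.+-congʳ (R.+-congʳ (v-inverse x))) (R.*-congˡ (R.trans (v-inverse y) (R.sym (xyyx x y))))) ⟩
      (1# - v x * v⁻ y - t * (v y * v⁻ x) + t * ((v x * v⁻ y) * (v y * v⁻ x))) * g 1 (y W.⊖ x)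
        ≈⟨ solve 4 (λ p t q g → (:1 :- p :- t :* q :+ t :* (p :* q)) :* g := (:1 :- p) :* ((:1 :- t :* q) :* g)) R.refl (v x * v⁻ y) t (v y * v⁻ x) _ ⟩
      (1# - v x * v⁻ y) * ((1# - t * (v y * v⁻ x)) * g 1 (y W.⊖ x))
        ≈⟨ R.*-cong (R.+-congˡ (R.-‿cong (v* x y))) (R.trans (R.*-congʳ (R.+-congˡ (R.-‿cong (R.trans (R.*-congˡ (v* y x)) (t* _))))) (geo-inverse (1 , y W.⊖ x) ℕₚ.≤-refl)) ⟩
      (1# - v (x W.⊖ y)) * 1# ≈⟨ R.*-identityʳ _ ⟩
      1# - v (x W.⊖ y) ∎)))
      where
      xyyx : ∀ x y → (v x * v⁻ y) * (v y * v⁻ x) ≈ 1#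
      xyyx x y = R.trans (solve 4 (λ x ȳ y x̄ → (x :* ȳ) :* (y :* x̄) := (x :* x̄) :* (y :* ȳ)) R.refl (v x) (v⁻ y) (v y) (v⁻ x))
        (R.trans (R.*-cong (v-inverse x) (v-inverse y)) (R.*-identityˡ 1#))

  -- The left side is the cofactor from `pivot≈` at `x = t^m u`. There `1 - x/y` cancels
  -- `1/(1 - t^m u/y)`, while `1/(1 - t x/y)` takes its place with exponent `m + 1`, and
  -- `1/(1 - t x/u)` becomes `1/(1 - t^(m+1))`.
  evaluated≈ : ∀ m u ys js → 1 ℕ.≤ m →
    ∏ ys (λ y → 1# - mono (m , u W.⊖ y)) * (∏ ys (λ y → g (suc m) (u W.⊖ y)) * (g (suc m) W.ε * ev (baseF m u ys js)))
    ≈ ev (baseF (suc m) u ys (suc m ∷ js))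
  evaluated≈ m u ys js 1≤m = begin
    A * (B * (g (suc m) W.ε * ev (baseF m u ys js))) ≈⟨ R.*-congˡ (R.*-congˡ (R.*-congˡ (ev-base m u ys js))) ⟩
    A * (B * (g (suc m) W.ε * (V v ys * (V v⁻ ys * (cross ys ys * (tails m u ys * ev (tF js)))))))
      ≈⟨ R.*-congˡ (R.*-congˡ (R.*-congˡ (R.*-congˡ (R.*-congˡ (R.*-congˡ (R.*-congʳ (R.sym (∏-* ys)))))))) ⟩
    A * (B * (g (suc m) W.ε * (V v ys * (V v⁻ ys * (cross ys ys * (C * G * ev (tF js)))))))
      ≈⟨ solve 9 (λ A B g V V⁻ c C G e → A :* (B :* (g :* (V :* (V⁻ :* (c :* (C :* G :* e)))))) := (A :* G) :* (V :* (V⁻ :* (c :* ((C :* B) :* (g :* e))))))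
           R.refl A B (g (suc m) W.ε) (V v ys) (V v⁻ ys) (cross ys ys) C G (ev (tF js)) ⟩
    (A * G) * (V v ys * (V v⁻ ys * (cross ys ys * ((C * B) * (g (suc m) W.ε * ev (tF js))))))
      ≈⟨ R.*-cong (∏-inverse ys (λ y → geo-inverse (m , u W.⊖ y) 1≤m)) (R.*-congˡ (R.*-congˡ (R.*-congˡ (R.*-congʳ (∏-* ys))))) ⟩
    1# * (V v ys * (V v⁻ ys * (cross ys ys * (tails (suc m) u ys * ev (tF (suc m ∷ js)))))) ≈⟨ R.*-identityˡ _ ⟩
    V v ys * (V v⁻ ys * (cross ys ys * (tails (suc m) u ys * ev (tF (suc m ∷ js))))) ≈⟨ R.sym (ev-base (suc m) u ys (suc m ∷ js)) ⟩
    ev (baseF (suc m) u ys (suc m ∷ js)) ∎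
    where
    A = ∏ ys (λ y → 1# - mono (m , u W.⊖ y))
    B = ∏ ys (λ y → g (suc m) (u W.⊖ y))
    C = ∏ ys (λ y → g 1 (y W.⊖ u))
    G = ∏ ys (λ y → g m (u W.⊖ y))

  ⟨pick⟩ : ∀ {A : Set} (xs : List A) G f → ⟨ pick xs G , f ⟩ ≡ Aℤ.pick xs (λ y ys → ⟨ G y ys , f ⟩)
  ⟨pick⟩ [] G f = T.⟨⟩-0 f
  ⟨pick⟩ (x ∷ xs) G f = trans (T.⟨⟩-+ (G x xs) _ f) (cong (λ z → ⟨ G x xs , f ⟩ ℤ.+ z) (⟨pick⟩ xs _ f))

  CT-test : MR.Test (CT k a)
  CT-test (d , (u , e)) l = cong (ℤ._* (δℤ u ℤ.* δV e)) (δℕ-< l)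

  CT-pivot : ∀ {m l js} → l ↭ vars a → ⟨ ev (pivotF m u₀ l js) , CT k a ⟩ ≡ ⟨ ev (pivotF m u₀ (vars a) js) , CT k a ⟩
  CT-pivot {m} {l} {js} p = trans
    (cong (λ fs → ⟨ ev fs , CT k a ⟩) (trans (cong₂ (λ u l → pivotF m u l js) (sym (substHom-u l)) (sym (substHom-vars l (trans (↭-length p) (length-vars a)))))
      (pivotF-nat {Wᵍ a} {Wᵍ a} (substHom l) m u₀ (vars a) js)))
    (trans (sym (⟨ev⟩-hom (lift {Wᵍ a} {Wᵍ a} (substHom l)) D (pivotF m u₀ (vars a) js) (CT k a))) (T.⟨⟩-cong _ (CT-subst k l p)))

LM : ℕ → CMon
LM a = ℕM ×M Grp.cmon (Wᵍ a)

-- Each step adds the `1 - t^a` of the interpolation and the `1 - t^(m+1)` of the evaluation; from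
-- `m = 1` the exponents run through `1, …, a` and `2, …, a + 1`.
denominators : ℕ → ℕ → List ℕ → List ℕ
denominators zero m js = js
denominators (suc a) m js = denominators a (suc m) (suc m ∷ suc a ∷ js)

-- The pivots differ by a permutation of the variables and so have equal constant terms; their
-- numbers at the successive steps multiply to `a!`.
constant-term : ∀ k D → k ℕ.≤ D → ∀ a m js → 1 ℕ.≤ m →
  Terms.⟨_,_⟩ (LM a) (Eval.ev (LM a) D (Lists.baseF (Wᵍ a) m u₀ (vars a) js)) (CT k a) ≡
  + (a !) ℤ.* Terms.⟨_,_⟩ ℕM (Eval.ev ℕM D (map geo (denominators a m js))) (δℕ k)
constant-term k D k≤D zero m js 1≤m = begin
  Terms.⟨_,_⟩ (LM 0) (Eval.ev (LM 0) D (Lists.tF (Wᵍ 0) js)) (CT k 0)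
    ≡⟨ cong (λ fs → Terms.⟨_,_⟩ (LM 0) (Eval.ev (LM 0) D fs) (CT k 0)) (Listₚ.map-∘ js) ⟩
  Terms.⟨_,_⟩ (LM 0) (Eval.ev (LM 0) D (map (mapFac (Hom.⟦_⟧ ι)) (map geo js))) (CT k 0) ≡⟨ sym (⟨ev⟩-hom ι D (map geo js) (CT k 0)) ⟩
  Terms.⟨_,_⟩ ℕM (Eval.ev ℕM D (map geo js)) (CT k 0 ∘ Hom.⟦_⟧ ι) ≡⟨ Terms.⟨⟩-cong ℕM (Eval.ev ℕM D (map geo js)) (λ d → ℤₚ.*-identityʳ (δℕ k d)) ⟩
  Terms.⟨_,_⟩ ℕM (Eval.ev ℕM D (map geo js)) (δℕ k) ≡⟨ sym (ℤₚ.*-identityˡ _) ⟩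
  + 1 ℤ.* Terms.⟨_,_⟩ ℕM (Eval.ev ℕM D (map geo js)) (δℕ k) ∎
  where
  open ≡-Reasoning
  ι : Hom ℕM (ℕM ×M Grp.cmon (Wᵍ 0))
  ι = record { ⟦_⟧ = λ d → d , W.ε ; ⟦∙⟧ = λ _ _ → refl ; ⟦ε⟧ = refl }
constant-term k D k≤D (suc a) m js 1≤m = begin
  A.T.⟨_,_⟩ (A.ev (LA.baseF m u₀ vs js)) (CT k (suc a)) ≡⟨ A.MR.⟨ A.base≈pivots m u₀ x₀ xs js ⟩≈ A.CT-test ⟩
  A.T.⟨_,_⟩ (A.Alt.pick vs (λ y ys → A.ev (LA.pivotF m u₀ (y ∷ ys) (suc (length ys) ∷ js)))) (CT k (suc a)) ≡⟨ A.⟨pick⟩ vs (λ y ys → A.ev (LA.pivotF m u₀ (y ∷ ys) (suc (length ys) ∷ js))) _ ⟩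
  Aℤ.pick vs (λ y ys → A.T.⟨_,_⟩ (A.ev (LA.pivotF m u₀ (y ∷ ys) (suc (length ys) ∷ js))) (CT k (suc a)))
    ≡⟨ Aℤ.pick-cong vs (λ y ys p → trans (A.CT-pivot {m} {y ∷ ys} p) (cong (λ n → A.T.⟨_,_⟩ (A.ev (LA.pivotF m u₀ vs (n ∷ js))) (CT k (suc a)))
         (trans (↭-length p) (length-vars (suc a))))) ⟩
  Aℤ.pick vs (λ _ _ → C) ≡⟨ pick-const vs C ⟩
  + length vs ℤ.* C ≡⟨ cong₂ (λ n c → + n ℤ.* c) (length-vars (suc a)) C≡ ⟩
  + suc a ℤ.* (+ (a !) ℤ.* Q) ≡⟨ sym (ℤₚ.*-assoc (+ suc a) (+ (a !)) Q) ⟩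
  (+ suc a ℤ.* + (a !)) ℤ.* Q ≡⟨ cong (ℤ._* Q) (sym (ℤₚ.pos-* (suc a) (a !))) ⟩
  + (suc a !) ℤ.* Q ∎
  where
  open ≡-Reasoning
  module A = Laurent (suc a) k D k≤D
  module B = Laurent a k D k≤D
  module LA = Lists (Wᵍ (suc a))
  module LB = Lists (Wᵍ a)
  ys : List (W a)
  ys = vars a
  xs vs : List (W (suc a))
  xs = map (Hom.⟦_⟧ embed) ys
  vs = x₀ ∷ xs
  js′ = suc a ∷ js
  C = A.T.⟨_,_⟩ (A.ev (LA.pivotF m u₀ vs js′)) (CT k (suc a))
  Q = Terms.⟨_,_⟩ ℕM (Eval.ev ℕM D (map geo (denominators (suc a) m js))) (δℕ k)
  E′ = ℕM ×M ℕM ×M Grp.cmon (Wᵍ a)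
  base : List (Fac (ℕ × ℕ × W a))
  base = map (mapFac (λ (d , w) → d , (0 , w))) (LB.baseF m u₀ ys js′)
  dif gm : W a → Fac (ℕ × ℕ × W a)
  dif y = diff (0 , (0 , W.ε)) (0 , (1 , W.neg y))
  gm y = geo (1 , (1 , W.neg y))
  -- The simplified pivot without `1/(1 - t^m u/x₀)`, written with natural exponents of `x₀`. From
  -- it `incl` recovers the Laurent factors, and `eval` puts `x₀ = t^m u`.
  Φ : List (Fac (ℕ × ℕ × W a))
  Φ = map dif ys ++ map gm ys ++ gm u₀ ∷ base
  incl-x₀ : ∀ (y : W a) → (proj₁ (W.neg y) , + 1 ∷ proj₂ (W.neg y)) ≡ x₀ W.⊖ Hom.⟦_⟧ embed y
  incl-x₀ (u , e) = cong₂ _,_ (sym (ℤₚ.+-identityˡ _)) (cong (+ 1 ∷_) (sym (0V-+ _)))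
  eval-u₀ : ∀ (y : W a) → (+ 1 ℤ.+ proj₁ (W.neg y) , proj₂ (W.neg y)) ≡ u₀ W.⊖ y
  eval-u₀ (u , e) = cong (_ ,_) (sym (0V-+ _))
  map-Φ : ∀ {E′ : Set} (L : Fac (ℕ × ℕ × W a) → Fac E′) →
    map L Φ ≡ map (L ∘ dif) ys ++ map (L ∘ gm) ys ++ L (gm u₀) ∷ map L base
  map-Φ L = trans (Listₚ.map-++ L (map dif ys) _) (cong₂ _++_ (sym (Listₚ.map-∘ ys))
    (trans (Listₚ.map-++ L (map gm ys) _) (cong (_++ L (gm u₀) ∷ map L base) (sym (Listₚ.map-∘ ys)))))
  incl eval : Fac (ℕ × ℕ × W a) → Fac _
  incl = mapFac (Hom.⟦_⟧ (inclHom {a}))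
  eval = mapFac (Hom.⟦_⟧ (evalHom {a} m))
  incl-base : map incl base ≡ LA.baseF m u₀ xs js′
  incl-base = trans (sym (Listₚ.map-∘ (LB.baseF m u₀ ys js′)))
    (trans (Listₚ.map-cong (λ { (mon _) → refl ; (diff _ _) → refl ; (geo _) → refl }) (LB.baseF m u₀ ys js′))
           (sym (baseF-nat {Wᵍ a} {Wᵍ (suc a)} embed m u₀ ys js′)))
  eval-base : map eval base ≡ LB.baseF m u₀ ys js′
  eval-base = trans (sym (Listₚ.map-∘ (LB.baseF m u₀ ys js′)))
    (trans (Listₚ.map-cong (λ { (mon w) → cong mon (same w) ; (diff w w′) → cong₂ diff (same w) (same w′) ; (geo w) → cong geo (same w) }) (LB.baseF m u₀ ys js′))
           (Listₚ.map-id _))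
    where
    same : ∀ (x : ℕ × W a) → Hom.⟦_⟧ (evalHom {a} m) (proj₁ x , (0 , proj₂ x)) ≡ x
    same (d , (u , e)) = cong (λ z → d , (z , e)) (ℤₚ.+-identityˡ u)
  A-side : A.ev (map incl Φ) A.R.≈ A.Alt.∏ xs (λ y → A.R.1# A.R.- A.v (x₀ W.⊖ y)) A.R.* (A.Alt.∏ xs (λ y → A.g 1 (x₀ W.⊖ y)) A.R.*
    (A.g 1 (x₀ W.⊖ u₀) A.R.* A.ev (LA.baseF m u₀ xs js′)))
  A-side = A.R.trans (A.R.reflexive (cong A.ev (map-Φ incl))) (A.R.trans (A.ev-parts _ _ ys _ _) (A.R.*-cong
    (A.R.sym (A.R.trans (A.Alt.∏-map (Hom.⟦_⟧ embed) ys) (A.Alt.∏-cong ys (λ y → A.R.+-cong (A.R.sym A.mono-ε)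
      (A.R.-‿cong (A.R.reflexive (cong (λ w → A.T.mono (0 , w)) (sym (incl-x₀ y)))))))))
    (A.R.*-cong (A.R.sym (A.R.trans (A.Alt.∏-map (Hom.⟦_⟧ embed) ys) (A.Alt.∏-cong ys (λ y → A.R.reflexive (cong (A.g 1) (sym (incl-x₀ y)))))))
      (A.R.*-cong (A.R.reflexive (cong (A.g 1) (incl-x₀ u₀))) (A.R.reflexive (cong A.ev incl-base))))))
  B-side : B.ev (map eval Φ) B.R.≈ B.ev (LB.baseF (suc m) u₀ ys (suc m ∷ js′))
  B-side = B.R.trans (B.R.reflexive (cong B.ev (map-Φ eval))) (B.R.trans (B.ev-parts _ _ ys _ _) (B.R.trans (B.R.*-cong
    (B.Alt.∏-cong ys (λ y → B.R.+-cong B.mono-ε (B.R.-‿cong (B.R.reflexive (cong₂ (λ d w → B.T.mono (d , w)) m≡ (eval-u₀ y))))))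
    (B.R.*-cong (B.Alt.∏-cong ys (λ y → B.R.reflexive (cong₂ B.g 1+m≡ (eval-u₀ y))))
      (B.R.*-cong (B.R.reflexive (cong₂ B.g 1+m≡ (trans (eval-u₀ u₀) (W.inv u₀)))) (B.R.reflexive (cong B.ev eval-base)))))
    (B.evaluated≈ m u₀ ys js′ 1≤m)))
    where
    m≡ : 1 ℕ.* m ℕ.+ 0 ≡ m
    m≡ = trans (ℕₚ.+-identityʳ _) (ℕₚ.*-identityˡ m)
    1+m≡ : 1 ℕ.* m ℕ.+ 1 ≡ suc m
    1+m≡ = trans (ℕₚ.+-comm _ 1) (cong suc (ℕₚ.*-identityˡ m))
  C≡ : C ≡ + (a !) ℤ.* Q
  C≡ = begin
    A.T.⟨_,_⟩ (A.ev (LA.pivotF m u₀ vs js′)) (CT k (suc a))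
      ≡⟨ A.MR.⟨ A.R.trans (A.pivot≈ m u₀ x₀ xs js′) (A.R.*-congˡ (A.R.sym A-side)) ⟩≈ A.CT-test ⟩
    A.T.⟨_,_⟩ (A.g m (u₀ W.⊖ x₀) A.T.* A.ev (map incl Φ)) (CT k (suc a))
      ≡⟨ cong (λ P → A.T.⟨_,_⟩ (A.g m (u₀ W.⊖ x₀) A.T.* P) (CT k (suc a))) (sym (mapE-ev inclHom D Φ)) ⟩
    A.T.⟨_,_⟩ (A.g m (u₀ W.⊖ x₀) A.T.* mapE inclHom (Eval.ev E′ D Φ)) (CT k (suc a)) ≡⟨ eliminate k D k≤D m 1≤m (Eval.ev E′ D Φ) ⟩
    Terms.⟨_,_⟩ E′ (Eval.ev E′ D Φ) (CT k a ∘ Hom.⟦_⟧ (evalHom m)) ≡⟨ ⟨ev⟩-hom (evalHom m) D Φ (CT k a) ⟩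
    B.T.⟨_,_⟩ (B.ev (map eval Φ)) (CT k a) ≡⟨ B.MR.⟨ B-side ⟩≈ B.CT-test ⟩
    B.T.⟨_,_⟩ (B.ev (LB.baseF (suc m) u₀ ys (suc m ∷ js′))) (CT k a) ≡⟨ constant-term k D k≤D a (suc m) (suc m ∷ js′) (s≤s z≤n) ⟩
    + (a !) ℤ.* Q ∎

-- The generating function of plane partitions with two rows.

≤ᵇ-true : ∀ {m n} → m ℕ.≤ n → (m ℕ.≤ᵇ n) ≡ true
≤ᵇ-true {m} {n} l with m ℕ.≤ᵇ n | ℕₚ.≤⇒≤ᵇ l
... | true | _ = refl

≤ᵇ-false : ∀ {m n} → n ℕ.< m → (m ℕ.≤ᵇ n) ≡ false
≤ᵇ-false {m} {n} l with m ℕ.≤ᵇ n in eq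
... | false = refl
... | true = ⊥-elim (ℕₚ.<⇒≱ l (ℕₚ.≤ᵇ⇒≤ m n (subst Bool.T (sym eq) tt)))

module TwoRows (k D : ℕ) (k≤D : k ℕ.≤ D) where
  open FacRing ℕM (λ n → n) (λ _ _ → refl) k D k≤D public
  open T using (mono; ⟨_,_⟩; supp-mono)
  open MR using (mono-*; high-degree)
  open R using (Carrier; _≈_; _+_; _*_; _-_; -_; 0#; 1#)
  open IntegerSolver MR.ring using (solve; _:+_; _:*_; _:-_; :-_; :0; :1; _:=_)
  open Relation.Binary.Reasoning.Setoid R.setoid

  S : ℕ → (ℕ → Carrier) → Carrier
  S zero h = h 0
  S (suc X) h = S X h + h (suc X)

  S-cong : ∀ X {g h} → (∀ x → x ℕ.≤ X → g x ≈ h x) → S X g ≈ S X h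
  S-cong zero e = e 0 z≤n
  S-cong (suc X) e = R.+-cong (S-cong X (λ x l → e x (ℕₚ.m≤n⇒m≤1+n l))) (e (suc X) ℕₚ.≤-refl)

  S-+ : ∀ X {g h} → S X g + S X h ≈ S X (λ x → g x + h x)
  S-+ zero = R.refl
  S-+ (suc X) {g} {h} = R.trans (solve 4 (λ a b c d → (a :+ b) :+ (c :+ d) := (a :+ c) :+ (b :+ d)) R.refl (S X g) (g (suc X)) (S X h) (h (suc X)))
    (R.+-congʳ (S-+ X))

  S-*ˡ : ∀ X c {h} → c * S X h ≈ S X (λ x → c * h x)
  S-*ˡ zero c = R.refl
  S-*ˡ (suc X) c = R.trans (R.distribˡ c _ _) (R.+-congʳ (S-*ˡ X c))

  S-*ʳ : ∀ X c {h} → S X h * c ≈ S X (λ x → h x * c)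
  S-*ʳ zero c = R.refl
  S-*ʳ (suc X) c = R.trans (R.distribʳ c _ _) (R.+-congʳ (S-*ʳ X c))

  τ : ℕ → Carrier
  τ = mono

  τ-+ : ∀ m n → τ (m ℕ.+ n) ≈ τ m * τ n
  τ-+ m n = R.sym (mono-* m n)

  -- rows a X: at most a parts, each at most X.
  rows : ℕ → ℕ → Carrier
  rows zero X = 1#
  rows (suc a) X = S X (λ x → τ x * rows a x)

  -- planes a X Y: two rows of length a, dominated entrywise, with first entries at most X and Y.
  planes : ℕ → ℕ → ℕ → Carrier
  planes zero X Y = 1#
  planes (suc a) X Y = S Y (λ y → S X (λ x → if y ℕ.≤ᵇ x then τ (x ℕ.+ y) * planes a x y else 0#))

  -- Pairs of rows violating the domination, by exchanging tails after the first violation.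
  violations : ℕ → ℕ → ℕ → Carrier
  violations zero X Y = 0#
  violations (suc b) X zero = 0#
  violations (suc b) X (suc Y) = τ 1 * (rows (suc (suc b)) Y * rows b (suc X))

  -- Counts the tails behind a first column `(x , y)` that make the pair violate domination: a later
  -- violation is required if `y ≤ x`, and the tails are arbitrary if the column itself is one.
  weight : ℕ → ℕ → ℕ → Carrier
  weight b x y = if y ℕ.≤ᵇ x then violations b x y else rows b x * rows b y

  -- The summands with `x ≤ A` are violating columns and add up to `rows (suc b) A`. Each further
  -- `x` contributes, through `violations`, exactly the amount by which `rows b` grows when its
  -- bound is raised from `x` to `x + 1`.
  row-weight : ∀ b A d → S (d ℕ.+ A) (λ x → τ (x ℕ.+ suc A) * weight b x (suc A)) ≈ τ (suc A) * (rows (suc b) A * rows b (suc (d ℕ.+ A)))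
  row-weight b A zero = begin
    S A (λ x → τ (x ℕ.+ suc A) * weight b x (suc A))
      ≈⟨ S-cong A (λ x l → R.trans (R.*-cong (τ-+ x (suc A)) (R.reflexive (cong (λ o → if o then violations b x (suc A) else rows b x * rows b (suc A)) (≤ᵇ-false (s≤s l)))))
           (solve 4 (λ p q r s → (p :* q) :* (r :* s) := (q :* s) :* (p :* r)) R.refl (τ x) (τ (suc A)) (rows b x) (rows b (suc A)))) ⟩
    S A (λ x → (τ (suc A) * rows b (suc A)) * (τ x * rows b x)) ≈⟨ R.sym (S-*ˡ A _) ⟩
    (τ (suc A) * rows b (suc A)) * rows (suc b) A ≈⟨ solve 3 (λ p q r → (p :* q) :* r := p :* (r :* q)) R.refl _ _ _ ⟩
    τ (suc A) * (rows (suc b) A * rows b (suc A)) ∎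
  row-weight b A (suc d) = R.trans (R.+-cong (row-weight b A d)
      (R.*-cong (τ-+ (suc (d ℕ.+ A)) (suc A)) (R.reflexive (cong (λ o → if o then violations b x (suc A) else rows b x * rows b (suc A)) (≤ᵇ-true (s≤s (ℕₚ.m≤n+m A d)))))))
    (step b)
    where
    x = suc (d ℕ.+ A)
    step : ∀ b → τ (suc A) * (rows (suc b) A * rows b x) + (τ x * τ (suc A)) * violations b x (suc A) ≈ τ (suc A) * (rows (suc b) A * rows b (suc x))
    step zero = solve 3 (λ p q r → p :* (q :* :1) :+ (r :* p) :* :0 := p :* (q :* :1)) R.refl (τ (suc A)) (rows 1 A) (τ x)
    step (suc b) = R.trans (solve 6 (λ p q r x t s → p :* (q :* r) :+ (x :* p) :* (t :* (q :* s)) := p :* (q :* (r :+ (t :* x) :* s))) R.refl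
        (τ (suc A)) (rows (suc (suc b)) A) (rows (suc b) x) (τ x) (τ 1) (rows b (suc x)))
      (R.*-congˡ (R.*-congˡ (R.+-congˡ (R.*-congʳ (R.sym (τ-+ 1 x))))))

  -- Split by the first column. By `row-weight` the violating pairs with `y = A + 1` have a closed
  -- form, and summing over `A` rebuilds a `rows` with one more part. The hypothesis on `Y` puts all
  -- `x < y` within the bound `X`.
  planes-violations : ∀ a X Y → Y ℕ.≤ suc X → rows a X * rows a Y ≈ planes a X Y + violations a X Y
  planes-violations zero X Y l = solve 0 (:1 :* :1 := :1 :+ :0) R.refl
  planes-violations (suc b) X Y l = begin
    rows (suc b) X * rows (suc b) Y ≈⟨ R.trans (S-*ˡ Y _) (S-cong Y (λ y _ → R.trans (S-*ʳ X _) (S-cong X (λ x _ →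
        R.trans (solve 4 (λ p q r s → (p :* q) :* (r :* s) := (p :* r) :* (q :* s)) R.refl (τ x) (rows b x) (τ y) (rows b y)) (R.*-congʳ (R.sym (τ-+ x y))))))) ⟩
    S Y (λ y → S X (λ x → τ (x ℕ.+ y) * (rows b x * rows b y))) ≈⟨ S-cong Y (λ y _ → R.trans (S-cong X (λ x _ → split x y)) (R.sym (S-+ X))) ⟩
    S Y (λ y → S X (λ x → if y ℕ.≤ᵇ x then τ (x ℕ.+ y) * planes b x y else 0#) + S X (λ x → τ (x ℕ.+ y) * weight b x y)) ≈⟨ R.sym (S-+ Y) ⟩
    planes (suc b) X Y + S Y (λ y → S X (λ x → τ (x ℕ.+ y) * weight b x y)) ≈⟨ R.+-congˡ (total Y l) ⟩
    planes (suc b) X Y + violations (suc b) X Y ∎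
    where
    split : ∀ x y → τ (x ℕ.+ y) * (rows b x * rows b y) ≈ (if y ℕ.≤ᵇ x then τ (x ℕ.+ y) * planes b x y else 0#) + τ (x ℕ.+ y) * weight b x y
    split x y with y ℕ.≤ᵇ x in eq
    ... | true = R.trans (R.*-congˡ (planes-violations b x y (ℕₚ.m≤n⇒m≤1+n (ℕₚ.≤ᵇ⇒≤ y x (subst Bool.T (sym eq) tt))))) (R.distribˡ _ _ _)
    ... | false = R.sym (R.+-identityˡ _)
    v0 : ∀ b x → violations b x 0 ≈ 0#
    v0 zero x = R.refl
    v0 (suc b) x = R.refl
    S-0 : ∀ X → S X (λ _ → 0#) ≈ 0#
    S-0 zero = R.refl
    S-0 (suc X) = R.trans (R.+-identityʳ _) (S-0 X)
    column : ∀ A → A ℕ.≤ X → S X (λ x → τ (x ℕ.+ suc A) * weight b x (suc A)) ≈ τ (suc A) * (rows (suc b) A * rows b (suc X))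
    column A A≤X = subst (λ X → S X (λ x → τ (x ℕ.+ suc A) * weight b x (suc A)) ≈ τ (suc A) * (rows (suc b) A * rows b (suc X))) (ℕₚ.m∸n+n≡m A≤X) (row-weight b A (X ℕ.∸ A))
    total : ∀ Y → Y ℕ.≤ suc X → S Y (λ y → S X (λ x → τ (x ℕ.+ y) * weight b x y)) ≈ violations (suc b) X Y
    total zero l = R.trans (S-cong X (λ x _ → R.trans (R.*-congˡ (v0 b x)) (R.zeroʳ _))) (S-0 X)
    total (suc zero) l = R.trans (R.+-cong (total zero z≤n) (column 0 z≤n)) (solve 3 (λ p q r → :0 :+ p :* (q :* r) := p :* (q :* r)) R.refl (τ 1) (rows (suc b) 0) (rows b (suc X)))
      ⟫ R.*-congˡ (R.*-congʳ (R.sym (R.trans (R.*-congʳ (R.reflexive (sym T.1≡mono))) (R.*-identityˡ _))))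
      where
      infixl 5 _⟫_
      _⟫_ : ∀ {x y z} → x ≈ y → y ≈ z → x ≈ z
      _⟫_ = R.trans
    total (suc (suc Y)) (s≤s l) = R.trans (R.+-cong (total (suc Y) (ℕₚ.m≤n⇒m≤1+n l)) (R.trans (column (suc Y) l) (R.*-congʳ (τ-+ 1 (suc Y)))))
      (solve 5 (λ t p q y r → t :* (p :* q) :+ (t :* y) :* (r :* q) := t :* ((p :+ y :* r) :* q)) R.refl (τ 1) (rows (suc (suc b)) Y) (rows b (suc X)) (τ (suc Y)) (rows (suc b) (suc Y)))

  τ0 : τ 0 ≈ 1#
  τ0 = R.reflexive (sym T.1≡mono)

  rows-0 : ∀ a → rows a 0 ≈ 1#
  rows-0 zero = R.refl
  rows-0 (suc a) = R.trans (R.*-cong τ0 (rows-0 a)) (R.*-identityˡ _)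

  -- Removing the first column, or a zero part.
  rows-columns : ∀ a X → rows (suc a) (suc X) ≈ rows a (suc X) + τ (suc a) * rows (suc a) X
  rows-columns zero zero = R.trans (R.+-congʳ (R.*-congʳ τ0)) (R.trans (solve 1 (λ t → :1 :* :1 :+ t :* :1 := :1 :+ t :* (:1 :* :1)) R.refl (τ 1)) (R.+-congˡ (R.*-congˡ (R.*-congʳ (R.sym τ0)))))
  rows-columns (suc a) zero = begin
    rows (2 ℕ.+ a) 0 + τ 1 * rows (suc a) 1 ≈⟨ R.+-cong (rows-0 (2 ℕ.+ a)) (R.*-congˡ (rows-columns a 0)) ⟩
    1# + τ 1 * (rows a 1 + τ (suc a) * rows (suc a) 0) ≈⟨ R.+-congˡ (R.*-congˡ (R.+-congˡ (R.*-congˡ (rows-0 (suc a))))) ⟩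
    1# + τ 1 * (rows a 1 + τ (suc a) * 1#) ≈⟨ solve 3 (λ t r s → :1 :+ t :* (r :+ s :* :1) := (:1 :+ t :* r) :+ (t :* s) :* :1) R.refl (τ 1) (rows a 1) (τ (suc a)) ⟩
    (1# + τ 1 * rows a 1) + (τ 1 * τ (suc a)) * 1# ≈⟨ R.+-cong (R.+-congʳ (R.sym (rows-0 (suc a)))) (R.*-cong (R.sym (τ-+ 1 (suc a))) (R.sym (rows-0 (2 ℕ.+ a)))) ⟩
    rows (suc a) 1 + τ (2 ℕ.+ a) * rows (2 ℕ.+ a) 0 ∎
  rows-columns zero (suc X) = begin
    rows 1 (suc X) + τ (2 ℕ.+ X) * 1# ≈⟨ R.+-cong (rows-columns 0 X) (R.*-congʳ (τ-+ 1 (suc X))) ⟩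
    (1# + τ 1 * rows 1 X) + (τ 1 * τ (suc X)) * 1# ≈⟨ solve 3 (λ t r s → (:1 :+ t :* r) :+ (t :* s) :* :1 := :1 :+ t :* (r :+ s :* :1)) R.refl (τ 1) (rows 1 X) (τ (suc X)) ⟩
    1# + τ 1 * rows 1 (suc X) ∎
  rows-columns (suc a) (suc X) = begin
    rows (2 ℕ.+ a) (suc X) + τ (2 ℕ.+ X) * rows (suc a) (2 ℕ.+ X)
      ≈⟨ R.+-cong (rows-columns (suc a) X) (R.*-congˡ (rows-columns a (suc X))) ⟩
    (rows (suc a) (suc X) + τ (2 ℕ.+ a) * rows (2 ℕ.+ a) X) + τ (2 ℕ.+ X) * (rows a (2 ℕ.+ X) + τ (suc a) * rows (suc a) (suc X))
      ≈⟨ solve 7 (λ p t q s r u o → (p :+ t :* q) :+ s :* (r :+ u :* p) := (p :+ s :* r) :+ (t :* q :+ (s :* u) :* p)) R.refl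
           (rows (suc a) (suc X)) (τ (2 ℕ.+ a)) (rows (2 ℕ.+ a) X) (τ (2 ℕ.+ X)) (rows a (2 ℕ.+ X)) (τ (suc a)) 1# ⟩
    rows (suc a) (2 ℕ.+ X) + (τ (2 ℕ.+ a) * rows (2 ℕ.+ a) X + (τ (2 ℕ.+ X) * τ (suc a)) * rows (suc a) (suc X))
      ≈⟨ R.+-congˡ (R.+-congˡ (R.*-congʳ (R.trans (R.sym (τ-+ (2 ℕ.+ X) (suc a))) (R.trans (R.reflexive (cong τ (sum-eq X a))) (τ-+ (2 ℕ.+ a) (suc X)))))) ⟩
    rows (suc a) (2 ℕ.+ X) + (τ (2 ℕ.+ a) * rows (2 ℕ.+ a) X + (τ (2 ℕ.+ a) * τ (suc X)) * rows (suc a) (suc X))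
      ≈⟨ solve 5 (λ p t q s r → p :+ (t :* q :+ (t :* s) :* r) := p :+ t :* (q :+ s :* r)) R.refl (rows (suc a) (2 ℕ.+ X)) (τ (2 ℕ.+ a)) (rows (2 ℕ.+ a) X) (τ (suc X)) (rows (suc a) (suc X)) ⟩
    rows (suc a) (2 ℕ.+ X) + τ (2 ℕ.+ a) * rows (2 ℕ.+ a) (suc X) ∎
    where
    sum-eq : ∀ X a → (2 ℕ.+ X) ℕ.+ suc a ≡ (2 ℕ.+ a) ℕ.+ suc X
    sum-eq = ℕSolver.solve-∀

  τ-big : τ (suc k) ≈ 0#
  τ-big = high-degree (supp-mono ℕₚ.≤-refl)

  rows-stable : ∀ a → rows a (suc k) ≈ rows a k
  rows-stable zero = R.refl
  rows-stable (suc a) = R.trans (R.+-congˡ (R.trans (R.*-congʳ τ-big) (R.zeroˡ _))) (R.+-identityʳ _)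

  rows-quotient : ∀ a → (1# - τ (suc a)) * rows (suc a) k ≈ rows a k
  rows-quotient a = begin
    (1# - τ (suc a)) * rows (suc a) k ≈⟨ solve 2 (λ t r → (:1 :- t) :* r := r :- t :* r) R.refl (τ (suc a)) (rows (suc a) k) ⟩
    rows (suc a) k - τ (suc a) * rows (suc a) k ≈⟨ R.+-congʳ (R.trans (R.sym (rows-stable (suc a))) (R.trans (rows-columns a k) (R.+-congʳ (rows-stable a)))) ⟩
    (rows a k + τ (suc a) * rows (suc a) k) - τ (suc a) * rows (suc a) k ≈⟨ solve 2 (λ r s → (r :+ s) :- s := r) R.refl (rows a k) _ ⟩
    rows a k ∎

  gs : ℕ → Carrier
  gs n = fac (geo n)

  gs-inverse : ∀ n → (1# - τ (suc n)) * gs (suc n) ≈ 1#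
  gs-inverse n = geo-inverse (suc n) (s≤s z≤n)

  range : ℕ → ℕ → Carrier
  range zero m = 1#
  range (suc a) m = gs (suc m) * range a (suc m)

  range-last : ∀ a m → range (suc a) m ≈ gs (suc (a ℕ.+ m)) * range a m
  range-last zero m = R.refl
  range-last (suc a) m = R.trans (R.*-congˡ (R.trans (range-last a (suc m)) (R.*-congʳ (R.reflexive (cong (λ n → gs (suc n)) (ℕₚ.+-suc a m))))))
    (solve 3 (λ p q r → p :* (q :* r) := q :* (p :* r)) R.refl (gs (suc m)) (gs (suc (suc (a ℕ.+ m)))) (range a (suc m)))

  rows-range : ∀ a → rows a k ≈ range a 0
  rows-range zero = R.refl
  rows-range (suc a) = begin
    rows (suc a) k ≈⟨ R.sym (R.trans (R.*-congʳ (gs-inverse a)) (R.*-identityˡ _)) ⟩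
    ((1# - τ (suc a)) * gs (suc a)) * rows (suc a) k ≈⟨ solve 3 (λ p q r → (p :* q) :* r := q :* (p :* r)) R.refl (1# - τ (suc a)) (gs (suc a)) (rows (suc a) k) ⟩
    gs (suc a) * ((1# - τ (suc a)) * rows (suc a) k) ≈⟨ R.*-congˡ (R.trans (rows-quotient a) (rows-range a)) ⟩
    gs (suc a) * range a 0 ≈⟨ R.trans (R.*-congʳ (R.reflexive (cong (λ n → gs (suc n)) (sym (ℕₚ.+-identityʳ a))))) (R.sym (range-last a 0)) ⟩
    range (suc a) 0 ∎

  denominators-range : ∀ a m js → ev (map geo (denominators a m js)) ≈ range a 0 * (range a m * ev (map geo js))
  denominators-range zero m js = solve 1 (λ e → e := :1 :* (:1 :* e)) R.refl _
  denominators-range (suc a) m js = begin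
    ev (map geo (denominators a (suc m) (suc m ∷ suc a ∷ js))) ≈⟨ denominators-range a (suc m) _ ⟩
    range a 0 * (range a (suc m) * (gs (suc m) * (gs (suc a) * ev (map geo js))))
      ≈⟨ solve 5 (λ p q r s e → p :* (q :* (r :* (s :* e))) := (s :* p) :* ((r :* q) :* e)) R.refl (range a 0) (range a (suc m)) (gs (suc m)) (gs (suc a)) _ ⟩
    (gs (suc a) * range a 0) * (range (suc a) m * ev (map geo js))
      ≈⟨ R.*-congʳ (R.trans (R.*-congʳ (R.reflexive (cong (λ n → gs (suc n)) (sym (ℕₚ.+-identityʳ a))))) (R.sym (range-last a 0))) ⟩
    range (suc a) 0 * (range (suc a) m * ev (map geo js)) ∎

  -- `violations` lowers the bound of its first factor to `k - 1`. The summand lost with the part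
  -- `k` is divisible by `t^k`, and the prefactor `τ 1` moves it beyond the truncation.
  violations-stable : 1 ℕ.≤ k → ∀ b → violations (suc b) k k ≈ τ 1 * (rows (suc (suc b)) k * rows b k)
  violations-stable 1≤k b = go k refl 1≤k
    where
    go : ∀ l → l ≡ k → 1 ℕ.≤ l → violations (suc b) k l ≈ τ 1 * (rows (suc (suc b)) k * rows b k)
    go (suc l) e _ = begin
      τ 1 * (rows (suc (suc b)) l * rows b (suc k)) ≈⟨ R.*-congˡ (R.*-congˡ (rows-stable b)) ⟩
      τ 1 * (rows (suc (suc b)) l * rows b k) ≈⟨ R.sym (R.trans (R.+-congˡ (R.trans (R.*-congʳ (R.trans (R.sym (τ-+ 1 (suc l))) (R.trans (R.reflexive (cong (λ n → τ (suc n)) e)) τ-big))) (R.zeroˡ _))) (R.+-identityʳ _)) ⟩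
      τ 1 * (rows (suc (suc b)) l * rows b k) + (τ 1 * τ (suc l)) * (rows (suc b) (suc l) * rows b k)
        ≈⟨ solve 5 (λ t p q s r → t :* (p :* q) :+ (t :* s) :* (r :* q) := t :* ((p :+ s :* r) :* q)) R.refl (τ 1) (rows (suc (suc b)) l) (rows b k) (τ (suc l)) (rows (suc b) (suc l)) ⟩
      τ 1 * (rows (suc (suc b)) (suc l) * rows b k) ≈⟨ R.*-congˡ (R.*-congʳ (R.reflexive (cong (rows (suc (suc b))) e))) ⟩
      τ 1 * (rows (suc (suc b)) k * rows b k) ∎

  -- With `r = rows (suc b) k` the count of violations gives
  -- `r² - t r² (1 - t^(b+1)) / (1 - t^(b+2))`, which is `r² (1 - t) / (1 - t^(b+2))`. The last
  -- quotient turns the denominators of one factor `r` from `1, …, b + 1` into `2, …, b + 2`.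
  planes-product : 1 ℕ.≤ k → ∀ b → planes (suc b) k k ≈ ev (map geo (denominators (suc b) 1 []))
  planes-product 1≤k b = begin
    g ≈⟨ R.sym (R.trans (R.*-congʳ (gs-inverse (suc b))) (R.*-identityˡ g)) ⟩
    ((1# - t₂) * gs (2 ℕ.+ b)) * g ≈⟨ R.*-congˡ g≈ ⟩
    ((1# - t₂) * gs (2 ℕ.+ b)) * (r₁ * r₁ - τ 1 * (r₂ * r₀))
      ≈⟨ solve 6 (λ t G r₁ τ r₂ r₀ → ((:1 :- t) :* G) :* (r₁ :* r₁ :- τ :* (r₂ :* r₀)) := G :* ((:1 :- t) :* (r₁ :* r₁) :- τ :* (((:1 :- t) :* r₂) :* r₀))) R.refl t₂ (gs (2 ℕ.+ b)) r₁ (τ 1) r₂ r₀ ⟩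
    gs (2 ℕ.+ b) * ((1# - t₂) * (r₁ * r₁) - τ 1 * (((1# - t₂) * r₂) * r₀))
      ≈⟨ R.*-congˡ (R.+-cong (R.*-congʳ (R.+-congˡ (R.-‿cong (τ-+ 1 (suc b))))) (R.-‿cong (R.*-congˡ (R.*-cong (rows-quotient (suc b)) (R.sym (rows-quotient b)))))) ⟩
    gs (2 ℕ.+ b) * ((1# - τ 1 * t₁) * (r₁ * r₁) - τ 1 * (r₁ * ((1# - t₁) * r₁)))
      ≈⟨ solve 4 (λ G τ t r → G :* ((:1 :- τ :* t) :* (r :* r) :- τ :* (r :* ((:1 :- t) :* r))) := (:1 :- τ) :* (G :* r) :* r) R.refl (gs (2 ℕ.+ b)) (τ 1) t₁ r₁ ⟩
    (1# - τ 1) * (gs (2 ℕ.+ b) * r₁) * r₁ ≈⟨ R.*-cong (R.*-congˡ (R.trans (R.*-cong (R.reflexive (cong (λ n → gs (suc n)) (sym (ℕₚ.+-identityʳ (suc b))))) (rows-range (suc b))) (R.sym (range-last (suc b) 0)))) (rows-range (suc b)) ⟩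
    (1# - τ 1) * (gs 1 * range (suc b) 1) * range (suc b) 0
      ≈⟨ solve 4 (λ t G p q → (:1 :- t) :* (G :* p) :* q := ((:1 :- t) :* G) :* (q :* (p :* :1))) R.refl (τ 1) (gs 1) (range (suc b) 1) (range (suc b) 0) ⟩
    ((1# - τ 1) * gs 1) * (range (suc b) 0 * (range (suc b) 1 * 1#)) ≈⟨ R.trans (R.*-congʳ (gs-inverse 0)) (R.*-identityˡ _) ⟩
    range (suc b) 0 * (range (suc b) 1 * 1#) ≈⟨ R.sym (denominators-range (suc b) 1 []) ⟩
    ev (map geo (denominators (suc b) 1 [])) ∎
    where
    g = planes (suc b) k k
    r₀ = rows b k
    r₁ = rows (suc b) k
    r₂ = rows (2 ℕ.+ b) k
    t₁ = τ (suc b)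
    t₂ = τ (2 ℕ.+ b)
    g≈ : g ≈ r₁ * r₁ - τ 1 * (r₂ * r₀)
    g≈ = R.trans (solve 2 (λ g v → g := (g :+ v) :- v) R.refl g (violations (suc b) k k))
      (R.+-cong (R.sym (planes-violations (suc b) k k (ℕₚ.n≤1+n k))) (R.-‿cong (violations-stable 1≤k b)))

-- Counting the arrays through their generating function.

b2ℤ : Bool → ℤ
b2ℤ b = if b then + 1 else + 0

b2ℤ-∧ : ∀ p q → b2ℤ (p ∧ q) ≡ b2ℤ p ℤ.* b2ℤ q
b2ℤ-∧ true q = sym (ℤₚ.*-identityˡ _)
b2ℤ-∧ false q = sym (ℤₚ.*-zeroˡ (b2ℤ q))

b2ℤ-≡ᵇ : ∀ m n → b2ℤ (m ℕ.≡ᵇ n) ≡ δℕ n m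
b2ℤ-≡ᵇ zero zero = refl
b2ℤ-≡ᵇ zero (suc n) = refl
b2ℤ-≡ᵇ (suc m) zero = refl
b2ℤ-≡ᵇ (suc m) (suc n) = b2ℤ-≡ᵇ m n

∑-cong-All : ∀ {A : Set} {xs : List A} {g h : A → ℤ} → All (λ x → g x ≡ h x) xs → ∑ xs g ≡ ∑ xs h
∑-cong-All [] = refl
∑-cong-All (p ∷ ps) = cong₂ ℤ._+_ p (∑-cong-All ps)

length-filterᵇ : ∀ {A : Set} (p : A → Bool) xs → + length (List.filterᵇ p xs) ≡ ∑ xs (b2ℤ ∘ p)
length-filterᵇ p [] = refl
length-filterᵇ p (x ∷ xs) with p x
... | true = cong (λ z → + 1 ℤ.+ z) (length-filterᵇ p xs)
... | false = trans (length-filterᵇ p xs) (sym (ℤₚ.+-identityˡ _))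

∑-cartesianProduct : ∀ {A B : Set} (xs : List A) (ys : List B) {g : A × B → ℤ} →
  ∑ (List.cartesianProduct xs ys) g ≡ ∑ xs (λ x → ∑ ys (λ y → g (x , y)))
∑-cartesianProduct [] ys = refl
∑-cartesianProduct (x ∷ xs) ys = trans (∑-++ (map (x ,_) ys) _) (cong₂ ℤ._+_ (∑-map (x ,_) ys) (∑-cartesianProduct xs ys))

∑↑ : ℕ → (ℕ → ℤ) → ℤ
∑↑ zero h = h 0
∑↑ (suc X) h = ∑↑ X h ℤ.+ h (suc X)

∑↑-cong : ∀ X {g h} → (∀ x → x ℕ.≤ X → g x ≡ h x) → ∑↑ X g ≡ ∑↑ X h
∑↑-cong zero e = e 0 z≤n
∑↑-cong (suc X) e = cong₂ ℤ._+_ (∑↑-cong X (λ x l → e x (ℕₚ.m≤n⇒m≤1+n l))) (e (suc X) ℕₚ.≤-refl)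

∑-upTo : ∀ k h → ∑ (upTo (suc k)) h ≡ ∑↑ k h
∑-upTo k h = trans (cong (λ l → ∑ l h) (sym (Listₚ.upTo-∷ʳ k))) (go k)
  where
  go : ∀ k → ∑ (upTo k List.∷ʳ k) h ≡ ∑↑ k h
  go zero = ℤₚ.+-identityʳ (h 0)
  go (suc k) = trans (∑-++ (upTo (suc k)) (suc k ∷ []) {h}) (cong₂ ℤ._+_ (∑-upTo k h) (ℤₚ.+-identityʳ (h (suc k))))

∑-upTo-≤ : ∀ k X h → X ℕ.≤ k → ∑ (upTo (suc k)) (λ x → b2ℤ (x ℕ.≤ᵇ X) ℤ.* h x) ≡ ∑↑ X h
∑-upTo-≤ k X h X≤k = trans (∑-upTo k _) (go k (ℕₚ.≤⇒≤′ X≤k))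
  where
  open import Data.Nat.Base using (_≤′_; ≤′-refl; ≤′-step)
  go : ∀ k → X ≤′ k → ∑↑ k (λ x → b2ℤ (x ℕ.≤ᵇ X) ℤ.* h x) ≡ ∑↑ X h
  go k ≤′-refl = ∑↑-cong X (λ x l → trans (cong (λ b → b2ℤ b ℤ.* h x) (≤ᵇ-true l)) (ℤₚ.*-identityˡ (h x)))
  go (suc k) (≤′-step l) = trans (cong₂ ℤ._+_ (go k l) (cong (λ b → b2ℤ b ℤ.* h (suc k)) (≤ᵇ-false (s≤s (ℕₚ.≤′⇒≤ l))))) (ℤₚ.+-identityʳ _)

decrFrom : ∀ {a} → ℕ → Vec ℕ a → Bool
decrFrom X [] = true
decrFrom X (x ∷ r) = (x ℕ.≤ᵇ X) ∧ decrFrom x r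

weaklyDecr-∷ : ∀ {a} x (r : Vec ℕ a) → weaklyDecr (x ∷ Vec.toList r) ≡ decrFrom x r
weaklyDecr-∷ x [] = refl
weaklyDecr-∷ x (y ∷ r) = cong ((y ℕ.≤ᵇ x) ∧_) (weaklyDecr-∷ y r)

∑-vecs : ∀ a k (φ : Vec ℕ (suc a) → ℤ) → ∑ (vecsUpTo (suc a) k) φ ≡ ∑ (upTo (suc k)) (λ x → ∑ (vecsUpTo a k) (λ r → φ (x ∷ r)))
∑-vecs a k φ = trans (∑-concatMap (λ x → map (x Vec.∷_) (vecsUpTo a k)) (upTo (suc k))) (∑-cong (upTo (suc k)) (λ x → ∑-map (x Vec.∷_) (vecsUpTo a k)))

weaklyDecr-vecs : ∀ a k → All (λ r → weaklyDecr (Vec.toList r) ≡ decrFrom k r) (vecsUpTo a k)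
weaklyDecr-vecs zero k = refl ∷ []
weaklyDecr-vecs (suc a) k = Allₚ.concat⁺ (Allₚ.map⁺ (Allₚ.applyUpTo⁺₁ (λ x → x) (suc k) (λ { {x} (s≤s l) →
  Allₚ.map⁺ (All.universal (λ r → trans (weaklyDecr-∷ x r) (sym (cong (_∧ decrFrom x r) (≤ᵇ-true l)))) (vecsUpTo a k)) })))

module Count (k D : ℕ) (k≤D : k ℕ.≤ D) where
  open TwoRows k D k≤D
  open T using (⟨_,_⟩)

  ⟨S⟩ : ∀ X h f → ⟨ S X h , f ⟩ ≡ ∑↑ X (λ x → ⟨ h x , f ⟩)
  ⟨S⟩ zero h f = refl
  ⟨S⟩ (suc X) h f = trans (T.⟨⟩-+ (S X h) _ f) (cong (ℤ._+ ⟨ h (suc X) , f ⟩) (⟨S⟩ X h f))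

  ⟨if⟩ : ∀ b P f → ⟨ (if b then P else R.0#) , f ⟩ ≡ b2ℤ b ℤ.* ⟨ P , f ⟩
  ⟨if⟩ true P f = sym (ℤₚ.*-identityˡ _)
  ⟨if⟩ false P f = T.⟨⟩-0 f

  dominated : ∀ {a} → ℕ → ℕ → Vec ℕ a → Vec ℕ a → Bool
  dominated X Y r s = decrFrom X r ∧ decrFrom Y s ∧ colsDecr r s

  -- Quantified over all `h` because stripping the first column translates the functional by
  -- `x + y`.
  count : ∀ a X Y → X ℕ.≤ k → Y ℕ.≤ k → ∀ (h : ℕ → ℤ) →
    ∑ (vecsUpTo a k) (λ r → ∑ (vecsUpTo a k) (λ s → b2ℤ (dominated X Y r s) ℤ.* h (Vec.sum r ℕ.+ Vec.sum s))) ≡ ⟨ planes a X Y , h ⟩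
  count zero X Y X≤ Y≤ h = trans (ℤₚ.+-identityʳ _) (trans (ℤₚ.+-identityʳ _) (trans (ℤₚ.*-identityˡ _)
    (sym (trans (cong (λ o → ⟨ o , h ⟩) T.1≡mono) (T.⟨⟩-mono 0 h)))))
  count (suc a) X Y X≤ Y≤ h = begin
    ∑ (vecsUpTo (suc a) k) (λ r → ∑ (vecsUpTo (suc a) k) (λ s → b2ℤ (dominated X Y r s) ℤ.* h (Vec.sum r ℕ.+ Vec.sum s)))
      ≡⟨ trans (∑-vecs a k _) (∑-cong U (λ x → trans (∑-cong Vs (λ r → ∑-vecs a k _)) (∑-swap Vs U))) ⟩
    ∑ U (λ x → ∑ U (λ y → ∑ Vs (λ r → ∑ Vs (λ s → b2ℤ (dominated X Y (x ∷ r) (y ∷ s)) ℤ.* h ((x ℕ.+ Vec.sum r) ℕ.+ (y ℕ.+ Vec.sum s))))))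
      ≡⟨ ∑-cong U (λ x → ∑-cong U (λ y → trans (∑-cong Vs (λ r → trans (∑-cong Vs (λ s → factor x y r s)) (sym (∑-*ˡ (c x y) Vs)))) (sym (∑-*ˡ (c x y) Vs)))) ⟩
    ∑ U (λ x → ∑ U (λ y → c x y ℤ.* G x y)) ≡⟨ ∑-swap U U {λ x y → c x y ℤ.* G x y} ⟩
    ∑ U (λ y → ∑ U (λ x → c x y ℤ.* G x y))
      ≡⟨ ∑-cong U (λ y → trans (∑-cong U (λ x → lemma (b2ℤ (x ℕ.≤ᵇ X)) (b2ℤ (y ℕ.≤ᵇ Y)) (b2ℤ (y ℕ.≤ᵇ x)) (G x y)))
           (sym (∑-*ˡ (b2ℤ (y ℕ.≤ᵇ Y)) U))) ⟩
    ∑ U (λ y → b2ℤ (y ℕ.≤ᵇ Y) ℤ.* ∑ U (λ x → b2ℤ (x ℕ.≤ᵇ X) ℤ.* (b2ℤ (y ℕ.≤ᵇ x) ℤ.* G x y))) ≡⟨ ∑-upTo-≤ k Y _ Y≤ ⟩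
    ∑↑ Y (λ y → ∑ U (λ x → b2ℤ (x ℕ.≤ᵇ X) ℤ.* (b2ℤ (y ℕ.≤ᵇ x) ℤ.* G x y)))
      ≡⟨ ∑↑-cong Y (λ y y≤ → trans (∑-upTo-≤ k X _ X≤) (∑↑-cong X (λ x x≤ → cong (b2ℤ (y ℕ.≤ᵇ x) ℤ.*_)
           (trans (count a x y (ℕₚ.≤-trans x≤ X≤) (ℕₚ.≤-trans y≤ Y≤) _) (sym (MR.⟨mono*⟩ (x ℕ.+ y) (planes a x y) h)))))) ⟩
    ∑↑ Y (λ y → ∑↑ X (λ x → b2ℤ (y ℕ.≤ᵇ x) ℤ.* ⟨ τ (x ℕ.+ y) R.* planes a x y , h ⟩))
      ≡⟨ sym (trans (⟨S⟩ Y _ h) (∑↑-cong Y (λ y _ → trans (⟨S⟩ X _ h) (∑↑-cong X (λ x _ → ⟨if⟩ (y ℕ.≤ᵇ x) _ h))))) ⟩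
    ⟨ planes (suc a) X Y , h ⟩ ∎
    where
    open ≡-Reasoning
    U = upTo (suc k)
    Vs = vecsUpTo a k
    c G : ℕ → ℕ → ℤ
    c x y = b2ℤ (x ℕ.≤ᵇ X) ℤ.* (b2ℤ (y ℕ.≤ᵇ Y) ℤ.* b2ℤ (y ℕ.≤ᵇ x))
    G x y = ∑ Vs (λ r → ∑ Vs (λ s → b2ℤ (dominated x y r s) ℤ.* h ((x ℕ.+ y) ℕ.+ (Vec.sum r ℕ.+ Vec.sum s))))
    lemma : ∀ p q r g → (p ℤ.* (q ℤ.* r)) ℤ.* g ≡ q ℤ.* (p ℤ.* (r ℤ.* g))
    lemma = ℤSolver.solve-∀
    sums : ∀ x r y s → (x ℕ.+ r) ℕ.+ (y ℕ.+ s) ≡ (x ℕ.+ y) ℕ.+ (r ℕ.+ s)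
    sums = ℕSolver.solve-∀
    regroup : ∀ p q r u v w h → (p ℤ.* u) ℤ.* ((q ℤ.* v) ℤ.* (r ℤ.* w)) ℤ.* h ≡ (p ℤ.* (q ℤ.* r)) ℤ.* ((u ℤ.* (v ℤ.* w)) ℤ.* h)
    regroup = ℤSolver.solve-∀
    b3 : ∀ p q r → b2ℤ (p ∧ q ∧ r) ≡ b2ℤ p ℤ.* (b2ℤ q ℤ.* b2ℤ r)
    b3 p q r = trans (b2ℤ-∧ p _) (cong (b2ℤ p ℤ.*_) (b2ℤ-∧ q r))
    factor : ∀ x y r s → b2ℤ (dominated X Y (x ∷ r) (y ∷ s)) ℤ.* h ((x ℕ.+ Vec.sum r) ℕ.+ (y ℕ.+ Vec.sum s)) ≡
      c x y ℤ.* (b2ℤ (dominated x y r s) ℤ.* h ((x ℕ.+ y) ℕ.+ (Vec.sum r ℕ.+ Vec.sum s)))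
    factor x y r s = begin
      b2ℤ (((x ℕ.≤ᵇ X) ∧ decrFrom x r) ∧ ((y ℕ.≤ᵇ Y) ∧ decrFrom y s) ∧ ((y ℕ.≤ᵇ x) ∧ colsDecr r s)) ℤ.* h ((x ℕ.+ Vec.sum r) ℕ.+ (y ℕ.+ Vec.sum s))
        ≡⟨ cong₂ ℤ._*_ (trans (b3 ((x ℕ.≤ᵇ X) ∧ decrFrom x r) ((y ℕ.≤ᵇ Y) ∧ decrFrom y s) ((y ℕ.≤ᵇ x) ∧ colsDecr r s)) (cong₂ ℤ._*_ (b2ℤ-∧ (x ℕ.≤ᵇ X) _) (cong₂ ℤ._*_ (b2ℤ-∧ (y ℕ.≤ᵇ Y) _) (b2ℤ-∧ (y ℕ.≤ᵇ x) _)))) (cong h (sums x (Vec.sum r) y (Vec.sum s))) ⟩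
      _ ≡⟨ regroup (b2ℤ (x ℕ.≤ᵇ X)) (b2ℤ (y ℕ.≤ᵇ Y)) (b2ℤ (y ℕ.≤ᵇ x)) (b2ℤ (decrFrom x r)) (b2ℤ (decrFrom y s)) (b2ℤ (colsDecr r s)) _ ⟩
      _ ≡⟨ cong (λ z → c x y ℤ.* (z ℤ.* h ((x ℕ.+ y) ℕ.+ (Vec.sum r ℕ.+ Vec.sum s)))) (sym (b3 (decrFrom x r) (decrFrom y s) (colsDecr r s))) ⟩
      c x y ℤ.* (b2ℤ (dominated x y r s) ℤ.* h ((x ℕ.+ y) ℕ.+ (Vec.sum r ℕ.+ Vec.sum s))) ∎

  planePartitions-count : ∀ a → + planePartitions2 k a ≡ ⟨ planes a k k , δℕ k ⟩
  planePartitions-count a = begin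
    + planePartitions2 k a ≡⟨ trans (length-filterᵇ _ (List.cartesianProduct Vs Vs)) (∑-cartesianProduct Vs Vs) ⟩
    ∑ Vs (λ r → ∑ Vs (λ s → b2ℤ (isPlanePartitionOf k r s)))
      ≡⟨ ∑-cong-All (All.map (λ {r} wr → ∑-cong-All (All.map (λ {s} ws → same r s wr ws) (weaklyDecr-vecs a k))) (weaklyDecr-vecs a k)) ⟩
    ∑ Vs (λ r → ∑ Vs (λ s → b2ℤ (dominated k k r s) ℤ.* δℕ k (Vec.sum r ℕ.+ Vec.sum s))) ≡⟨ count a k k ℕₚ.≤-refl ℕₚ.≤-refl (δℕ k) ⟩
    ⟨ planes a k k , δℕ k ⟩ ∎
    where
    open ≡-Reasoning
    Vs = vecsUpTo a k
    ∧-assoc : ∀ p q r u → p ∧ q ∧ r ∧ u ≡ (p ∧ q ∧ r) ∧ u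
    ∧-assoc true true r u = refl
    ∧-assoc true false r u = refl
    ∧-assoc false q r u = refl
    same : ∀ (r s : Vec ℕ a) → weaklyDecr (Vec.toList r) ≡ decrFrom k r → weaklyDecr (Vec.toList s) ≡ decrFrom k s →
      b2ℤ (isPlanePartitionOf k r s) ≡ b2ℤ (dominated k k r s) ℤ.* δℕ k (Vec.sum r ℕ.+ Vec.sum s)
    same r s wr ws = trans (cong₂ (λ p q → b2ℤ (p ∧ q ∧ colsDecr r s ∧ (Vec.sum r ℕ.+ Vec.sum s ℕ.≡ᵇ k))) wr ws)
      (trans (cong b2ℤ (∧-assoc (decrFrom k r) (decrFrom k s) (colsDecr r s) _))
      (trans (b2ℤ-∧ (dominated k k r s) _) (cong (b2ℤ (dominated k k r s) ℤ.*_) (b2ℤ-≡ᵇ _ k))))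

planePartitions-product : ∀ k D → 1 ℕ.≤ k → k ℕ.≤ D → ∀ b →
  + planePartitions2 k (suc b) ≡ Terms.⟨_,_⟩ ℕM (Eval.ev ℕM D (map geo (denominators (suc b) 1 []))) (δℕ k)
planePartitions-product k D 1≤k k≤D b = trans (Count.planePartitions-count k D k≤D (suc b))
  (TR.MR.⟨ TR.planes-product 1≤k b ⟩≈ (λ e l → δℕ-< l))
  where module TR = TwoRows k D k≤D

-- Newton's identities and the average of the power sums over the classes of a symmetric group.

-- Sum of φ r s over r + s = n with 1 ≤ r.
conv : ℕ → (ℕ → ℕ → ℤ) → ℤ
conv zero φ = + 0
conv (suc n) φ = φ 1 n ℤ.+ conv n (λ r s → φ (suc r) s)

conv-cong : ∀ n {φ ψ : ℕ → ℕ → ℤ} → (∀ r s → 1 ℕ.≤ r → r ℕ.+ s ≡ n → φ r s ≡ ψ r s) → conv n φ ≡ conv n ψ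
conv-cong zero e = refl
conv-cong (suc n) e = cong₂ ℤ._+_ (e 1 n ℕₚ.≤-refl refl) (conv-cong n (λ r s _ p → e (suc r) s (s≤s z≤n) (cong suc p)))

conv-+ : ∀ n {φ ψ : ℕ → ℕ → ℤ} → conv n (λ r s → φ r s ℤ.+ ψ r s) ≡ conv n φ ℤ.+ conv n ψ
conv-+ zero = refl
conv-+ (suc n) {φ} {ψ} = trans (cong (λ z → (φ 1 n ℤ.+ ψ 1 n) ℤ.+ z) (conv-+ n {λ r s → φ (suc r) s} {λ r s → ψ (suc r) s})) (lemma (φ 1 n) (ψ 1 n) _ _)
  where
  lemma : ∀ a b c d → (a ℤ.+ b) ℤ.+ (c ℤ.+ d) ≡ (a ℤ.+ c) ℤ.+ (b ℤ.+ d)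
  lemma = ℤSolver.solve-∀

conv-*ˡ : ∀ n c {φ : ℕ → ℕ → ℤ} → c ℤ.* conv n φ ≡ conv n (λ r s → c ℤ.* φ r s)
conv-*ˡ zero c = ℤₚ.*-zeroʳ c
conv-*ˡ (suc n) c {φ} = trans (ℤₚ.*-distribˡ-+ c (φ 1 n) _) (cong (λ z → c ℤ.* φ 1 n ℤ.+ z) (conv-*ˡ n c {λ r s → φ (suc r) s}))

conv-0 : ∀ n → conv n (λ _ _ → + 0) ≡ + 0
conv-0 zero = refl
conv-0 (suc n) = trans (ℤₚ.+-identityˡ _) (conv-0 n)

conv-∑ : ∀ {A : Set} n (xs : List A) {φ : ℕ → ℕ → A → ℤ} → ∑ xs (λ x → conv n (λ r s → φ r s x)) ≡ conv n (λ r s → ∑ xs (φ r s))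
conv-∑ n [] = sym (conv-0 n)
conv-∑ n (x ∷ xs) {φ} = trans (cong (λ z → conv n (λ r s → φ r s x) ℤ.+ z) (conv-∑ n xs {φ})) (sym (conv-+ n))

conv-split : ∀ n {φ ψ χ : ℕ → ℕ → ℤ} → (∀ r → φ r 0 ≡ ψ r 0) → (∀ r s → φ r (suc s) ≡ ψ r (suc s) ℤ.+ χ r s) →
  conv (suc n) φ ≡ conv (suc n) ψ ℤ.+ conv n χ
conv-split zero {φ} {ψ} z s = trans (cong (ℤ._+ + 0) (z 1)) (sym (ℤₚ.+-identityʳ _))
conv-split (suc n) {φ} {ψ} {χ} z s = trans (cong₂ ℤ._+_ (s 1 n) (conv-split n {λ r → φ (suc r)} {λ r → ψ (suc r)} {λ r → χ (suc r)} (z ∘ suc) (s ∘ suc)))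
  (lemma (ψ 1 (suc n)) (χ 1 n) (conv (suc n) (λ r s → ψ (suc r) s)) _)
  where
  lemma : ∀ a b c d → (a ℤ.+ b) ℤ.+ (c ℤ.+ d) ≡ (a ℤ.+ c) ℤ.+ (b ℤ.+ d)
  lemma = ℤSolver.solve-∀

conv-last : ∀ n (g : ℕ → ℤ) → conv (suc n) (λ r _ → g r) ≡ conv n (λ r _ → g r) ℤ.+ g (suc n)
conv-last zero g = ℤₚ.+-comm (g 1) (+ 0)
conv-last (suc n) g = trans (cong (λ z → g 1 ℤ.+ z) (conv-last n (g ∘ suc))) (sym (ℤₚ.+-assoc (g 1) _ _))

-- Power sums p_ρ and complete homogeneous sums h_n of a list of monomials, paired with f.
module PowerSums (M : CMon) where
  open CMon M

  pw : List E → List ℕ → (E → ℤ) → ℤ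
  pw ms [] f = f ε
  pw ms (r ∷ ρ) f = ∑ ms (λ m → pw ms ρ (λ e → f (pow r m ∙ e)))

  hw : List E → ℕ → (E → ℤ) → ℤ
  hw ms zero f = f ε
  hw [] (suc n) f = + 0
  hw (m ∷ ms) (suc n) f = hw ms (suc n) f ℤ.+ hw (m ∷ ms) n (λ e → f (m ∙ e))

  pw-cong : ∀ ms ρ {f g} → (∀ e → f e ≡ g e) → pw ms ρ f ≡ pw ms ρ g
  pw-cong ms [] e = e ε
  pw-cong ms (r ∷ ρ) e = ∑-cong ms (λ m → pw-cong ms ρ (λ x → e (pow r m ∙ x)))

  hw-cong : ∀ ms n {f g} → (∀ e → f e ≡ g e) → hw ms n f ≡ hw ms n g
  hw-cong ms zero e = e ε
  hw-cong [] (suc n) e = refl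
  hw-cong (m ∷ ms) (suc n) e = cong₂ ℤ._+_ (hw-cong ms (suc n) e) (hw-cong (m ∷ ms) n (λ x → e (m ∙ x)))

  pw-↭ : ∀ ms {ρ σ} f → ρ ↭ σ → pw ms ρ f ≡ pw ms σ f
  pw-↭ ms f Perm.refl = refl
  pw-↭ ms f (prep r p) = ∑-cong ms (λ m → pw-↭ ms _ p)
  pw-↭ ms f (swap {xs} r s p) = trans (∑-swap ms ms) (∑-cong ms (λ m′ → ∑-cong ms (λ m → trans
    (pw-cong ms xs (λ e → cong f (trans (sym (assoc (pow r m) (pow s m′) e)) (trans (cong (_∙ e) (comm (pow r m) (pow s m′))) (assoc (pow s m′) (pow r m) e)))))
    (pw-↭ ms _ p))))
  pw-↭ ms f (Perm.trans p q) = trans (pw-↭ ms f p) (pw-↭ ms f q)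

  -- This is `∑ p_r h_(n-r) = n h_n`. Taking `m` out of the complete sums gives the identity for
  -- `ms` in degree `n` and, times `m`, the one for `m ∷ ms` in degree `n - 1`; a leftover
  -- `m h_(n-1)`, from `r = 1`, raises the coefficient from `n - 1` to `n`.
  newton : ∀ ms n f → conv n (λ r s → ∑ ms (λ m → hw ms s (λ e → f (pow r m ∙ e)))) ≡ + n ℤ.* hw ms n f
  newton [] n f = trans (conv-0 n) (sym (vanish n))
    where
    vanish : ∀ n → + n ℤ.* hw [] n f ≡ + 0
    vanish zero = ℤₚ.*-zeroˡ (f ε)
    vanish (suc n) = ℤₚ.*-zeroʳ (+ suc n)
  newton (m ∷ ms) zero f = sym (ℤₚ.*-zeroˡ (f ε))
  newton (m ∷ ms) (suc n) f = begin
    conv (suc n) (λ r s → H s (shift r m f) ℤ.+ ∑ ms (λ m′ → H s (shift r m′ f)))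
      ≡⟨ conv-+ (suc n) {λ r s → H s (shift r m f)} {λ r s → ∑ ms (λ m′ → H s (shift r m′ f))} ⟩
    (H n (shift 1 m f) ℤ.+ conv n (λ r s → H s (shift (suc r) m f))) ℤ.+ conv (suc n) (λ r s → ∑ ms (λ m′ → H s (shift r m′ f)))
      ≡⟨ cong₂ ℤ._+_ (cong₂ ℤ._+_ (hw-cong (m ∷ ms) n (λ e → cong (λ x → f (x ∙ e)) (idʳ m)))
           (conv-cong n (λ r s _ _ → hw-cong (m ∷ ms) s (λ e → cong f (assoc m (pow r m) e)))))
         (conv-split n {λ r s → ∑ ms (λ m′ → H s (shift r m′ f))} {λ r s → ∑ ms (λ m′ → hw ms s (shift r m′ f))} {λ r s → ∑ ms (λ m′ → H s (shift r m′ fm))}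
           (λ r → refl) (λ r s → trans (∑-+ ms {λ m′ → hw ms (suc s) (shift r m′ f)} {λ m′ → H s (λ e → shift r m′ f (m ∙ e))})
              (cong (λ z → ∑ ms (λ m′ → hw ms (suc s) (shift r m′ f)) ℤ.+ z) (∑-cong ms (λ m′ → hw-cong (m ∷ ms) s (λ e → cong f (swap-first (pow r m′) e))))))) ⟩
    (H n fm ℤ.+ conv n (λ r s → H s (shift r m fm))) ℤ.+ (conv (suc n) (λ r s → ∑ ms (λ m′ → hw ms s (shift r m′ f))) ℤ.+ conv n (λ r s → ∑ ms (λ m′ → H s (shift r m′ fm))))
      ≡⟨ cong (λ z → (H n fm ℤ.+ conv n (λ r s → H s (shift r m fm))) ℤ.+ (z ℤ.+ conv n (λ r s → ∑ ms (λ m′ → H s (shift r m′ fm))))) (newton ms (suc n) f) ⟩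
    (H n fm ℤ.+ conv n (λ r s → H s (shift r m fm))) ℤ.+ (+ suc n ℤ.* hw ms (suc n) f ℤ.+ conv n (λ r s → ∑ ms (λ m′ → H s (shift r m′ fm))))
      ≡⟨ regroup (H n fm) (conv n (λ r s → H s (shift r m fm))) (+ suc n ℤ.* hw ms (suc n) f) _ ⟩
    (+ suc n ℤ.* hw ms (suc n) f ℤ.+ H n fm) ℤ.+ (conv n (λ r s → H s (shift r m fm)) ℤ.+ conv n (λ r s → ∑ ms (λ m′ → H s (shift r m′ fm))))
      ≡⟨ cong (λ z → (+ suc n ℤ.* hw ms (suc n) f ℤ.+ H n fm) ℤ.+ z) (trans (sym (conv-+ n {λ r s → H s (shift r m fm)} {λ r s → ∑ ms (λ m′ → H s (shift r m′ fm))})) (newton (m ∷ ms) n fm)) ⟩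
    (+ suc n ℤ.* hw ms (suc n) f ℤ.+ H n fm) ℤ.+ + n ℤ.* H n fm
      ≡⟨ trans (ℤₚ.+-assoc (+ suc n ℤ.* hw ms (suc n) f) (H n fm) _) (cong (λ z → + suc n ℤ.* hw ms (suc n) f ℤ.+ z) (sym (ℤₚ.suc-* (+ n) (H n fm)))) ⟩
    + suc n ℤ.* hw ms (suc n) f ℤ.+ + suc n ℤ.* H n fm ≡⟨ sym (ℤₚ.*-distribˡ-+ (+ suc n) (hw ms (suc n) f) (H n fm)) ⟩
    + suc n ℤ.* H (suc n) f ∎
    where
    open ≡-Reasoning
    H = hw (m ∷ ms)
    shift : ℕ → E → (E → ℤ) → E → ℤ
    shift r m f e = f (pow r m ∙ e)
    fm : E → ℤ
    fm e = f (m ∙ e)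
    swap-first : ∀ x e → x ∙ (m ∙ e) ≡ m ∙ (x ∙ e)
    swap-first x e = trans (sym (assoc x m e)) (trans (cong (_∙ e) (comm x m)) (assoc m x e))
    regroup : ∀ a b c d → (a ℤ.+ b) ℤ.+ (c ℤ.+ d) ≡ (c ℤ.+ a) ℤ.+ (b ℤ.+ d)
    regroup = ℤSolver.solve-∀

∑P : ℕ → ℕ → ℕ → (List ℕ → ℤ) → ℤ
∑P f n m φ = ∑ (partsBounded f n m) φ

private
  term : ℕ → ℕ → ℕ → List (List ℕ)
  term f n p = if p ℕ.≤ᵇ suc n then map (p ∷_) (partsBounded f (suc n ℕ.∸ p) p) else []

  ∑P-last : ∀ f n m φ → ∑P (suc f) (suc n) (suc m) φ ≡ ∑P (suc f) (suc n) m φ ℤ.+ ∑ (term f n (suc m)) φ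
  ∑P-last f n m φ = trans (∑-concatMap (term f n) (oneTo (suc m)))
    (trans (cong (λ l → ∑ l (λ p → ∑ (term f n p) φ)) (sym (Listₚ.applyUpTo-∷ʳ suc m)))
    (trans (∑-++ (oneTo m) (suc m ∷ [])) (cong₂ ℤ._+_ (sym (∑-concatMap (term f n) (oneTo m))) (ℤₚ.+-identityʳ _))))

-- Partitions are split by whether the largest admissible part occurs. This trades the enumeration
-- by first parts for a recursion in `n` and `m`.
∑P-step : ∀ f n m φ → ∑P (suc f) (suc m ℕ.+ n) (suc m) φ ≡ ∑P (suc f) (suc m ℕ.+ n) m φ ℤ.+ ∑P f n (suc m) (φ ∘ (suc m ∷_))
∑P-step f n m φ = trans (∑P-last f (m ℕ.+ n) m φ) (cong (λ z → ∑P (suc f) (suc m ℕ.+ n) m φ ℤ.+ z)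
  (trans (cong (λ b → ∑ (if b then map (suc m ∷_) (partsBounded f (suc (m ℕ.+ n) ℕ.∸ suc m) (suc m)) else []) φ) (≤ᵇ-true (s≤s (ℕₚ.m≤m+n m n))))
  (trans (∑-map (suc m List.∷_) (partsBounded f (m ℕ.+ n ℕ.∸ m) (suc m))) (cong (λ k → ∑P f k (suc m) (φ ∘ (suc m ∷_))) (ℕₚ.m+n∸m≡n m n)))))

∑P-large : ∀ f n m φ → n ℕ.< m → ∑P (suc f) (suc n) (suc m) φ ≡ ∑P (suc f) (suc n) m φ
∑P-large f n m φ n<m = trans (∑P-last f n m φ) (trans (cong (λ b → ∑P (suc f) (suc n) m φ ℤ.+
  ∑ (if b then map (suc m ∷_) (partsBounded f (suc n ℕ.∸ suc m) (suc m)) else []) φ) (≤ᵇ-false (s≤s n<m))) (ℤₚ.+-identityʳ _))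

private
  compare : ∀ n m → (n ℕ.< m) ⊎ (∃ λ n′ → n ≡ m ℕ.+ n′)
  compare n m with m ℕ.≤? n
  ... | yes l = inj₂ (n ℕ.∸ m , sym (ℕₚ.m+[n∸m]≡n l))
  ... | no l = inj₁ (ℕₚ.≰⇒> l)

∑P-fuel : ∀ f g n m φ → n ℕ.≤ f → n ℕ.≤ g → ∑P f n m φ ≡ ∑P g n m φ
∑P-fuel f g zero m φ _ _ = refl
∑P-fuel (suc f) (suc g) (suc n) zero φ _ _ = refl
∑P-fuel (suc f) (suc g) (suc n) (suc m) φ (s≤s p) (s≤s q) with compare n m
... | inj₁ n<m = trans (∑P-large f n m φ n<m) (trans (∑P-fuel (suc f) (suc g) (suc n) m φ (s≤s p) (s≤s q)) (sym (∑P-large g n m φ n<m)))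
... | inj₂ (n′ , refl) = trans (∑P-step f n′ m φ) (trans (cong₂ ℤ._+_ (∑P-fuel (suc f) (suc g) (suc m ℕ.+ n′) m φ (s≤s p) (s≤s q))
    (∑P-fuel f g n′ (suc m) _ (ℕₚ.≤-trans (ℕₚ.m≤n+m n′ m) p) (ℕₚ.≤-trans (ℕₚ.m≤n+m n′ m) q))) (sym (∑P-step g n′ m φ)))

∑P-cong : ∀ f n m {φ ψ} → n ℕ.≤ f → (∀ ρ → sum ρ ≡ n → All (λ p → 1 ℕ.≤ p × p ℕ.≤ m) ρ → φ ρ ≡ ψ ρ) → ∑P f n m φ ≡ ∑P f n m ψ
∑P-cong f zero m l e = cong (ℤ._+ + 0) (e [] refl [])
∑P-cong (suc f) (suc n) zero l e = refl
∑P-cong (suc f) (suc n) (suc m) {φ} {ψ} (s≤s l) e with compare n m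
... | inj₁ n<m = trans (∑P-large f n m φ n<m) (trans (∑P-cong (suc f) (suc n) m (s≤s l) (λ ρ s a → e ρ s (All.map (λ (p , q) → p , ℕₚ.m≤n⇒m≤1+n q) a))) (sym (∑P-large f n m ψ n<m)))
... | inj₂ (n′ , refl) = trans (∑P-step f n′ m φ) (trans (cong₂ ℤ._+_
    (∑P-cong (suc f) (suc m ℕ.+ n′) m (s≤s l) (λ ρ s a → e ρ s (All.map (λ (p , q) → p , ℕₚ.m≤n⇒m≤1+n q) a)))
    (∑P-cong f n′ (suc m) (ℕₚ.≤-trans (ℕₚ.m≤n+m n′ m) l) (λ ρ s a → e (suc m ∷ ρ) (cong (suc m ℕ.+_) s) ((s≤s z≤n , ℕₚ.≤-refl) ∷ a)))) (sym (∑P-step f n′ m ψ)))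

∑P-bound : ∀ f n m φ → n ℕ.≤ m → ∑P (suc f) n m φ ≡ ∑P (suc f) n n φ
∑P-bound f zero m φ l = refl
∑P-bound f (suc n) m φ l = go m (ℕₚ.≤⇒≤′ l)
  where
  open import Data.Nat.Base using (_≤′_; ≤′-refl; ≤′-step)
  go : ∀ m → suc n ≤′ m → ∑P (suc f) (suc n) m φ ≡ ∑P (suc f) (suc n) (suc n) φ
  go m ≤′-refl = refl
  go (suc m) (≤′-step l) = trans (∑P-large f n m φ (ℕₚ.≤′⇒≤ l)) (go m l)

ins : ℕ → List ℕ → List ℕ
ins r [] = r ∷ []
ins r (p ∷ ρ) = if p ℕ.≤ᵇ r then r ∷ p ∷ ρ else p ∷ ins r ρ

ins-↭ : ∀ r ρ → ins r ρ ↭ r ∷ ρ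
ins-↭ r [] = ↭-refl
ins-↭ r (p ∷ ρ) with p ℕ.≤ᵇ r
... | true = ↭-refl
... | false = ↭-trans (prep p (ins-↭ r ρ)) (swap p r ↭-refl)

ins-max : ∀ r ρ → All (λ p → 1 ℕ.≤ p × p ℕ.≤ r) ρ → ins r ρ ≡ r ∷ ρ
ins-max r [] a = refl
ins-max r (p ∷ ρ) ((_ , l) ∷ _) = cong (λ b → if b then r ∷ p ∷ ρ else p ∷ ins r ρ) (≤ᵇ-true l)

ins-below : ∀ r m ρ → r ℕ.≤ m → ins r (suc m ∷ ρ) ≡ suc m ∷ ins r ρ
ins-below r m ρ l = cong (λ b → if b then r ∷ suc m ∷ ρ else suc m ∷ ins r ρ) (≤ᵇ-false (s≤s l))

mult-∷ : ∀ i p ρ → mult i (p ∷ ρ) ≡ (if i ℕ.≡ᵇ p then 1 else 0) ℕ.+ mult i ρ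
mult-∷ i p ρ with i ℕ.≡ᵇ p
... | true = refl
... | false = refl

≡ᵇ-refl : ∀ n → (n ℕ.≡ᵇ n) ≡ true
≡ᵇ-refl zero = refl
≡ᵇ-refl (suc n) = ≡ᵇ-refl n

≡ᵇ-≢ : ∀ {m n} → m ≢ n → (m ℕ.≡ᵇ n) ≡ false
≡ᵇ-≢ {m} {n} ne with m ℕ.≡ᵇ n in eq
... | false = refl
... | true = ⊥-elim (ne (ℕₚ.≡ᵇ⇒≡ m n (subst Bool.T (sym eq) tt)))

mult-≢ : ∀ {i p} ρ → i ≢ p → mult i (p ∷ ρ) ≡ mult i ρ
mult-≢ {i} {p} ρ ne = trans (mult-∷ i p ρ) (cong (λ b → (if b then 1 else 0) ℕ.+ mult i ρ) (≡ᵇ-≢ ne))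

mult-≡ : ∀ p ρ → mult p (p ∷ ρ) ≡ suc (mult p ρ)
mult-≡ p ρ = trans (mult-∷ p p ρ) (cong (λ b → (if b then 1 else 0) ℕ.+ mult p ρ) (≡ᵇ-refl p))

mult-↭ : ∀ i {ρ σ} → ρ ↭ σ → mult i ρ ≡ mult i σ
mult-↭ i Perm.refl = refl
mult-↭ i (prep {xs} {ys} p q) = trans (mult-∷ i p xs) (trans (cong (_ ℕ.+_) (mult-↭ i q)) (sym (mult-∷ i p ys)))
mult-↭ i (swap {xs} {ys} p q s) = begin
  mult i (p ∷ q ∷ xs) ≡⟨ trans (mult-∷ i p _) (cong (_ ℕ.+_) (trans (mult-∷ i q xs) (cong (_ ℕ.+_) (mult-↭ i s)))) ⟩
  _ ≡⟨ lemma (if i ℕ.≡ᵇ p then 1 else 0) (if i ℕ.≡ᵇ q then 1 else 0) (mult i ys) ⟩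
  _ ≡⟨ sym (trans (mult-∷ i q _) (cong (_ ℕ.+_) (mult-∷ i p ys))) ⟩
  mult i (q ∷ p ∷ ys) ∎
  where
  open ≡-Reasoning
  lemma : ∀ a b c → a ℕ.+ (b ℕ.+ c) ≡ b ℕ.+ (a ℕ.+ c)
  lemma = ℕSolver.solve-∀
mult-↭ i (Perm.trans p q) = trans (mult-↭ i p) (mult-↭ i q)

mult-large : ∀ i ρ → sum ρ ℕ.< i → mult i ρ ≡ 0
mult-large i [] l = refl
mult-large i (p ∷ ρ) l = trans (mult-≢ ρ (λ e → ℕₚ.<-irrefl (sym e) (ℕₚ.≤-<-trans (ℕₚ.m≤m+n p (sum ρ)) l)))
  (mult-large i ρ (ℕₚ.≤-<-trans (ℕₚ.m≤n+m (sum ρ) p) l))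

mult-bounded : ∀ {m} ρ → All (λ p → 1 ℕ.≤ p × p ℕ.≤ m) ρ → mult (suc m) ρ ≡ 0
mult-bounded [] [] = refl
mult-bounded (p ∷ ρ) ((_ , l) ∷ a) = trans (mult-≢ ρ (λ e → ℕₚ.<-irrefl (sym e) (s≤s l))) (mult-bounded ρ a)

∑P-0 : ∀ f n m {φ} → n ℕ.≤ f → (∀ ρ → sum ρ ≡ n → All (λ p → 1 ℕ.≤ p × p ℕ.≤ m) ρ → φ ρ ≡ + 0) → ∑P f n m φ ≡ + 0
∑P-0 f n m l e = trans (∑P-cong f n m l e) (∑-0 (partsBounded f n m) (λ _ → refl))

-- Removing a part r is a bijection from the partitions with a part r.
∑P-ins : ∀ f n m r {φ} → suc r ℕ.+ n ℕ.≤ f → suc r ℕ.≤ m → (∀ ρ → mult (suc r) ρ ≡ 0 → φ ρ ≡ + 0) →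
  ∑P f (suc r ℕ.+ n) m φ ≡ ∑P f n m (φ ∘ ins (suc r))
∑P-ins (suc f) n (suc m) r {φ} (s≤s l) r≤m z with suc r ℕ.≟ suc m
... | yes refl = begin
  ∑P (suc f) (suc m ℕ.+ n) (suc m) φ ≡⟨ ∑P-step f n m φ ⟩
  ∑P (suc f) (suc m ℕ.+ n) m φ ℤ.+ ∑P f n (suc m) (φ ∘ (suc m ∷_))
    ≡⟨ cong₂ ℤ._+_ (∑P-0 (suc f) (suc m ℕ.+ n) m (s≤s l) (λ ρ _ a → z ρ (mult-bounded ρ a)))
         (trans (∑P-fuel f (suc f) n (suc m) _ n≤f (ℕₚ.m≤n⇒m≤1+n n≤f)) (∑P-cong (suc f) n (suc m) (ℕₚ.m≤n⇒m≤1+n n≤f) (λ ρ _ a → cong φ (sym (ins-max (suc m) ρ a))))) ⟩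
  + 0 ℤ.+ ∑P (suc f) n (suc m) (φ ∘ ins (suc m)) ≡⟨ ℤₚ.+-identityˡ _ ⟩
  ∑P (suc f) n (suc m) (φ ∘ ins (suc m)) ∎
  where
  open ≡-Reasoning
  n≤f = ℕₚ.≤-trans (ℕₚ.m≤n+m n m) l
... | no ne = go (compare n (suc m))
  where
  open ≡-Reasoning
  r<m : suc r ℕ.≤ m
  r<m = ℕₚ.≤-pred (ℕₚ.≤∧≢⇒< r≤m ne)
  n≤f = ℕₚ.≤-trans (ℕₚ.m≤n+m n r) l
  IH : ∑P (suc f) (suc r ℕ.+ n) m φ ≡ ∑P (suc f) n m (φ ∘ ins (suc r))
  IH = ∑P-ins (suc f) n m r (s≤s l) r<m z
  z′ : ∀ ρ → mult (suc r) ρ ≡ 0 → φ (suc m ∷ ρ) ≡ + 0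
  z′ ρ e = z (suc m ∷ ρ) (trans (mult-≢ ρ ne) e)
  go : (n ℕ.< suc m) ⊎ (∃ λ n′ → n ≡ suc m ℕ.+ n′) → ∑P (suc f) (suc r ℕ.+ n) (suc m) φ ≡ ∑P (suc f) n (suc m) (φ ∘ ins (suc r))
  go (inj₂ (n′ , refl)) = begin
    ∑P (suc f) (suc r ℕ.+ (suc m ℕ.+ n′)) (suc m) φ ≡⟨ cong (λ k → ∑P (suc f) k (suc m) φ) (swap+ (suc r) (suc m) n′) ⟩
    ∑P (suc f) (suc m ℕ.+ (suc r ℕ.+ n′)) (suc m) φ ≡⟨ ∑P-step f (suc r ℕ.+ n′) m φ ⟩
    ∑P (suc f) (suc m ℕ.+ (suc r ℕ.+ n′)) m φ ℤ.+ ∑P f (suc r ℕ.+ n′) (suc m) (φ ∘ (suc m ∷_))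
      ≡⟨ cong₂ ℤ._+_ (trans (cong (λ k → ∑P (suc f) k m φ) (sym (swap+ (suc r) (suc m) n′))) IH)
           (trans (∑P-ins f n′ (suc m) r smaller r≤m z′) (∑-cong (partsBounded f n′ (suc m)) (λ ρ → cong φ (sym (ins-below (suc r) m ρ r<m))))) ⟩
    ∑P (suc f) (suc m ℕ.+ n′) m (φ ∘ ins (suc r)) ℤ.+ ∑P f n′ (suc m) (φ ∘ ins (suc r) ∘ (suc m ∷_)) ≡⟨ sym (∑P-step f n′ m (φ ∘ ins (suc r))) ⟩
    ∑P (suc f) (suc m ℕ.+ n′) (suc m) (φ ∘ ins (suc r)) ∎
    where
    swap+ : ∀ a b c → a ℕ.+ (b ℕ.+ c) ≡ b ℕ.+ (a ℕ.+ c)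
    swap+ = ℕSolver.solve-∀
    smaller : suc r ℕ.+ n′ ℕ.≤ f
    smaller = ℕₚ.≤-trans (s≤s (ℕₚ.m≤n+m (r ℕ.+ n′) m)) (ℕₚ.≤-trans (ℕₚ.≤-reflexive (swap′ m r n′)) l)
      where
      swap′ : ∀ m r n → suc (m ℕ.+ (r ℕ.+ n)) ≡ r ℕ.+ (suc m ℕ.+ n)
      swap′ = ℕSolver.solve-∀
  go (inj₁ n<m) = trans (left (compare (r ℕ.+ n) m)) (trans IH (sym right))
    where
    right : ∑P (suc f) n (suc m) (φ ∘ ins (suc r)) ≡ ∑P (suc f) n m (φ ∘ ins (suc r))
    right = drop n n<m
      where
      drop : ∀ n → n ℕ.< suc m → ∑P (suc f) n (suc m) (φ ∘ ins (suc r)) ≡ ∑P (suc f) n m (φ ∘ ins (suc r))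
      drop zero l = refl
      drop (suc n) (s≤s l) = ∑P-large f n m _ l
    left : (r ℕ.+ n ℕ.< m) ⊎ (∃ λ n′ → r ℕ.+ n ≡ m ℕ.+ n′) → ∑P (suc f) (suc r ℕ.+ n) (suc m) φ ≡ ∑P (suc f) (suc r ℕ.+ n) m φ
    left (inj₁ lt) = ∑P-large f (r ℕ.+ n) m φ lt
    -- Next to a part `suc m` there is room for at most `r`, so such partitions lack the part
    -- `suc r` and `φ` vanishes on them.
    left (inj₂ (n′ , e)) = begin
      ∑P (suc f) (suc (r ℕ.+ n)) (suc m) φ ≡⟨ cong (λ k → ∑P (suc f) (suc k) (suc m) φ) e ⟩
      ∑P (suc f) (suc m ℕ.+ n′) (suc m) φ ≡⟨ ∑P-step f n′ m φ ⟩
      ∑P (suc f) (suc m ℕ.+ n′) m φ ℤ.+ ∑P f n′ (suc m) (φ ∘ (suc m ∷_))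
        ≡⟨ cong (λ w → ∑P (suc f) (suc m ℕ.+ n′) m φ ℤ.+ w) (∑P-0 f n′ (suc m) (ℕₚ.≤-trans (ℕₚ.m≤n+m n′ m) (subst (ℕ._≤ f) e l))
             (λ ρ s _ → z′ ρ (mult-large (suc r) ρ (subst (ℕ._< suc r) (sym s) n′≤r)))) ⟩
      ∑P (suc f) (suc m ℕ.+ n′) m φ ℤ.+ + 0 ≡⟨ ℤₚ.+-identityʳ _ ⟩
      ∑P (suc f) (suc m ℕ.+ n′) m φ ≡⟨ cong (λ k → ∑P (suc f) (suc k) m φ) (sym e) ⟩
      ∑P (suc f) (suc (r ℕ.+ n)) m φ ∎
      where
      n′≤r : n′ ℕ.< suc r
      n′≤r = s≤s (ℕₚ.+-cancelˡ-≤ m n′ r (ℕₚ.≤-trans (ℕₚ.≤-reflexive (sym e)) (ℕₚ.≤-trans (ℕₚ.+-monoʳ-≤ r (ℕₚ.≤-pred n<m)) (ℕₚ.≤-reflexive (ℕₚ.+-comm r m)))))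

-- The product in `zρ` is bounded by the size of `ρ`. A free bound lets partitions of different
-- sizes be compared factor by factor.
zN : ℕ → List ℕ → ℕ
zN N ρ = product (map (zFactor ρ) (upTo N))

zN-suc : ∀ N ρ → zN (suc N) ρ ≡ zN N ρ ℕ.* zFactor ρ N
zN-suc N ρ = trans (cong (λ l → product (map (zFactor ρ) l)) (sym (Listₚ.upTo-∷ʳ N)))
  (trans (cong product (Listₚ.map-++ (zFactor ρ) (upTo N) (N ∷ []))) (trans (product-++ (map (zFactor ρ) (upTo N)) (zFactor ρ N ∷ []))
    (cong (zN N ρ ℕ.*_) (ℕₚ.*-identityʳ _))))

zFactor-0 : ∀ ρ i → mult (suc i) ρ ≡ 0 → zFactor ρ i ≡ 1
zFactor-0 ρ i e = cong (λ m → suc i ℕ.^ m ℕ.* m !) e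

zN-large : ∀ N ρ → sum ρ ℕ.≤ N → zN N ρ ≡ zρ ρ
zN-large N ρ l = go N (ℕₚ.≤⇒≤′ l)
  where
  open import Data.Nat.Base using (_≤′_; ≤′-refl; ≤′-step)
  go : ∀ N → sum ρ ≤′ N → zN N ρ ≡ zρ ρ
  go N ≤′-refl = refl
  go (suc N) (≤′-step l) = trans (zN-suc N ρ) (trans (cong₂ ℕ._*_ (go N l) (zFactor-0 ρ N (mult-large (suc N) ρ (s≤s (ℕₚ.≤′⇒≤ l))))) (ℕₚ.*-identityʳ _))

zN-cong : ∀ N {ρ σ} → (∀ i → mult i ρ ≡ mult i σ) → zN N ρ ≡ zN N σ
zN-cong N e = cong product (Listₚ.map-cong (λ i → cong (λ m → suc i ℕ.^ m ℕ.* m !) (e (suc i))) (upTo N))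

zFactor-≡ : ∀ r σ → zFactor (suc r ∷ σ) r ≡ (suc r ℕ.* suc (mult (suc r) σ)) ℕ.* zFactor σ r
zFactor-≡ r σ = trans (cong (λ m → suc r ℕ.^ m ℕ.* m !) (mult-≡ (suc r) σ)) (lemma (suc r) (suc (mult (suc r) σ)) (suc r ℕ.^ mult (suc r) σ) (mult (suc r) σ !))
  where
  lemma : ∀ r m p f → (r ℕ.* p) ℕ.* (m ℕ.* f) ≡ (r ℕ.* m) ℕ.* (p ℕ.* f)
  lemma = ℕSolver.solve-∀

zFactor-≢ : ∀ r i σ → i ≢ r → zFactor (suc r ∷ σ) i ≡ zFactor σ i
zFactor-≢ r i σ ne = cong (λ m → suc i ℕ.^ m ℕ.* m !) (mult-≢ σ (ne ∘ ℕₚ.suc-injective))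

zN-below : ∀ N r σ → N ℕ.≤ r → zN N (suc r ∷ σ) ≡ zN N σ
zN-below zero r σ l = refl
zN-below (suc N) r σ l = trans (zN-suc N (suc r ∷ σ)) (trans (cong₂ ℕ._*_ (zN-below N r σ (ℕₚ.≤-trans (ℕₚ.n≤1+n N) l)) (zFactor-≢ r N σ (ℕₚ.<⇒≢ l))) (sym (zN-suc N σ)))

zN-∷ : ∀ N r σ → r ℕ.< N → zN N (suc r ∷ σ) ≡ (suc r ℕ.* suc (mult (suc r) σ)) ℕ.* zN N σ
zN-∷ (suc N) r σ (s≤s l) with r ℕ.≟ N
... | yes refl = trans (zN-suc r (suc r ∷ σ)) (trans (cong₂ ℕ._*_ (zN-below r r σ ℕₚ.≤-refl) (zFactor-≡ r σ))
  (trans (lemma (zN r σ) (suc r ℕ.* suc (mult (suc r) σ)) (zFactor σ r)) (cong ((suc r ℕ.* suc (mult (suc r) σ)) ℕ.*_) (sym (zN-suc r σ)))))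
  where
  lemma : ∀ a b c → a ℕ.* (b ℕ.* c) ≡ b ℕ.* (a ℕ.* c)
  lemma = ℕSolver.solve-∀
... | no ne = trans (zN-suc N (suc r ∷ σ)) (trans (cong₂ ℕ._*_ (zN-∷ N r σ (ℕₚ.≤∧≢⇒< l ne)) (zFactor-≢ r N σ (ne ∘ sym)))
  (trans (ℕₚ.*-assoc (suc r ℕ.* suc (mult (suc r) σ)) (zN N σ) (zFactor σ N)) (cong ((suc r ℕ.* suc (mult (suc r) σ)) ℕ.*_) (sym (zN-suc N σ)))))

partSum : ℕ → List ℕ → ℕ
partSum zero ρ = 0
partSum (suc N) ρ = partSum N ρ ℕ.+ suc N ℕ.* mult (suc N) ρ

partSum-[] : ∀ N → partSum N [] ≡ 0
partSum-[] zero = refl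
partSum-[] (suc N) = trans (cong₂ ℕ._+_ (partSum-[] N) (ℕₚ.*-zeroʳ (suc N))) refl

partSum-below : ∀ N p ρ → N ℕ.< p → partSum N (p ∷ ρ) ≡ partSum N ρ
partSum-below zero p ρ l = refl
partSum-below (suc N) p ρ l = cong₂ ℕ._+_ (partSum-below N p ρ (ℕₚ.≤-trans (ℕₚ.n≤1+n _) l)) (cong (suc N ℕ.*_) (mult-≢ ρ (ℕₚ.<⇒≢ l)))

partSum-∷ : ∀ N p ρ → 1 ℕ.≤ p → p ℕ.≤ N → partSum N (p ∷ ρ) ≡ p ℕ.+ partSum N ρ
partSum-∷ zero (suc p) ρ _ ()
partSum-∷ (suc N) p ρ 1≤ l with p ℕ.≟ suc N
... | yes refl = trans (cong₂ ℕ._+_ (partSum-below N p ρ ℕₚ.≤-refl) (cong (suc N ℕ.*_) (mult-≡ p ρ))) (lemma (partSum N ρ) (suc N) (mult p ρ))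
  where
  lemma : ∀ a n m → a ℕ.+ n ℕ.* suc m ≡ n ℕ.+ (a ℕ.+ n ℕ.* m)
  lemma a n m = trans (cong (a ℕ.+_) (ℕₚ.*-suc n m)) (lemma′ a n (n ℕ.* m))
    where
    lemma′ : ∀ a n k → a ℕ.+ (n ℕ.+ k) ≡ n ℕ.+ (a ℕ.+ k)
    lemma′ = ℕSolver.solve-∀
... | no ne = trans (cong₂ ℕ._+_ (partSum-∷ N p ρ 1≤ (ℕₚ.≤-pred (ℕₚ.≤∧≢⇒< l ne))) (cong (suc N ℕ.*_) (mult-≢ ρ (ne ∘ sym)))) (ℕₚ.+-assoc p _ _)

partSum-sum : ∀ N ρ → All (λ p → 1 ℕ.≤ p × p ℕ.≤ N) ρ → partSum N ρ ≡ sum ρ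
partSum-sum N [] [] = partSum-[] N
partSum-sum N (p ∷ ρ) ((1≤ , l) ∷ a) = trans (partSum-∷ N p ρ 1≤ l) (cong (p ℕ.+_) (partSum-sum N ρ a))

!*!∣[+]! : ∀ a b → a ! ℕ.* b ! ∣ (a ℕ.+ b) !
!*!∣[+]! a b = subst (λ c → c ! ℕ.* b ! ∣ (a ℕ.+ b) !) (ℕₚ.m+n∸n≡m a b) ([n∸k]!k!∣n! (ℕₚ.m≤n+m b a))

!∣!+ : ∀ a b → a ! ∣ (a ℕ.+ b) !
!∣!+ a b = ∣-trans (m∣m*n (b !)) (!*!∣[+]! a b)

-- iᵐ m! divides (i m)!, since the last factor of (i (m + 1))! is i (m + 1).
zFactor∣ : ∀ i m → suc i ℕ.^ m ℕ.* m ! ∣ (suc i ℕ.* m) !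
zFactor∣ i zero = 1∣ _
zFactor∣ i (suc m) = ∣-trans (∣-reflexive (lemma (suc i) (suc m) (suc i ℕ.^ m) (m !)))
  (∣-trans (*-pres-∣ (∣-refl {suc i ℕ.* suc m}) (∣-trans (zFactor∣ i m) (!∣!+ (suc i ℕ.* m) i)))
           (∣-reflexive (trans (cong (λ k → k ℕ.* (suc i ℕ.* m ℕ.+ i) !) (e i m)) (cong _! (sym (e i m))))))
  where
  lemma : ∀ r m p f → (r ℕ.* p) ℕ.* (m ℕ.* f) ≡ (r ℕ.* m) ℕ.* (p ℕ.* f)
  lemma = ℕSolver.solve-∀
  e : ∀ i m → suc i ℕ.* suc m ≡ suc (suc i ℕ.* m ℕ.+ i)
  e = ℕSolver.solve-∀

-- Each factor `i^m m!` divides `(i m)!`, and a product of factorials divides the factorial of the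
-- sum. This makes the division in `classSize` exact.
zN∣ : ∀ N ρ → zN N ρ ∣ partSum N ρ !
zN∣ zero ρ = 1∣ _
zN∣ (suc N) ρ = ∣-trans (∣-reflexive (zN-suc N ρ)) (∣-trans (*-pres-∣ (zN∣ N ρ) (zFactor∣ N (mult (suc N) ρ))) (!*!∣[+]! (partSum N ρ) _))

parts-≤-sum : ∀ {m} ρ → All (λ p → 1 ℕ.≤ p × p ℕ.≤ m) ρ → All (λ p → 1 ℕ.≤ p × p ℕ.≤ sum ρ) ρ
parts-≤-sum [] [] = []
parts-≤-sum (p ∷ ρ) ((1≤ , _) ∷ a) = (1≤ , ℕₚ.m≤m+n p (sum ρ)) ∷ All.map (λ (x , y) → x , ℕₚ.≤-trans y (ℕₚ.m≤n+m (sum ρ) p)) (parts-≤-sum ρ a)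

classSize-z : ∀ {n m ρ} → sum ρ ≡ n → All (λ p → 1 ℕ.≤ p × p ℕ.≤ m) ρ → classSize n ρ ℕ.* zρ ρ ≡ n !
classSize-z {n} {m} {ρ} refl a = DivMod.m/n*n≡m {{product≢0 ρ (upTo (sum ρ))}}
  (subst (λ k → zρ ρ ∣ k !) (partSum-sum (sum ρ) ρ (parts-≤-sum ρ a)) (zN∣ (sum ρ) ρ))

-- Both sides are `s! n! / z_σ` with `n = suc r + s`, since adding the part `suc r` multiplies `z`
-- by `suc r` times the new multiplicity.
classSize-∷ : ∀ {r s m σ} → sum σ ≡ s → All (λ p → 1 ℕ.≤ p × p ℕ.≤ m) σ → let ρ = ins (suc r) σ in
  s ! ℕ.* ((suc r ℕ.* mult (suc r) ρ) ℕ.* classSize (suc r ℕ.+ s) ρ) ≡ (suc r ℕ.+ s) ! ℕ.* classSize s σ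
classSize-∷ {r} {s} {m} {σ} refl a = ℕₚ.*-cancelʳ-≡ _ _ (zρ σ) {{product≢0 σ (upTo (sum σ))}} (begin
  (s ! ℕ.* (k ℕ.* C)) ℕ.* zρ σ ≡⟨ lemma (s !) k C (zρ σ) ⟩
  s ! ℕ.* (C ℕ.* (k ℕ.* zρ σ)) ≡⟨ cong (λ x → s ! ℕ.* (C ℕ.* x)) (sym z≡) ⟩
  s ! ℕ.* (C ℕ.* zρ ρ) ≡⟨ cong (s ! ℕ.*_) (classSize-z {n} {n} {ρ} sumρ allρ) ⟩
  s ! ℕ.* n ! ≡⟨ cong (ℕ._* n !) (sym (classSize-z {s} {m} {σ} refl a)) ⟩
  (classSize s σ ℕ.* zρ σ) ℕ.* n ! ≡⟨ lemma′ (classSize s σ) (zρ σ) (n !) ⟩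
  (n ! ℕ.* classSize s σ) ℕ.* zρ σ ∎)
  where
  open ≡-Reasoning
  n = suc r ℕ.+ s
  ρ = ins (suc r) σ
  k = suc r ℕ.* mult (suc r) ρ
  C = classSize n ρ
  lemma : ∀ f k c z → (f ℕ.* (k ℕ.* c)) ℕ.* z ≡ f ℕ.* (c ℕ.* (k ℕ.* z))
  lemma = ℕSolver.solve-∀
  lemma′ : ∀ c z n → (c ℕ.* z) ℕ.* n ≡ (n ℕ.* c) ℕ.* z
  lemma′ = ℕSolver.solve-∀
  mults : ∀ i → mult i ρ ≡ mult i (suc r ∷ σ)
  mults i = mult-↭ i (ins-↭ (suc r) σ)
  sumρ : sum ρ ≡ n
  sumρ = sum-↭ (ins-↭ (suc r) σ)
  allρ : All (λ p → 1 ℕ.≤ p × p ℕ.≤ n) ρ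
  allρ = All-resp-↭ (↭-sym (ins-↭ (suc r) σ)) ((s≤s z≤n , ℕₚ.m≤m+n (suc r) s) ∷ All.map (λ (x , y) → x , ℕₚ.≤-trans y (ℕₚ.m≤n+m s (suc r))) (parts-≤-sum σ a))
  z≡ : zρ ρ ≡ k ℕ.* zρ σ
  z≡ = begin
    zρ ρ ≡⟨ sym (zN-large n ρ (ℕₚ.≤-reflexive sumρ)) ⟩
    zN n ρ ≡⟨ zN-cong n {ρ} {suc r ∷ σ} mults ⟩
    zN n (suc r ∷ σ) ≡⟨ zN-∷ n r σ (s≤s (ℕₚ.m≤m+n r s)) ⟩
    (suc r ℕ.* suc (mult (suc r) σ)) ℕ.* zN n σ ≡⟨ cong₂ (λ x y → (suc r ℕ.* x) ℕ.* y) (sym (trans (mults (suc r)) (mult-≡ (suc r) σ))) (zN-large n σ (ℕₚ.m≤n+m s (suc r))) ⟩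
    k ℕ.* zρ σ ∎

conv-partSum : ∀ n ρ → conv n (λ r _ → + (r ℕ.* mult r ρ)) ≡ + partSum n ρ
conv-partSum zero ρ = refl
conv-partSum (suc n) ρ = trans (conv-last n (λ r → + (r ℕ.* mult r ρ))) (cong (ℤ._+ + (suc n ℕ.* mult (suc n) ρ)) (conv-partSum n ρ))

module Average (M : CMon) where
  open CMon M
  open PowerSums M

  -- Write `n` as the sum of `r` times the multiplicity of `r` in `ρ`. By `classSize-∷`, deleting
  -- one part `r` reduces each summand to the average in degree `n - r`, and Newton's identity
  -- reassembles the results.
  average : ∀ ms n f → ∑ (partitionsOf n) (λ ρ → + classSize n ρ ℤ.* pw ms ρ f) ≡ + (n !) ℤ.* hw ms n f
  average ms = <-rec (λ n → ∀ f → ∑ (partitionsOf n) (λ ρ → + classSize n ρ ℤ.* pw ms ρ f) ≡ + (n !) ℤ.* hw ms n f) step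
    where
    open ≡-Reasoning
    step : ∀ n → (∀ {m} → m ℕ.< n → ∀ f → ∑ (partitionsOf m) (λ ρ → + classSize m ρ ℤ.* pw ms ρ f) ≡ + (m !) ℤ.* hw ms m f) →
      ∀ f → ∑ (partitionsOf n) (λ ρ → + classSize n ρ ℤ.* pw ms ρ f) ≡ + (n !) ℤ.* hw ms n f
    step zero rec f = ℤₚ.+-identityʳ _
    step n@(suc n₀) rec f = ℤₚ.*-cancelˡ-≡ (+ n) _ _ (begin
      + n ℤ.* ∑P n n n (λ ρ → + classSize n ρ ℤ.* pw ms ρ f) ≡⟨ ∑-*ˡ (+ n) (partitionsOf n) ⟩
      ∑P n n n (λ ρ → + n ℤ.* (+ classSize n ρ ℤ.* pw ms ρ f)) ≡⟨ ∑P-cong n n n ℕₚ.≤-refl (λ ρ s a → begin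
          + n ℤ.* c ρ ≡⟨ cong (λ k → + k ℤ.* c ρ) (trans (sym s) (sym (partSum-sum n ρ a))) ⟩
          + partSum n ρ ℤ.* c ρ ≡⟨ cong (ℤ._* c ρ) (sym (conv-partSum n ρ)) ⟩
          conv n (λ r _ → + (r ℕ.* mult r ρ)) ℤ.* c ρ ≡⟨ trans (ℤₚ.*-comm _ (c ρ)) (conv-*ˡ n (c ρ) {λ r _ → + (r ℕ.* mult r ρ)}) ⟩
          conv n (λ r _ → c ρ ℤ.* + (r ℕ.* mult r ρ)) ∎) ⟩
      ∑P n n n (λ ρ → conv n (λ r _ → c ρ ℤ.* + (r ℕ.* mult r ρ))) ≡⟨ conv-∑ n (partitionsOf n) {λ r _ ρ → c ρ ℤ.* + (r ℕ.* mult r ρ)} ⟩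
      conv n (λ r _ → ∑P n n n (λ ρ → c ρ ℤ.* + (r ℕ.* mult r ρ))) ≡⟨ conv-cong n part ⟩
      conv n (λ r s → + (n !) ℤ.* ∑ ms (λ m → hw ms s (λ e → f (pow r m ∙ e)))) ≡⟨ sym (conv-*ˡ n (+ (n !)) {λ r s → ∑ ms (λ m → hw ms s (λ e → f (pow r m ∙ e)))}) ⟩
      + (n !) ℤ.* conv n (λ r s → ∑ ms (λ m → hw ms s (λ e → f (pow r m ∙ e)))) ≡⟨ cong (+ (n !) ℤ.*_) (newton ms n f) ⟩
      + (n !) ℤ.* (+ n ℤ.* hw ms n f) ≡⟨ rearrange (+ (n !)) (+ n) (hw ms n f) ⟩
      + n ℤ.* (+ (n !) ℤ.* hw ms n f) ∎)
      where
      rearrange : ∀ a b c → a ℤ.* (b ℤ.* c) ≡ b ℤ.* (a ℤ.* c)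
      rearrange = ℤSolver.solve-∀
      c : List ℕ → ℤ
      c ρ = + classSize n ρ ℤ.* pw ms ρ f
      part : ∀ r s → 1 ℕ.≤ r → r ℕ.+ s ≡ n →
        ∑P n n n (λ ρ → c ρ ℤ.* + (r ℕ.* mult r ρ)) ≡ + (n !) ℤ.* ∑ ms (λ m → hw ms s (λ e → f (pow r m ∙ e)))
      -- The induction hypothesis carries the factor `s !`; multiplying through by it keeps the
      -- comparison of class sizes integral.
      part (suc r) s _ e = ℤₚ.*-cancelˡ-≡ (+ (s !)) _ _ {{s!≢0}} (begin
        + (s !) ℤ.* ∑P n n n ψ ≡⟨ cong (λ k → + (s !) ℤ.* ∑P n k n ψ) (sym e) ⟩
        + (s !) ℤ.* ∑P n (suc r ℕ.+ s) n ψ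
          ≡⟨ cong (+ (s !) ℤ.*_) (∑P-ins n s n r (ℕₚ.≤-reflexive e) (subst (suc r ℕ.≤_) e (ℕₚ.m≤m+n (suc r) s))
               (λ ρ z → trans (cong (λ m → c ρ ℤ.* + (suc r ℕ.* m)) z) (trans (cong (λ k → c ρ ℤ.* + k) (ℕₚ.*-zeroʳ r)) (ℤₚ.*-zeroʳ (c ρ))))) ⟩
        + (s !) ℤ.* ∑P n s n (ψ ∘ ins (suc r)) ≡⟨ cong (+ (s !) ℤ.*_) (trans (∑P-bound n₀ s n _ s≤n) (∑P-fuel n s s s _ s≤n ℕₚ.≤-refl)) ⟩
        + (s !) ℤ.* ∑P s s s (ψ ∘ ins (suc r)) ≡⟨ ∑-*ˡ (+ (s !)) (partitionsOf s) ⟩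
        ∑P s s s (λ σ → + (s !) ℤ.* ψ (ins (suc r) σ)) ≡⟨ ∑P-cong s s s ℕₚ.≤-refl (λ σ sσ a → summand σ sσ a) ⟩
        ∑P s s s (λ σ → + (n !) ℤ.* ∑ ms (λ m → + classSize s σ ℤ.* pw ms σ (g m))) ≡⟨ sym (∑-*ˡ (+ (n !)) (partitionsOf s)) ⟩
        + (n !) ℤ.* ∑P s s s (λ σ → ∑ ms (λ m → + classSize s σ ℤ.* pw ms σ (g m)))
          ≡⟨ cong (+ (n !) ℤ.*_) (trans (∑-swap (partitionsOf s) ms) (trans (∑-cong ms (λ m → rec s<n (g m))) (sym (∑-*ˡ (+ (s !)) ms)))) ⟩
        + (n !) ℤ.* (+ (s !) ℤ.* ∑ ms (λ m → hw ms s (g m))) ≡⟨ rearrange (+ (n !)) (+ (s !)) _ ⟩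
        + (s !) ℤ.* (+ (n !) ℤ.* ∑ ms (λ m → hw ms s (g m))) ∎)
        where
        s!≢0 = s ℕₚ.!≢0
        ψ : List ℕ → ℤ
        ψ ρ = c ρ ℤ.* + (suc r ℕ.* mult (suc r) ρ)
        g : E → E → ℤ
        g m e = f (pow (suc r) m ∙ e)
        s<n : s ℕ.< n
        s<n = subst (s ℕ.<_) e (s≤s (ℕₚ.m≤n+m s r))
        s≤n : s ℕ.≤ n
        s≤n = ℕₚ.<⇒≤ s<n
        summand : ∀ σ → sum σ ≡ s → All (λ p → 1 ℕ.≤ p × p ℕ.≤ s) σ →
          + (s !) ℤ.* ψ (ins (suc r) σ) ≡ + (n !) ℤ.* ∑ ms (λ m → + classSize s σ ℤ.* pw ms σ (g m))
        summand σ sσ a = begin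
          + (s !) ℤ.* ((+ classSize n ρ ℤ.* pw ms ρ f) ℤ.* + K) ≡⟨ shuffle (+ (s !)) (+ classSize n ρ) (pw ms ρ f) (+ K) ⟩
          (+ (s !) ℤ.* (+ K ℤ.* + classSize n ρ)) ℤ.* pw ms ρ f
            ≡⟨ cong₂ ℤ._*_ (trans (cong (+ (s !) ℤ.*_) (sym (ℤₚ.pos-* K _))) (trans (sym (ℤₚ.pos-* (s !) _))
                 (trans (cong +_ nat) (ℤₚ.pos-* (n !) _)))) (pw-↭ ms f (ins-↭ (suc r) σ)) ⟩
          (+ (n !) ℤ.* + classSize s σ) ℤ.* ∑ ms (λ m → pw ms σ (g m)) ≡⟨ ℤₚ.*-assoc (+ (n !)) (+ classSize s σ) _ ⟩
          + (n !) ℤ.* (+ classSize s σ ℤ.* ∑ ms (λ m → pw ms σ (g m))) ≡⟨ cong (+ (n !) ℤ.*_) (∑-*ˡ (+ classSize s σ) ms) ⟩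
          + (n !) ℤ.* ∑ ms (λ m → + classSize s σ ℤ.* pw ms σ (g m)) ∎
          where
          ρ = ins (suc r) σ
          K = suc r ℕ.* mult (suc r) ρ
          shuffle : ∀ a b c d → a ℤ.* ((b ℤ.* c) ℤ.* d) ≡ (a ℤ.* (d ℤ.* b)) ℤ.* c
          shuffle = ℤSolver.solve-∀
          nat : s ! ℕ.* (K ℕ.* classSize n ρ) ≡ n ! ℕ.* classSize s σ
          nat = subst (λ k → s ! ℕ.* (K ℕ.* classSize k ρ) ≡ k ! ℕ.* classSize s σ) e (classSize-∷ {r} {s} {s} {σ} sσ a)

-- Characters as coefficients of a power sum times the Vandermonde product.

unitsN : ∀ m → List (Vec ℕ m)
unitsN zero = []
unitsN (suc m) = (1 ∷ Vec.replicate m 0) ∷ map (0 ∷_) (unitsN m)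

length-unitsN : ∀ m → length (unitsN m) ≡ m
length-unitsN zero = refl
length-unitsN (suc m) = cong suc (trans (Listₚ.length-map (0 Vec.∷_) (unitsN m)) (length-unitsN m))

eqV : ∀ {m} → Vec ℕ m → Vec ℕ m → ℤ
eqV [] [] = + 1
eqV (x ∷ xs) (l ∷ ls) = δℕ x l ℤ.* eqV xs ls

VM : ℕ → CMon
VM = VecM ℕM

_⊕_ : ∀ {m} → Vec ℕ m → Vec ℕ m → Vec ℕ m
_⊕_ = Vec.zipWith ℕ._+_

0N : ∀ {m} → Vec ℕ m
0N = Vec.replicate _ 0

0N-⊕ : ∀ {m} (x : Vec ℕ m) → 0N ⊕ x ≡ x
0N-⊕ {m} = CMon.idˡ (VM m)

consHom : ∀ {m} → Hom (VM m) (VM (suc m))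
consHom = record { ⟦_⟧ = 0 ∷_ ; ⟦∙⟧ = λ _ _ → refl ; ⟦ε⟧ = refl }

pow-unit : ∀ {m} r → CMon.pow (VM (suc m)) r (1 ∷ 0N) ≡ r ∷ 0N
pow-unit zero = refl
pow-unit {m} (suc r) = trans (cong ((1 ∷ 0N) ⊕_) (pow-unit r)) (cong (suc r ∷_) (0N-⊕ 0N))

δℕ-+ : ∀ r x l → r ℕ.≤ l → δℕ (r ℕ.+ x) l ≡ δℕ x (l ℕ.∸ r)
δℕ-+ zero x l _ = refl
δℕ-+ (suc r) x (suc l) (s≤s p) = δℕ-+ r x l p

δℕ-> : ∀ {m n} → n ℕ.< m → δℕ m n ≡ + 0
δℕ-> {suc m} {zero} l = refl
δℕ-> {suc m} {suc n} (s≤s l) = δℕ-> l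

-- `K` stands for the pairing with the power sum of the remaining parts. Leaving it abstract lets
-- the induction on `v` absorb the condition on the first coordinate into a new operator `K′`.
choices-sum : ∀ {m} r (v : Vec ℕ m) (K : (Vec ℕ m → ℤ) → ℤ) (e : List ℕ → ℤ) →
  (∀ {f g} → (∀ x → f x ≡ g x) → K f ≡ K g) → K (λ _ → + 0) ≡ + 0 → (∀ v → e (Vec.toList v) ≡ K (λ x → eqV x v)) →
  ∑ (choices r (Vec.toList v)) e ≡ ∑ (unitsN m) (λ u → K (λ x → eqV (CMon.pow (VM m) r u ⊕ x) v))
choices-sum r [] K e K-cong K-0 spec = refl
choices-sum {suc m} r (l ∷ v) K e K-cong K-0 spec = trans (∑-++ (if r ℕ.≤ᵇ l then (l ℕ.∸ r ∷ Vec.toList v) ∷ [] else []) _) (cong₂ ℤ._+_ head-eq tail-eq)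
  where
  head-eq : ∑ (if r ℕ.≤ᵇ l then (l ℕ.∸ r ∷ Vec.toList v) ∷ [] else []) e ≡ K (λ x → eqV (CMon.pow (VM (suc m)) r (1 ∷ 0N) ⊕ x) (l ∷ v))
  head-eq with r ℕ.≤ᵇ l in eq
  ... | true = trans (ℤₚ.+-identityʳ _) (trans (spec (l ℕ.∸ r ∷ v)) (K-cong (λ { (x ∷ xs) → sym (trans
      (cong (λ u → eqV (u ⊕ (x ∷ xs)) (l ∷ v)) (pow-unit r)) (cong₂ ℤ._*_ (δℕ-+ r x l (ℕₚ.≤ᵇ⇒≤ r l (subst Bool.T (sym eq) tt))) (cong (λ y → eqV y v) (0N-⊕ xs)))) })))
  ... | false = sym (trans (K-cong (λ { (x ∷ xs) → trans (cong (λ u → eqV (u ⊕ (x ∷ xs)) (l ∷ v)) (pow-unit r))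
      (cong (ℤ._* eqV (0N ⊕ xs) v) (δℕ-> (ℕₚ.<-≤-trans (ℕₚ.≰⇒> (λ p → subst Bool.T eq (ℕₚ.≤⇒≤ᵇ p))) (ℕₚ.m≤m+n r x)))) })) K-0)
  K′ : (Vec ℕ m → ℤ) → ℤ
  K′ f = K (λ { (x ∷ xs) → δℕ x l ℤ.* f xs })
  tail-eq : ∑ (map (l ∷_) (choices r (Vec.toList v))) e ≡ ∑ (map (0 ∷_) (unitsN m)) (λ u → K (λ x → eqV (CMon.pow (VM (suc m)) r u ⊕ x) (l ∷ v)))
  tail-eq = trans (∑-map (l List.∷_) (choices r (Vec.toList v))) (trans
    (choices-sum r v K′ (λ α → e (l ∷ α)) (λ p → K-cong (λ { (x ∷ xs) → cong (δℕ x l ℤ.*_) (p xs) }))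
      (trans (K-cong (λ { (x ∷ xs) → ℤₚ.*-zeroʳ (δℕ x l) })) K-0) (λ v′ → trans (spec (l ∷ v′)) (K-cong (λ { (x ∷ xs) → refl }))))
    (sym (trans (∑-map (0 Vec.∷_) (unitsN m)) (∑-cong (unitsN m) (λ u → K-cong (λ { (x ∷ xs) → cong (λ y → eqV (y ⊕ (x ∷ xs)) (l ∷ v)) (sym (Hom.⟦pow⟧ consHom r u)) }))))))

+sum : ∀ {A : Set} (g : A → ℕ) xs → + sum (map g xs) ≡ ∑ xs (λ x → + g x)
+sum g [] = refl
+sum g (x ∷ xs) = cong (λ z → + g x ℤ.+ z) (+sum g xs)

module PowerSumsLinear (M : CMon) where
  open CMon M
  open PowerSums M

  pw-0 : ∀ ms ρ → pw ms ρ (λ _ → + 0) ≡ + 0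
  pw-0 ms [] = refl
  pw-0 ms (r ∷ ρ) = ∑-0 ms (λ m → pw-0 ms ρ)

  pw-sub : ∀ ms ρ f g → pw ms ρ (λ e → f e ℤ.+ ℤ.- g e) ≡ pw ms ρ f ℤ.+ ℤ.- pw ms ρ g
  pw-sub ms [] f g = refl
  pw-sub ms (r ∷ ρ) f g = trans (∑-cong ms (λ m → pw-sub ms ρ _ _))
    (trans (∑-+ ms {λ m → pw ms ρ (λ e → f (pow r m ∙ e))} {λ m → ℤ.- pw ms ρ (λ e → g (pow r m ∙ e))})
           (cong (λ z → pw ms (r ∷ ρ) f ℤ.+ z) (∑-neg ms {λ m → pw ms ρ (λ e → g (pow r m ∙ e))})))

  pw-alt : ∀ {A : Set} ms ρ (xs : List A) (g : A → List A → E → ℤ) →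
    Aℤ.alt xs (λ y ys → pw ms ρ (g y ys)) ≡ pw ms ρ (λ e → Aℤ.alt xs (λ y ys → g y ys e))
  pw-alt ms ρ [] g = sym (pw-0 ms ρ)
  pw-alt ms ρ (x ∷ xs) g = trans (cong (λ z → pw ms ρ (g x xs) ℤ.+ ℤ.- z) (pw-alt ms ρ xs (λ y ys → g y (x ∷ ys)))) (sym (pw-sub ms ρ _ _))

  pw-altPerm : ∀ {A : Set} ms ρ n (xs : List A) (G : List A → E → ℤ) →
    Aℤ.altPerm n xs (λ w → pw ms ρ (G w)) ≡ pw ms ρ (λ e → Aℤ.altPerm n xs (λ w → G w e))
  pw-altPerm ms ρ zero xs G = refl
  pw-altPerm ms ρ (suc n) xs G = trans (Aℤ.alt-cong xs (λ y ys _ → pw-altPerm ms ρ n ys (G ∘ (y ∷_)))) (pw-alt ms ρ xs _)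

  -- Every monomial of `p_ρ` has degree the size of `ρ`, so only the values of the functionals there
  -- matter.
  pw-degree : ∀ (deg : E → ℕ) → (∀ a b → deg (a ∙ b) ≡ deg a ℕ.+ deg b) → ∀ ms → All (λ m → ∀ r → deg (pow r m) ≡ r) ms →
    ∀ ρ f g → (∀ e → deg e ≡ sum ρ ℕ.+ deg ε → f e ≡ g e) → pw ms ρ f ≡ pw ms ρ g
  pw-degree deg deg-∙ ms ds [] f g h = h ε refl
  pw-degree deg deg-∙ ms ds (r ∷ ρ) f g h = ∑-cong-All (All.map (λ {m} d → pw-degree deg deg-∙ ms ds ρ _ _ (λ e p →
    h (pow r m ∙ e) (trans (deg-∙ _ e) (trans (cong₂ ℕ._+_ (d r) p) (sym (ℕₚ.+-assoc r (sum ρ) (deg ε))))))) ds)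

pw-hom : ∀ {M M′} (φ : Hom M M′) ms ρ f → PowerSums.pw M′ (map (Hom.⟦_⟧ φ) ms) ρ f ≡ PowerSums.pw M ms ρ (f ∘ Hom.⟦_⟧ φ)
pw-hom φ ms [] f = cong f (sym (Hom.⟦ε⟧ φ))
pw-hom {M} {M′} φ ms (r ∷ ρ) f = trans (∑-map (Hom.⟦_⟧ φ) ms) (∑-cong ms (λ m → trans (pw-hom φ ms ρ _)
  (PowerSums.pw-cong M ms ρ (λ e → cong f (sym (trans (Hom.⟦∙⟧ φ (CMon.pow M r m) e) (cong (λ z → CMon._∙_ M′ z (Hom.⟦_⟧ φ e)) (Hom.⟦pow⟧ φ r m))))))))

-- `p_r(x) p_r(y) = p_r(x y)`, where `x y` is the alphabet of all products of letters.
pw-× : ∀ M M′ ms ms′ ρ f g → PowerSums.pw M ms ρ f ℤ.* PowerSums.pw M′ ms′ ρ g ≡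
  PowerSums.pw (M ×M M′) (List.cartesianProduct ms ms′) ρ (λ (e , e′) → f e ℤ.* g e′)
pw-× M M′ ms ms′ [] f g = refl
pw-× M M′ ms ms′ (r ∷ ρ) f g = begin
  ∑ ms (λ m → PowerSums.pw M ms ρ (λ e → f (CMon._∙_ M (CMon.pow M r m) e))) ℤ.* G
    ≡⟨ trans (∑-*ʳ G ms) (∑-cong ms (λ m → trans (∑-*ˡ (PowerSums.pw M ms ρ (λ e → f (CMon._∙_ M (CMon.pow M r m) e))) ms′) (∑-cong ms′ (λ m′ → pw-× M M′ ms ms′ ρ (λ e → f (CMon._∙_ M (CMon.pow M r m) e)) (λ e′ → g (CMon._∙_ M′ (CMon.pow M′ r m′) e′)))))) ⟩
  ∑ ms (λ m → ∑ ms′ (λ m′ → PowerSums.pw (M ×M M′) (List.cartesianProduct ms ms′) ρ (λ (e , e′) → f (CMon._∙_ M (CMon.pow M r m) e) ℤ.* g (CMon._∙_ M′ (CMon.pow M′ r m′) e′))))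
    ≡⟨ sym (trans (∑-cartesianProduct ms ms′) (∑-cong ms (λ m → ∑-cong ms′ (λ m′ → PowerSums.pw-cong (M ×M M′) _ ρ (λ e →
         cong (λ x → h (CMon._∙_ (M ×M M′) x e)) (pow-× M M′ r (m , m′))))))) ⟩
  PowerSums.pw (M ×M M′) (List.cartesianProduct ms ms′) (r ∷ ρ) h ∎
  where
  open ≡-Reasoning
  G = PowerSums.pw M′ ms′ (r ∷ ρ) g
  h : CMon.E M × CMon.E M′ → ℤ
  h (e , e′) = f e ℤ.* g e′

-- A map from the parts of `ρ` to the positions is a choice of one variable in every factor `p_r`,
-- and the condition on its fibres prescribes the resulting monomial.
eta-pw : ∀ {m} ρ (v : Vec ℕ m) → + eta (Vec.toList v) ρ ≡ PowerSums.pw (VM m) (unitsN m) ρ (λ x → eqV x v)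
eta-pw [] v = go v
  where
  go : ∀ {m} (v : Vec ℕ m) → + (if allZero (Vec.toList v) then 1 else 0) ≡ eqV 0N v
  go [] = refl
  go (zero ∷ v) = trans (go v) (sym (ℤₚ.*-identityˡ _))
  go (suc l ∷ v) = sym (ℤₚ.*-zeroˡ (eqV 0N v))
eta-pw {m} (r ∷ ρ) v = trans (+sum (λ α → eta α ρ) (choices r (Vec.toList v)))
  (choices-sum r v (PowerSums.pw (VM m) (unitsN m) ρ) (λ α → + eta α ρ) (PowerSums.pw-cong (VM m) (unitsN m) ρ)
    (PowerSumsLinear.pw-0 (VM m) (unitsN m) ρ) (eta-pw ρ))

eqZ : ∀ {m} → List ℤ → Vec ℕ m → ℤ
eqZ [] [] = + 1
eqZ (z ∷ α) (x ∷ xs) = δℤ ((ℤ.- (+ x)) ℤ.+ z) ℤ.* eqZ α xs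
eqZ _ _ = + 0

δℤ-neg : ∀ x n → δℤ ((ℤ.- (+ x)) ℤ.+ -[1+ n ]) ≡ + 0
δℤ-neg zero n = refl
δℤ-neg (suc x) n = refl

etaZ-pw : ∀ {m} α ρ → length α ≡ m → etaZ α ρ ≡ PowerSums.pw (VM m) (unitsN m) ρ (eqZ α)
etaZ-pw {m} α ρ len with toNatComp α | natural α m len
  where
  Natural : ∀ (α : List ℤ) m → Maybe (List ℕ) → Set
  Natural α m nothing = ∀ (x : Vec ℕ m) → eqZ α x ≡ + 0
  Natural α m (just β) = ∃ λ (v : Vec ℕ m) → Vec.toList v ≡ β × (∀ (x : Vec ℕ m) → eqZ α x ≡ eqV x v)
  natural : ∀ α m → length α ≡ m → Natural α m (toNatComp α)
  natural [] zero _ = [] , refl , λ { [] → refl }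
  natural (+ n ∷ α) (suc m) len with toNatComp α | natural α m (ℕₚ.suc-injective len)
  ... | nothing | z = λ { (x ∷ xs) → trans (cong (δℤ ((ℤ.- (+ x)) ℤ.+ (+ n)) ℤ.*_) (z xs)) (ℤₚ.*-zeroʳ (δℤ ((ℤ.- (+ x)) ℤ.+ (+ n)))) }
  ... | just β | v , refl , e = n ∷ v , refl , λ { (x ∷ xs) → cong₂ ℤ._*_ (δℤ-minus x n) (e xs) }
  natural (-[1+ n ] ∷ α) (suc m) len = λ { (x ∷ xs) → cong (ℤ._* eqZ α xs) (δℤ-neg x n) }
... | nothing | z = sym (trans (PowerSums.pw-cong (VM m) (unitsN m) ρ z) (PowerSumsLinear.pw-0 (VM m) (unitsN m) ρ))
... | just β | v , refl , e = trans (eta-pw ρ v) (PowerSums.pw-cong (VM m) (unitsN m) ρ (λ x → sym (e x)))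

∑-foldr : ∀ {A : Set} (g : A → ℤ) xs → List.foldr ℤ._+_ (+ 0) (map g xs) ≡ ∑ xs g
∑-foldr g [] = refl
∑-foldr g (x ∷ xs) = cong (λ z → g x ℤ.+ z) (∑-foldr g xs)

∑-pickS : ∀ {A : Set} (xs : List A) (g : A → List A → ℤ) → ∑ (pickS xs) (λ (s , y , ys) → s ℤ.* g y ys) ≡ Aℤ.alt xs g
∑-pickS [] g = refl
∑-pickS (x ∷ xs) g = cong₂ ℤ._+_ (ℤₚ.*-identityˡ (g x xs)) (trans (∑-map (λ (s , y , ys) → ℤ.- s , y , x ∷ ys) (pickS xs))
  (trans (∑-cong (pickS xs) (λ (s , y , ys) → sym (ℤₚ.neg-distribˡ-* s (g y (x ∷ ys))))) (trans (∑-neg (pickS xs)) (cong ℤ.-_ (∑-pickS xs (λ y ys → g y (x ∷ ys)))))))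

∑-permsF : ∀ {A : Set} n (xs : List A) (G : List A → ℤ) → length xs ≡ n → ∑ (permsF n xs) (λ (s , w) → s ℤ.* G w) ≡ Aℤ.altPerm n xs G
∑-permsF zero xs G len = trans (ℤₚ.+-identityʳ _) (ℤₚ.*-identityˡ _)
∑-permsF (suc n) (x ∷ xs) G len = begin
  ∑ (permsF (suc n) (x ∷ xs)) g ≡⟨ ∑-concatMap (λ (s , y , ys) → map (λ (t , w) → s ℤ.* t , y ∷ w) (permsF n ys)) (pickS (x ∷ xs)) {g} ⟩
  ∑ (pickS (x ∷ xs)) (λ (s , y , ys) → ∑ (map (λ (t , w) → s ℤ.* t , y ∷ w) (permsF n ys)) g)
    ≡⟨ ∑-cong (pickS (x ∷ xs)) (λ (s , y , ys) → trans (∑-map (λ (t , w) → s ℤ.* t , y ∷ w) (permsF n ys) {g})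
         (trans (∑-cong (permsF n ys) (λ (t , w) → ℤₚ.*-assoc s t (G (y ∷ w)))) (sym (∑-*ˡ s (permsF n ys) {λ (t , w) → t ℤ.* G (y ∷ w)})))) ⟩
  ∑ (pickS (x ∷ xs)) (λ (s , y , ys) → s ℤ.* ∑ (permsF n ys) (λ (t , w) → t ℤ.* G (y ∷ w)))
    ≡⟨ ∑-pickS (x ∷ xs) (λ y ys → ∑ (permsF n ys) (λ (t , w) → t ℤ.* G (y ∷ w))) ⟩
  Aℤ.alt (x ∷ xs) (λ y ys → ∑ (permsF n ys) (λ (t , w) → t ℤ.* G (y ∷ w)))
    ≡⟨ Aℤ.alt-cong (x ∷ xs) (λ y ys p → ∑-permsF n ys (G ∘ (y ∷_)) (ℕₚ.suc-injective (trans (↭-length p) len))) ⟩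
  Aℤ.altPerm (suc n) (x ∷ xs) G ∎
  where
  open ≡-Reasoning
  g : ℤ × List _ → ℤ
  g (s , w) = s ℤ.* G w

fromL : ∀ m → List ℕ → Vec ℕ m
fromL zero _ = []
fromL (suc m) [] = 0 ∷ fromL m []
fromL (suc m) (l ∷ ls) = l ∷ fromL m ls

staircase : ℕ → List ℕ → List ℕ → List ℕ
staircase ℓ (l ∷ ls) (i ∷ is) = l ℕ.+ (ℓ ℕ.∸ i) ∷ staircase ℓ ls is
staircase ℓ _ _ = []

-- The exponents λᵢ + ℓ − i.
shifted : ∀ ℓ → List ℕ → Vec ℕ ℓ
shifted ℓ ls = fromL ℓ (staircase ℓ ls (oneTo ℓ))

entries : List ℕ → List ℕ → List ℕ → List ℤ
entries = zipWith3 (λ l i wi → (+ l ℤ.- + i) ℤ.+ + wi)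

-- Adding `ℓ - wᵢ` on both sides turns the entry `λᵢ - i + wᵢ`, which may be negative, into the
-- exponent `λᵢ + ℓ - i`, the same for every `w`.
eqZ-entries : ∀ {m} ℓ ls is ws → length ls ≡ m → length is ≡ m → length ws ≡ m → All (ℕ._≤ ℓ) is → All (ℕ._≤ ℓ) ws → ∀ x →
  eqZ {m} (entries ls is ws) x ≡ eqV (fromL m (map (ℓ ℕ.∸_) ws) ⊕ x) (fromL m (staircase ℓ ls is))
eqZ-entries {zero} ℓ [] [] [] _ _ _ _ _ [] = refl
eqZ-entries {suc m} ℓ (l ∷ ls) (i ∷ is) (w ∷ ws) p q r (i≤ ∷ is≤) (w≤ ∷ ws≤) (x ∷ xs) = cong₂ ℤ._*_
  (trans (cong δℤ arith) (δℤ-minus (ℓ ℕ.∸ w ℕ.+ x) (l ℕ.+ (ℓ ℕ.∸ i))))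
  (eqZ-entries ℓ ls is ws (ℕₚ.suc-injective p) (ℕₚ.suc-injective q) (ℕₚ.suc-injective r) is≤ ws≤ xs)
  where
  minus : ∀ {j} → j ℕ.≤ ℓ → + (ℓ ℕ.∸ j) ≡ + ℓ ℤ.- + j
  minus {j} j≤ = trans (sym (ℤₚ.⊖-≥ j≤)) (sym (ℤₚ.m-n≡m⊖n ℓ j))
  rearrange : ∀ x l i w ℓ → ℤ.- x ℤ.+ ((l ℤ.- i) ℤ.+ w) ≡ ℤ.- ((ℓ ℤ.- w) ℤ.+ x) ℤ.+ (l ℤ.+ (ℓ ℤ.- i))
  rearrange = ℤSolver.solve-∀
  arith : ℤ.- (+ x) ℤ.+ ((+ l ℤ.- + i) ℤ.+ + w) ≡ ℤ.- (+ (ℓ ℕ.∸ w ℕ.+ x)) ℤ.+ + (l ℕ.+ (ℓ ℕ.∸ i))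
  arith = trans (rearrange (+ x) (+ l) (+ i) (+ w) (+ ℓ)) (sym (cong₂ (λ a b → ℤ.- (a ℤ.+ + x) ℤ.+ (+ l ℤ.+ b)) (minus w≤) (minus i≤)))

length-oneTo : ∀ ℓ → length (oneTo ℓ) ≡ ℓ
length-oneTo ℓ = Listₚ.length-applyUpTo suc ℓ

oneTo-≤ : ∀ ℓ → All (ℕ._≤ ℓ) (oneTo ℓ)
oneTo-≤ ℓ = Allₚ.applyUpTo⁺₁ suc ℓ (λ l → l)

length-entries : ∀ {m} ls is ws → length ls ≡ m → length is ≡ m → length ws ≡ m → length (entries ls is ws) ≡ m
length-entries [] is ws p q r = p
length-entries (l ∷ ls) (i ∷ is) (w ∷ ws) refl q r = cong suc (length-entries ls is ws refl (ℕₚ.suc-injective q) (ℕₚ.suc-injective r))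

-- The coefficient of y^(λ+δ) in y^x ∑_w sgn(w) y^(ℓ−w).
alternant : ∀ ℓ → List ℕ → Vec ℕ ℓ → ℤ
alternant ℓ ls x = Aℤ.altPerm ℓ (oneTo ℓ) (λ w → eqV (fromL ℓ (map (ℓ ℕ.∸_) w) ⊕ x) (shifted ℓ ls))

character-pw : ∀ ls ρ → let ℓ = length ls in character ls ρ ≡ PowerSums.pw (VM ℓ) (unitsN ℓ) ρ (alternant ℓ ls)
character-pw ls ρ = begin
  character ls ρ ≡⟨ trans (∑-foldr _ (signedPerms ℓ)) (∑-cong (signedPerms ℓ) (λ (s , w) → refl)) ⟩
  ∑ (permsF ℓ (oneTo ℓ)) (λ (s , w) → s ℤ.* etaZ (entries ls (oneTo ℓ) w) ρ) ≡⟨ ∑-permsF ℓ (oneTo ℓ) (λ w → etaZ (entries ls (oneTo ℓ) w) ρ) (length-oneTo ℓ) ⟩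
  Aℤ.altPerm ℓ (oneTo ℓ) (λ w → etaZ (entries ls (oneTo ℓ) w) ρ) ≡⟨ Aℤ.altPerm-cong ℓ (oneTo ℓ) (length-oneTo ℓ) (λ w p →
      let len = trans (↭-length p) (length-oneTo ℓ) in
      trans (etaZ-pw (entries ls (oneTo ℓ) w) ρ (length-entries ls (oneTo ℓ) w refl (length-oneTo ℓ) len))
        (PowerSums.pw-cong (VM ℓ) (unitsN ℓ) ρ (eqZ-entries ℓ ls (oneTo ℓ) w refl (length-oneTo ℓ) len (oneTo-≤ ℓ) (All-resp-↭ (↭-sym p) (oneTo-≤ ℓ))))) ⟩
  Aℤ.altPerm ℓ (oneTo ℓ) (λ w → PowerSums.pw (VM ℓ) (unitsN ℓ) ρ (λ x → eqV (fromL ℓ (map (ℓ ℕ.∸_) w) ⊕ x) (shifted ℓ ls)))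
    ≡⟨ PowerSumsLinear.pw-altPerm (VM ℓ) (unitsN ℓ) ρ ℓ (oneTo ℓ) _ ⟩
  PowerSums.pw (VM ℓ) (unitsN ℓ) ρ (alternant ℓ ls) ∎
  where
  open ≡-Reasoning
  ℓ = length ls

module Pairings {M : CMon} {deg : CMon.E M → ℕ} {deg-∙ : ∀ a b → deg (CMon._∙_ M a b) ≡ deg a ℕ.+ deg b}
                {N D : ℕ} {N≤D : N ℕ.≤ D} where
  open FacRing M deg deg-∙ N D N≤D
  open T using (⟨_,_⟩)
  open CMon M

  ⟨alt⟩ : ∀ {A : Set} (xs : List A) g f → ⟨ Alt.alt xs g , f ⟩ ≡ Aℤ.alt xs (λ y ys → ⟨ g y ys , f ⟩)
  ⟨alt⟩ [] g f = T.⟨⟩-0 f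
  ⟨alt⟩ (x ∷ xs) g f = trans (T.⟨⟩-+ (g x xs) _ f) (cong (λ z → ⟨ g x xs , f ⟩ ℤ.+ z)
    (trans (T.⟨⟩-neg _ f) (cong ℤ.-_ (⟨alt⟩ xs _ f))))

  ⟨altPerm⟩ : ∀ {A : Set} n (xs : List A) G f → ⟨ Alt.altPerm n xs G , f ⟩ ≡ Aℤ.altPerm n xs (λ w → ⟨ G w , f ⟩)
  ⟨altPerm⟩ zero xs G f = refl
  ⟨altPerm⟩ (suc n) xs G f = trans (⟨alt⟩ xs _ f) (Aℤ.alt-cong xs (λ y ys _ → ⟨altPerm⟩ n ys _ f))

  ⟨pick⟩ : ∀ {A : Set} (xs : List A) g f → ⟨ Alt.pick xs g , f ⟩ ≡ Aℤ.pick xs (λ y ys → ⟨ g y ys , f ⟩)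
  ⟨pick⟩ [] g f = T.⟨⟩-0 f
  ⟨pick⟩ (x ∷ xs) g f = trans (T.⟨⟩-+ (g x xs) _ f) (cong (λ z → ⟨ g x xs , f ⟩ ℤ.+ z) (⟨pick⟩ xs _ f))

  ⟨permSum⟩ : ∀ {A : Set} n (xs : List A) G f → ⟨ Alt.permSum n xs G , f ⟩ ≡ Aℤ.permSum n xs (λ w → ⟨ G w , f ⟩)
  ⟨permSum⟩ zero xs G f = refl
  ⟨permSum⟩ (suc n) xs G f = trans (⟨pick⟩ xs _ f) (Aℤ.pick-cong xs (λ y ys _ → ⟨permSum⟩ n ys _ f))

  -- 1 / ∏ (1 − m) pairs with functions supported in degree n as h_n does.
  geo-hw : ∀ ms → All (λ m → deg m ≡ 1) ms → ∀ n F → n ℕ.≤ D → (∀ e → deg e ≢ n → F e ≡ + 0) →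
    ⟨ ev (map geo ms) , F ⟩ ≡ PowerSums.hw M ms n F
  geo-hw [] [] zero F l s = trans (cong (λ o → ⟨ o , F ⟩) T.1≡mono) (T.⟨⟩-mono ε F)
  geo-hw [] [] (suc n) F l s = trans (cong (λ o → ⟨ o , F ⟩) T.1≡mono) (trans (T.⟨⟩-mono ε F) (s ε (λ e → ℕₚ.0≢1+n (trans (sym (deg-pow 0 ε)) e))))
  geo-hw (m ∷ ms) (d ∷ ds) n F l s = trans (T.⟨⟩-* (series D m) P F) (trans (⟨series⟩ D m _) (go D n F ℕₚ.≤-refl l s))
    where
    P = ev (map geo ms)
    go : ∀ D′ n F → D′ ℕ.≤ D → n ℕ.≤ D′ → (∀ e → deg e ≢ n → F e ≡ + 0) → ∑≤ D′ (λ b → ⟨ P , (λ e → F (pow b m ∙ e)) ⟩) ≡ PowerSums.hw M (m ∷ ms) n F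
    first : ∀ n F → n ℕ.≤ D → (∀ e → deg e ≢ n → F e ≡ + 0) → ⟨ P , (λ e → F (pow 0 m ∙ e)) ⟩ ≡ PowerSums.hw M ms n F
    first n F l s = trans (T.⟨⟩-cong P (λ e → cong F (idˡ e))) (geo-hw ms ds n F l s)
    go zero zero F _ _ s = first 0 F z≤n s
    go (suc D′) zero F _ _ s = trans (cong₂ ℤ._+_ (first 0 F z≤n s) (∑≤-0 D′ (λ b → T.⟨⟩-0ʳ P (λ e → s _ (λ z →
      ℕₚ.1+n≢0 (trans (sym (trans (deg-∙ _ e) (cong (ℕ._+ deg e) (trans (deg-∙ m _) (cong (ℕ._+ deg (pow b m)) d))))) z)))))) (ℤₚ.+-identityʳ _)
    go (suc D′) (suc n) F p (s≤s q) s = cong₂ ℤ._+_ (first (suc n) F (ℕₚ.≤-trans (s≤s q) p) s)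
      (trans (∑≤-cong D′ (λ b → T.⟨⟩-cong P (λ e → cong F (assoc m (pow b m) e))))
        (go D′ n (λ e → F (m ∙ e)) (ℕₚ.≤-trans (ℕₚ.n≤1+n D′) p) q (λ e ne → s (m ∙ e) (λ z → ne (ℕₚ.suc-injective (trans (sym (trans (deg-∙ m e) (cong (ℕ._+ deg e) d))) z))))))

sum-⊕ : ∀ {m} (x y : Vec ℕ m) → Vec.sum (x ⊕ y) ≡ Vec.sum x ℕ.+ Vec.sum y
sum-⊕ [] [] = refl
sum-⊕ (x ∷ xs) (y ∷ ys) = trans (cong ((x ℕ.+ y) ℕ.+_) (sum-⊕ xs ys)) (lemma x y (Vec.sum xs) (Vec.sum ys))
  where
  lemma : ∀ a b c d → (a ℕ.+ b) ℕ.+ (c ℕ.+ d) ≡ (a ℕ.+ c) ℕ.+ (b ℕ.+ d)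
  lemma = ℕSolver.solve-∀

δℕ-≢ : ∀ {m n} → m ≢ n → δℕ m n ≡ + 0
δℕ-≢ {zero} {zero} ne = ⊥-elim (ne refl)
δℕ-≢ {zero} {suc n} ne = refl
δℕ-≢ {suc m} {zero} ne = refl
δℕ-≢ {suc m} {suc n} ne = δℕ-≢ (ne ∘ cong suc)

δℕ-refl : ∀ n → δℕ n n ≡ + 1
δℕ-refl zero = refl
δℕ-refl (suc n) = δℕ-refl n

eqV-≢ : ∀ {m} {x l : Vec ℕ m} → x ≢ l → eqV x l ≡ + 0
eqV-≢ {x = []} {[]} ne = ⊥-elim (ne refl)
eqV-≢ {x = x ∷ xs} {l ∷ ls} ne with x ℕ.≟ l
... | no x≢l = cong (ℤ._* eqV xs ls) (δℕ-≢ x≢l)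
... | yes refl = trans (cong (δℕ x x ℤ.*_) (eqV-≢ (λ e → ne (cong (x ∷_) e)))) (ℤₚ.*-zeroʳ (δℕ x x))

powprod-map : ∀ {M M′} (φ : Hom M M′) es bs → CMon.powprod M′ (map (Hom.⟦_⟧ φ) es) bs ≡ Hom.⟦_⟧ φ (CMon.powprod M es bs)
powprod-map φ [] bs = sym (Hom.⟦ε⟧ φ)
powprod-map φ (e ∷ es) [] = sym (Hom.⟦ε⟧ φ)
powprod-map {M} {M′} φ (e ∷ es) (b ∷ bs) = trans (cong₂ (CMon._∙_ M′) (sym (Hom.⟦pow⟧ φ b e)) (powprod-map φ es bs)) (sym (Hom.⟦∙⟧ φ _ _))

powprod-units : ∀ m bs → CMon.powprod (VM m) (unitsN m) bs ≡ fromL m bs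
powprod-units zero bs = refl
powprod-units (suc m) [] = go m
  where
  go : ∀ m → 0N {suc m} ≡ 0 ∷ fromL m []
  go zero = refl
  go (suc m) = cong (0 ∷_) (go m)
powprod-units (suc m) (b ∷ bs) = trans (cong₂ _⊕_ (pow-unit b) (trans (powprod-map consHom (unitsN m) bs) (cong (0 ∷_) (powprod-units m bs))))
  (cong₂ _∷_ (ℕₚ.+-identityʳ b) (0N-⊕ (fromL m bs)))

downFrom-oneTo : ∀ ℓ → downFrom ℓ ≡ map (ℓ ℕ.∸_) (oneTo ℓ)
downFrom-oneTo zero = refl
downFrom-oneTo (suc ℓ) = cong (ℓ ∷_) (trans (downFrom-oneTo ℓ) (trans (Listₚ.map-applyUpTo suc (ℓ ℕ.∸_) ℓ) (sym (Listₚ.map-applyUpTo (suc ∘ suc) (suc ℓ ℕ.∸_) ℓ))))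

-- The Jacobi-Trudi sum permutes exponents over variables in fixed order, whereas the determinant of
-- `vandermonde` permutes the variables; hence the transposition. Degrees beyond that of
-- `shifted ℓ ls` cannot meet the functional.
alternant-pairing : ∀ D ℓ ls x → Vec.sum (shifted ℓ ls) ℕ.≤ D →
  alternant ℓ ls x ≡ Terms.⟨_,_⟩ (VM ℓ) (Eval.ev (VM ℓ) D (vdm (unitsN ℓ))) (λ y → eqV (y ⊕ x) (shifted ℓ ls))
alternant-pairing D ℓ ls x N≤D = sym (begin
  ⟨ ev (vdm us) , f ⟩ ≡⟨ MR.⟨ expand ⟩≈ test ⟩
  ⟨ Alt.altPerm (length us) (downFrom ℓ) (λ es → mono (fromL ℓ es)) , f ⟩ ≡⟨ ⟨altPerm⟩ (length us) (downFrom ℓ) _ f ⟩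
  Aℤ.altPerm (length us) (downFrom ℓ) (λ es → ⟨ mono (fromL ℓ es) , f ⟩) ≡⟨ cong₂ (λ n l → Aℤ.altPerm n l (λ es → ⟨ mono (fromL ℓ es) , f ⟩)) (length-unitsN ℓ) (downFrom-oneTo ℓ) ⟩
  Aℤ.altPerm ℓ (map (ℓ ℕ.∸_) (oneTo ℓ)) (λ es → ⟨ mono (fromL ℓ es) , f ⟩) ≡⟨ Aℤ.altPerm-map ℓ (ℓ ℕ.∸_) (oneTo ℓ) ⟩
  Aℤ.altPerm ℓ (oneTo ℓ) (λ w → ⟨ mono (fromL ℓ (map (ℓ ℕ.∸_) w)) , f ⟩) ≡⟨ Aℤ.altPerm-cong ℓ (oneTo ℓ) (length-oneTo ℓ) (λ w _ → T.⟨⟩-mono _ f) ⟩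
  alternant ℓ ls x ∎)
  where
  open ≡-Reasoning
  L = shifted ℓ ls
  us = unitsN ℓ
  open FacRing (VM ℓ) Vec.sum sum-⊕ (Vec.sum L) D N≤D
  open Pairings {VM ℓ} {Vec.sum} {sum-⊕} {Vec.sum L} {D} {N≤D}
  open T using (mono; ⟨_,_⟩)
  open Algebra.Properties.Semiring.Exp R.semiring using () renaming (_^_ to _^ʳ_)
  f : Vec ℕ ℓ → ℤ
  f y = eqV (y ⊕ x) L
  test : MR.Test f
  test y l = eqV-≢ {x = y ⊕ x} {L} (λ e → ℕₚ.<⇒≱ l (ℕₚ.≤-trans (ℕₚ.m≤m+n (Vec.sum y) (Vec.sum x)) (ℕₚ.≤-reflexive (trans (sym (sum-⊕ y x)) (cong Vec.sum e)))))
  len : length (downFrom ℓ) ≡ length us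
  len = trans (Listₚ.length-downFrom ℓ) (sym (length-unitsN ℓ))
  expand : ev (vdm us) R.≈ Alt.altPerm (length us) (downFrom ℓ) (λ es → mono (fromL ℓ es))
  expand = R.trans (ev-vdm us) (R.trans (Alt.vandermonde mono us) (R.trans
    (R.reflexive (cong (λ n → Alt.det (λ e y → mono y ^ʳ e) (downFrom n) us) (length-unitsN ℓ)))
    (R.trans (Alt.det-transpose (λ e y → mono y ^ʳ e) (downFrom ℓ) us len)
    (R.trans (Alt.det-altPerm (λ y e → mono y ^ʳ e) us (downFrom ℓ))
      (Alt.altPerm-cong (length us) (downFrom ℓ) len (λ es _ → R.trans (zipΠ-mono us es) (R.reflexive (cong mono (powprod-units ℓ es)))))))))

-- The character of (n − k, k) on partitions of n, through the exponent of t in ∏ (1 + t^ρᵢ).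
twoRow : ℕ → ℕ → ℤ
twoRow k z = δℕ k z ℤ.+ ℤ.- δℕ k (suc z)

-- In total degree `m + k` the exponent of the second variable determines that of the first, so the
-- first variable may be set to 1.
twoRow-character : ∀ m k ρ → 1 ℕ.≤ k → sum ρ ≡ m ℕ.+ k →
  character (m ∷ k ∷ []) ρ ≡ PowerSums.pw ℕM (0 ∷ 1 ∷ []) ρ (twoRow k)
twoRow-character m (suc k) ρ 1≤k s = begin
  character (m ∷ suc k ∷ []) ρ ≡⟨ character-pw (m ∷ suc k ∷ []) ρ ⟩
  PowerSums.pw (VM 2) (unitsN 2) ρ (alternant 2 (m ∷ suc k ∷ []))
    ≡⟨ PowerSumsLinear.pw-degree (VM 2) Vec.sum sum-⊕ (unitsN 2) ((λ r → trans (cong Vec.sum (pow-unit r)) (ℕₚ.+-identityʳ r)) ∷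
         (λ r → trans (cong Vec.sum (trans (sym (Hom.⟦pow⟧ consHom r (1 ∷ []))) (cong (0 ∷_) (pow-unit r)))) (ℕₚ.+-identityʳ r)) ∷ []) ρ _ _ agree ⟩
  PowerSums.pw (VM 2) (unitsN 2) ρ (twoRow (suc k) ∘ Hom.⟦_⟧ second) ≡⟨ sym (pw-hom second (unitsN 2) ρ (twoRow (suc k))) ⟩
  PowerSums.pw ℕM (0 ∷ 1 ∷ []) ρ (twoRow (suc k)) ∎
  where
  open ≡-Reasoning
  second : Hom (VM 2) ℕM
  second = record { ⟦_⟧ = λ { (x ∷ y ∷ []) → y } ; ⟦∙⟧ = λ { (x ∷ y ∷ []) (x′ ∷ y′ ∷ []) → refl } ; ⟦ε⟧ = refl }
  agree : ∀ e → Vec.sum e ≡ sum ρ ℕ.+ Vec.sum (0N {2}) → alternant 2 (m ∷ suc k ∷ []) e ≡ twoRow (suc k) (Hom.⟦_⟧ second e)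
  agree (x ∷ y ∷ []) p = values
    where
    total : x ℕ.+ y ≡ m ℕ.+ suc k
    total = trans (cong (x ℕ.+_) (sym (ℕₚ.+-identityʳ y))) (trans p (trans (ℕₚ.+-identityʳ _) s))
    forced : ∀ {x′ d y c c′} → c′ ≡ c → (y ≡ c → x′ ≡ d) → δℕ x′ d ℤ.* (δℕ y c′ ℤ.* + 1) ≡ δℕ c y
    forced {x′} {d} {y} {c} refl h with y ℕ.≟ c
    ... | yes refl = trans (cong₂ (λ a b → a ℤ.* (b ℤ.* + 1)) (trans (cong (λ z → δℕ z d) (h refl)) (δℕ-refl d)) (δℕ-refl y)) (sym (δℕ-refl y))
    ... | no ne = trans (cong (λ b → δℕ x′ d ℤ.* (b ℤ.* + 1)) (δℕ-≢ ne)) (trans (ℤₚ.*-zeroʳ (δℕ x′ d)) (sym (δℕ-≢ (ne ∘ sym))))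
    simplify : ∀ a b → (a ℤ.+ ℤ.- + 0) ℤ.+ ℤ.- ((b ℤ.+ ℤ.- + 0) ℤ.+ ℤ.- + 0) ≡ a ℤ.+ ℤ.- b
    simplify = ℤSolver.solve-∀
    values : alternant 2 (m ∷ suc k ∷ []) (x ∷ y ∷ []) ≡ twoRow (suc k) y
    values = trans (simplify (eqV (1 ℕ.+ x ∷ y ∷ []) (m ℕ.+ 1 ∷ suc k ℕ.+ 0 ∷ [])) (eqV (x ∷ 1 ℕ.+ y ∷ []) (m ℕ.+ 1 ∷ suc k ℕ.+ 0 ∷ [])))
      (cong₂ (λ a b → a ℤ.+ ℤ.- b)
        (forced {suc x} {m ℕ.+ 1} {y} (ℕₚ.+-identityʳ (suc k)) (λ e → trans (cong suc (ℕₚ.+-cancelʳ-≡ (suc k) x m (trans (cong (x ℕ.+_) (sym e)) total))) (ℕₚ.+-comm 1 m)))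
        (forced {x} {m ℕ.+ 1} {suc y} (ℕₚ.+-identityʳ (suc k)) (λ e → ℕₚ.+-cancelʳ-≡ k x (m ℕ.+ 1)
          (trans (cong (x ℕ.+_) (sym (ℕₚ.suc-injective e))) (trans total (sym (ℕₚ.+-assoc m 1 k)))))))

alternant-degree : ∀ ls x → Vec.sum x ≢ sum ls → alternant (length ls) ls x ≡ + 0
alternant-degree ls x ne = trans (Aℤ.altPerm-cong ℓ (oneTo ℓ) (length-oneTo ℓ) (λ w p → eqV-≢ {x = fromL ℓ (map (ℓ ℕ.∸_) w) ⊕ x} {shifted ℓ ls}
    (λ e → ne (ℕₚ.+-cancelˡ-≡ C _ _ (trans (cong (ℕ._+ Vec.sum x) (sym (sumw w p))) (trans (sym (sum-⊕ (fromL ℓ (map (ℓ ℕ.∸_) w)) x)) (trans (cong Vec.sum e) total)))))))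
  (zeros ℓ (oneTo ℓ))
  where
  ℓ = length ls
  C = sum (map (ℓ ℕ.∸_) (oneTo ℓ))
  zeros : ∀ n (xs : List ℕ) → Aℤ.altPerm n xs (λ _ → + 0) ≡ + 0
  zeros zero xs = refl
  zeros (suc n) xs = trans (Aℤ.alt-cong xs (λ y ys _ → zeros n ys)) (Aℤ.alt-0 xs)
  sum-fromL : ∀ m l → length l ≡ m → Vec.sum (fromL m l) ≡ sum l
  sum-fromL zero [] e = refl
  sum-fromL (suc m) (x ∷ l) e = cong (x ℕ.+_) (sum-fromL m l (ℕₚ.suc-injective e))
  sumw : ∀ w → w ↭ oneTo ℓ → Vec.sum (fromL ℓ (map (ℓ ℕ.∸_) w)) ≡ C
  sumw w p = trans (sum-fromL ℓ _ (trans (Listₚ.length-map (ℓ ℕ.∸_) w) (trans (↭-length p) (length-oneTo ℓ)))) (sum-↭ (map⁺ (ℓ ℕ.∸_) p))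
  stairs : ∀ l is → length l ≡ length is → sum (staircase ℓ l is) ≡ sum (map (ℓ ℕ.∸_) is) ℕ.+ sum l
  stairs [] [] e = refl
  stairs (x ∷ l) (i ∷ is) e = trans (cong ((x ℕ.+ (ℓ ℕ.∸ i)) ℕ.+_) (stairs l is (ℕₚ.suc-injective e))) (lemma x (ℓ ℕ.∸ i) (sum (map (ℓ ℕ.∸_) is)) (sum l))
    where
    lemma : ∀ a b c d → (a ℕ.+ b) ℕ.+ (c ℕ.+ d) ≡ (b ℕ.+ c) ℕ.+ (a ℕ.+ d)
    lemma = ℕSolver.solve-∀
  length-stairs : ∀ l is → length l ≡ length is → length (staircase ℓ l is) ≡ length l
  length-stairs [] [] e = refl
  length-stairs (x ∷ l) (i ∷ is) e = cong suc (length-stairs l is (ℕₚ.suc-injective e))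
  total : Vec.sum (shifted ℓ ls) ≡ C ℕ.+ sum ls
  total = trans (sum-fromL ℓ _ (length-stairs ls (oneTo ℓ) (sym (length-oneTo ℓ)))) (stairs ls (oneTo ℓ) (sym (length-oneTo ℓ)))

δℤ-≢ : ∀ {z} → z ≢ + 0 → δℤ z ≡ + 0
δℤ-≢ {+ zero} ne = ⊥-elim (ne refl)
δℤ-≢ {+ suc _} ne = refl
δℤ-≢ { -[1+ _ ]} ne = refl

δℕ-sym : ∀ m n → δℕ m n ≡ δℕ n m
δℕ-sym zero zero = refl
δℕ-sym zero (suc n) = refl
δℕ-sym (suc m) zero = refl
δℕ-sym (suc m) (suc n) = δℕ-sym m n

-- The Cauchy kernel and the coefficient of `x^L`.

δW : ∀ {a} → W a → ℤ
δW (u , e) = δℤ u ℤ.* δV e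

-- The second alphabet needs negative exponents because inverses of its letters will be substituted
-- for the first alphabet. Its first letter is `u`.
weightHom : ∀ {a} → Hom (VM (suc a)) (Grp.cmon (Wᵍ a))
weightHom = record { ⟦_⟧ = λ { (n ∷ v) → + n , Vec.map +_ v } ; ⟦∙⟧ = λ { (n ∷ v) (n′ ∷ v′) → cong (+ (n ℕ.+ n′) ,_) (go v v′) } ; ⟦ε⟧ = cong (+ 0 ,_) (z _) }
  where
  go : ∀ {a} (v v′ : Vec ℕ a) → Vec.map +_ (v ⊕ v′) ≡ Vec.zipWith ℤ._+_ (Vec.map +_ v) (Vec.map +_ v′)
  go [] [] = refl
  go (x ∷ v) (x′ ∷ v′) = cong (_ ∷_) (go v v′)
  z : ∀ a → Vec.map +_ (0N {a}) ≡ 0V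
  z zero = refl
  z (suc a) = cong (_ ∷_) (z a)

⟦_⟧ᵂ : ∀ {a} → Vec ℕ (suc a) → W a
⟦_⟧ᵂ = Hom.⟦_⟧ weightHom

allVars : ∀ a → List (W a)
allVars a = u₀ ∷ vars a

weight-units : ∀ a → map ⟦_⟧ᵂ (unitsN (suc a)) ≡ allVars a
weight-units a = cong₂ _∷_ (cong (+ 1 ,_) (zeroes a)) (trans (sym (Listₚ.map-∘ (unitsN a))) (go a))
  where
  zeroes : ∀ a → Vec.map +_ (0N {a}) ≡ 0V
  zeroes zero = refl
  zeroes (suc a) = cong (_ ∷_) (zeroes a)
  go : ∀ a → map (λ v → ⟦ 0 ∷ v ⟧ᵂ) (unitsN a) ≡ vars a
  go zero = refl
  go (suc a) = cong₂ _∷_ (cong (λ v → + 0 , + 1 ∷ v) (zeroes a)) (trans (sym (Listₚ.map-∘ (unitsN a)))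
    (trans (Listₚ.map-∘ (unitsN a)) (cong (map (Hom.⟦_⟧ embed)) (go a))))

eqV-weight : ∀ {a} (x l : Vec ℕ (suc a)) → eqV x l ≡ δW (⟦ x ⟧ᵂ W.⊖ ⟦ l ⟧ᵂ)
eqV-weight (x ∷ xs) (l ∷ ls) = cong₂ ℤ._*_ (δ x l) (go xs ls)
  where
  δ : ∀ x l → δℕ x l ≡ δℤ (+ x ℤ.+ ℤ.- (+ l))
  δ x l = trans (δℕ-sym x l) (sym (trans (cong δℤ (ℤₚ.+-comm (+ x) (ℤ.- (+ l)))) (δℤ-minus l x)))
  go : ∀ {a} (x l : Vec ℕ a) → eqV x l ≡ δV (Vec.zipWith ℤ._+_ (Vec.map +_ x) (Vec.map ℤ.-_ (Vec.map +_ l)))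
  go [] [] = refl
  go (x ∷ xs) (l ∷ ls) = cong₂ ℤ._*_ (δ x l) (go xs ls)

_≤V_ : ∀ {m} → Vec ℕ m → Vec ℕ m → Set
[] ≤V [] = ⊤
(x ∷ xs) ≤V (l ∷ ls) = x ℕ.≤ l × xs ≤V ls

_∸V_ : ∀ {m} → Vec ℕ m → Vec ℕ m → Vec ℕ m
_∸V_ = Vec.zipWith ℕ._∸_

module _ (M : CMon) where
  open CMon M

  powprodV : ∀ {m} → List E → Vec ℕ m → E
  powprodV ws x = powprod ws (Vec.toList x)

  pow-+ : ∀ b c e → pow (b ℕ.+ c) e ≡ pow b e ∙ pow c e
  pow-+ zero c e = sym (idˡ _)
  pow-+ (suc b) c e = trans (cong (e ∙_) (pow-+ b c e)) (sym (assoc e _ _))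

  pow-ε : ∀ b → pow b ε ≡ ε
  pow-ε zero = refl
  pow-ε (suc b) = trans (idˡ _) (pow-ε b)

  powprodV-⊕ : ∀ {m} ws (x y : Vec ℕ m) → powprodV ws (x ⊕ y) ≡ powprodV ws x ∙ powprodV ws y
  powprodV-⊕ [] [] [] = sym (idˡ ε)
  powprodV-⊕ [] (x ∷ xs) (y ∷ ys) = sym (idˡ ε)
  powprodV-⊕ (w ∷ ws) [] [] = sym (idˡ ε)
  powprodV-⊕ (w ∷ ws) (x ∷ xs) (y ∷ ys) = trans (cong₂ _∙_ (pow-+ x y w) (powprodV-⊕ ws xs ys)) (∙-interchange M (pow x w) (pow y w) _ _)

  powprodV-0 : ∀ m ws → powprodV {m} ws 0N ≡ ε
  powprodV-0 zero [] = refl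
  powprodV-0 zero (w ∷ ws) = refl
  powprodV-0 (suc m) [] = refl
  powprodV-0 (suc m) (w ∷ ws) = trans (idˡ _) (powprodV-0 m ws)

  powprodV-units : ∀ {m} ws → length ws ≡ m → map (powprodV ws) (unitsN m) ≡ ws
  powprodV-units [] refl = refl
  powprodV-units {suc m} (w ∷ ws) p = cong₂ _∷_ (trans (cong₂ _∙_ (idʳ w) (powprodV-0 m ws)) (idʳ w))
    (trans (sym (Listₚ.map-∘ (unitsN m))) (trans (Listₚ.map-cong (λ x → idˡ (powprodV ws x)) (unitsN m)) (powprodV-units ws (ℕₚ.suc-injective p))))

∸V-⊕ : ∀ {m} (x l : Vec ℕ m) → x ≤V l → (l ∸V x) ⊕ x ≡ l
∸V-⊕ [] [] _ = refl
∸V-⊕ (x ∷ xs) (l ∷ ls) (p , q) = cong₂ _∷_ (ℕₚ.m∸n+n≡m p) (∸V-⊕ xs ls q)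

-- The multiple geometric sum ∑_b g (∑ bᵢ uᵢ, ∏ wᵢ^bᵢ).
module BoxSum (Y : CMon) (D : ℕ) where
  open CMon Y

  boxSum : ∀ {m} → List (Vec ℕ m) → List E → (Vec ℕ m → E → ℤ) → ℤ
  boxSum (u ∷ us) (w ∷ ws) g = ∑≤ D (λ b → boxSum us ws (λ x y → g (CMon.pow (VM _) b u ⊕ x) (pow b w ∙ y)))
  boxSum _ _ g = g 0N ε

  boxSum-cong : ∀ {m} (us : List (Vec ℕ m)) ws {g h} → (∀ x y → g x y ≡ h x y) → boxSum us ws g ≡ boxSum us ws h
  boxSum-cong [] ws e = e _ _
  boxSum-cong (u ∷ us) [] e = e _ _
  boxSum-cong (u ∷ us) (w ∷ ws) e = ∑≤-cong D (λ b → boxSum-cong us ws (λ x y → e _ _))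

  boxSum-0 : ∀ {m} (us : List (Vec ℕ m)) ws {g} → (∀ x y → g x y ≡ + 0) → boxSum us ws g ≡ + 0
  boxSum-0 [] ws e = e _ _
  boxSum-0 (u ∷ us) [] e = e _ _
  boxSum-0 (u ∷ us) (w ∷ ws) e = ∑≤-0 D (λ b → boxSum-0 us ws (λ x y → e _ _))

  boxSum-cons : ∀ {m} (us : List (Vec ℕ m)) ws g → boxSum (map (0 ∷_) us) ws g ≡ boxSum us ws (λ x y → g (0 ∷ x) y)
  boxSum-cons [] ws g = refl
  boxSum-cons (u ∷ us) [] g = refl
  boxSum-cons (u ∷ us) (w ∷ ws) g = ∑≤-cong D (λ b → trans (boxSum-cons us ws _) (boxSum-cong us ws (λ x y →
    cong (λ z → g (z ⊕ (0 ∷ x)) (pow b w ∙ y)) (sym (Hom.⟦pow⟧ consHom b u)))))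

  -- In coordinate `i` only `b = lᵢ - xᵢ` contributes; this is a true difference by `x ≤V l` and
  -- lies within the truncation because `Vec.sum l ≤ D`.
  boxSum-units : ∀ {m} ws → length ws ≡ m → ∀ (x l : Vec ℕ m) → x ≤V l → Vec.sum l ℕ.≤ D → ∀ H →
    boxSum (unitsN m) ws (λ c y → eqV (c ⊕ x) l ℤ.* H y) ≡ H (powprodV Y ws (l ∸V x))
  boxSum-units [] refl [] [] _ _ H = ℤₚ.*-identityˡ _
  boxSum-units {suc m} (w ∷ ws) p (x ∷ xs) (l ∷ ls) (q , r) s H = begin
    ∑≤ D (λ b → boxSum (map (0 ∷_) (unitsN m)) ws (λ c y → eqV ((CMon.pow (VM (suc m)) b (1 ∷ 0N) ⊕ c) ⊕ (x ∷ xs)) (l ∷ ls) ℤ.* H (pow b w ∙ y)))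
      ≡⟨ ∑≤-cong D (λ b → trans (boxSum-cons (unitsN m) ws _) (trans (boxSum-cong (unitsN m) ws (λ c y → inner b c y))
           (boxSum-units ws (ℕₚ.suc-injective p) xs ls r (ℕₚ.≤-trans (ℕₚ.m≤n+m _ l) s) (λ y → δℕ b (l ℕ.∸ x) ℤ.* H (pow b w ∙ y))))) ⟩
    ∑≤ D (λ b → δℕ b (l ℕ.∸ x) ℤ.* H (pow b w ∙ powprodV Y ws (ls ∸V xs))) ≡⟨ ∑≤-cong D (λ b → ℤₚ.*-comm (δℕ b (l ℕ.∸ x)) _) ⟩
    ∑≤ D (λ b → H (pow b w ∙ powprodV Y ws (ls ∸V xs)) ℤ.* δℕ b (l ℕ.∸ x))
      ≡⟨ ∑≤-δ D (l ℕ.∸ x) (λ b → H (pow b w ∙ powprodV Y ws (ls ∸V xs))) (ℕₚ.≤-trans (ℕₚ.m∸n≤m l x) (ℕₚ.≤-trans (ℕₚ.m≤m+n l _) s)) ⟩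
    H (pow (l ℕ.∸ x) w ∙ powprodV Y ws (ls ∸V xs)) ∎
    where
    open ≡-Reasoning
    rearrange : ∀ a b c → (a ℤ.* b) ℤ.* c ≡ b ℤ.* (a ℤ.* c)
    rearrange = ℤSolver.solve-∀
    inner : ∀ b c y → eqV ((CMon.pow (VM (suc m)) b (1 ∷ 0N) ⊕ (0 ∷ c)) ⊕ (x ∷ xs)) (l ∷ ls) ℤ.* H (pow b w ∙ y) ≡
      eqV (c ⊕ xs) ls ℤ.* (δℕ b (l ℕ.∸ x) ℤ.* H (pow b w ∙ y))
    inner b c y = trans (cong (ℤ._* H (pow b w ∙ y)) (trans (cong (λ z → eqV ((z ⊕ (0 ∷ c)) ⊕ (x ∷ xs)) (l ∷ ls)) (pow-unit b))
        (cong₂ ℤ._*_ (trans (cong (λ z → δℕ z l) (trans (cong (ℕ._+ x) (ℕₚ.+-identityʳ b)) (ℕₚ.+-comm b x))) (δℕ-+ x b l q)) (cong (λ z → eqV (z ⊕ xs) ls) (0N-⊕ c)))))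
      (rearrange (δℕ b (l ℕ.∸ x)) (eqV (c ⊕ xs) ls) (H (pow b w ∙ y)))

-- Two truncations meet here. `G` is graded by the total x-degree and cut off at that of `x^L`,
-- which makes the factors `1 - xᵢ yⱼ` invertible; `B` is graded by `t` and cut off at `k`.
module Integral (a k : ℕ) (L : Vec ℕ (suc a)) (k≤D : k ℕ.≤ Vec.sum L) where
  D : ℕ
  D = Vec.sum L
  Wc : CMon
  Wc = Grp.cmon (Wᵍ a)
  M₁ : CMon
  M₁ = VM (suc a) ×M Wc ×M ℕM
  E₁ : Set
  E₁ = CMon.E M₁
  us : List (Vec ℕ (suc a))
  us = unitsN (suc a)
  Ys : List (W a)
  Ys = allVars a
  hL : W a
  hL = ⟦ L ⟧ᵂ

  module G = FacRing M₁ (Vec.sum ∘ proj₁) (λ e e′ → sum-⊕ (proj₁ e) (proj₁ e′)) D D ℕₚ.≤-refl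
  module GP = Pairings {M₁} {Vec.sum ∘ proj₁} {λ e e′ → sum-⊕ (proj₁ e) (proj₁ e′)} {D} {D} {ℕₚ.≤-refl}
  module B = Laurent a k D k≤D
  module BP = Pairings {LM a} {proj₁} {λ _ _ → refl} {k} {D} {k≤D}

  -- The coefficients of x^L and y^L in a monomial times the Vandermonde product.
  altX : Vec ℕ (suc a) → ℤ
  altX x = Terms.⟨_,_⟩ (VM (suc a)) (Eval.ev (VM (suc a)) D (vdm us)) (λ x′ → eqV (x′ ⊕ x) L)

  altY : W a → ℤ
  altY y = Terms.⟨_,_⟩ Wc (Eval.ev Wc D (vdm Ys)) (λ y′ → δW ((y′ W.∙ y) W.⊖ hL))

  altX≡altY : ∀ x → altX x ≡ altY ⟦ x ⟧ᵂ
  altX≡altY x = begin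
    altX x ≡⟨ Terms.⟨⟩-cong (VM (suc a)) (Eval.ev (VM (suc a)) D (vdm us)) (λ x′ → trans (eqV-weight (x′ ⊕ x) L) (cong (λ y → δW (y W.⊖ hL)) (Hom.⟦∙⟧ weightHom x′ x))) ⟩
    Terms.⟨_,_⟩ (VM (suc a)) (Eval.ev (VM (suc a)) D (vdm us)) (λ x′ → δW ((⟦ x′ ⟧ᵂ W.∙ ⟦ x ⟧ᵂ) W.⊖ hL)) ≡⟨ ⟨ev⟩-hom weightHom D (vdm us) (λ y′ → δW ((y′ W.∙ ⟦ x ⟧ᵂ) W.⊖ hL)) ⟩
    Terms.⟨_,_⟩ Wc (Eval.ev Wc D (map (mapFac ⟦_⟧ᵂ) (vdm us))) (λ y′ → δW ((y′ W.∙ ⟦ x ⟧ᵂ) W.⊖ hL))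
      ≡⟨ cong (λ fs → Terms.⟨_,_⟩ Wc (Eval.ev Wc D fs) (λ y′ → δW ((y′ W.∙ ⟦ x ⟧ᵂ) W.⊖ hL))) (trans (vdm-map ⟦_⟧ᵂ us) (cong vdm (weight-units a))) ⟩
    altY ⟦ x ⟧ᵂ ∎
    where open ≡-Reasoning

  target : E₁ → ℤ
  target (x , (y , z)) = eqV x L ℤ.* (δW (y W.⊖ hL) ℤ.* δℕ k z)

  target-test : G.MR.Test target
  target-test (x , (y , z)) l = cong (ℤ._* (δW (y W.⊖ hL) ℤ.* δℕ k z)) (eqV-≢ {x = x} {L} (λ e → ℕₚ.<⇒≢ l (sym (cong Vec.sum e))))

  integrand : E₁ → ℤ
  integrand (x , (y , z)) = altX x ℤ.* (altY y ℤ.* twoRow k z)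

  ι₁ : Hom (VM (suc a)) M₁
  ι₁ = record { ⟦_⟧ = λ x → x , (W.ε , 0) ; ⟦∙⟧ = λ x x′ → cong (x ⊕ x′ ,_) (cong (_, 0) (sym (W.idˡ _))) ; ⟦ε⟧ = refl }
  ι₂ : Hom Wc M₁
  ι₂ = record { ⟦_⟧ = λ y → 0N , (y , 0) ; ⟦∙⟧ = λ y y′ → cong (_, (y W.∙ y′ , 0)) (sym (0N-⊕ 0N)) ; ⟦ε⟧ = refl }
  ι₃ : Hom ℕM M₁
  ι₃ = record { ⟦_⟧ = λ z → 0N , (W.ε , z) ; ⟦∙⟧ = λ z z′ → cong₂ _,_ (sym (0N-⊕ 0N)) (cong (_, z ℕ.+ z′) (sym (W.idˡ _))) ; ⟦ε⟧ = refl }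

  V₁ V₂ V₃ : G.T.Carrier
  V₁ = G.ev (vdm (map (Hom.⟦_⟧ ι₁) us))
  V₂ = G.ev (vdm (map (Hom.⟦_⟧ ι₂) Ys))
  V₃ = G.ev (diff (0N , (W.ε , 0)) (0N , (W.ε , 1)) ∷ [])

  -- Multiplication by `V(x) V(y) (1 - t)` is moved from the functional into the ring, which leaves
  -- the plain coefficient `target`.
  integrand≡ : ∀ e → integrand e ≡ G.T.⟨_,_⟩ (V₁ G.T.* (V₂ G.T.* V₃)) (λ b → target (CMon._∙_ M₁ e b))
  integrand≡ e@(x , (y , z)) = sym (begin
    G.T.⟨_,_⟩ (V₁ G.T.* (V₂ G.T.* V₃)) (λ b → target (e ∙ b)) ≡⟨ G.T.⟨⟩-* V₁ _ _ ⟩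
    G.T.⟨_,_⟩ V₁ (λ b → G.T.⟨_,_⟩ (V₂ G.T.* V₃) (λ c → target (e ∙ (b ∙ c)))) ≡⟨ G.T.⟨⟩-cong V₁ (λ b → G.T.⟨⟩-* V₂ V₃ _) ⟩
    G.T.⟨_,_⟩ V₁ (λ b → G.T.⟨_,_⟩ V₂ (λ c → G.T.⟨_,_⟩ V₃ (λ d → target (e ∙ (b ∙ (c ∙ d))))))
      ≡⟨ pair₁ (λ b → G.T.⟨_,_⟩ V₂ (λ c → G.T.⟨_,_⟩ V₃ (λ d → target (e ∙ (b ∙ (c ∙ d)))))) ⟩
    X.⟨_,_⟩ P₁ (λ x′ → G.T.⟨_,_⟩ V₂ (λ c → G.T.⟨_,_⟩ V₃ (λ d → target (e ∙ (ι x′ ∙ (c ∙ d))))))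
      ≡⟨ X.⟨⟩-cong P₁ (λ x′ → pair₂ (λ c → G.T.⟨_,_⟩ V₃ (λ d → target (e ∙ (ι x′ ∙ (c ∙ d)))))) ⟩
    X.⟨_,_⟩ P₁ (λ x′ → Y.⟨_,_⟩ P₂ (λ y′ → G.T.⟨_,_⟩ V₃ (λ d → target (e ∙ (ι x′ ∙ (Hom.⟦_⟧ ι₂ y′ ∙ d))))))
      ≡⟨ X.⟨⟩-cong P₁ (λ x′ → Y.⟨⟩-cong P₂ (λ y′ → trans (sym (⟨ev⟩-hom ι₃ D (diff 0 1 ∷ []) (λ d → target (e ∙ (ι x′ ∙ (Hom.⟦_⟧ ι₂ y′ ∙ d)))))) (trans (Z.⟨⟩-cong P₃ (λ z′ → point x′ y′ z′))
           (trans (Z.⟨⟩-scale P₃ (eqV (x′ ⊕ x) L) _) (cong (eqV (x′ ⊕ x) L ℤ.*_) (Z.⟨⟩-scale P₃ (δW ((y′ W.∙ y) W.⊖ hL)) _)))))) ⟩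
    X.⟨_,_⟩ P₁ (λ x′ → Y.⟨_,_⟩ P₂ (λ y′ → eqV (x′ ⊕ x) L ℤ.* (δW ((y′ W.∙ y) W.⊖ hL) ℤ.* T₃)))
      ≡⟨ X.⟨⟩-cong P₁ (λ x′ → trans (Y.⟨⟩-scale P₂ (eqV (x′ ⊕ x) L) _) (cong (eqV (x′ ⊕ x) L ℤ.*_) (trans (Y.⟨⟩-cong P₂ (λ y′ → ℤₚ.*-comm (δW ((y′ W.∙ y) W.⊖ hL)) T₃)) (Y.⟨⟩-scale P₂ T₃ _)))) ⟩
    X.⟨_,_⟩ P₁ (λ x′ → eqV (x′ ⊕ x) L ℤ.* (T₃ ℤ.* altY y))
      ≡⟨ trans (X.⟨⟩-cong P₁ (λ x′ → ℤₚ.*-comm (eqV (x′ ⊕ x) L) _)) (X.⟨⟩-scale P₁ (T₃ ℤ.* altY y) _) ⟩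
    (T₃ ℤ.* altY y) ℤ.* altX x ≡⟨ trans (ℤₚ.*-comm _ (altX x)) (cong (altX x ℤ.*_) (trans (ℤₚ.*-comm T₃ (altY y)) (cong (altY y ℤ.*_) T₃≡))) ⟩
    altX x ℤ.* (altY y ℤ.* twoRow k z) ∎)
    where
    open ≡-Reasoning
    open CMon M₁ using (_∙_)
    module X = Terms (VM (suc a))
    module Y = Terms Wc
    module Z = Terms ℕM
    ι = Hom.⟦_⟧ ι₁
    P₁ = Eval.ev (VM (suc a)) D (vdm us)
    P₂ = Eval.ev Wc D (vdm Ys)
    P₃ = Eval.ev ℕM D (diff 0 1 ∷ [])
    pair₁ : ∀ g → G.T.⟨_,_⟩ V₁ g ≡ X.⟨_,_⟩ P₁ (g ∘ ι)
    pair₁ g = trans (cong (λ fs → G.T.⟨_,_⟩ (G.ev fs) g) (sym (vdm-map (Hom.⟦_⟧ ι₁) us))) (sym (⟨ev⟩-hom ι₁ D (vdm us) g))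
    pair₂ : ∀ g → G.T.⟨_,_⟩ V₂ g ≡ Y.⟨_,_⟩ P₂ (g ∘ Hom.⟦_⟧ ι₂)
    pair₂ g = trans (cong (λ fs → G.T.⟨_,_⟩ (G.ev fs) g) (sym (vdm-map (Hom.⟦_⟧ ι₂) Ys))) (sym (⟨ev⟩-hom ι₂ D (vdm Ys) g))
    T₃ = Z.⟨_,_⟩ P₃ (λ z′ → δℕ k (z′ ℕ.+ z))
    T₃≡ : T₃ ≡ twoRow k z
    T₃≡ = trans (Z.⟨⟩-* (Z.mono 0 Z.+ (Z.- Z.mono 1)) Z.1# _) (trans (Z.⟨⟩-+ (Z.mono 0) _ _) (cong₂ ℤ._+_ (one 0)
      (trans (Z.⟨⟩-neg (Z.mono 1) _) (cong ℤ.-_ (one 1)))))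
      where
      one : ∀ d → Z.⟨_,_⟩ (Z.mono d) (λ i → Z.⟨_,_⟩ Z.1# (λ j → δℕ k ((i ℕ.+ j) ℕ.+ z))) ≡ δℕ k (d ℕ.+ z)
      one d = trans (Z.⟨⟩-mono d _) (trans (cong (λ o → Z.⟨_,_⟩ o (λ j → δℕ k ((d ℕ.+ j) ℕ.+ z))) Z.1≡mono) (trans (Z.⟨⟩-mono 0 _) (cong (λ i → δℕ k (i ℕ.+ z)) (ℕₚ.+-identityʳ d))))
    point : ∀ x′ y′ z′ → target (e ∙ (ι x′ ∙ (Hom.⟦_⟧ ι₂ y′ ∙ Hom.⟦_⟧ ι₃ z′))) ≡ eqV (x′ ⊕ x) L ℤ.* (δW ((y′ W.∙ y) W.⊖ hL) ℤ.* δℕ k (z′ ℕ.+ z))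
    point x′ y′ z′ = cong target (cong₂ _,_ xs (cong₂ _,_ ys (ℕₚ.+-comm z z′)))
      where
      xs : x ⊕ (x′ ⊕ (0N ⊕ 0N)) ≡ x′ ⊕ x
      xs = trans (CMon.comm (VM (suc a)) x _) (cong (_⊕ x) (trans (cong (x′ ⊕_) (0N-⊕ 0N)) (CMon.idʳ (VM (suc a)) x′)))
      ys : y W.∙ (W.ε W.∙ (y′ W.∙ W.ε)) ≡ y′ W.∙ y
      ys = trans (W.comm y _) (cong (W._∙ y) (trans (W.idˡ _) (W.idʳ y′)))

  -- The letters `xᵢ yⱼ` and `t xᵢ yⱼ`: the character with two rows contributes the alphabet `1, t`.
  ms : List E₁
  ms = List.cartesianProduct us (List.cartesianProduct Ys (0 ∷ 1 ∷ []))

  grid : List (Vec ℕ (suc a)) → List (Fac E₁)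
  grid xs = concatMap (λ x → map (λ y → geo (x , (y , 1))) Ys) xs

  1-t : List (Fac E₁)
  1-t = diff (0N , (W.ε , 0)) (0N , (W.ε , 1)) ∷ []

  fs : List (Fac E₁)
  fs = grid us ++ 1-t

  Q : Vec ℕ (suc a) → W a → G.T.Carrier
  Q x y = G.fac (geo (x , (y , 0)))

  sum-0N : ∀ m → Vec.sum (0N {m}) ≡ 0
  sum-0N zero = refl
  sum-0N (suc m) = sum-0N m

  units-sum : ∀ m → All (λ u → Vec.sum u ≡ 1) (unitsN m)
  units-sum zero = []
  units-sum (suc m) = cong suc (sum-0N m) ∷ Allₚ.map⁺ (units-sum m)

  -- Only the factors `1/(1 - xᵢ yⱼ)` enter Cauchy's determinant; those with `t`, together with
  -- `1 - t`, are carried along in `fs`.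
  kernel : G.ev (map geo ms) G.R.* (V₁ G.R.* (V₂ G.R.* V₃)) G.R.≈ G.Alt.altPerm (suc a) Ys (λ w → G.Alt.zipΠ Q us w G.R.* G.ev fs)
  kernel = begin
    G.ev (map geo ms) * (V₁ * (V₂ * V₃)) ≈⟨ R.*-cong product≈ (R.*-cong (vd ι₁ us) (R.*-congʳ (vd ι₂ Ys))) ⟩
    (∏ us (λ x → ∏ Ys (Q x)) * Q₁) * (V x₁ us * (V y₁ Ys * V₃))
      ≈⟨ solve 5 (λ q r v w t → (q :* r) :* (v :* (w :* t)) := (v :* w :* q) :* (r :* t)) R.refl _ Q₁ (V x₁ us) (V y₁ Ys) V₃ ⟩
    (V x₁ us * V y₁ Ys * ∏ us (λ x → ∏ Ys (Q x))) * (Q₁ * V₃) ≈⟨ R.*-cong (G.Alt.cauchy x₁ y₁ Q us inverses Ys lengths) (R.sym ev-fs) ⟩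
    G.Alt.det Q us Ys * G.ev fs ≈⟨ R.*-congʳ (R.trans (G.Alt.det-altPerm Q us Ys) (R.reflexive (cong (λ n → G.Alt.altPerm n Ys (G.Alt.zipΠ Q us)) (length-unitsN (suc a))))) ⟩
    G.Alt.altPerm (suc a) Ys (G.Alt.zipΠ Q us) * G.ev fs ≈⟨ G.Alt.altPerm-*ʳ (suc a) Ys (G.ev fs) {G.Alt.zipΠ Q us} ⟩
    G.Alt.altPerm (suc a) Ys (λ w → G.Alt.zipΠ Q us w * G.ev fs) ∎
    where
    module R = G.R
    open R using (_*_; _+_; -_; _-_; _≈_; 1#)
    open G.Alt using (∏; V)
    open IntegerSolver G.MR.ring using (solve; _:*_; _:=_)
    open Relation.Binary.Reasoning.Setoid R.setoid
    x₁ : Vec ℕ (suc a) → G.T.Carrier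
    x₁ x = G.T.mono (Hom.⟦_⟧ ι₁ x)
    y₁ : W a → G.T.Carrier
    y₁ y = G.T.mono (Hom.⟦_⟧ ι₂ y)
    Q₁ : G.T.Carrier
    Q₁ = ∏ us (λ x → ∏ Ys (λ y → G.fac (geo (x , (y , 1)))))
    lengths : length us ≡ length Ys
    lengths = trans (length-unitsN (suc a)) (cong suc (sym (length-vars a)))
    vd : ∀ {M} (φ : Hom M M₁) ys → G.ev (vdm (map (Hom.⟦_⟧ φ) ys)) ≈ V (λ y → G.T.mono (Hom.⟦_⟧ φ y)) ys
    vd φ ys = R.trans (G.ev-vdm (map (Hom.⟦_⟧ φ) ys)) (G.Alt.V-map G.T.mono (Hom.⟦_⟧ φ) ys)
    ev-cartesian : ∀ {A B : Set} (g : A × B → Fac E₁) xs ys → G.ev (map g (List.cartesianProduct xs ys)) ≈ ∏ xs (λ x → ∏ ys (λ y → G.fac (g (x , y))))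
    ev-cartesian g [] ys = R.refl
    ev-cartesian g (x ∷ xs) ys = R.trans (R.reflexive (cong G.ev (trans (Listₚ.map-++ g (map (x ,_) ys) _) (cong (_++ map g (List.cartesianProduct xs ys)) (sym (Listₚ.map-∘ ys))))))
      (R.trans (G.ev-++ (map (λ y → g (x , y)) ys) _) (R.*-cong (G.ev-map (λ y → g (x , y)) ys) (ev-cartesian g xs ys)))
    ∏-cartesian : ∀ {A B : Set} (xs : List A) (ys : List B) (h : A × B → G.T.Carrier) → ∏ (List.cartesianProduct xs ys) h ≈ ∏ xs (λ x → ∏ ys (λ y → h (x , y)))
    ∏-cartesian [] ys h = R.refl
    ∏-cartesian (x ∷ xs) ys h = R.trans (∏-++ (map (x ,_) ys) _) (R.*-cong (G.Alt.∏-map (x ,_) ys) (∏-cartesian xs ys h))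
      where
      ∏-++ : ∀ {A : Set} (xs ys : List A) {h} → ∏ (xs ++ ys) h ≈ ∏ xs h * ∏ ys h
      ∏-++ [] ys = R.sym (R.*-identityˡ _)
      ∏-++ (x ∷ xs) ys = R.trans (R.*-congˡ (∏-++ xs ys)) (R.sym (R.*-assoc _ _ _))
    product≈ : G.ev (map geo ms) ≈ ∏ us (λ x → ∏ Ys (Q x)) * Q₁
    product≈ = R.trans (ev-cartesian geo us (List.cartesianProduct Ys (0 ∷ 1 ∷ []))) (R.trans
      (G.Alt.∏-cong us (λ x → R.trans (∏-cartesian Ys (0 ∷ 1 ∷ []) _) (R.trans (G.Alt.∏-cong Ys (λ y → R.*-congˡ (R.*-identityʳ _))) (R.sym (G.Alt.∏-* Ys)))))
      (R.sym (G.Alt.∏-* us)))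
    ev-fs : G.ev fs ≈ Q₁ * V₃
    ev-fs = R.trans (G.ev-++ (grid us) 1-t) (R.*-congʳ
      (R.trans (G.ev-concatMap (λ x → map (λ y → geo (x , (y , 1))) Ys) us) (G.Alt.∏-cong us (λ x → G.ev-map (λ y → geo (x , (y , 1))) Ys))))
    inverses : All (λ x → ∀ y → (1# - x₁ x * y₁ y) * Q x y ≈ 1#) us
    inverses = All.map (λ {x} s y → R.trans (R.*-congʳ (R.+-congˡ (R.-‿cong (R.trans (G.MR.mono-* _ _)
        (R.reflexive (cong G.T.mono (cong₂ _,_ (CMon.idʳ (VM (suc a)) x) (cong (_, 0) (W.idˡ y)))))))))
      (G.geo-inverse (x , (y , 0)) (ℕₚ.≤-reflexive (sym s)))) (units-sum (suc a))

  open BoxSum Wc D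

  ⟨zipΠ⟩ : ∀ xs ws f → G.T.⟨_,_⟩ (G.Alt.zipΠ Q xs ws) f ≡ boxSum xs ws (λ x y → f (x , (y , 0)))
  ⟨zipΠ⟩ [] ws f = trans (cong (λ o → G.T.⟨_,_⟩ o f) G.T.1≡mono) (G.T.⟨⟩-mono _ f)
  ⟨zipΠ⟩ (x ∷ xs) [] f = trans (cong (λ o → G.T.⟨_,_⟩ o f) G.T.1≡mono) (G.T.⟨⟩-mono _ f)
  ⟨zipΠ⟩ (x ∷ xs) (w ∷ ws) f = trans (G.T.⟨⟩-* (Q x w) _ f) (trans (Eval.⟨series⟩ M₁ D D (x , (w , 0)) _)
    (∑≤-cong D (λ b → trans (⟨zipΠ⟩ xs ws _) (boxSum-cong xs ws (λ x′ y′ → cong (λ p → f (CMon._∙_ M₁ p (x′ , (y′ , 0)))) (pow≡ b))))))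
    where
    pow≡ : ∀ b → CMon.pow M₁ b (x , (w , 0)) ≡ (CMon.pow (VM (suc a)) b x , (CMon.pow Wc b w , 0))
    pow≡ b = trans (pow-× (VM (suc a)) (Wc ×M ℕM) b (x , (w , 0))) (cong (CMon.pow (VM (suc a)) b x ,_)
      (trans (pow-× Wc ℕM b (w , 0)) (cong (CMon.pow Wc b w ,_) (pow-ε ℕM b))))

  -- In `fs` every `xᵢ` is accompanied by a `t`, so no exponent of an `xᵢ` exceeds that of `t`.
  Bounded : E₁ → Set
  Bounded (x , (y , z)) = x ≤V Vec.replicate (suc a) z

  fs-bounded : G.T.Supp Bounded (G.ev fs)
  fs-bounded = G.supp-ev (b0 (suc a) 0) (λ {e} {e′} → b+ (proj₁ e) (proj₁ e′))
    (Allₚ.++⁺ (grid-bounded us (units-≤ (suc a))) ((b0 (suc a) 0 , b0 (suc a) 1) ∷ []))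
    where
    b0 : ∀ m z → 0N {m} ≤V Vec.replicate m z
    b0 zero z = tt
    b0 (suc m) z = z≤n , b0 m z
    b+ : ∀ {m z z′} (x x′ : Vec ℕ m) → x ≤V Vec.replicate m z → x′ ≤V Vec.replicate m z′ → (x ⊕ x′) ≤V Vec.replicate m (z ℕ.+ z′)
    b+ [] [] _ _ = tt
    b+ (x ∷ xs) (x′ ∷ xs′) (p , q) (p′ , q′) = ℕₚ.+-mono-≤ p p′ , b+ xs xs′ q q′
    grid-bounded : ∀ xs → All (λ u → u ≤V Vec.replicate (suc a) 1) xs → All (AllFac Bounded) (grid xs)
    grid-bounded [] [] = []
    grid-bounded (x ∷ xs) (b ∷ bs) = Allₚ.++⁺ (Allₚ.map⁺ (All.universal (λ y → b) Ys)) (grid-bounded xs bs)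
    units-≤ : ∀ m → All (λ u → u ≤V Vec.replicate m 1) (unitsN m)
    units-≤ zero = []
    units-≤ (suc m) = (ℕₚ.≤-refl , b0 m 1) ∷ Allₚ.map⁺ (All.map (λ p → z≤n , p) (units-≤ m))

  shift : List (W a) → W a
  shift w = powprodV Wc w L W.⊖ hL

  -- The substitution `xᵢ = 1/wᵢ`. Extracting the coefficient of `x^L y^L` leaves in addition the
  -- monomial `w^L / y^L`, which is `shift w`.
  Θ : List (W a) → Hom M₁ (LM a)
  Θ w = record
    { ⟦_⟧ = λ (x , (y , z)) → z , y W.⊖ powprodV Wc w x
    ; ⟦∙⟧ = λ (x , (y , z)) (x′ , (y′ , z′)) → cong (z ℕ.+ z′ ,_) (trans (cong (λ p → (y W.∙ y′) W.⊖ p) (powprodV-⊕ Wc w x x′))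
        (trans (cong ((y W.∙ y′) W.∙_) (Hom.⟦∙⟧ (negHom (Wᵍ a)) (powprodV Wc w x) (powprodV Wc w x′))) (∙-interchange Wc y y′ _ _)))
    ; ⟦ε⟧ = cong (0 ,_) (trans (cong (λ p → W.ε W.⊖ p) (powprodV-0 Wc (suc a) w)) (W.inv W.ε))
    }

  module _ (k≤L : Vec.replicate (suc a) k ≤V L) where
    -- The factor `1/(1 - xᵢ wᵢ)` must supply `(xᵢ wᵢ)^b` with `b` equal to `Lᵢ` minus the exponent
    -- of `xᵢ` in `fs`. In degree `t^k` that exponent is at most `k ≤ Lᵢ`, so exactly one such `b`
    -- exists, and the outcome is `wᵢ^Lᵢ` times the substituted monomial.
    evaluate : ∀ w → length w ≡ suc a → G.T.⟨_,_⟩ (G.Alt.zipΠ Q us w G.T.* G.ev fs) target ≡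
      B.T.⟨_,_⟩ (B.T.mono (0 , shift w) B.T.* B.ev (map (mapFac (Hom.⟦_⟧ (Θ w))) fs)) (CT k a)
    evaluate w len = begin
      G.T.⟨_,_⟩ (G.Alt.zipΠ Q us w G.T.* G.ev fs) target ≡⟨ trans (G.T.⟨⟩-* (G.Alt.zipΠ Q us w) (G.ev fs) target) (G.T.⟨⟩-swap (G.Alt.zipΠ Q us w) (G.ev fs) _) ⟩
      G.T.⟨_,_⟩ (G.ev fs) (λ e → G.T.⟨_,_⟩ (G.Alt.zipΠ Q us w) (λ c → target (CMon._∙_ M₁ c e))) ≡⟨ G.T.⟨⟩-supp fs-bounded (λ e b → trans (⟨zipΠ⟩ us w _) (point e b)) ⟩
      G.T.⟨_,_⟩ (G.ev fs) (λ e → CT k a (CMon._∙_ (LM a) (0 , shift w) (Hom.⟦_⟧ (Θ w) e))) ≡⟨ ⟨ev⟩-hom (Θ w) D fs (λ e → CT k a (CMon._∙_ (LM a) (0 , shift w) e)) ⟩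
      B.T.⟨_,_⟩ (B.ev (map (mapFac (Hom.⟦_⟧ (Θ w))) fs)) (λ e → CT k a (CMon._∙_ (LM a) (0 , shift w) e)) ≡⟨ sym (B.MR.⟨mono*⟩ (0 , shift w) _ (CT k a)) ⟩
      B.T.⟨_,_⟩ (B.T.mono (0 , shift w) B.T.* B.ev (map (mapFac (Hom.⟦_⟧ (Θ w))) fs)) (CT k a) ∎
      where
      open ≡-Reasoning
      ≤V-trans : ∀ {m} {x y z : Vec ℕ m} → x ≤V y → y ≤V z → x ≤V z
      ≤V-trans {x = []} {[]} {[]} _ _ = tt
      ≤V-trans {x = _ ∷ _} {_ ∷ _} {_ ∷ _} (p , q) (p′ , q′) = ℕₚ.≤-trans p p′ , ≤V-trans q q′
      cancel : ∀ p q s l y → p W.∙ q ≡ s → (p W.∙ y) W.⊖ l ≡ (s W.⊖ l) W.∙ (y W.⊖ q)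
      cancel p q s l y e = sym (begin
        (s W.⊖ l) W.∙ (y W.⊖ q) ≡⟨ cong (λ s → (s W.⊖ l) W.∙ (y W.⊖ q)) (sym e) ⟩
        ((p W.∙ q) W.⊖ l) W.∙ (y W.⊖ q) ≡⟨ trans (cong (((p W.∙ q) W.⊖ l) W.∙_) (W.comm y _)) (∙-interchange Wc (p W.∙ q) (W.neg l) (W.neg q) y) ⟩
        ((p W.∙ q) W.⊖ q) W.∙ (W.neg l W.∙ y) ≡⟨ cong₂ W._∙_ (trans (W.assoc p q _) (trans (cong (p W.∙_) (W.inv q)) (W.idʳ p))) (W.comm _ y) ⟩
        p W.∙ (y W.⊖ l) ≡⟨ sym (W.assoc p y _) ⟩
        (p W.∙ y) W.⊖ l ∎)
      point : ∀ e → Bounded e → boxSum us w (λ x y → target (CMon._∙_ M₁ (x , (y , 0)) e)) ≡ CT k a (CMon._∙_ (LM a) (0 , shift w) (Hom.⟦_⟧ (Θ w) e))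
      point (x , (y , z)) b with k ℕ.≟ z
      ... | no k≢z = trans (boxSum-0 us w (λ x′ y′ → trans (cong (λ d → eqV (x′ ⊕ x) L ℤ.* (δW ((y′ W.∙ y) W.⊖ hL) ℤ.* d)) (δℕ-≢ k≢z))
              (trans (cong (eqV (x′ ⊕ x) L ℤ.*_) (ℤₚ.*-zeroʳ (δW ((y′ W.∙ y) W.⊖ hL)))) (ℤₚ.*-zeroʳ (eqV (x′ ⊕ x) L)))))
            (sym (cong (ℤ._* δW (shift w W.∙ (y W.⊖ powprodV Wc w x))) (δℕ-≢ k≢z)))
      ... | yes refl = trans (boxSum-units w len x L x≤L ℕₚ.≤-refl (λ y′ → δW ((y′ W.∙ y) W.⊖ hL) ℤ.* δℕ k k))
          (trans (cong (λ v → δW v ℤ.* δℕ k k) (cancel (powprodV Wc w (L ∸V x)) (powprodV Wc w x) (powprodV Wc w L) hL y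
              (trans (sym (powprodV-⊕ Wc w (L ∸V x) x)) (cong (powprodV Wc w) (∸V-⊕ x L x≤L)))))
            (ℤₚ.*-comm (δW (shift w W.∙ (y W.⊖ powprodV Wc w x))) (δℕ k k)))
        where
        x≤L : x ≤V L
        x≤L = ≤V-trans b k≤L

    cross′ : B.T.Carrier
    cross′ = B.cross Ys Ys B.R.* (B.R.1# B.R.- B.t)

    -- The product runs over all ratios `yⱼ/wᵢ`, and the `wᵢ` are the variables in another order; so
    -- it does not depend on `w`.
    ev-Θ : ∀ w → w ↭ Ys → B.ev (map (mapFac (Hom.⟦_⟧ (Θ w))) fs) B.R.≈ cross′
    ev-Θ w p = begin
      B.ev (map θ fs) ≈⟨ R.reflexive (cong B.ev (Listₚ.map-++ θ (grid us) 1-t)) ⟩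
      B.ev (map θ (grid us) ++ map θ 1-t) ≈⟨ B.ev-++ (map θ (grid us)) (map θ 1-t) ⟩
      B.ev (map θ (grid us)) * B.ev (map θ 1-t) ≈⟨ R.*-cong (R.trans (blocks us) square) last ⟩
      B.cross Ys Ys * (1# - B.t) ∎
      where
      module R = B.R
      open R using (_*_; _+_; -_; _-_; _≈_; 1#)
      open B.Alt using (∏)
      open Relation.Binary.Reasoning.Setoid R.setoid
      θ : Fac E₁ → Fac (ℕ × W a)
      θ = mapFac (Hom.⟦_⟧ (Θ w))
      blocks : ∀ us → B.ev (map θ (grid us)) ≈ ∏ us (λ x → ∏ Ys (λ y → B.g 1 (y W.⊖ powprodV Wc w x)))
      blocks [] = R.refl
      blocks (x ∷ us) = R.trans (R.reflexive (cong B.ev (Listₚ.map-++ θ (map (λ y → geo (x , (y , 1))) Ys) (grid us))))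
        (R.trans (B.ev-++ (map θ (map (λ y → geo (x , (y , 1))) Ys)) (map θ (grid us))) (R.*-cong (R.trans (R.reflexive (cong B.ev (sym (Listₚ.map-∘ Ys)))) (B.ev-map (λ y → θ (geo (x , (y , 1)))) Ys)) (blocks us)))
      square : ∏ us (λ x → ∏ Ys (λ y → B.g 1 (y W.⊖ powprodV Wc w x))) ≈ B.cross Ys Ys
      square = R.trans (R.sym (B.Alt.∏-map (powprodV Wc w) us)) (R.trans (R.reflexive (cong (λ l → ∏ l (λ w′ → ∏ Ys (λ y → B.g 1 (y W.⊖ w′))))
          (powprodV-units Wc w (trans (↭-length p) (cong suc (length-vars a))))))
        (R.trans (B.Alt.∏-↭ (λ w′ → ∏ Ys (λ y → B.g 1 (y W.⊖ w′))) p) (B.Alt.∏-swap Ys Ys)))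
      last : B.ev (map θ 1-t) ≈ 1# - B.t
      last = R.trans (R.*-identityʳ _) (R.trans (R.reflexive (cong (λ v → B.fac (diff (0 , v) (1 , v))) (cong proj₂ (Hom.⟦ε⟧ (Θ w))))) (R.+-congʳ B.mono-ε))

    residue : List (W a) → ℤ
    residue w = B.T.⟨_,_⟩ (B.T.mono (0 , shift w) B.T.* cross′) (CT k a)

    integral : G.T.⟨_,_⟩ (G.ev (map geo ms)) integrand ≡ Aℤ.altPerm (suc a) Ys residue
    integral = begin
      G.T.⟨_,_⟩ (G.ev (map geo ms)) integrand ≡⟨ G.T.⟨⟩-cong (G.ev (map geo ms)) integrand≡ ⟩
      G.T.⟨_,_⟩ (G.ev (map geo ms)) (λ e → G.T.⟨_,_⟩ (V₁ G.T.* (V₂ G.T.* V₃)) (λ b → target (CMon._∙_ M₁ e b))) ≡⟨ sym (G.T.⟨⟩-* (G.ev (map geo ms)) _ target) ⟩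
      G.T.⟨_,_⟩ (G.ev (map geo ms) G.T.* (V₁ G.T.* (V₂ G.T.* V₃))) target ≡⟨ G.MR.⟨ kernel ⟩≈ target-test ⟩
      G.T.⟨_,_⟩ (G.Alt.altPerm (suc a) Ys (λ w → G.Alt.zipΠ Q us w G.R.* G.ev fs)) target ≡⟨ GP.⟨altPerm⟩ (suc a) Ys (λ w → G.Alt.zipΠ Q us w G.R.* G.ev fs) target ⟩
      Aℤ.altPerm (suc a) Ys (λ w → G.T.⟨_,_⟩ (G.Alt.zipΠ Q us w G.R.* G.ev fs) target)
        ≡⟨ Aℤ.altPerm-cong (suc a) Ys (cong suc (length-vars a)) (λ w p → trans (evaluate w (trans (↭-length p) (cong suc (length-vars a))))
             (B.MR.⟨ B.R.*-congˡ (ev-Θ w p) ⟩≈ B.CT-test)) ⟩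
      Aℤ.altPerm (suc a) Ys residue ∎
      where open ≡-Reasoning

-- Fixing `u` and symmetrising the other variables.

lookup-δ : ∀ {m} (e : Vec ℤ m) j → Vec.lookup e j ≢ + 0 → δV e ≡ + 0
lookup-δ (z ∷ e) Fin.zero ne = cong (ℤ._* δV e) (δℤ-≢ ne)
lookup-δ (z ∷ e) (Fin.suc j) ne = trans (cong (δℤ z ℤ.*_) (lookup-δ e j ne)) (ℤₚ.*-zeroʳ (δℤ z))

coordinate : ∀ {a} → Fin a → Hom (Grp.cmon (Wᵍ a)) ℤM
coordinate {a} j = record { ⟦_⟧ = λ (u , e) → Vec.lookup e j ; ⟦∙⟧ = λ (u , e) (u′ , e′) → lookup-+ j e e′ ; ⟦ε⟧ = lookup-0 j }
  where
  lookup-+ : ∀ {a} (j : Fin a) e e′ → Vec.lookup (Vec.zipWith ℤ._+_ e e′) j ≡ Vec.lookup e j ℤ.+ Vec.lookup e′ j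
  lookup-+ Fin.zero (z ∷ e) (z′ ∷ e′) = refl
  lookup-+ (Fin.suc j) (z ∷ e) (z′ ∷ e′) = lookup-+ j e e′
  lookup-0 : ∀ {a} (j : Fin a) → Vec.lookup (0V {a}) j ≡ + 0
  lookup-0 Fin.zero = refl
  lookup-0 (Fin.suc j) = lookup-0 j

IsBit : ℤ → Set
IsBit z = z ≡ + 0 ⊎ z ≡ + 1

vars-bits : ∀ a (j : Fin a) → All (λ y → IsBit (Vec.lookup (proj₂ y) j)) (allVars a)
vars-bits a j = inj₁ (Hom.⟦ε⟧ (coordinate j)) ∷ go a j
  where
  go : ∀ a (j : Fin a) → All (λ y → IsBit (Vec.lookup (proj₂ y) j)) (vars a)
  go (suc a) Fin.zero = inj₂ refl ∷ Allₚ.map⁺ (All.universal (λ _ → inj₁ refl) (vars a))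
  go (suc a) (Fin.suc j) = inj₁ (Hom.⟦ε⟧ (coordinate j)) ∷ Allₚ.map⁺ (go a j)

vars-coordinate : ∀ a → All (λ y → ∃ λ j → Vec.lookup (proj₂ y) j ≡ + 1) (vars a)
vars-coordinate zero = []
vars-coordinate (suc a) = (Fin.zero , refl) ∷ Allₚ.map⁺ (All.map (λ (j , e) → Fin.suc j , e) (vars-coordinate a))

fromL-toList : ∀ {m} (v : Vec ℕ m) → fromL m (Vec.toList v) ≡ v
fromL-toList [] = refl
fromL-toList (x ∷ v) = cong (x ∷_) (fromL-toList v)

module Evaluation (a k L₀ : ℕ) (L′ : Vec ℕ a) (L′≡ : Vec.toList L′ ≡ map (k ℕ.+_) (downFrom a))
                  (large : k ℕ.+ (k ℕ.+ a) ℕ.< L₀) where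

  L : Vec ℕ (suc a)
  L = L₀ ∷ L′

  k≤L₀ : k ℕ.≤ L₀
  k≤L₀ = ℕₚ.≤-trans (ℕₚ.m≤m+n k _) (ℕₚ.<⇒≤ large)

  open Integral a k L (ℕₚ.≤-trans k≤L₀ (ℕₚ.m≤m+n L₀ _))
  open B using (v; v⁻; cross; tails; t; g)
  module R = B.R
  open R using (_*_; _+_; -_; _-_; 1#; _≈_)
  open B.Alt using (∏; V; altPerm; permSum)
  open Lists (Wᵍ a)
  open IntegerSolver B.MR.ring using (solve; _:*_; _:=_; :1)
  open Algebra.Properties.Semiring.Exp R.semiring using () renaming (_^_ to _^ʳ_)

  bs : List ℕ
  bs = map (k ℕ.+_) (downFrom a)

  entries-bounds : ∀ {m} n (l : Vec ℕ m) → Vec.toList l ≡ map (k ℕ.+_) (downFrom n) → Vec.replicate m k ≤V l × l ≤V Vec.replicate m (k ℕ.+ n)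
  entries-bounds n [] e = tt , tt
  entries-bounds (suc n) (x ∷ l) e with Listₚ.∷-injective e
  ... | refl , e′ with entries-bounds n l e′
  ... | lo , hi = (ℕₚ.m≤m+n k n , lo) , (ℕₚ.+-monoʳ-≤ k (ℕₚ.n≤1+n n) , weaken l hi)
    where
    weaken : ∀ {m} (l : Vec ℕ m) → l ≤V Vec.replicate m (k ℕ.+ n) → l ≤V Vec.replicate m (k ℕ.+ suc n)
    weaken [] _ = tt
    weaken (x ∷ l) (p , q) = ℕₚ.≤-trans p (ℕₚ.+-monoʳ-≤ k (ℕₚ.n≤1+n n)) , weaken l q

  k≤L : Vec.replicate (suc a) k ≤V L
  k≤L = k≤L₀ , proj₁ (entries-bounds a L′ L′≡)

  lookup-≤ : ∀ {m c} (l : Vec ℕ m) j → l ≤V Vec.replicate m c → Vec.lookup l j ℕ.≤ c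
  lookup-≤ (x ∷ l) Fin.zero (p , _) = p
  lookup-≤ (x ∷ l) (Fin.suc j) (_ , q) = lookup-≤ l j q

  -- A variable other than u raised to the large power L₀ cannot be compensated in degree k.
  residue-zero : ∀ j y w → Vec.lookup (proj₂ y) j ≡ + 1 → All (λ y → IsBit (Vec.lookup (proj₂ y) j)) w → residue k≤L (y ∷ w) ≡ + 0
  residue-zero j y w y₁ bits = begin
    B.T.⟨_,_⟩ (B.T.mono (0 , c) * cross′ k≤L) (CT k a) ≡⟨ B.MR.⟨ R.*-congˡ expand ⟩≈ B.CT-test ⟩
    B.T.⟨_,_⟩ (B.T.mono (0 , c) * B.ev kernelF) (CT k a) ≡⟨ B.MR.⟨mono*⟩ (0 , c) (B.ev kernelF) (CT k a) ⟩
    B.T.⟨_,_⟩ (B.ev kernelF) (λ e → CT k a (CMon._∙_ (LM a) (0 , c) e)) ≡⟨ B.T.⟨⟩-supp supported point ⟩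
    B.T.⟨_,_⟩ (B.ev kernelF) (λ _ → + 0) ≡⟨ B.T.⟨⟩-0ʳ (B.ev kernelF) (λ _ → refl) ⟩
    + 0 ∎
    where
    open ≡-Reasoning
    c = shift (y ∷ w)
    π : W a → ℤ
    π = Hom.⟦_⟧ (coordinate j)
    kernelF : List F
    kernelF = crossF Ys Ys ++ diff (0 , W.ε) (1 , W.ε) ∷ []
    expand : cross′ k≤L ≈ B.ev kernelF
    expand = R.sym (R.trans (B.ev-++ (crossF Ys Ys) _) (R.*-cong (B.ev-cross Ys Ys) (R.trans (R.*-identityʳ _) (R.+-congʳ B.mono-ε))))
    -- In every monomial of the kernel the exponent of the variable `j` is at least minus that of
    -- `t`: each ratio of variables has exponent at least `-1` and carries a `t`.
    S : ℕ × W a → Set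
    S (d , x) = ∃ λ n → + d ℤ.+ π x ≡ + n
    S-∙ : ∀ {e e′} → S e → S e′ → S (CMon._∙_ (LM a) e e′)
    S-∙ {d , x} {d′ , x′} (n , p) (n′ , p′) = n ℕ.+ n′ , trans (cong (λ z → + (d ℕ.+ d′) ℤ.+ z) (Hom.⟦∙⟧ (coordinate j) x x′))
      (trans (swap4 (+ d) (+ d′) (π x) (π x′)) (cong₂ ℤ._+_ p p′))
      where
      swap4 : ∀ a b c d → (a ℤ.+ b) ℤ.+ (c ℤ.+ d) ≡ (a ℤ.+ c) ℤ.+ (b ℤ.+ d)
      swap4 = ℤSolver.solve-∀
    S-ε : ∀ d → S (d , W.ε)
    S-ε d = d , trans (cong (λ z → + d ℤ.+ z) (Hom.⟦ε⟧ (coordinate j))) (ℤₚ.+-identityʳ _)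
    ratio : ∀ x x′ → IsBit (π x) → IsBit (π x′) → S (1 , x W.⊖ x′)
    ratio x x′ p p′ = let (n , e) = bits₂ p p′ in n , trans (cong (λ z → + 1 ℤ.+ z) (trans (Hom.⟦∙⟧ (coordinate j) x (W.neg x′)) (cong (λ z → π x ℤ.+ z) (lookup-neg j (proj₂ x′))))) e
      where
      lookup-neg : ∀ {a} (j : Fin a) (e : Vec ℤ a) → Vec.lookup (Vec.map ℤ.-_ e) j ≡ ℤ.- Vec.lookup e j
      lookup-neg Fin.zero (z ∷ e) = refl
      lookup-neg (Fin.suc j) (z ∷ e) = lookup-neg j e
      bits₂ : ∀ {z z′} → IsBit z → IsBit z′ → ∃ λ n → + 1 ℤ.+ (z ℤ.+ ℤ.- z′) ≡ + n
      bits₂ (inj₁ refl) (inj₁ refl) = 1 , refl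
      bits₂ (inj₁ refl) (inj₂ refl) = 0 , refl
      bits₂ (inj₂ refl) (inj₁ refl) = 2 , refl
      bits₂ (inj₂ refl) (inj₂ refl) = 1 , refl
    cross-S : ∀ xs ys → All (IsBit ∘ π) xs → All (IsBit ∘ π) ys → All (AllFac S) (crossF xs ys)
    cross-S [] ys _ _ = []
    cross-S (x ∷ xs) ys (p ∷ ps) qs = Allₚ.++⁺ (Allₚ.map⁺ (All.map (λ {y} q → ratio x y p q) qs)) (cross-S xs ys ps qs)
    supported : B.T.Supp S (B.ev kernelF)
    supported = B.supp-ev (S-ε 0) (λ {e} {e′} → S-∙ {e} {e′}) (Allₚ.++⁺ (cross-S Ys Ys (vars-bits a j) (vars-bits a j)) ((S-ε 0 , S-ε 1) ∷ []))
    π-powprod : ∀ {m} ws (l : Vec ℕ m) → All (IsBit ∘ π) ws → ∃ λ n → π (powprodV Wc ws l) ≡ + n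
    π-powprod [] l _ = 0 , Hom.⟦ε⟧ (coordinate j)
    π-powprod (w ∷ ws) [] _ = 0 , Hom.⟦ε⟧ (coordinate j)
    π-powprod (w ∷ ws) (b ∷ l) (p ∷ ps) with π-powprod ws l ps | bit p
      where
      bit : IsBit (π w) → ∃ λ n → π (CMon.pow Wc b w) ≡ + n
      bit (inj₁ e) = 0 , trans (Hom.⟦pow⟧ (coordinate j) b w) (trans (powℤ b (π w)) (trans (cong (+ b ℤ.*_) e) (ℤₚ.*-zeroʳ (+ b))))
      bit (inj₂ e) = b , trans (Hom.⟦pow⟧ (coordinate j) b w) (trans (powℤ b (π w)) (trans (cong (+ b ℤ.*_) e) (ℤₚ.*-identityʳ (+ b))))
    ... | n , e | n′ , e′ = n′ ℕ.+ n , trans (Hom.⟦∙⟧ (coordinate j) (CMon.pow Wc b w) (powprodV Wc ws l)) (cong₂ ℤ._+_ e′ e)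
    lookup-weight : ∀ {a} (j : Fin a) (l : Vec ℕ a) → Vec.lookup (Vec.map ℤ.-_ (Vec.map +_ l)) j ≡ ℤ.- (+ Vec.lookup l j)
    lookup-weight Fin.zero (x ∷ l) = refl
    lookup-weight (Fin.suc j) (x ∷ l) = lookup-weight j l
    l = Vec.lookup L′ j
    πc : ∃ λ p → π c ≡ (+ L₀ ℤ.+ + p) ℤ.+ ℤ.- (+ l)
    πc with π-powprod w L′ bits
    ... | p , e = p , trans (Hom.⟦∙⟧ (coordinate j) (powprodV Wc (y ∷ w) L) (W.neg hL)) (cong₂ ℤ._+_
      (trans (Hom.⟦∙⟧ (coordinate j) (CMon.pow Wc L₀ y) (powprodV Wc w L′)) (cong₂ ℤ._+_ (trans (Hom.⟦pow⟧ (coordinate j) L₀ y) (trans (powℤ L₀ (π y)) (trans (cong (+ L₀ ℤ.*_) y₁) (ℤₚ.*-identityʳ (+ L₀))))) e))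
      (lookup-weight j L′))
    point : ∀ e → S e → CT k a (CMon._∙_ (LM a) (0 , c) e) ≡ + 0
    point (d , x) (n , s) with k ℕ.≟ d
    ... | no ne = cong (ℤ._* δW (c W.∙ x)) (δℕ-≢ ne)
    ... | yes refl = trans (cong (λ z → δℕ k k ℤ.* (δℤ (proj₁ (c W.∙ x)) ℤ.* z)) (lookup-δ (proj₂ (c W.∙ x)) j nonzero))
        (trans (cong (δℕ k k ℤ.*_) (ℤₚ.*-zeroʳ (δℤ (proj₁ (c W.∙ x))))) (ℤₚ.*-zeroʳ (δℕ k k)))
      where
      -- In degree `t^k` this exponent is at least `L₀ - l - k` with `l ≤ k + a`, hence positive by
      -- `large`.
      nonzero : π (c W.∙ x) ≢ + 0
      nonzero z with πc
      ... | p , e = ℕₚ.<⇒≱ large (ℕₚ.≤-trans (ℕₚ.≤-trans (ℕₚ.m≤m+n L₀ (p ℕ.+ n)) (ℕₚ.≤-reflexive balance)) (ℕₚ.≤-trans (ℕₚ.+-monoˡ-≤ k (lookup-≤ L′ j (proj₂ (entries-bounds a L′ L′≡)))) (ℕₚ.≤-reflexive (ℕₚ.+-comm (k ℕ.+ a) k))))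
        where
        shuffle₁ : ∀ L p l k x → (L ℤ.+ (p ℤ.+ (k ℤ.+ x))) ≡ (((L ℤ.+ p) ℤ.+ ℤ.- l) ℤ.+ x) ℤ.+ (l ℤ.+ k)
        shuffle₁ = ℤSolver.solve-∀
        balance : L₀ ℕ.+ (p ℕ.+ n) ≡ l ℕ.+ k
        balance = ℤₚ.+-injective (begin
          + L₀ ℤ.+ (+ p ℤ.+ + n) ≡⟨ cong (λ z → + L₀ ℤ.+ (+ p ℤ.+ z)) (sym s) ⟩
          + L₀ ℤ.+ (+ p ℤ.+ (+ k ℤ.+ π x)) ≡⟨ shuffle₁ (+ L₀) (+ p) (+ l) (+ k) (π x) ⟩
          (((+ L₀ ℤ.+ + p) ℤ.+ ℤ.- (+ l)) ℤ.+ π x) ℤ.+ (+ l ℤ.+ + k)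
            ≡⟨ cong (ℤ._+ (+ l ℤ.+ + k)) (trans (cong (ℤ._+ π x) (sym e)) (trans (sym (Hom.⟦∙⟧ (coordinate j) c x)) z)) ⟩
          + 0 ℤ.+ (+ l ℤ.+ + k) ≡⟨ ℤₚ.+-identityˡ _ ⟩
          + l ℤ.+ + k ∎)

  fixed : Aℤ.altPerm (suc a) Ys (residue k≤L) ≡ Aℤ.altPerm a (vars a) (λ w → residue k≤L (u₀ ∷ w))
  fixed = trans (cong (λ z → first ℤ.+ ℤ.- z) (trans (Aℤ.alt-cong (vars a) others) (Aℤ.alt-0 (vars a)))) (ℤₚ.+-identityʳ first)
    where
    first = Aℤ.altPerm a (vars a) (λ w → residue k≤L (u₀ ∷ w))
    zeros : ∀ {A : Set} n (xs : List A) → Aℤ.altPerm n xs (λ _ → + 0) ≡ + 0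
    zeros zero xs = refl
    zeros (suc n) xs = trans (Aℤ.alt-cong xs (λ y ys _ → zeros n ys)) (Aℤ.alt-0 xs)
    others : ∀ y ys → y ∷ ys ↭ vars a → Aℤ.altPerm a (u₀ ∷ ys) (λ w → residue k≤L (y ∷ w)) ≡ + 0
    others y ys p with All-resp-↭ (↭-sym p) (vars-coordinate a)
    ... | (j , y₁) ∷ _ = trans (Aℤ.altPerm-cong a (u₀ ∷ ys) (trans (↭-length p) (length-vars a)) (λ w q → residue-zero j y w y₁
        (tail-All (All-resp-↭ (↭-sym (↭-trans (prep y q) (↭-trans (swap y u₀ ↭-refl) (prep u₀ p)))) (vars-bits a j))))) (zeros a (u₀ ∷ ys))
      where
      tail-All : ∀ {A : Set} {P : A → Set} {x xs} → All P (x ∷ xs) → All P xs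
      tail-All (_ ∷ ps) = ps

  vs : List (W a)
  vs = vars a

  p⃗ : List (W a) → W a
  p⃗ w = CMon.powprod Wc w bs

  ι₀ ι₀⁻ : Hom Wc (LM a)
  ι₀ = record { ⟦_⟧ = 0 ,_ ; ⟦∙⟧ = λ _ _ → refl ; ⟦ε⟧ = refl }
  ι₀⁻ = record { ⟦_⟧ = λ y → 0 , W.neg y ; ⟦∙⟧ = λ p q → cong (0 ,_) (Hom.⟦∙⟧ (negHom (Wᵍ a)) p q) ; ⟦ε⟧ = cong (0 ,_) (Hom.⟦ε⟧ (negHom (Wᵍ a))) }

  shifted-alternant : ∀ (φ : Hom Wc (LM a)) → ∏ vs (λ y → B.T.mono (Hom.⟦_⟧ φ y) ^ʳ k) * V (λ y → B.T.mono (Hom.⟦_⟧ φ y)) vs ≈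
    altPerm a vs (λ w → B.T.mono (Hom.⟦_⟧ φ (p⃗ w)))
  shifted-alternant φ = R.trans (R.sym (B.Alt.V-shift x k vs)) (R.trans (R.reflexive (cong (λ n → B.Alt.det (λ e y → x y ^ʳ e) (map (k ℕ.+_) (downFrom n)) vs) (length-vars a)))
    (R.trans (B.Alt.det-altPerm (λ e y → x y ^ʳ e) bs vs) (R.trans (R.reflexive (cong (λ n → altPerm n vs (B.Alt.zipΠ (λ e y → x y ^ʳ e) bs)) (trans (Listₚ.length-map (k ℕ.+_) (downFrom a)) (Listₚ.length-downFrom a))))
    (B.Alt.altPerm-cong a vs (length-vars a) (λ w _ → zip w bs)))))
    where
    x : W a → B.T.Carrier
    x y = B.T.mono (Hom.⟦_⟧ φ y)
    zip : ∀ w bs → B.Alt.zipΠ (λ e y → x y ^ʳ e) bs w ≈ B.T.mono (Hom.⟦_⟧ φ (CMon.powprod Wc w bs))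
    zip w bs = R.trans (R.reflexive (relabel w bs)) (R.trans (B.zipΠ-mono′ bs (map (Hom.⟦_⟧ φ) w)) (R.reflexive (cong B.T.mono (powprod-map φ w bs))))
      where
      relabel : ∀ w bs → B.Alt.zipΠ (λ e y → x y ^ʳ e) bs w ≡ B.Alt.zipΠ (λ e y → B.T.mono y ^ʳ e) bs (map (Hom.⟦_⟧ φ) w)
      relabel [] [] = refl
      relabel [] (b ∷ bs) = refl
      relabel (y ∷ w) [] = refl
      relabel (y ∷ w) (b ∷ bs) = cong (x y ^ʳ b *_) (relabel w bs)

  cross-tails : cross′ k≤L ≈ cross vs vs * tails 1 u₀ vs
  cross-tails = begin
    (g 1 (u₀ W.⊖ u₀) * ∏ vs (λ y → g 1 (u₀ W.⊖ y))) * ∏ vs (λ x → g 1 (x W.⊖ u₀) * ∏ vs (λ y → g 1 (x W.⊖ y))) * (1# - t)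
      ≈⟨ R.*-congʳ (R.*-congˡ (R.sym (B.Alt.∏-* vs))) ⟩
    (g 1 (u₀ W.⊖ u₀) * A) * (C * cross vs vs) * (1# - t)
      ≈⟨ solve 5 (λ h A C c t → (h :* A) :* (C :* c) :* t := (t :* h) :* (c :* (C :* A))) R.refl (g 1 (u₀ W.⊖ u₀)) A C (cross vs vs) (1# - t) ⟩
    ((1# - t) * g 1 (u₀ W.⊖ u₀)) * (cross vs vs * (C * A))
      ≈⟨ R.*-cong (R.trans (R.*-congˡ (R.reflexive (cong (g 1) (W.inv u₀)))) (B.geo-inverse (1 , W.ε) ℕₚ.≤-refl)) (R.*-congˡ (B.Alt.∏-* vs)) ⟩
    1# * (cross vs vs * tails 1 u₀ vs) ≈⟨ R.*-identityˡ _ ⟩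
    cross vs vs * tails 1 u₀ vs ∎
    where
    open Relation.Binary.Reasoning.Setoid R.setoid
    A = ∏ vs (λ y → g 1 (u₀ W.⊖ y))
    C = ∏ vs (λ x → g 1 (x W.⊖ u₀))

  powersF : List (W a) → List F
  powersF = map (λ y → mon (0 , CMon.pow Wc k y))

  -- The contribution of one permutation once the alternant in `1/y` is expanded. All factors are
  -- written in the order `w`, so that it is the image of `orbitF vs` under a renaming of the
  -- variables.
  orbitF : List (W a) → List F
  orbitF w = mon (0 , W.neg (p⃗ w)) ∷ vandermondeF w ++ powersF w ++ crossF w w ++ tailF 1 u₀ w

  ev-orbit : ∀ w → B.ev (orbitF w) ≈ v⁻ (p⃗ w) * (V v w * (∏ w (λ y → v y ^ʳ k) * (cross w w * tails 1 u₀ w)))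
  ev-orbit w = R.*-congˡ (R.trans (B.ev-++ (vandermondeF w) _) (R.*-cong (B.ev-V w) (R.trans (B.ev-++ (powersF w) _) (R.*-cong
    (R.trans (B.ev-map _ w) (B.Alt.∏-cong w (λ y → R.sym (R.trans (B.mono-^ (0 , y) k) (R.reflexive (cong B.T.mono (sym (Hom.⟦pow⟧ ι₀ k y))))))))
    (R.trans (B.ev-++ (crossF w w) _) (R.*-cong (B.ev-cross w w) (B.ev-tail 1 u₀ w)))))))

  CT-orbit : ∀ w → w ↭ vs → B.T.⟨_,_⟩ (B.ev (orbitF w)) (CT k a) ≡ B.T.⟨_,_⟩ (B.ev (orbitF vs)) (CT k a)
  CT-orbit w p = trans (cong (λ fs → B.T.⟨_,_⟩ (B.ev fs) (CT k a)) natural)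
    (trans (sym (⟨ev⟩-hom σ̂ D (orbitF vs) (CT k a))) (B.T.⟨⟩-cong (B.ev (orbitF vs)) (CT-subst k w p)))
    where
    σ : Hom Wc Wc
    σ = substHom w
    σ̂ : Hom (LM a) (LM a)
    σ̂ = lift {Wᵍ a} {Wᵍ a} σ
    w≡ : map (Hom.⟦_⟧ σ) vs ≡ w
    w≡ = substHom-vars w (trans (↭-length p) (length-vars a))
    θ : F → F
    θ = mapFac (Hom.⟦_⟧ σ̂)
    natural : orbitF w ≡ map θ (orbitF vs)
    natural = trans (cong orbitF (sym w≡)) (cong₂ _∷_
      (cong (λ y → mon (0 , y)) (trans (cong W.neg (powprod-map σ vs bs)) (sym (⟦neg⟧ {Wᵍ a} {Wᵍ a} σ (p⃗ vs)))))
      (trans (cong₂ _++_ (vandermondeF-nat {Wᵍ a} {Wᵍ a} σ vs) (trans (cong₂ _++_ (powers vs) (trans (cong₂ _++_ (crossF-nat {Wᵍ a} {Wᵍ a} σ vs vs)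
          (trans (cong (λ u → tailF 1 u (map (Hom.⟦_⟧ σ) vs)) (sym (substHom-u w))) (tailF-nat {Wᵍ a} {Wᵍ a} σ 1 u₀ vs)))
        (sym (Listₚ.map-++ θ (crossF vs vs) _)))) (sym (Listₚ.map-++ θ (powersF vs) _)))) (sym (Listₚ.map-++ θ (vandermondeF vs) _))))
      where
      powers : ∀ ys → powersF (map (Hom.⟦_⟧ σ) ys) ≡ map θ (powersF ys)
      powers [] = refl
      powers (y ∷ ys) = cong₂ _∷_ (cong (λ y → mon (0 , y)) (sym (Hom.⟦pow⟧ σ k y))) (powers ys)

  value : ℤ
  value = B.T.⟨_,_⟩ (B.ev (orbitF vs)) (CT k a)

  -- The powers of `u` cancel, and the signed sum of the monomials `p⃗ w` is the alternant
  -- `∏ y^k V(y)`. With the fixed inverse of `p⃗ vs` and the kernel this makes up the single orbit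
  -- term of `vs`.
  sum≡value : Aℤ.altPerm a vs (λ w → residue k≤L (u₀ ∷ w)) ≡ value
  sum≡value = begin
    Aℤ.altPerm a vs (λ w → residue k≤L (u₀ ∷ w)) ≡⟨ Aℤ.altPerm-cong a vs (length-vars a) (λ w _ → B.MR.⟨ split w ⟩≈ B.CT-test) ⟩
    Aℤ.altPerm a vs (λ w → B.T.⟨_,_⟩ (v (p⃗ w) * (v⁻ (p⃗ vs) * cross′ k≤L)) (CT k a)) ≡⟨ sym (BP.⟨altPerm⟩ a vs (λ w → v (p⃗ w) * (v⁻ (p⃗ vs) * cross′ k≤L)) (CT k a)) ⟩
    B.T.⟨_,_⟩ (altPerm a vs (λ w → v (p⃗ w) * (v⁻ (p⃗ vs) * cross′ k≤L))) (CT k a) ≡⟨ B.MR.⟨ assemble ⟩≈ B.CT-test ⟩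
    value ∎
    where
    open ≡-Reasoning
    hL≡ : hL ≡ CMon.pow Wc L₀ u₀ W.∙ p⃗ vs
    hL≡ = trans (cong ⟦_⟧ᵂ (sym (trans (powprod-units (suc a) (Vec.toList L)) (fromL-toList L)))) (trans (sym (powprod-map weightHom us (Vec.toList L)))
      (trans (cong (λ l → CMon.powprod Wc l (Vec.toList L)) (weight-units a)) (cong (λ l → CMon.pow Wc L₀ u₀ W.∙ CMon.powprod Wc vs l) L′≡)))
    quotient : ∀ p q r → (p W.∙ q) W.⊖ (p W.∙ r) ≡ q W.⊖ r
    quotient p q r = trans (cong ((p W.∙ q) W.∙_) (Hom.⟦∙⟧ (negHom (Wᵍ a)) p r)) (trans (∙-interchange Wc p q _ _) (trans (cong (W._∙ (q W.⊖ r)) (W.inv p)) (W.idˡ _)))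
    split : ∀ w → B.T.mono (0 , shift (u₀ ∷ w)) * cross′ k≤L ≈ v (p⃗ w) * (v⁻ (p⃗ vs) * cross′ k≤L)
    split w = R.trans (R.*-congʳ (R.trans (R.reflexive (cong (λ y → B.T.mono (0 , y)) (trans (cong₂ W._⊖_ (cong (λ l → CMon.pow Wc L₀ u₀ W.∙ CMon.powprod Wc w l) L′≡) hL≡)
      (quotient (CMon.pow Wc L₀ u₀) (p⃗ w) (p⃗ vs))))) (R.sym (B.v* (p⃗ w) (p⃗ vs))))) (R.*-assoc _ _ _)
    assemble : altPerm a vs (λ w → v (p⃗ w) * (v⁻ (p⃗ vs) * cross′ k≤L)) ≈ B.ev (orbitF vs)
    assemble = R.trans (R.sym (B.Alt.altPerm-*ʳ a vs (v⁻ (p⃗ vs) * cross′ k≤L) {λ w → v (p⃗ w)})) (R.trans (R.*-cong (R.sym (shifted-alternant ι₀)) (R.*-congˡ cross-tails))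
      (R.trans (solve 4 (λ p V m c → (p :* V) :* (m :* c) := m :* (V :* (p :* c))) R.refl (∏ vs (λ y → v y ^ʳ k)) (V v vs) (v⁻ (p⃗ vs)) _) (R.sym (ev-orbit vs))))

  -- Insert `1 = ∏ y^k ∏ y^(-k)`. Then `∏ y^(-k) V(1/y)` is an alternant in the inverse variables,
  -- the antisymmetry of `V(y)` removes its signs, and each permutation yields one orbit term.
  base≈orbits : B.ev (baseF 1 u₀ vs []) ≈ permSum a vs (λ w → B.ev (orbitF w))
  base≈orbits = begin
    B.ev (baseF 1 u₀ vs []) ≈⟨ B.ev-base 1 u₀ vs [] ⟩
    V v vs * (V v⁻ vs * (cross vs vs * (tails 1 u₀ vs * 1#))) ≈⟨ R.sym (R.trans (R.*-congʳ (B.Alt.∏-inverse vs powers-inverse)) (R.*-identityˡ _)) ⟩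
    (P * P⁻) * (V v vs * (V v⁻ vs * (cross vs vs * (tails 1 u₀ vs * 1#))))
      ≈⟨ solve 6 (λ P P⁻ V V⁻ c t → (P :* P⁻) :* (V :* (V⁻ :* (c :* (t :* :1)))) := ((P⁻ :* V⁻) :* V) :* (P :* (c :* t))) R.refl P P⁻ (V v vs) (V v⁻ vs) (cross vs vs) (tails 1 u₀ vs) ⟩
    ((P⁻ * V v⁻ vs) * V v vs) * Z vs ≈⟨ R.*-congʳ (R.trans (R.*-congʳ (shifted-alternant ι₀⁻)) (B.Alt.altPerm-antisymmetric (B.Alt.V-antisymmetric v) a vs (length-vars a))) ⟩
    permSum a vs (λ w → v⁻ (p⃗ w) * V v w) * Z vs ≈⟨ B.Alt.permSum-*ʳ a vs (Z vs) ⟩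
    permSum a vs (λ w → (v⁻ (p⃗ w) * V v w) * Z vs) ≈⟨ B.Alt.permSum-cong a vs (length-vars a) (λ w p → R.trans (R.*-congˡ
        (R.*-cong (B.Alt.∏-↭ _ (↭-sym p)) (R.*-cong (B.cross-↭ (↭-sym p)) (B.Alt.∏-↭ _ (↭-sym p))))) (R.trans (R.*-assoc _ _ _) (R.sym (ev-orbit w)))) ⟩
    permSum a vs (λ w → B.ev (orbitF w)) ∎
    where
    open Relation.Binary.Reasoning.Setoid R.setoid
    P = ∏ vs (λ y → v y ^ʳ k)
    P⁻ = ∏ vs (λ y → v⁻ y ^ʳ k)
    Z : List (W a) → B.T.Carrier
    Z l = ∏ l (λ y → v y ^ʳ k) * (cross l l * tails 1 u₀ l)
    powers-inverse : ∀ y → v y ^ʳ k * v⁻ y ^ʳ k ≈ 1#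
    powers-inverse y = R.trans (R.*-cong (B.mono-^ _ k) (B.mono-^ _ k)) (B.mono-inverse _ _ (trans (sym (CMon.pow-∙ (LM a) k _ _)) (trans (cong (CMon.pow (LM a) k) (cong (0 ,_) (W.inv y))) (pow-ε (LM a) k))))

  permSum-const : ∀ {A : Set} n (xs : List A) c → length xs ≡ n → Aℤ.permSum n xs (λ _ → c) ≡ + (n !) ℤ.* c
  permSum-const zero xs c e = sym (ℤₚ.*-identityˡ c)
  permSum-const (suc n) xs c e = trans (Aℤ.pick-cong xs (λ y ys p → permSum-const n ys c (ℕₚ.suc-injective (trans (↭-length p) e))))
    (trans (pick-const xs _) (trans (cong (λ l → + l ℤ.* (+ (n !) ℤ.* c)) e) (trans (sym (ℤₚ.*-assoc (+ suc n) (+ (n !)) c)) (cong (ℤ._* c) (sym (ℤₚ.pos-* (suc n) (n !)))))))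

  -- The orbit terms have equal constant terms, so the factor `a!` of the symmetrisation cancels the
  -- one from `constant-term`.
  evaluation : G.T.⟨_,_⟩ (G.ev (map geo ms)) integrand ≡ Terms.⟨_,_⟩ ℕM (Eval.ev ℕM D (map geo (denominators a 1 []))) (δℕ k)
  evaluation = trans (integral k≤L) (trans fixed (trans sum≡value (ℤₚ.*-cancelˡ-≡ (+ (a !)) value _ {{a ℕₚ.!≢0}} (begin
    + (a !) ℤ.* value ≡⟨ sym (permSum-const a vs value (length-vars a)) ⟩
    Aℤ.permSum a vs (λ _ → value) ≡⟨ Aℤ.permSum-cong a vs (length-vars a) (λ w p → sym (CT-orbit w p)) ⟩
    Aℤ.permSum a vs (λ w → B.T.⟨_,_⟩ (B.ev (orbitF w)) (CT k a)) ≡⟨ sym (BP.⟨permSum⟩ a vs (λ w → B.ev (orbitF w)) (CT k a)) ⟩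
    B.T.⟨_,_⟩ (permSum a vs (λ w → B.ev (orbitF w))) (CT k a) ≡⟨ sym (B.MR.⟨ base≈orbits ⟩≈ B.CT-test) ⟩
    B.T.⟨_,_⟩ (B.ev (baseF 1 u₀ vs [])) (CT k a) ≡⟨ constant-term k D (ℕₚ.≤-trans k≤L₀ (ℕₚ.m≤m+n L₀ _)) a 1 [] ℕₚ.≤-refl ⟩
    + (a !) ℤ.* Terms.⟨_,_⟩ ℕM (Eval.ev ℕM D (map geo (denominators a 1 []))) (δℕ k) ∎))))
    where open ≡-Reasoning

-- The Kronecker coefficient of the padded rectangle.

character-alternant : ∀ ℓ ls ρ → length ls ≡ ℓ → character ls ρ ≡ PowerSums.pw (VM ℓ) (unitsN ℓ) ρ (alternant ℓ ls)
character-alternant ℓ ls ρ refl = character-pw ls ρ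

alternant-degree′ : ∀ ℓ ls x → length ls ≡ ℓ → Vec.sum x ≢ sum ls → alternant ℓ ls x ≡ + 0
alternant-degree′ ℓ ls x refl = alternant-degree ls x

kronecker-value : ∀ λ′ μ ν n g → size λ′ ≡ n →
  ∑ (partitionsOf n) (λ ρ → ((+ classSize n ρ ℤ.* character λ′ ρ) ℤ.* character μ ρ) ℤ.* character ν ρ) ≡ + (n !) ℤ.* + g →
  kronecker λ′ μ ν ≡ + g
kronecker-value λ′ μ ν n g refl e = trans (cong (λ z → (z ℤ./ℕ (n !)) {{n ℕₚ.!≢0}}) (trans (∑-foldr _ (partitionsOf n)) (trans e (trans (sym (ℤₚ.pos-* (n !) g)) (cong +_ (ℕₚ.*-comm (n !) g))))))
  (cong +_ (DivMod.m*n/n≡m g (n !) {{n ℕₚ.!≢0}}))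
  where open import Data.Integer.DivMod using (_/ℕ_)

All-cartesianProduct : ∀ {A B : Set} {P : A → Set} xs (ys : List B) → All P xs → All (P ∘ proj₁) (List.cartesianProduct xs ys)
All-cartesianProduct [] ys [] = []
All-cartesianProduct (x ∷ xs) ys (p ∷ ps) = Allₚ.++⁺ (Allₚ.map⁺ (All.universal (λ _ → p) ys)) (All-cartesianProduct xs ys ps)

sum-replicate : ∀ a k → sum (replicate a k) ≡ a ℕ.* k
sum-replicate zero k = refl
sum-replicate (suc a) k = cong (k ℕ.+_) (sum-replicate a k)

shifted-rect : ∀ a k m → ∃ λ (L′ : Vec ℕ a) → shifted (suc a) (m ∷ replicate a k) ≡ (m ℕ.+ a) ∷ L′ × Vec.toList L′ ≡ map (k ℕ.+_) (downFrom a)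
shifted-rect a k m = fromL a (staircase (suc a) (replicate a k) (List.applyUpTo (suc ∘ suc) a)) , refl , go a (suc ∘ suc) (λ _ → refl)
  where
  go : ∀ b (f : ℕ → ℕ) → (∀ i → suc a ℕ.∸ f i ≡ b ℕ.∸ suc i) →
    Vec.toList (fromL b (staircase (suc a) (replicate b k) (List.applyUpTo f b))) ≡ map (k ℕ.+_) (downFrom b)
  go zero f h = refl
  go (suc b) f h = cong₂ _∷_ (cong (k ℕ.+_) (h 0)) (go b (f ∘ suc) (h ∘ suc))

module Rectangle (a k m n : ℕ) (1≤k : 1 ℕ.≤ k) (size≡ : m ℕ.+ a ℕ.* k ≡ n) (large : k ℕ.+ (k ℕ.+ a) ℕ.< m ℕ.+ a) where
  ls : List ℕ
  ls = m ∷ replicate a k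

  L′ : Vec ℕ a
  L′ = proj₁ (shifted-rect a k m)
  L : Vec ℕ (suc a)
  L = (m ℕ.+ a) ∷ L′
  L≡ : shifted (suc a) ls ≡ L
  L≡ = proj₁ (proj₂ (shifted-rect a k m))

  open Evaluation a k (m ℕ.+ a) L′ (proj₂ (proj₂ (shifted-rect a k m))) large using (evaluation; k≤L₀)
  open Integral a k L (ℕₚ.≤-trans k≤L₀ (ℕₚ.m≤m+n (m ℕ.+ a) _))

  length-ls : length ls ≡ suc a
  length-ls = cong suc (Listₚ.length-replicate a)

  sum-ls : sum ls ≡ n
  sum-ls = trans (cong (m ℕ.+_) (sum-replicate a k)) size≡

  alternant≡altX : ∀ x → alternant (suc a) ls x ≡ altX x
  alternant≡altX x = subst (λ l → alternant (suc a) ls x ≡ Terms.⟨_,_⟩ (VM (suc a)) (Eval.ev (VM (suc a)) D (vdm us)) (λ y → eqV (y ⊕ x) l)) L≡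
    (alternant-pairing D (suc a) ls x (ℕₚ.≤-reflexive (cong Vec.sum L≡)))

  character-X : ∀ ρ → character ls ρ ≡ PowerSums.pw (VM (suc a)) us ρ altX
  character-X ρ = trans (character-alternant (suc a) ls ρ length-ls) (PowerSums.pw-cong (VM (suc a)) us ρ alternant≡altX)

  -- The two factors `χ^λ` are read in different alphabets, so that their product involves the
  -- letters `xᵢ yⱼ` of Cauchy's identity.
  character-Y : ∀ ρ → character ls ρ ≡ PowerSums.pw Wc Ys ρ altY
  character-Y ρ = trans (character-X ρ) (trans (PowerSums.pw-cong (VM (suc a)) us ρ altX≡altY)
    (trans (sym (pw-hom weightHom us ρ altY)) (cong (λ l → PowerSums.pw Wc l ρ altY) (weight-units a))))

  product-of-characters : ∀ ρ → sum ρ ≡ n → (character ls ρ ℤ.* character ls ρ) ℤ.* character ((n ℕ.∸ k) ∷ k ∷ []) ρ ≡ PowerSums.pw M₁ ms ρ integrand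
  product-of-characters ρ s = begin
    (character ls ρ ℤ.* character ls ρ) ℤ.* character ((n ℕ.∸ k) ∷ k ∷ []) ρ ≡⟨ ℤₚ.*-assoc (character ls ρ) _ _ ⟩
    character ls ρ ℤ.* (character ls ρ ℤ.* character ((n ℕ.∸ k) ∷ k ∷ []) ρ)
      ≡⟨ cong₂ ℤ._*_ (character-X ρ) (cong₂ ℤ._*_ (character-Y ρ) (twoRow-character (n ℕ.∸ k) k ρ 1≤k (trans s (sym (ℕₚ.m∸n+n≡m k≤n))))) ⟩
    PowerSums.pw (VM (suc a)) us ρ altX ℤ.* (PowerSums.pw Wc Ys ρ altY ℤ.* PowerSums.pw ℕM (0 ∷ 1 ∷ []) ρ (twoRow k))
      ≡⟨ cong (PowerSums.pw (VM (suc a)) us ρ altX ℤ.*_) (pw-× Wc ℕM Ys (0 ∷ 1 ∷ []) ρ altY (twoRow k)) ⟩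
    PowerSums.pw (VM (suc a)) us ρ altX ℤ.* PowerSums.pw (Wc ×M ℕM) (List.cartesianProduct Ys (0 ∷ 1 ∷ [])) ρ (λ (y , z) → altY y ℤ.* twoRow k z)
      ≡⟨ pw-× (VM (suc a)) (Wc ×M ℕM) us (List.cartesianProduct Ys (0 ∷ 1 ∷ [])) ρ altX (λ (y , z) → altY y ℤ.* twoRow k z) ⟩
    PowerSums.pw M₁ ms ρ integrand ∎
    where
    open ≡-Reasoning
    k≤n : k ℕ.≤ n
    k≤n = ℕₚ.≤-trans (ℕₚ.<⇒≤ (ℕₚ.+-cancelʳ-< a k m (ℕₚ.≤-<-trans (ℕₚ.m≤n+m (k ℕ.+ a) k) large))) (subst (m ℕ.≤_) size≡ (ℕₚ.m≤m+n m _))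

  -- By homogeneity of `altX` the functional lives in x-degree `n` alone, which lets the product of
  -- geometric series stand for `h_n`.
  integrand-degree : ∀ e → Vec.sum (proj₁ e) ≢ n → integrand e ≡ + 0
  integrand-degree (x , (y , z)) ne = cong (ℤ._* (altY y ℤ.* twoRow k z)) (trans (sym (alternant≡altX x)) (alternant-degree′ (suc a) ls x length-ls (λ e → ne (trans e sum-ls))))

  n≤D : n ℕ.≤ D
  n≤D = subst₂ ℕ._≤_ size≡ refl (ℕₚ.+-mono-≤ (ℕₚ.m≤m+n m a) (go a L′ (proj₂ (proj₂ (shifted-rect a k m)))))
    where
    go : ∀ {c} b (l : Vec ℕ c) → Vec.toList l ≡ map (k ℕ.+_) (downFrom b) → b ℕ.* k ℕ.≤ Vec.sum l
    go zero l e = z≤n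
    go (suc b) (x ∷ l) e with Listₚ.∷-injective e
    ... | refl , e′ = ℕₚ.+-mono-≤ (ℕₚ.m≤m+n k b) (go b l e′)

  multiplicity : ∀ b → a ≡ suc b →
    ∑ (partitionsOf n) (λ ρ → ((+ classSize n ρ ℤ.* character ls ρ) ℤ.* character ls ρ) ℤ.* character ((n ℕ.∸ k) ∷ k ∷ []) ρ) ≡ + (n !) ℤ.* + planePartitions2 k a
  multiplicity b refl = begin
    ∑ (partitionsOf n) (λ ρ → ((+ classSize n ρ ℤ.* character ls ρ) ℤ.* character ls ρ) ℤ.* character ((n ℕ.∸ k) ∷ k ∷ []) ρ)
      ≡⟨ ∑P-cong n n n ℕₚ.≤-refl (λ ρ s _ → trans (regroup (+ classSize n ρ) (character ls ρ) (character ls ρ) _) (cong (+ classSize n ρ ℤ.*_) (product-of-characters ρ s))) ⟩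
    ∑ (partitionsOf n) (λ ρ → + classSize n ρ ℤ.* PowerSums.pw M₁ ms ρ integrand) ≡⟨ Average.average M₁ ms n integrand ⟩
    + (n !) ℤ.* PowerSums.hw M₁ ms n integrand ≡⟨ cong (+ (n !) ℤ.*_) (sym (GP.geo-hw ms (All-cartesianProduct us (List.cartesianProduct Ys (0 ∷ 1 ∷ [])) (units-sum (suc a))) n integrand n≤D integrand-degree)) ⟩
    + (n !) ℤ.* G.T.⟨_,_⟩ (G.ev (map geo ms)) integrand ≡⟨ cong (+ (n !) ℤ.*_) (trans evaluation (sym (planePartitions-product k D 1≤k (ℕₚ.≤-trans k≤L₀ (ℕₚ.m≤m+n (m ℕ.+ a) _)) b))) ⟩
    + (n !) ℤ.* + planePartitions2 k a ∎
    where
    open ≡-Reasoning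
    regroup : ∀ c x y z → ((c ℤ.* x) ℤ.* y) ℤ.* z ≡ c ℤ.* ((x ℤ.* y) ℤ.* z)
    regroup = ℤSolver.solve-∀

trivial-character : ∀ n ρ → sum ρ ≡ n → character (n ∷ []) ρ ≡ + 1
trivial-character n ρ s = trans (character-pw (n ∷ []) ρ) (trans
  (PowerSumsLinear.pw-degree (VM 1) Vec.sum sum-⊕ (unitsN 1) ((λ r → trans (cong Vec.sum (pow-unit r)) (ℕₚ.+-identityʳ r)) ∷ []) ρ _ (λ _ → + 1) agree)
  (constant ρ))
  where
  constant : ∀ ρ → PowerSums.pw (VM 1) (unitsN 1) ρ (λ _ → + 1) ≡ + 1
  constant [] = refl
  constant (r ∷ ρ) = trans (ℤₚ.+-identityʳ _) (constant ρ)
  agree : ∀ e → Vec.sum e ≡ sum ρ ℕ.+ 0 → alternant 1 (n ∷ []) e ≡ + 1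
  agree (x ∷ []) e = trans (cong (λ y → (δℕ y (n ℕ.+ 0) ℤ.* + 1) ℤ.+ + 0) x≡n) (cong (λ d → (d ℤ.* + 1) ℤ.+ + 0) (δℕ-refl (n ℕ.+ 0)))
    where
    x≡n : x ≡ n ℕ.+ 0
    x≡n = trans (sym (ℕₚ.+-identityʳ x)) (trans e (cong (ℕ._+ 0) s))

planePartitions-zero : ∀ a → planePartitions2 0 a ≡ 1
planePartitions-zero a = ℤₚ.+-injective (trans (planePartitions-count a) (trans (TR.MR.⟨ go a ⟩≈ (λ e l → δℕ-< l)) (trans (cong (λ o → TR.T.⟨_,_⟩ o (δℕ 0)) TR.T.1≡mono) (TR.T.⟨⟩-mono 0 (δℕ 0)))))
  where
  open Count 0 0 z≤n
  module TR = TwoRows 0 0 z≤n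
  go : ∀ a → TR.planes a 0 0 TR.R.≈ TR.R.1#
  go zero = TR.R.refl
  go (suc a) = TR.R.trans (TR.R.*-cong TR.τ0 (go a)) (TR.R.*-identityˡ _)

-- The padded partitions have a single row, so all characters are trivial, and the average is `h_n`
-- of a one-letter alphabet.
theorem-zero : ∀ a n → kronecker (n ∷ []) (n ∷ []) (n ∷ []) ≡ + planePartitions2 0 a
theorem-zero a n = trans (kronecker-value (n ∷ []) (n ∷ []) (n ∷ []) n 1 (ℕₚ.+-identityʳ n) (begin
  ∑ (partitionsOf n) (λ ρ → ((+ classSize n ρ ℤ.* χ ρ) ℤ.* χ ρ) ℤ.* χ ρ)
    ≡⟨ ∑P-cong n n n ℕₚ.≤-refl (λ ρ s _ → trans (cong (λ c → ((+ classSize n ρ ℤ.* c) ℤ.* c) ℤ.* c) (trivial-character n ρ s)) (trans (ones (+ classSize n ρ)) (cong (+ classSize n ρ ℤ.*_) (sym (constant ρ))))) ⟩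
  ∑ (partitionsOf n) (λ ρ → + classSize n ρ ℤ.* PowerSums.pw ℕM (0 ∷ []) ρ (λ _ → + 1)) ≡⟨ Average.average ℕM (0 ∷ []) n (λ _ → + 1) ⟩
  + (n !) ℤ.* PowerSums.hw ℕM (0 ∷ []) n (λ _ → + 1) ≡⟨ cong (+ (n !) ℤ.*_) (complete n) ⟩
  + (n !) ℤ.* + 1 ∎)) (cong +_ (sym (planePartitions-zero a)))
  where
  open ≡-Reasoning
  χ = character (n ∷ [])
  ones : ∀ c → ((c ℤ.* + 1) ℤ.* + 1) ℤ.* + 1 ≡ c ℤ.* + 1
  ones = ℤSolver.solve-∀
  constant : ∀ ρ → PowerSums.pw ℕM (0 ∷ []) ρ (λ _ → + 1) ≡ + 1
  constant [] = refl
  constant (r ∷ ρ) = trans (ℤₚ.+-identityʳ _) (constant ρ)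
  complete : ∀ n → PowerSums.hw ℕM (0 ∷ []) n (λ _ → + 1) ≡ + 1
  complete zero = refl
  complete (suc n) = trans (ℤₚ.+-identityˡ _) (complete n)

theorem3p3 : (a k : ℕ) → 1 ≤ a →
    Σ ℕ (λ N → (n : ℕ) → N ≤ n →
    kronecker (pad n (rect k a)) (pad n (rect k a)) (pad n (row k))
    ≡ + planePartitions2 k a)
theorem3p3 a zero 1≤a = 0 , λ n _ → theorem-zero a n
-- The bound leaves a first row `m = n - a k` of length at least `2 k + 1`, so that `L₀ = m + a`
-- exceeds `k + (k + a)`.
theorem3p3 a@(suc b) k@(suc _) 1≤a = suc (k ℕ.+ k) ℕ.+ a ℕ.* k , λ n N≤n →
  let s = sum-replicate a k
      m = n ℕ.∸ sum (replicate a k)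
      ak≤n = ℕₚ.≤-trans (ℕₚ.m≤n+m (a ℕ.* k) (suc (k ℕ.+ k))) N≤n
      size≡ = trans (cong (λ c → (n ℕ.∸ c) ℕ.+ a ℕ.* k) s) (ℕₚ.m∸n+n≡m ak≤n)
      large = ℕₚ.≤-trans (ℕₚ.≤-reflexive (cong suc (sym (ℕₚ.+-assoc k k a))))
                (ℕₚ.+-monoˡ-≤ a (ℕₚ.≤-trans (ℕₚ.m+n≤o⇒m≤o∸n (suc (k ℕ.+ k)) N≤n) (ℕₚ.≤-reflexive (cong (n ℕ.∸_) (sym s)))))
      module Rect = Rectangle a k m n (s≤s z≤n) size≡ large
  in trans (cong (λ r → kronecker (pad n (rect k a)) (pad n (rect k a)) ((n ℕ.∸ r) ∷ k ∷ [])) (ℕₚ.+-identityʳ k))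
     (kronecker-value (m ∷ replicate a k) (m ∷ replicate a k) ((n ℕ.∸ k) ∷ k ∷ []) n (planePartitions2 k a) Rect.sum-ls (Rect.multiplicity b refl))
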